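{- Assume GCH. Then for each integer $k\ge 1$ there is a $k$-bounded colouring $f:[\omega_1]^2\to\omega_1$ and there are two c.c.c. posets $\mathcal P$ and $\mathcal Q$ such that $$V^{\mathcal P}\models \text{``$f$ c.c.c-indestructibly establishes } \omega_1\not\rightarrow^* [(\omega_1;\omega_1)]_{k\text{ -bdd}}\text{''},$$ and $$V^{\mathcal Q}\models \text{``$\omega_1$ is the union of countably many $f$-rainbow sets''}.$$
   Context: For a set $X$ and $n\in\omega$, $[X]^n$ is the set of $n$-element subsets of $X$. $V$ is the ground model and $V^{P}$ denotes a generic extension of $V$ by the poset $P$. A function $f:[X]^2\to C$ is $k$-bounded if $|f^{ -1}\{c\}|\le k$ for each $c\in C$. A set $R\subseteq X$ is $f$-rainbow if $f\restriction [R]^2$ is one-to-one. For sets $A,B$ of ordinals put $[A;B]=\{\{\alpha,\beta\}:\alpha\in A,\ \beta\in B,\ \alpha<\beta\}$. The relation $\omega_1\rightarrow^*[(\omega_1;\omega_1)]_{k\text{ -bdd}}$ says: for every $k$-bounded colouring $c$ of $[\omega_1]^2$ there are sets $A,B\subseteq\omega_1$ of order type $\omega_1$ (with $\sup A\le\sup B$, which is automatic here) such that $|[A;B]\cap c^{ -1}\{\xi\}|<k$ for each $\xi\in\operatorname{ran}(c)$. A colouring $f$ of $[\omega_1]^2$ establishes $\omega_1\not\rightarrow^*[(\omega_1;\omega_1)]_{k\text{ -bdd}}$ if $f$ is a counterexample to the positive relation: $f$ is $k$-bounded and for all $A,B\subseteq\omega_1$ of order type $\omega_1$ there is $\xi\in\operatorname{ran}(f)$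 with $|[A;B]\cap f^{ -1}\{\xi\}|\ge k$. The function $f$ c.c.c-indestructibly establishes this relation (in a given model) if for every c.c.c. poset $R$ of that model, in every generic extension by $R$ the function $f$ establishes the relation. -}

module Defs where

open import Data.Fin using (Fin)
open import Data.Nat using (ℕ; suc)
open import Data.Product using (∃; ∃-syntax; _×_)
open import Data.Sum using (_⊎_)
open import Data.Vec using (Vec; _∷_; lookup)
open import Function.Bundles using (_⇔_)
open import Level using (Level; Lift; _⊔_) renaming (suc to lsuc)
open import Data.Empty using (⊥)
open import Relation.Nullary using (¬_)
open import Relation.Unary using (Pred; _⊆_; _∩_)

-- The ground model V is an arbitrary model of ZFC + GCH, not assumed
-- transitive or countable.  All set-theoretic notions are relativised to a
-- model: every "set", "function", "ordinal" below is an element of the model,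
-- and quantifiers range over its carrier.  The surrounding logic is
-- meant to be classical (see the excluded-middle hypothesis in the theorem).

record Structure (ℓ : Level) : Set (lsuc ℓ) where
  infix 4 _∈_
  field
    Carrier : Set ℓ
    _∈_     : Carrier → Carrier → Set ℓ

infix  8 _∈̇_ _≈̇_
infixr 6 _∧̇_
infixr 5 _∨̇_
infixr 4 _→̇_

-- First-order formulas of the language of set theory, with de Bruijn
-- variables; needed only for the Separation and Replacement schemes.
data Formula : ℕ → Set where
  _∈̇_ _≈̇_       : ∀ {n} → Fin n → Fin n → Formula n
  ⊥̇             : ∀ {n} → Formula n
  _∧̇_ _∨̇_ _→̇_ : ∀ {n} → Formula n → Formula n → Formula n
  ∀̇_ ∃̇_         : ∀ {n} → Formula (suc n) → Formula n

module Sets {ℓ : Level} (S : Structure ℓ) where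
  open Structure S public

  infix 4 _≈_ _∉_

  -- Equality of sets is coextensionality, so that models presented without
  -- quotients (such as M[G], given by names) are allowed; the axiom of
  -- extensionality then says that ∈ respects ≈ on the left.
  _≈_ : Carrier → Carrier → Set ℓ
  x ≈ y = ∀ z → z ∈ x ⇔ z ∈ y

  _∉_ : Carrier → Carrier → Set ℓ
  x ∉ y = ¬ (x ∈ y)

  Class : Set (lsuc ℓ)
  Class = Pred Carrier ℓ

  ⌊_⌋ : Carrier → Class
  ⌊ x ⌋ z = z ∈ x

  Empty : Class
  Empty x = ∀ z → z ∉ x

  ⟦_⟧ : ∀ {n} → Formula n → Vec Carrier n → Set ℓ
  ⟦ i ∈̇ j ⟧ ρ = lookup ρ i ∈ lookup ρ j
  ⟦ i ≈̇ j ⟧ ρ = lookup ρ i ≈ lookup ρ j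
  ⟦ ⊥̇     ⟧ ρ = Lift ℓ ⊥
  ⟦ φ ∧̇ ψ ⟧ ρ = ⟦ φ ⟧ ρ × ⟦ ψ ⟧ ρ
  ⟦ φ ∨̇ ψ ⟧ ρ = ⟦ φ ⟧ ρ ⊎ ⟦ ψ ⟧ ρ
  ⟦ φ →̇ ψ ⟧ ρ = ⟦ φ ⟧ ρ → ⟦ ψ ⟧ ρ
  ⟦ ∀̇ φ   ⟧ ρ = ∀ x → ⟦ φ ⟧ (x ∷ ρ)
  ⟦ ∃̇ φ   ⟧ ρ = ∃[ x ] ⟦ φ ⟧ (x ∷ ρ)

  -- z = {x, y}
  IsPair : Carrier → Carrier → Carrier → Set ℓ
  IsPair z x y = ∀ u → u ∈ z ⇔ (u ≈ x ⊎ u ≈ y)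

  -- p = {{x}, {x, y}}
  IsOrderedPair : Carrier → Carrier → Carrier → Set ℓ
  IsOrderedPair p x y =
    ∃[ s ] ∃[ d ] IsPair s x x × IsPair d x y × IsPair p s d

  ⟨_,_⟩∈_ : Carrier → Carrier → Carrier → Set ℓ
  ⟨ x , y ⟩∈ r = ∃[ p ] IsOrderedPair p x y × p ∈ r

  IsUnion : Carrier → Carrier → Set ℓ
  IsUnion u x = ∀ z → z ∈ u ⇔ (∃[ y ] y ∈ x × z ∈ y)

  IsPowerset : Carrier → Carrier → Set ℓ
  IsPowerset p x = ∀ z → z ∈ p ⇔ ⌊ z ⌋ ⊆ ⌊ x ⌋

  -- s = y ∪ {y}
  IsSuc : Carrier → Carrier → Set ℓ
  IsSuc s y = ∀ z → z ∈ s ⇔ (z ∈ y ⊎ z ≈ y)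

  Inductive : Class
  Inductive x = (∃[ e ] Empty e × e ∈ x)
              × (∀ y → y ∈ x → ∃[ s ] IsSuc s y × s ∈ x)

  -- f is (the graph of) a function with domain exactly D and values in C.
  IsFunction : Carrier → Class → Class → Set ℓ
  IsFunction f D C =
      (∀ p → p ∈ f → ∃[ a ] ∃[ b ] D a × C b × IsOrderedPair p a b)
    × (∀ a → D a → ∃[ b ] ⟨ a , b ⟩∈ f)
    × (∀ a b b′ → ⟨ a , b ⟩∈ f → ⟨ a , b′ ⟩∈ f → b ≈ b′)

  InjectiveOn : Carrier → Class → Set ℓ
  InjectiveOn f D =
    ∀ a a′ b → D a → D a′ → ⟨ a , b ⟩∈ f → ⟨ a′ , b ⟩∈ f → a ≈ a′

  OntoClass : Carrier → Class → Set ℓ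
  OntoClass f C = ∀ b → C b → ∃[ a ] ⟨ a , b ⟩∈ f

  infix 4 _≼_ _≃_

  -- |D| ≤ |C| and |D| = |C|, as witnessed inside the model.
  _≼_ : Class → Class → Set ℓ
  D ≼ C = ∃[ f ] IsFunction f D C × InjectiveOn f D

  _≃_ : Class → Class → Set ℓ
  D ≃ C = ∃[ f ] IsFunction f D C × InjectiveOn f D × OntoClass f C

  record IsZFC : Set ℓ where
    field
      extensionality : ∀ x y w → x ≈ y → x ∈ w → y ∈ w
      foundation     : ∀ x → ∃ ⌊ x ⌋ → ∃[ y ] y ∈ x × (∀ z → z ∈ y → z ∉ x)
      pairing        : ∀ x y → ∃[ z ] IsPair z x y
      union          : ∀ x → ∃[ u ] IsUnion u x
      powerset       : ∀ x → ∃[ p ] IsPowerset p x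
      infinity       : ∃ Inductive
      separation     : ∀ {n} (φ : Formula (suc n)) (ρ : Vec Carrier n) a →
                       ∃[ b ] (∀ x → x ∈ b ⇔ (x ∈ a × ⟦ φ ⟧ (x ∷ ρ)))
      replacement    : ∀ {n} (φ : Formula (suc (suc n))) (ρ : Vec Carrier n) a →
                       (∀ x y y′ → x ∈ a → ⟦ φ ⟧ (x ∷ y ∷ ρ) →
                                   ⟦ φ ⟧ (x ∷ y′ ∷ ρ) → y ≈ y′) →
                       ∃[ b ] (∀ y → y ∈ b ⇔
                                 (∃[ x ] x ∈ a × ⟦ φ ⟧ (x ∷ y ∷ ρ)))
      choice         : ∀ x → (∀ y → y ∈ x → ∃ ⌊ y ⌋) →
                       ∃[ f ] (∃[ u ] IsFunction f ⌊ x ⌋ ⌊ u ⌋)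
                            × (∀ y b → ⟨ y , b ⟩∈ f → b ∈ y)

  Transitive : Class
  Transitive x = ∀ y → y ∈ x → ⌊ y ⌋ ⊆ ⌊ x ⌋

  IsOrdinal : Class
  IsOrdinal α = Transitive α
              × (∀ β γ → β ∈ α → γ ∈ α → β ∈ γ ⊎ β ≈ γ ⊎ γ ∈ β)

  IsCardinal : Class
  IsCardinal κ = IsOrdinal κ × (∀ β → β ∈ κ → ¬ (⌊ β ⌋ ≃ ⌊ κ ⌋))

  IsOmega : Class
  IsOmega w = ∀ z → z ∈ w ⇔ (∀ x → Inductive x → z ∈ x)

  IsInteger : Class
  IsInteger k = ∃[ ω ] IsOmega ω × k ∈ ω

  Countable : Class
  Countable x = ∃[ ω ] IsOmega ω × ⌊ x ⌋ ≼ ⌊ ω ⌋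

  -- μ = κ⁺
  IsSuccessorCardinal : Carrier → Carrier → Set ℓ
  IsSuccessorCardinal μ κ =
    IsCardinal μ × κ ∈ μ × (∀ ν → IsCardinal ν → κ ∈ ν → ⌊ μ ⌋ ⊆ ⌊ ν ⌋)

  IsOmega₁ : Class
  IsOmega₁ w = ∃[ ω ] IsOmega ω × IsSuccessorCardinal w ω

  -- 2^κ = κ⁺ for every infinite cardinal κ.
  GCH : Set ℓ
  GCH = ∀ ω κ μ p → IsOmega ω → IsCardinal κ → ⌊ ω ⌋ ⊆ ⌊ κ ⌋ →
        IsSuccessorCardinal μ κ → IsPowerset p κ → ⌊ p ⌋ ≃ ⌊ μ ⌋

  -- A ≅ (α, ∈) for a set A of ordinals.
  HasOrderType : Carrier → Carrier → Set ℓ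
  HasOrderType A α =
    ∃[ h ] IsFunction h ⌊ α ⌋ ⌊ A ⌋ × InjectiveOn h ⌊ α ⌋ × OntoClass h ⌊ A ⌋
         × (∀ β γ b c → ⟨ β , b ⟩∈ h → ⟨ γ , c ⟩∈ h → β ∈ γ ⇔ b ∈ c)

  [_]² : Carrier → Class
  [ X ]² z = ∃[ α ] ∃[ β ] α ∈ X × β ∈ X × ¬ (α ≈ β) × IsPair z α β

  -- {{α, β} : α ∈ A, β ∈ B, α < β}
  [_⨾_] : Carrier → Carrier → Class
  [ A ⨾ B ] z = ∃[ α ] ∃[ β ] α ∈ A × β ∈ B × α ∈ β × IsPair z α β

  fiber : Carrier → Carrier → Class
  fiber f ξ z = ⟨ z , ξ ⟩∈ f

  IsColouring : (f X C : Carrier) → Set ℓ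
  IsColouring f X C = IsFunction f [ X ]² ⌊ C ⌋

  Bounded : (k f : Carrier) → Set ℓ
  Bounded k f = ∀ c → fiber f c ≼ ⌊ k ⌋

  Rainbow : (f X R : Carrier) → Set ℓ
  Rainbow f X R = ⌊ R ⌋ ⊆ ⌊ X ⌋ × InjectiveOn f [ R ]²

  -- f establishes ω₁ ↛* [(ω₁;ω₁)]_{k-bdd}.
  Establishes : (k f : Carrier) → Set ℓ
  Establishes k f =
    ∃[ w ] IsOmega₁ w
         × (∃[ C ] IsColouring f w C)
         × Bounded k f
         × (∀ A B → ⌊ A ⌋ ⊆ ⌊ w ⌋ → ⌊ B ⌋ ⊆ ⌊ w ⌋ →
            HasOrderType A w → HasOrderType B w →
            ∃[ ξ ] (∃[ z ] ⟨ z , ξ ⟩∈ f)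
                 × ⌊ k ⌋ ≼ ([ A ⨾ B ] ∩ fiber f ξ))

  Omega₁IsCountableUnionOfRainbowSets : Carrier → Set ℓ
  Omega₁IsCountableUnionOfRainbowSets f =
    ∃[ w ] IsOmega₁ w
         × (∃[ F ] Countable F
                 × (∀ R → R ∈ F → Rainbow f w R)
                 × IsUnion w F)

  -- The poset (P, L), with p ≤ q meaning (p, q) ∈ L.
  IsPoset : (P L : Carrier) → Set ℓ
  IsPoset P L =
      ∃ ⌊ P ⌋
    × (∀ z → z ∈ L → ∃[ p ] ∃[ q ] p ∈ P × q ∈ P × IsOrderedPair z p q)
    × (∀ p → p ∈ P → ⟨ p , p ⟩∈ L)
    × (∀ p q r → ⟨ p , q ⟩∈ L → ⟨ q , r ⟩∈ L → ⟨ p , r ⟩∈ L)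
    × (∀ p q → ⟨ p , q ⟩∈ L → ⟨ q , p ⟩∈ L → p ≈ q)

  Compatible : (L p q : Carrier) → Set ℓ
  Compatible L p q = ∃[ r ] ⟨ r , p ⟩∈ L × ⟨ r , q ⟩∈ L

  CCC : (P L : Carrier) → Set ℓ
  CCC P L = ∀ A → ⌊ A ⌋ ⊆ ⌊ P ⌋ →
            (∀ p q → p ∈ A → q ∈ A → ¬ (p ≈ q) → ¬ Compatible L p q) →
            Countable A

  IsCCCPoset : (P L : Carrier) → Set ℓ
  IsCCCPoset P L = IsPoset P L × CCC P L

  Dense : (P L D : Carrier) → Set ℓ
  Dense P L D = ⌊ D ⌋ ⊆ ⌊ P ⌋
              × (∀ p → p ∈ P → ∃[ q ] q ∈ D × ⟨ q , p ⟩∈ L)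

  IsFilter : (P L G : Carrier) → Set ℓ
  IsFilter P L G =
      ⌊ G ⌋ ⊆ ⌊ P ⌋
    × ∃ ⌊ G ⌋
    × (∀ p q → p ∈ G → ⟨ p , q ⟩∈ L → q ∈ G)
    × (∀ p q → p ∈ G → q ∈ G → ∃[ r ] r ∈ G × ⟨ r , p ⟩∈ L × ⟨ r , q ⟩∈ L)

  -- x = val(τ, G) = {val(σ, G) : (σ, p) ∈ τ for some p ∈ G}: v is the
  -- recursively defined evaluation on a transitive set t containing τ.
  IsValue : (G τ x : Carrier) → Set ℓ
  IsValue G τ x =
    ∃[ t ] ∃[ v ] Transitive t × τ ∈ t
      × (∃[ c ] IsFunction v ⌊ t ⌋ ⌊ c ⌋)
      × (∀ σ s → ⟨ σ , s ⟩∈ v → ∀ y → y ∈ s ⇔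
           (∃[ ρ ] ∃[ p ] ⟨ ρ , p ⟩∈ σ × p ∈ G × ⟨ ρ , y ⟩∈ v))
      × ⟨ τ , x ⟩∈ v

record Model (ℓ : Level) : Set (lsuc ℓ) where
  field
    structure : Structure ℓ
  open Sets structure public
  field
    isZFC : IsZFC

-- N = M[G] for some filter G on (P, L) generic over M; embed is the inclusion
-- of M in M[G] as a transitive submodel.  Names are arbitrary elements
-- τ of M: members of τ that are not of the form (σ, p) with p ∈ P do not
-- contribute to val(τ, G).
record GenericExtension {ℓ} (M : Model ℓ) (P L : Model.Carrier M) : Set (lsuc ℓ) where
  private module M = Model M
  field
    extension : Model ℓ
  private module N = Model extension
  field
    embed      : M.Carrier → N.Carrier
    preserves  : ∀ x y → x M.∈ y → embed x N.∈ embed y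
    reflects   : ∀ x y → embed x N.∈ embed y → x M.∈ y
    transitive : ∀ x y → y N.∈ embed x → ∃[ x′ ] y N.≈ embed x′
    G          : N.Carrier
    filter     : N.IsFilter (embed P) (embed L) G
    generic    : ∀ D → M.Dense P L D → ∃[ p ] p M.∈ D × embed p N.∈ G
    generated  : ∀ x → ∃[ τ ] N.IsValue G (embed τ) x

-- V^P ⊨ Φ: Φ holds in every generic extension of M by (P, L).  Φ receives the
-- extension and the inclusion of M in it.  For countable M, every condition
-- lies in a generic filter, and this says exactly that every condition
-- forces Φ; quantifying the theorem over all models of ZFC + GCH, the
-- countable ones among them, therefore loses nothing.
Forces : ∀ {ℓ a} (M : Model ℓ) (P L : Model.Carrier M) →
         ((N : Model ℓ) → (Model.Carrier M → Model.Carrier N) → Set a) →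
         Set (lsuc ℓ ⊔ a)
Forces M P L Φ = (E : GenericExtension M P L) →
                 Φ (GenericExtension.extension E) (GenericExtension.embed E)

CCCIndestructiblyEstablishes : ∀ {ℓ} (M : Model ℓ) (k f : Model.Carrier M) → Set (lsuc ℓ)
CCCIndestructiblyEstablishes M k f =
  ∀ R L → Model.IsCCCPoset M R L →
  Forces M R L (λ N ι → Model.Establishes N (ι k) (ι f))

{-# OPTIONS --safe #-}
module Submission where

-- For b < ω₁ let 𝓕 b be a disjoint family of subsets of b with at most k elements, and colour { α , b }, α < b, by b together
-- with the member of 𝓕 b containing α, or { α } if there is none.  This colouring is k-bounded.  By CH the families can be
-- built by recursion on b so generically that finite patterns of disjoint sets can be found in several 𝓕 b at once; this is
-- what makes the two posets of finite cliques below c.c.c.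
--
-- Q consists of the finite cliques of the graph on ω₁ × ω which joins ( α , n ) and ( b , m ) if α ≠ b and, in case n = m and
-- α < b, { α } ∈ 𝓕 b.  In V^Q the rows of the generic clique are rainbow and cover ω₁.
--
-- P consists of the finite cliques of a graph on ω₂ × ω₁.  The vertex ( ξ , γ ) carries disjoint k-element sets s and t and an
-- ordinal b, nothing of it below γ, and two vertices of the same row ξ are joined if s or t of one belongs to 𝓕 b for the b of the other.
-- For the c.c.c. one chooses from each vertex of a condition one of its two sets so that the chosen sets are disjoint; this is
-- possible because the edges s ∪ t form a forest: each meets every component of the earlier ones in at most one point.
-- Every set W of triples ( s , t , b ), if rich enough, is the supply of ω₂ many rows.
--
-- Let A and B be uncountable in an extension of V^P by a c.c.c. poset R, and suppose that some r₀ in the generic filter forces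
-- that no k-element member of an 𝓕 b, b ∈ B, is contained in A.  The triples with s ∪ t ⊆ A and b ∈ B forced by some r ≤ r₀
-- form a rich set with a name in V, so by genericity some row of the generic clique contains uncountably many of them.
-- The corresponding conditions r form an uncountable antichain of R, a contradiction.

open import Defs
open import Axiom.ExcludedMiddle using (ExcludedMiddle)
open import Data.Bool using (true; false; if_then_else_)
open import Data.Empty using (⊥; ⊥-elim)
open import Data.Fin using (Fin; zero; suc; _↑ˡ_; _↑ʳ_; splitAt)
open import Data.Fin.Properties using (splitAt-↑ˡ; splitAt-↑ʳ)
open import Data.Nat using (ℕ; zero; suc; _+_; _≡ᵇ_)
open import Data.Product using (∃; ∃-syntax; _×_; _,_; proj₁; proj₂)
open import Data.Sum using (_⊎_; inj₁; inj₂; [_,_]′)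
open import Data.Unit.Polymorphic using (⊤; tt)
open import Data.Vec using (Vec; _∷_; lookup; tabulate)
open import Data.Vec.Properties using (lookup∘tabulate; tabulate-cong)
open import Function.Bundles using (_⇔_; mk⇔; module Equivalence)
open import Level using (Lift; lift; lower) renaming (suc to lsuc)
open import Relation.Binary.PropositionalEquality using (_≡_; refl; sym; trans; cong; subst; subst₂)
open import Relation.Nullary using (¬_; Dec; yes; no)
open import Relation.Unary using (_⊆_)
open Equivalence using (to; from)

-- The obstacle is the chain condition of P. Genericity of `𝓕` supplies only patterns that are
-- disjoint families, whereas the sets attached to the vertices of a condition come from different
-- rows and may overlap. Hence the two halves: in a forest at most one point of an edge is connected
-- to the points already used, and the half that misses it can be taken. Forests in turn dictate
-- what richness of W means: for every unbounded set of ordinals in V, some triple of W has its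
-- points separated by that set. Applied to the closure points of the graph built so far, this puts
-- the points into different components. As only unbounded sets of V are tested, triples drawn from
-- sets of a later model can be rich too. The number ω₂ is needed for a W that has only a name. For
-- each triple that may enter W one condition is fixed that puts it there; all these conditions
-- together use at most ω₁ rows. Some row with the right supply is therefore untouched, and its
-- vertices can be added to the conditions without obligation. GCH enters as CH, for the bookkeeping
-- of `𝓕`, and at ω₁, for indexing the supplies by ω₂.

private
  ⇔-refl : ∀ {ℓ} {A : Set ℓ} → A ⇔ A
  ⇔-refl = mk⇔ (λ a → a) (λ a → a)

  ⇔-sym : ∀ {a b} {A : Set a} {B : Set b} → A ⇔ B → B ⇔ A
  ⇔-sym e = mk⇔ (from e) (to e)

  ⇔-trans : ∀ {a b c} {A : Set a} {B : Set b} {C : Set c} → A ⇔ B → B ⇔ C → A ⇔ C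
  ⇔-trans e e′ = mk⇔ (λ a → to e′ (to e a)) (λ c → from e (from e′ c))

  -- Renaming of variables in formulas

  lift-ren : ∀ {n m} → (Fin n → Fin m) → Fin (suc n) → Fin (suc m)
  lift-ren r zero    = zero
  lift-ren r (suc i) = suc (r i)

  ren : ∀ {n m} → (Fin n → Fin m) → Formula n → Formula m
  ren r (i ∈̇ j) = r i ∈̇ r j
  ren r (i ≈̇ j) = r i ≈̇ r j
  ren r ⊥̇       = ⊥̇
  ren r (φ ∧̇ ψ) = ren r φ ∧̇ ren r ψ
  ren r (φ ∨̇ ψ) = ren r φ ∨̇ ren r ψ
  ren r (φ →̇ ψ) = ren r φ →̇ ren r ψ
  ren r (∀̇ φ)   = ∀̇ ren (lift-ren r) φ
  ren r (∃̇ φ)   = ∃̇ ren (lift-ren r) φ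

  module SetTheory {ℓ} (em : ExcludedMiddle ℓ) (M : Model ℓ) where

    -- Definability with parameters in a model

    module Definability where
      open Model M public renaming (Carrier to V)
      open IsZFC isZFC public

      ⟦ren⟧ : ∀ {n m} (r : Fin n → Fin m) φ {ρ : Vec V n} {σ : Vec V m} →
              (∀ i → lookup σ (r i) ≡ lookup ρ i) → ⟦ ren r φ ⟧ σ ⇔ ⟦ φ ⟧ ρ
      ⟦ren⟧ r (i ∈̇ j) h = mk⇔ (subst₂ _∈_ (h i) (h j)) (subst₂ _∈_ (sym (h i)) (sym (h j)))
      ⟦ren⟧ r (i ≈̇ j) h = mk⇔ (subst₂ _≈_ (h i) (h j)) (subst₂ _≈_ (sym (h i)) (sym (h j)))
      ⟦ren⟧ r ⊥̇       h = ⇔-refl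
      ⟦ren⟧ r (φ ∧̇ ψ) h = mk⇔ (λ (a , b) → to (⟦ren⟧ r φ h) a , to (⟦ren⟧ r ψ h) b)
                               (λ (a , b) → from (⟦ren⟧ r φ h) a , from (⟦ren⟧ r ψ h) b)
      ⟦ren⟧ r (φ ∨̇ ψ) h = mk⇔ [ (λ a → inj₁ (to (⟦ren⟧ r φ h) a)) , (λ b → inj₂ (to (⟦ren⟧ r ψ h) b)) ]′
                               [ (λ a → inj₁ (from (⟦ren⟧ r φ h) a)) , (λ b → inj₂ (from (⟦ren⟧ r ψ h) b)) ]′
      ⟦ren⟧ r (φ →̇ ψ) h = mk⇔ (λ f a → to (⟦ren⟧ r ψ h) (f (from (⟦ren⟧ r φ h) a)))
                               (λ f a → from (⟦ren⟧ r ψ h) (f (to (⟦ren⟧ r φ h) a)))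
      ⟦ren⟧ r (∀̇ φ) {ρ} {σ} h = mk⇔ (λ f x → to (⟦ren⟧ _ φ (h′ x)) (f x)) (λ f x → from (⟦ren⟧ _ φ (h′ x)) (f x))
        where h′ : ∀ x i → lookup (x ∷ σ) (lift-ren r i) ≡ lookup (x ∷ ρ) i
              h′ x zero    = refl
              h′ x (suc i) = h i
      ⟦ren⟧ r (∃̇ φ) {ρ} {σ} h = mk⇔ (λ (x , a) → x , to (⟦ren⟧ _ φ (h′ x)) a) (λ (x , a) → x , from (⟦ren⟧ _ φ (h′ x)) a)
        where h′ : ∀ x i → lookup (x ∷ σ) (lift-ren r i) ≡ lookup (x ∷ ρ) i
              h′ x zero    = refl
              h′ x (suc i) = h i

      Env : ℕ → Set ℓ
      Env zero    = ⊤
      Env (suc n) = V × Env n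

      get : ∀ {n} → Fin n → Env n → V
      get zero    ρ = proj₁ ρ
      get (suc i) ρ = get i (proj₂ ρ)

      val : ∀ {n} → Fin n ⊎ V → Env n → V
      val (inj₁ i) ρ = get i ρ
      val (inj₂ c) ρ = c

      -- Definability with parameters: σ assigns to every variable of the formula a variable of the environment or a parameter.
      D : ∀ n → (Env n → Set ℓ) → Set ℓ
      D n P = ∃ λ N → ∃ λ (φ : Formula N) → ∃ λ (σ : Fin N → Fin n ⊎ V) →
        ∀ ρ → ⟦ φ ⟧ (tabulate (λ i → val (σ i) ρ)) ⇔ P ρ

      Dcong : ∀ {n P Q} → (∀ ρ → P ρ ⇔ Q ρ) → D n P → D n Q
      Dcong e (N , φ , σ , h) = N , φ , σ , λ ρ → ⇔-trans (h ρ) (e ρ)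

      module _ {n : ℕ} {P Q : Env n → Set ℓ} where
        private
          -- The two formulas get disjoint blocks of variables, so their assignments never have to
          -- be reconciled.
          merge : (c : ∀ {m} → Formula m → Formula m → Formula m) (R : Set ℓ → Set ℓ → Set ℓ) →
                  (∀ {m} (φ ψ : Formula m) ρ → ⟦ c φ ψ ⟧ ρ ≡ R (⟦ φ ⟧ ρ) (⟦ ψ ⟧ ρ)) →
                  (∀ {A A′ B B′} → A ⇔ A′ → B ⇔ B′ → R A B ⇔ R A′ B′) →
                  D n P → D n Q → D n (λ ρ → R (P ρ) (Q ρ))
          merge c R comp cg (N₁ , φ₁ , σ₁ , h₁) (N₂ , φ₂ , σ₂ , h₂) =
            N₁ + N₂ , c (ren (_↑ˡ N₂) φ₁) (ren (N₁ ↑ʳ_) φ₂) , σ ,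
            λ ρ → subst (_⇔ R (P ρ) (Q ρ)) (sym (comp (ren (_↑ˡ N₂) φ₁) (ren (N₁ ↑ʳ_) φ₂) _))
                    (cg (⇔-trans (⟦ren⟧ (_↑ˡ N₂) φ₁ (l ρ)) (h₁ ρ)) (⇔-trans (⟦ren⟧ (N₁ ↑ʳ_) φ₂ (r ρ)) (h₂ ρ)))
            where
              σ : Fin (N₁ + N₂) → Fin n ⊎ V
              σ i = [ σ₁ , σ₂ ]′ (splitAt N₁ i)
              l : ∀ ρ i → lookup (tabulate (λ i → val (σ i) ρ)) (i ↑ˡ N₂) ≡ lookup (tabulate (λ i → val (σ₁ i) ρ)) i
              l ρ i = trans (lookup∘tabulate _ (i ↑ˡ N₂))
                      (trans (cong (λ z → val ([ σ₁ , σ₂ ]′ z) ρ) (splitAt-↑ˡ N₁ i N₂)) (sym (lookup∘tabulate _ i)))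
              r : ∀ ρ i → lookup (tabulate (λ i → val (σ i) ρ)) (N₁ ↑ʳ i) ≡ lookup (tabulate (λ i → val (σ₂ i) ρ)) i
              r ρ i = trans (lookup∘tabulate _ (N₁ ↑ʳ i))
                      (trans (cong (λ z → val ([ σ₁ , σ₂ ]′ z) ρ) (splitAt-↑ʳ N₁ N₂ i)) (sym (lookup∘tabulate _ i)))

        ×′ : D n P → D n Q → D n (λ ρ → P ρ × Q ρ)
        ×′ = merge _∧̇_ _×_ (λ _ _ _ → refl) (λ e f → mk⇔ (λ (a , b) → to e a , to f b) (λ (a , b) → from e a , from f b))
        ⊎′ : D n P → D n Q → D n (λ ρ → P ρ ⊎ Q ρ)
        ⊎′ = merge _∨̇_ _⊎_ (λ _ _ _ → refl) (λ e f → mk⇔ [ (λ a → inj₁ (to e a)) , (λ b → inj₂ (to f b)) ]′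
                                                             [ (λ a → inj₁ (from e a)) , (λ b → inj₂ (from f b)) ]′)
        →′ : D n P → D n Q → D n (λ ρ → P ρ → Q ρ)
        →′ = merge _→̇_ (λ A B → A → B) (λ _ _ _ → refl)
               (λ e f → mk⇔ (λ h a → to f (h (from e a))) (λ h a → from f (h (to e a))))

      ⊥′ : ∀ {n} → D n (λ _ → Lift ℓ ⊥)
      ⊥′ = 0 , ⊥̇ , (λ ()) , λ _ → ⇔-refl

      someV : V
      someV = proj₁ infinity

      module _ {n : ℕ} where
        private
          -- Several variables of one formula may stand for the variable to be quantified. `bind`
          -- identifies all of them with the bound variable; their old slots remain and hold the
          -- dummy parameter `someV`, which is never looked up.
          shift : (Fin (suc n) ⊎ V) → Fin n ⊎ V
          shift (inj₁ zero)    = inj₂ someV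
          shift (inj₁ (suc i)) = inj₁ i
          shift (inj₂ c)       = inj₂ c
          bind : ∀ {N} → Fin (suc n) ⊎ V → Fin N → Fin (suc N)
          bind (inj₁ zero)    i = zero
          bind (inj₁ (suc _)) i = suc i
          bind (inj₂ c)       i = suc i
          ok : ∀ {N} (σ : Fin N → Fin (suc n) ⊎ V) x (ρ : Env n) i →
               lookup (x ∷ tabulate (λ i → val (shift (σ i)) ρ)) (bind (σ i) i) ≡ lookup (tabulate (λ i → val (σ i) (x , ρ))) i
          ok σ x ρ i = trans (lem (σ i) refl) (sym (lookup∘tabulate _ i))
            where
              lem : ∀ s → σ i ≡ s → lookup (x ∷ tabulate (λ i → val (shift (σ i)) ρ)) (bind s i) ≡ val (σ i) (x , ρ)
              lem (inj₁ zero)    e = cong (λ s → val s (x , ρ)) (sym e)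
              lem (inj₁ (suc j)) e = trans (lookup∘tabulate _ i) (trans (cong (λ s → val (shift s) ρ) e) (cong (λ s → val s (x , ρ)) (sym e)))
              lem (inj₂ c)       e = trans (lookup∘tabulate _ i) (trans (cong (λ s → val (shift s) ρ) e) (cong (λ s → val s (x , ρ)) (sym e)))

        ∀′ : ∀ {P : Env (suc n) → Set ℓ} → D (suc n) P → D n (λ ρ → ∀ x → P (x , ρ))
        ∀′ (N , φ , σ , h) = N , ∀̇ ren (λ i → bind (σ i) i) φ , (λ i → shift (σ i)) ,
          λ ρ → mk⇔ (λ f x → to (h (x , ρ)) (to (⟦ren⟧ _ φ (ok σ x ρ)) (f x)))
                    (λ f x → from (⟦ren⟧ _ φ (ok σ x ρ)) (from (h (x , ρ)) (f x)))

        ∃′ : ∀ {P : Env (suc n) → Set ℓ} → D (suc n) P → D n (λ ρ → ∃ λ x → P (x , ρ))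
        ∃′ (N , φ , σ , h) = N , ∃̇ ren (λ i → bind (σ i) i) φ , (λ i → shift (σ i)) ,
          λ ρ → mk⇔ (λ (x , f) → x , to (h (x , ρ)) (to (⟦ren⟧ _ φ (ok σ x ρ)) f))
                    (λ (x , f) → x , from (⟦ren⟧ _ φ (ok σ x ρ)) (from (h (x , ρ)) f))

      ≈-refl : ∀ {x} → x ≈ x
      ≈-refl z = ⇔-refl
      ≈-sym : ∀ {x y} → x ≈ y → y ≈ x
      ≈-sym e z = ⇔-sym (e z)
      ≈-trans : ∀ {x y z} → x ≈ y → y ≈ z → x ≈ z
      ≈-trans e f z = ⇔-trans (e z) (f z)

      -- Equality is coextensionality, so formulas respect it only thanks to the axiom of
      -- extensionality, which enters at the left argument of membership. `D-resp`, and through it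
      -- `≈-subst` and `≈-cong`, rest on this.
      invariant : ∀ {n} (φ : Formula n) {ρ σ : Vec V n} → (∀ i → lookup ρ i ≈ lookup σ i) → ⟦ φ ⟧ ρ ⇔ ⟦ φ ⟧ σ
      invariant (i ∈̇ j) e = mk⇔ (λ p → to (e j _) (extensionality _ _ _ (e i) p))
                                 (λ p → from (e j _) (extensionality _ _ _ (≈-sym (e i)) p))
      invariant (i ≈̇ j) e = mk⇔ (λ p → ≈-trans (≈-sym (e i)) (≈-trans p (e j))) (λ p → ≈-trans (e i) (≈-trans p (≈-sym (e j))))
      invariant ⊥̇       e = ⇔-refl
      invariant (φ ∧̇ ψ) e = mk⇔ (λ (a , b) → to (invariant φ e) a , to (invariant ψ e) b)
                               (λ (a , b) → from (invariant φ e) a , from (invariant ψ e) b)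
      invariant (φ ∨̇ ψ) e = mk⇔ [ (λ a → inj₁ (to (invariant φ e) a)) , (λ b → inj₂ (to (invariant ψ e) b)) ]′
                               [ (λ a → inj₁ (from (invariant φ e) a)) , (λ b → inj₂ (from (invariant ψ e) b)) ]′
      invariant (φ →̇ ψ) e = mk⇔ (λ f a → to (invariant ψ e) (f (from (invariant φ e) a)))
                               (λ f a → from (invariant ψ e) (f (to (invariant φ e) a)))
      invariant (∀̇ φ) e = mk⇔ (λ f x → to (invariant φ (cons e)) (f x)) (λ f x → from (invariant φ (cons e)) (f x))
        where cons : ∀ {n} {ρ σ : Vec V n} {x} → (∀ i → lookup ρ i ≈ lookup σ i) → ∀ i → lookup (x ∷ ρ) i ≈ lookup (x ∷ σ) i
              cons e zero    = ≈-refl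
              cons e (suc i) = e i
      invariant (∃̇ φ) e = mk⇔ (λ (x , f) → x , to (invariant φ (cons e)) f) (λ (x , f) → x , from (invariant φ (cons e)) f)
        where cons : ∀ {n} {ρ σ : Vec V n} {x} → (∀ i → lookup ρ i ≈ lookup σ i) → ∀ i → lookup (x ∷ ρ) i ≈ lookup (x ∷ σ) i
              cons e zero    = ≈-refl
              cons e (suc i) = e i

      ∈′ : ∀ {n} (i j : Fin n ⊎ V) → D n (λ ρ → val i ρ ∈ val j ρ)
      ∈′ i j = 2 , zero ∈̇ suc zero , (λ { zero → i ; (suc zero) → j }) , λ ρ → ⇔-refl
      ≈′ : ∀ {n} (i j : Fin n ⊎ V) → D n (λ ρ → val i ρ ≈ val j ρ)
      ≈′ i j = 2 , zero ≈̇ suc zero , (λ { zero → i ; (suc zero) → j }) , λ ρ → ⇔-refl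

    open Definability public

    -- Definable terms and a syntax with binders

    module Definable where
      dne : {A : Set ℓ} → ¬ ¬ A → A
      dne {A} h with em {A}
      ... | yes a = a
      ... | no ¬a = ⊥-elim (h ¬a)

      ¬∀⇒∃¬ : {A : Set ℓ} {P : A → Set ℓ} → ¬ (∀ x → P x) → ∃ λ x → ¬ P x
      ¬∀⇒∃¬ {A} {P} h with em {∃ λ x → ¬ P x}
      ... | yes e = e
      ... | no ¬e = ⊥-elim (h (λ x → dne (λ np → ¬e (x , np))))

      -- Definable terms, through their graphs.
      T : ∀ n → (Env n → V) → Set ℓ
      T n t = D (suc n) (λ ρ → proj₁ ρ ≈ t (proj₂ ρ))

      reindex : ∀ {n m P} (r : Fin n → Fin m) (g : Env m → Env n) → (∀ i ρ → get (r i) ρ ≡ get i (g ρ)) →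
            D n P → D m (λ ρ → P (g ρ))
      reindex {n} {m} r g e (N , φ , σ , h) = N , φ , (λ i → sh (σ i)) ,
          λ ρ → subst (λ v → ⟦ φ ⟧ v ⇔ _) (sym (tabulate-cong (λ i → val-sh (σ i) ρ))) (h (g ρ))
        where
          sh : Fin n ⊎ V → Fin m ⊎ V
          sh (inj₁ i) = inj₁ (r i)
          sh (inj₂ c) = inj₂ c
          val-sh : ∀ s ρ → val (sh s) ρ ≡ val s (g ρ)
          val-sh (inj₁ i) ρ = e i ρ
          val-sh (inj₂ c) ρ = refl

      skip : ∀ {n} → Fin (suc n) → Fin (suc (suc n))
      skip zero     = zero
      skip (suc i)  = suc (suc i)

      get-skip : ∀ {n} (i : Fin (suc n)) (ρ : Env (suc (suc n))) → get (skip i) ρ ≡ get i (proj₁ ρ , proj₂ (proj₂ ρ))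
      get-skip zero    ρ = refl
      get-skip (suc i) ρ = refl

      T-con : ∀ {n} c → T n (λ _ → c)
      T-con c = ≈′ (inj₁ zero) (inj₂ c)
      T-var : ∀ {n} → T (suc n) proj₁
      T-var = ≈′ (inj₁ zero) (inj₁ (suc zero))
      T-wk : ∀ {n} {t : Env n → V} → T n t → T (suc n) (λ ρ → t (proj₂ ρ))
      T-wk d = reindex skip (λ (z , x , ρ) → z , ρ) get-skip d

      D-resp : ∀ {n} {P : Env (suc n) → Set ℓ} → D (suc n) P → ∀ {x y ρ} → x ≈ y → P (x , ρ) → P (y , ρ)
      D-resp (N , φ , σ , h) {x} {y} {ρ} e p = to (h (y , ρ)) (to (invariant φ (λ i → lem i)) (from (h (x , ρ)) p))
        where
          v : ∀ s → val s (x , ρ) ≈ val s (y , ρ)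
          v (inj₁ zero) = e
          v (inj₁ (suc i)) = ≈-refl
          v (inj₂ c)    = ≈-refl
          lem : ∀ i → lookup (tabulate (λ i → val (σ i) (x , ρ))) i ≈ lookup (tabulate (λ i → val (σ i) (y , ρ))) i
          lem i = subst₂ _≈_ (sym (lookup∘tabulate _ i)) (sym (lookup∘tabulate _ i)) (v (σ i))

      -- A definable term is given by its graph only, so substituting it goes through an existential
      -- quantifier; `D-resp` removes the quantifier again.
      plug : ∀ {n} {P : Env (suc n) → Set ℓ} {t : Env n → V} → D (suc n) P → T n t → D n (λ ρ → P (t ρ , ρ))
      plug {t = t} d b = Dcong (λ ρ → mk⇔ (λ (x , e , p) → D-resp d e p) (λ p → t ρ , ≈-refl , p)) (∃′ (×′ b d))

      T-ext : ∀ {n} {t : Env n → V} → D (suc n) (λ ρ → proj₁ ρ ∈ t (proj₂ ρ)) → T n t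
      T-ext {n} {t} d = ∀′ (Dcong (λ ρ → mk⇔ (λ (a , b) → mk⇔ a b) (λ e → to e , from e))
          (×′ (→′ (∈′ (inj₁ zero) (inj₁ (suc zero))) d′) (→′ d′ (∈′ (inj₁ zero) (inj₁ (suc zero))))))
        where d′ = reindex skip (λ (w , z , ρ) → w , ρ) get-skip d

      ∈-resp : ∀ {x x′ y y′} → x ≈ x′ → y ≈ y′ → x ∈ y → x′ ∈ y′
      ∈-resp p q r = to (q _) (extensionality _ _ _ p r)

      D-∈ : ∀ {n} {t u : Env n → V} → T n t → T n u → D n (λ ρ → t ρ ∈ u ρ)
      D-∈ {t = t} {u} a b = plug {t = u} (plug {t = λ ρ → t (proj₂ ρ)} (∈′ (inj₁ zero) (inj₁ (suc zero))) (T-wk a)) b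
      D-≈ : ∀ {n} {t u : Env n → V} → T n t → T n u → D n (λ ρ → t ρ ≈ u ρ)
      D-≈ {t = t} {u} a b = plug {t = u} (plug {t = λ ρ → t (proj₂ ρ)} (≈′ (inj₁ zero) (inj₁ (suc zero))) (T-wk a)) b

      private
        sep-ex : ∀ (P : V → Set ℓ) → D 1 (λ ρ → P (proj₁ ρ)) → ∀ a → ∃ λ b → ∀ x → x ∈ b ⇔ (x ∈ a × P x)
        sep-ex P (N , φ , σ , h) a = proj₁ s , λ x → ⇔-trans (proj₂ s x)
                (mk⇔ (λ (p , q) → p , to (h (x , tt)) (to (⟦ren⟧ r φ (ok x)) q))
                     (λ (p , q) → p , from (⟦ren⟧ r φ (ok x)) (from (h (x , tt)) q)))
          where
            r : Fin N → Fin (suc N)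
            r i = [ (λ _ → zero) , (λ _ → suc i) ]′ (σ i)
            ps : Fin N → V
            ps i = [ (λ _ → someV) , (λ c → c) ]′ (σ i)
            s = separation (ren r φ) (tabulate ps) a
            ok : ∀ x i → lookup (x ∷ tabulate ps) (r i) ≡ lookup (tabulate (λ i → val (σ i) (x , tt))) i
            ok x i = trans (lem (σ i) refl) (sym (lookup∘tabulate _ i))
              where
                lem : ∀ s → σ i ≡ s → lookup (x ∷ tabulate ps) ([ (λ _ → zero) , (λ _ → suc i) ]′ s) ≡ val (σ i) (x , tt)
                lem (inj₁ zero) e = cong (λ s → val s (x , tt)) (sym e)
                lem (inj₂ c) e = trans (lookup∘tabulate _ i) (trans (cong [ (λ _ → someV) , (λ c → c) ]′ e) (cong (λ s → val s (x , tt)) (sym e)))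

        img-ex : ∀ (t : V → V) → T 1 (λ ρ → t (proj₁ ρ)) → ∀ a → ∃ λ b → ∀ y → y ∈ b ⇔ (∃ λ x → x ∈ a × y ≈ t x)
        img-ex t (N , φ , σ , h) a = proj₁ s , λ y → ⇔-trans (proj₂ s y)
                (mk⇔ (λ (x , p , q) → x , p , to (h (y , x , tt)) (to (⟦ren⟧ r φ (ok x y)) q))
                     (λ (x , p , q) → x , p , from (⟦ren⟧ r φ (ok x y)) (from (h (y , x , tt)) q)))
          where
            r′ : Fin N → Fin 2 ⊎ V → Fin (suc (suc N))
            r′ i (inj₁ zero) = suc zero
            r′ i (inj₁ (suc zero)) = zero
            r′ i (inj₂ c) = suc (suc i)
            r : Fin N → Fin (suc (suc N))
            r i = r′ i (σ i)
            ps : Fin N → V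
            ps i = [ (λ _ → someV) , (λ c → c) ]′ (σ i)
            ok : ∀ x y i → lookup (x ∷ y ∷ tabulate ps) (r i) ≡ lookup (tabulate (λ i → val (σ i) (y , x , tt))) i
            ok x y i = trans (lem (σ i) refl) (sym (lookup∘tabulate _ i))
              where
                lem : ∀ s → σ i ≡ s → lookup (x ∷ y ∷ tabulate ps) (r′ i s) ≡ val (σ i) (y , x , tt)
                lem (inj₁ zero) e = cong (λ s → val s (y , x , tt)) (sym e)
                lem (inj₁ (suc zero)) e = cong (λ s → val s (y , x , tt)) (sym e)
                lem (inj₂ c) e = trans (lookup∘tabulate _ i) (trans (cong [ (λ _ → someV) , (λ c → c) ]′ e) (cong (λ s → val s (y , x , tt)) (sym e)))
            s = replacement (ren r φ) (tabulate ps) a λ x y y′ _ p q →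
                  ≈-trans (to (h (y , x , tt)) (to (⟦ren⟧ r φ (ok x y)) p))
                          (≈-sym (to (h (y′ , x , tt)) (to (⟦ren⟧ r φ (ok x y′)) q)))

      -- The set with the given members, when there is one (and junk otherwise).
      private
        the-set : (V → Set ℓ) → V
        the-set P with em {∃ λ b → ∀ x → x ∈ b ⇔ P x}
        ... | yes (b , _) = b
        ... | no _        = someV

        the-set-spec : ∀ (P : V → Set ℓ) → (∃ λ b → ∀ x → x ∈ b ⇔ P x) → ∀ x → x ∈ the-set P ⇔ P x
        the-set-spec P e with em {∃ λ b → ∀ x → x ∈ b ⇔ P x}
        ... | yes (b , h) = h
        ... | no ¬e       = ⊥-elim (¬e e)

      abstract
        -- No proof of definability is demanded here: `evT` can thus be defined by recursion on the
        -- syntax, and `D-ev` shows afterwards that the predicates that arise are definable.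
        sep : (V → Set ℓ) → V → V
        sep P a = the-set (λ x → x ∈ a × P x)
        sep-D : ∀ (P : V → Set ℓ) → D 1 (λ ρ → P (proj₁ ρ)) → ∀ a x → x ∈ sep P a ⇔ (x ∈ a × P x)
        sep-D P d a = the-set-spec _ (sep-ex P d a)
        img : (V → V) → V → V
        img t a = the-set (λ y → ∃ λ x → x ∈ a × y ≈ t x)
        img-D : ∀ (t : V → V) → T 1 (λ ρ → t (proj₁ ρ)) → ∀ a y → y ∈ img t a ⇔ (∃ λ x → x ∈ a × y ≈ t x)
        img-D t d a = the-set-spec _ (img-ex t d a)

      fix : ∀ {n} {P : Env (suc n) → Set ℓ} → D (suc n) P → ∀ ρ → D 1 (λ x → P (proj₁ x , ρ))
      fix {n} {P} (N , φ , σ , h) ρ = N , φ , (λ i → f (σ i)) ,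
          λ x → subst (λ v → ⟦ φ ⟧ v ⇔ _) (sym (tabulate-cong (λ i → g (σ i) x))) (h (proj₁ x , ρ))
        where
          f : Fin (suc n) ⊎ V → Fin 1 ⊎ V
          f (inj₁ zero)    = inj₁ zero
          f (inj₁ (suc i)) = inj₂ (get i ρ)
          f (inj₂ c)       = inj₂ c
          g : ∀ s x → val (f s) x ≡ val s (proj₁ x , ρ)
          g (inj₁ zero) x = refl
          g (inj₁ (suc i)) x = refl
          g (inj₂ c) x = refl

      T-sep : ∀ {n} {P : Env (suc n) → Set ℓ} {a : Env n → V} → D (suc n) P → T n a →
              T n (λ ρ → sep (λ x → P (x , ρ)) (a ρ))
      T-sep {P = P} {a} d e = T-ext (Dcong (λ (x , ρ) → ⇔-sym (sep-D (λ x → P (x , ρ)) (fix d ρ) (a ρ) x))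
                                          (×′ (D-∈ T-var (T-wk e)) d))

      -- Formulas and terms with binders, whose meaning computes to the predicate or set they denote.
      -- A variable is named by the depth of its binder.  A name ending in ᶠ stands for the syntax of the notion without ᶠ.
      data Raw : Set (lsuc ℓ)
      data RawT : Set (lsuc ℓ)

      data Raw where
        memʳ eqʳ       : RawT → RawT → Raw
        ⊥ʳ             : Raw
        andʳ orʳ impʳ  : Raw → Raw → Raw
        iffʳ           : Raw → Raw → Raw
        notʳ           : Raw → Raw
        allʳ exʳ       : ℕ → Raw → Raw
        rel₁ : (P : V → Set ℓ) → D 1 (λ ρ → P (proj₁ ρ)) → RawT → Raw
        rel₂ : (P : V → V → Set ℓ) → D 2 (λ ρ → P (proj₁ ρ) (proj₁ (proj₂ ρ))) → RawT → RawT → Raw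
        rel₃ : (P : V → V → V → Set ℓ) → D 3 (λ ρ → P (proj₁ ρ) (proj₁ (proj₂ ρ)) (proj₁ (proj₂ (proj₂ ρ)))) →
               RawT → RawT → RawT → Raw

      data RawT where
        varʳ : ℕ → RawT
        conʳ : V → RawT
        fn₁  : (t : V → V) → T 1 (λ ρ → t (proj₁ ρ)) → RawT → RawT
        fn₂  : (t : V → V → V) → T 2 (λ ρ → t (proj₁ ρ) (proj₁ (proj₂ ρ))) → RawT → RawT → RawT
        sepʳ : ℕ → Raw → RawT → RawT

      Asg : Set ℓ
      Asg = ℕ → V

      infixl 5 _[_↦_]
      _[_↦_] : Asg → ℕ → V → Asg
      (e [ d ↦ x ]) i = if i ≡ᵇ d then x else e i

      evT : RawT → Asg → V
      ev  : Raw → Asg → Set ℓ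

      evT (varʳ i)     e = e i
      evT (conʳ c)     e = c
      evT (fn₁ t _ x)  e = t (evT x e)
      evT (fn₂ t _ x y) e = t (evT x e) (evT y e)
      evT (sepʳ d r a) e = sep (λ x → ev r (e [ d ↦ x ])) (evT a e)

      ev (memʳ s t) e = evT s e ∈ evT t e
      ev (eqʳ s t)  e = evT s e ≈ evT t e
      ev ⊥ʳ         e = Lift ℓ ⊥
      ev (andʳ r s) e = ev r e × ev s e
      ev (orʳ r s)  e = ev r e ⊎ ev s e
      ev (impʳ r s) e = ev r e → ev s e
      ev (iffʳ r s) e = ev r e ⇔ ev s e
      ev (notʳ r)   e = ¬ ev r e
      ev (allʳ d r) e = ∀ x → ev r (e [ d ↦ x ])
      ev (exʳ d r)  e = ∃ λ x → ev r (e [ d ↦ x ])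
      ev (rel₁ P _ s) e = P (evT s e)
      ev (rel₂ P _ s t) e = P (evT s e) (evT t e)
      ev (rel₃ P _ s t u) e = P (evT s e) (evT t e) (evT u e)

      private
        upd : ∀ {n} {E : Env n → Asg} d → (∀ i → T n (λ ρ → E ρ i)) →
              ∀ i → T (suc n) (λ ρ → (E (proj₂ ρ) [ d ↦ proj₁ ρ ]) i)
        upd d h i with i ≡ᵇ d
        ... | true  = T-var
        ... | false = T-wk (h i)

      T-ev : ∀ {n} (t : RawT) {E : Env n → Asg} → (∀ i → T n (λ ρ → E ρ i)) → T n (λ ρ → evT t (E ρ))
      D-ev : ∀ {n} (r : Raw) {E : Env n → Asg} → (∀ i → T n (λ ρ → E ρ i)) → D n (λ ρ → ev r (E ρ))

      T-ev (varʳ i) h = h i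
      T-ev (conʳ c) h = T-con c
      T-ev {n} (fn₁ t d x) {E} h = plug {t = λ ρ → evT x (E (proj₂ ρ))} (reindex (λ { zero → suc zero ; (suc zero) → zero }) (λ (x , z , ρ) → z , x , tt)
                                          (λ { zero ρ → refl ; (suc zero) ρ → refl }) d) (T-wk (T-ev x h))
      T-ev (fn₂ t d x y) {E} h = plug {t = λ ρ → evT y (E (proj₂ ρ))} (plug {t = λ ρ → evT x (E (proj₂ (proj₂ ρ)))}
              (reindex (λ { zero → suc (suc zero) ; (suc zero) → zero ; (suc (suc zero)) → suc zero })
                  (λ (x , y , z , ρ) → z , x , y , tt)
                  (λ { zero ρ → refl ; (suc zero) ρ → refl ; (suc (suc zero)) ρ → refl }) d) (T-wk (T-wk (T-ev x h)))) (T-wk (T-ev y h))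
      T-ev (sepʳ d r a) h = T-sep (D-ev r (upd d h)) (T-ev a h)

      D-ev (memʳ s t) h = D-∈ (T-ev s h) (T-ev t h)
      D-ev (eqʳ s t)  h = D-≈ (T-ev s h) (T-ev t h)
      D-ev ⊥ʳ         h = ⊥′
      D-ev (andʳ r s) h = ×′ (D-ev r h) (D-ev s h)
      D-ev (orʳ r s)  h = ⊎′ (D-ev r h) (D-ev s h)
      D-ev (impʳ r s) h = →′ (D-ev r h) (D-ev s h)
      D-ev (iffʳ r s) h = Dcong (λ ρ → mk⇔ (λ (a , b) → mk⇔ a b) (λ e → to e , from e))
                            (×′ (→′ (D-ev r h) (D-ev s h)) (→′ (D-ev s h) (D-ev r h)))
      D-ev (notʳ r)   h = Dcong (λ ρ → mk⇔ (λ f a → lower (f a)) (λ f a → lift (f a))) (→′ (D-ev r h) ⊥′)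
      D-ev (allʳ d r) h = ∀′ (D-ev r (upd d h))
      D-ev (exʳ d r)  h = ∃′ (D-ev r (upd d h))
      D-ev (rel₁ P d s) {E} h = plug {t = λ ρ → evT s (E ρ)} (reindex (λ { zero → zero }) (λ (x , ρ) → x , tt) (λ { zero ρ → refl }) d) (T-ev s h)
      D-ev (rel₂ P d s t) {E} h = plug {t = λ ρ → evT t (E ρ)} (plug {t = λ ρ → evT s (E (proj₂ ρ))}
              (reindex (λ { zero → zero ; (suc zero) → suc zero }) (λ (x , y , ρ) → x , y , tt)
                  (λ { zero ρ → refl ; (suc zero) ρ → refl }) d) (T-wk (T-ev s h))) (T-ev t h)

      D-ev (rel₃ P d s t u) {E} h = plug {t = λ ρ → evT u (E ρ)} (plug {t = λ ρ → evT t (E (proj₂ ρ))} (plug {t = λ ρ → evT s (E (proj₂ (proj₂ ρ)))}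
              (reindex (λ { zero → zero ; (suc zero) → suc zero ; (suc (suc zero)) → suc (suc zero) }) (λ (x , y , z , ρ) → x , y , z , tt)
                  (λ { zero ρ → refl ; (suc zero) ρ → refl ; (suc (suc zero)) ρ → refl }) d) (T-wk (T-wk (T-ev s h)))) (T-wk (T-ev t h))) (T-ev u h)

      -- The argument counts the enclosing binders. It is the fresh name that `∀ᶠ`, `∃ᶠ` and `sepᶠ`
      -- give to their variable, which allows object-level binders to be written as Agda functions.
      Tm Fm : Set (lsuc ℓ)
      Tm = ℕ → RawT
      Fm = ℕ → Raw

      infix  7 _∈ᶠ_ _≈ᶠ_ _⊑ᶠ_
      infixr 6 _∧ᶠ_
      infixr 5 _∨ᶠ_
      infixr 4 _⇒ᶠ_
      infix  4.5 _⇔ᶠ_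
      infix  2 ∀ᶠ ∃ᶠ
      infix  20 !_

      !_ : V → Tm
      (! c) d = conʳ c
      _∈ᶠ_ _≈ᶠ_ _⊑ᶠ_ : Tm → Tm → Fm
      (s ∈ᶠ t) d = memʳ (s d) (t d)
      (s ≈ᶠ t) d = eqʳ (s d) (t d)
      _∧ᶠ_ _∨ᶠ_ _⇒ᶠ_ _⇔ᶠ_ : Fm → Fm → Fm
      (r ∧ᶠ s) d = andʳ (r d) (s d)
      (r ∨ᶠ s) d = orʳ (r d) (s d)
      (r ⇒ᶠ s) d = impʳ (r d) (s d)
      (r ⇔ᶠ s) d = iffʳ (r d) (s d)
      ¬ᶠ : Fm → Fm
      ¬ᶠ r d = notʳ (r d)
      ∀ᶠ ∃ᶠ : (Tm → Fm) → Fm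
      ∀ᶠ f d = allʳ d (f (λ _ → varʳ d) (suc d))
      ∃ᶠ f d = exʳ d (f (λ _ → varʳ d) (suc d))
      s ⊑ᶠ t = ∀ᶠ λ z → z ∈ᶠ s ⇒ᶠ z ∈ᶠ t
      sepᶠ : (Tm → Fm) → Tm → Tm
      sepᶠ f a d = sepʳ d (f (λ _ → varʳ d) (suc d)) (a d)

      asg₀ : Asg
      asg₀ _ = someV

      P₁ : (Tm → Fm) → V → Set ℓ
      P₁ f x = ev (f (λ _ → varʳ 0) 1) (asg₀ [ 0 ↦ x ])
      P₂ : (Tm → Tm → Fm) → V → V → Set ℓ
      P₂ f x y = ev (f (λ _ → varʳ 0) (λ _ → varʳ 1) 2) (asg₀ [ 0 ↦ x ] [ 1 ↦ y ])
      P₃ : (Tm → Tm → Tm → Fm) → V → V → V → Set ℓ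
      P₃ f x y z = ev (f (λ _ → varʳ 0) (λ _ → varʳ 1) (λ _ → varʳ 2) 3) (asg₀ [ 0 ↦ x ] [ 1 ↦ y ] [ 2 ↦ z ])
      t₁ : (Tm → Tm) → V → V
      t₁ f x = evT (f (λ _ → varʳ 0) 1) (asg₀ [ 0 ↦ x ])
      t₂ : (Tm → Tm → Tm) → V → V → V
      t₂ f x y = evT (f (λ _ → varʳ 0) (λ _ → varʳ 1) 2) (asg₀ [ 0 ↦ x ] [ 1 ↦ y ])

      private
        asg₁-T : ∀ i → T 1 (λ ρ → (asg₀ [ 0 ↦ proj₁ ρ ]) i)
        asg₁-T zero    = T-var
        asg₁-T (suc i) = T-con _
        asg₂-T : ∀ i → T 2 (λ ρ → (asg₀ [ 0 ↦ proj₁ ρ ] [ 1 ↦ proj₁ (proj₂ ρ) ]) i)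
        asg₂-T zero          = T-var
        asg₂-T (suc zero)    = T-wk T-var
        asg₂-T (suc (suc i)) = T-con _
        asg₃-T : ∀ i → T 3 (λ ρ → (asg₀ [ 0 ↦ proj₁ ρ ] [ 1 ↦ proj₁ (proj₂ ρ) ] [ 2 ↦ proj₁ (proj₂ (proj₂ ρ)) ]) i)
        asg₃-T zero                = T-var
        asg₃-T (suc zero)          = T-wk T-var
        asg₃-T (suc (suc zero))    = T-wk (T-wk T-var)
        asg₃-T (suc (suc (suc i))) = T-con _

      abstract
       D₁ : ∀ f → D 1 (λ ρ → P₁ f (proj₁ ρ))
       D₁ f = D-ev (f (λ _ → varʳ 0) 1) asg₁-T
       D₂ : ∀ f → D 2 (λ ρ → P₂ f (proj₁ ρ) (proj₁ (proj₂ ρ)))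
       D₂ f = D-ev (f (λ _ → varʳ 0) (λ _ → varʳ 1) 2) asg₂-T
       D₃ : ∀ f → D 3 (λ ρ → P₃ f (proj₁ ρ) (proj₁ (proj₂ ρ)) (proj₁ (proj₂ (proj₂ ρ))))
       D₃ f = D-ev (f (λ _ → varʳ 0) (λ _ → varʳ 1) (λ _ → varʳ 2) 3) asg₃-T
       T₁ : ∀ f → T 1 (λ ρ → t₁ f (proj₁ ρ))
       T₁ f = T-ev (f (λ _ → varʳ 0) 1) asg₁-T
       T₂ : ∀ f → T 2 (λ ρ → t₂ f (proj₁ ρ) (proj₁ (proj₂ ρ)))
       T₂ f = T-ev (f (λ _ → varʳ 0) (λ _ → varʳ 1) 2) asg₂-T

      ≈-subst : (f : Tm → Fm) → ∀ {x y} → x ≈ y → P₁ f x → P₁ f y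
      ≈-subst f e p = D-resp (D₁ f) {ρ = tt} e p

      ≈-cong : (f : Tm → Tm) → ∀ {x y} → x ≈ y → t₁ f x ≈ t₁ f y
      ≈-cong f {x} {y} e = D-resp (T-swap (T₁ f)) {ρ = t₁ f x , tt} e ≈-refl
        where T-swap : ∀ {t : V → V} → T 1 (λ ρ → t (proj₁ ρ)) → D 2 (λ ρ → proj₁ (proj₂ ρ) ≈ t (proj₁ ρ))
              T-swap d = reindex (λ { zero → suc zero ; (suc zero) → zero }) (λ (x , z , ρ) → z , x , ρ)
                             (λ { zero ρ → refl ; (suc zero) ρ → refl }) d

      sep-spec : (f : Tm → Fm) → ∀ a x → x ∈ sep (P₁ f) a ⇔ (x ∈ a × P₁ f x)
      sep-spec f = sep-D (P₁ f) (D₁ f)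
      img-spec : (f : Tm → Tm) → ∀ a y → y ∈ img (t₁ f) a ⇔ (∃ λ x → x ∈ a × y ≈ t₁ f x)
      img-spec f = img-D (t₁ f) (T₁ f)

      fn₁ᶠ : (t : V → V) → T 1 (λ ρ → t (proj₁ ρ)) → Tm → Tm
      fn₁ᶠ t d x n = fn₁ t d (x n)
      fn₂ᶠ : (t : V → V → V) → T 2 (λ ρ → t (proj₁ ρ) (proj₁ (proj₂ ρ))) → Tm → Tm → Tm
      fn₂ᶠ t d x y n = fn₂ t d (x n) (y n)

      rel₁ᶠ : (P : V → Set ℓ) → D 1 (λ ρ → P (proj₁ ρ)) → Tm → Fm
      rel₁ᶠ P d x n = rel₁ P d (x n)
      rel₂ᶠ : (P : V → V → Set ℓ) → D 2 (λ ρ → P (proj₁ ρ) (proj₁ (proj₂ ρ))) → Tm → Tm → Fm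
      rel₂ᶠ P d x y n = rel₂ P d (x n) (y n)

      rel₃ᶠ : (P : V → V → V → Set ℓ) → D 3 (λ ρ → P (proj₁ ρ) (proj₁ (proj₂ ρ)) (proj₁ (proj₂ (proj₂ ρ)))) → Tm → Tm → Tm → Fm
      rel₃ᶠ P d x y z n = rel₃ P d (x n) (y n) (z n)

      T₁-by : (t : V → V) (f : Tm → Tm → Fm) → (∀ z x → z ∈ t x ⇔ P₂ f z x) → T 1 (λ ρ → t (proj₁ ρ))
      T₁-by t f h = T-ext (Dcong (λ (z , x , _) → ⇔-sym (h z x)) (D₂ f))
      T₂-by : (t : V → V → V) (f : Tm → Tm → Tm → Fm) → (∀ z x y → z ∈ t x y ⇔ P₃ f z x y) →
              T 2 (λ ρ → t (proj₁ ρ) (proj₁ (proj₂ ρ)))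
      T₂-by t f h = T-ext (Dcong (λ (z , x , y , _) → ⇔-sym (h z x y)) (D₃ f))

    open Definable public

    -- Elementary sets: unions, pairs, products, functions

    module BasicSets where
      infix 4 _⊑_
      _⊑_ : V → V → Set ℓ
      x ⊑ y = ∀ z → z ∈ x → z ∈ y

      ⊑-antisym : ∀ {x y} → x ⊑ y → y ⊑ x → x ≈ y
      ⊑-antisym p q z = mk⇔ (p z) (q z)

      ∈-congˡ : ∀ {x x′ y} → x ≈ x′ → x ∈ y → x′ ∈ y
      ∈-congˡ p = ∈-resp p ≈-refl
      ∈-congʳ : ∀ {x y y′} → y ≈ y′ → x ∈ y → x ∈ y′
      ∈-congʳ p = to (p _)

      abstract
        Sep : (Tm → Fm) → V → V
        Sep f = sep (P₁ f)
        Sep-spec : ∀ f {a x} → x ∈ Sep f a ⇔ (x ∈ a × P₁ f x)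
        Sep-spec f = sep-spec f _ _
        Img : (Tm → Tm) → V → V
        Img f = img (t₁ f)
        Img-spec : ∀ f {a y} → y ∈ Img f a ⇔ (∃ λ x → x ∈ a × y ≈ t₁ f x)
        Img-spec f = img-spec f _ _

      module _ {f : Tm → Fm} {a x : V} where
        ∈Sep : x ∈ a → P₁ f x → x ∈ Sep f a
        ∈Sep p q = from (Sep-spec f) (p , q)
        Sep⊑ : x ∈ Sep f a → x ∈ a
        Sep⊑ p = proj₁ (to (Sep-spec f) p)
        SepP : x ∈ Sep f a → P₁ f x
        SepP p = proj₂ (to (Sep-spec f) p)

      module _ {t : Tm → Tm} {a : V} where
        ∈Img : ∀ {x} → x ∈ a → t₁ t x ∈ Img t a
        ∈Img p = from (Img-spec t) (_ , p , ≈-refl)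
        Img⁻ : ∀ {y} → y ∈ Img t a → ∃ λ x → x ∈ a × y ≈ t₁ t x
        Img⁻ p = to (Img-spec t) p

      abstract
        ⋃ : V → V
        ⋃ x = proj₁ (union x)
        ⋃-spec : ∀ x z → z ∈ ⋃ x ⇔ (∃ λ y → y ∈ x × z ∈ y)
        ⋃-spec x = proj₂ (union x)

        𝒫 : V → V
        𝒫 x = proj₁ (powerset x)
        𝒫-spec : ∀ x z → z ∈ 𝒫 x ⇔ z ⊑ x
        𝒫-spec x z = mk⇔ (λ p w → to (proj₂ (powerset x) z) p) (λ p → from (proj₂ (powerset x) z) (p _))

        pair : V → V → V
        pair x y = proj₁ (pairing x y)
        pair-spec : ∀ x y z → z ∈ pair x y ⇔ (z ≈ x ⊎ z ≈ y)
        pair-spec x y = proj₂ (pairing x y)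

      abstract
        ⋃-T : T 1 (λ ρ → ⋃ (proj₁ ρ))
        ⋃-T = T₁-by ⋃ (λ z x → ∃ᶠ λ y → y ∈ᶠ x ∧ᶠ z ∈ᶠ y) (λ z x → ⋃-spec x z)
        𝒫-T : T 1 (λ ρ → 𝒫 (proj₁ ρ))
        𝒫-T = T₁-by 𝒫 (λ z x → z ⊑ᶠ x) (λ z x → 𝒫-spec x z)
        pair-T : T 2 (λ ρ → pair (proj₁ ρ) (proj₁ (proj₂ ρ)))
        pair-T = T₂-by pair (λ z x y → z ≈ᶠ x ∨ᶠ z ≈ᶠ y) (λ z x y → pair-spec x y z)
      ⋃ᶠ 𝒫ᶠ : Tm → Tm
      ⋃ᶠ = fn₁ᶠ ⋃ ⋃-T
      𝒫ᶠ = fn₁ᶠ 𝒫 𝒫-T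
      pairᶠ : Tm → Tm → Tm
      pairᶠ = fn₂ᶠ pair pair-T

      ⋃⁺ : ∀ {x y z} → y ∈ x → z ∈ y → z ∈ ⋃ x
      ⋃⁺ p q = from (⋃-spec _ _) (_ , p , q)
      ⋃⁻ : ∀ {x z} → z ∈ ⋃ x → ∃ λ y → y ∈ x × z ∈ y
      ⋃⁻ = to (⋃-spec _ _)
      𝒫⁺ : ∀ {x z} → z ⊑ x → z ∈ 𝒫 x
      𝒫⁺ = from (𝒫-spec _ _)
      𝒫⁻ : ∀ {x z} → z ∈ 𝒫 x → z ⊑ x
      𝒫⁻ = to (𝒫-spec _ _)
      pairˡ : ∀ {x y} → x ∈ pair x y
      pairˡ = from (pair-spec _ _ _) (inj₁ ≈-refl)
      pairʳ : ∀ {x y} → y ∈ pair x y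
      pairʳ = from (pair-spec _ _ _) (inj₂ ≈-refl)
      pair⁻ : ∀ {x y z} → z ∈ pair x y → z ≈ x ⊎ z ≈ y
      pair⁻ = to (pair-spec _ _ _)

      private
        ∪₀ ∩₀ ∖₀ ⟨⟩₀ : V → V → V
        ∪₀ x y = ⋃ (pair x y)
        ∩₀ x y = Sep (λ z → z ∈ᶠ ! y) x
        ∖₀ x y = Sep (λ z → ¬ᶠ (z ∈ᶠ ! y)) x
        ⟨⟩₀ x y = pair (pair x x) (pair x y)
        ∅₀ : V
        ∅₀ = Sep (λ x → ¬ᶠ (x ≈ᶠ x)) someV
        ∪₀-spec : ∀ x y z → z ∈ ∪₀ x y ⇔ (z ∈ x ⊎ z ∈ y)
        ∪₀-spec x y z = mk⇔ (λ p → f (⋃⁻ p)) [ ⋃⁺ pairˡ , ⋃⁺ pairʳ ]′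
          where f : (∃ λ w → w ∈ pair x y × z ∈ w) → z ∈ x ⊎ z ∈ y
                f (w , p , q) with pair⁻ p
                ... | inj₁ e = inj₁ (∈-congʳ e q)
                ... | inj₂ e = inj₂ (∈-congʳ e q)

      infixr 6 _∪_
      infixr 7 _∩ˢ_
      infix  7 _∖_
      abstract
        ∅ : V
        ∅ = ∅₀
        ∅⁻ : ∀ {x} → ¬ (x ∈ ∅)
        ∅⁻ p = SepP {λ x → ¬ᶠ (x ≈ᶠ x)} p ≈-refl

        _∪_ : V → V → V
        _∪_ = ∪₀
        ∪-spec : ∀ x y z → z ∈ x ∪ y ⇔ (z ∈ x ⊎ z ∈ y)
        ∪-spec = ∪₀-spec

        _∩ˢ_ : V → V → V
        _∩ˢ_ = ∩₀
        ∩-spec : ∀ x y z → z ∈ x ∩ˢ y ⇔ (z ∈ x × z ∈ y)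
        ∩-spec x y z = Sep-spec (λ z → z ∈ᶠ ! y)

        _∖_ : V → V → V
        _∖_ = ∖₀
        ∖-spec : ∀ x y z → z ∈ x ∖ y ⇔ (z ∈ x × ¬ (z ∈ y))
        ∖-spec x y z = Sep-spec (λ z → ¬ᶠ (z ∈ᶠ ! y))

        ⟪_⟫ : V → V
        ⟪ x ⟫ = pair x x
        ⟪⟫-spec : ∀ x z → z ∈ ⟪ x ⟫ ⇔ z ≈ x
        ⟪⟫-spec x z = mk⇔ (λ p → [ (λ e → e) , (λ e → e) ]′ (pair⁻ p)) (λ e → from (pair-spec _ _ _) (inj₁ e))

        ⟨_,_⟩ : V → V → V
        ⟨_,_⟩ = ⟨⟩₀
        ⟨,⟩-spec : ∀ x y z → z ∈ ⟨ x , y ⟩ ⇔ (z ≈ ⟪ x ⟫ ⊎ z ≈ pair x y)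
        ⟨,⟩-spec x y z = pair-spec _ _ _

      abstract
        ⟪⟫-T : T 1 (λ ρ → ⟪_⟫ (proj₁ ρ))
        ⟪⟫-T = T₁-by ⟪_⟫ (λ z x → z ≈ᶠ x) (λ z x → ⟪⟫-spec x z)
      ⟪_⟫ᶠ : Tm → Tm
      ⟪_⟫ᶠ = fn₁ᶠ ⟪_⟫ ⟪⟫-T
      abstract
        ∪-T : T 2 (λ ρ → _∪_ (proj₁ ρ) (proj₁ (proj₂ ρ)))
        ∪-T = T₂-by _∪_ (λ z x y → z ∈ᶠ x ∨ᶠ z ∈ᶠ y) (λ z x y → ∪-spec x y z)
        ∖-T : T 2 (λ ρ → _∖_ (proj₁ ρ) (proj₁ (proj₂ ρ)))
        ∖-T = T₂-by _∖_ (λ z x y → z ∈ᶠ x ∧ᶠ ¬ᶠ (z ∈ᶠ y)) (λ z x y → ∖-spec x y z)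
        ⟨,⟩-T : T 2 (λ ρ → ⟨_,_⟩ (proj₁ ρ) (proj₁ (proj₂ ρ)))
        ⟨,⟩-T = T₂-by ⟨_,_⟩ (λ z x y → z ≈ᶠ ⟪ x ⟫ᶠ ∨ᶠ z ≈ᶠ pairᶠ x y) (λ z x y → ⟨,⟩-spec x y z)
      infixr 8 _∪ᶠ_
      infix  8 _∖ᶠ_
      _∪ᶠ_ _∖ᶠ_ ⟨_,_⟩ᶠ : Tm → Tm → Tm
      _∪ᶠ_ = fn₂ᶠ _∪_ ∪-T
      _∖ᶠ_ = fn₂ᶠ _∖_ ∖-T
      ⟨_,_⟩ᶠ = fn₂ᶠ ⟨_,_⟩ ⟨,⟩-T

      ∅-unique : ∀ {x} → (∀ z → ¬ (z ∈ x)) → x ≈ ∅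
      ∅-unique h = ⊑-antisym (λ z p → ⊥-elim (h z p)) (λ z p → ⊥-elim (∅⁻ p))
      nonempty : ∀ {x} → ¬ (x ≈ ∅) → ∃ λ z → z ∈ x
      nonempty {x} h = dne (λ n → h (∅-unique (λ z p → n (z , p))))

      Disjoint : V → V → Set ℓ
      Disjoint x y = ∀ z → z ∈ x → ¬ (z ∈ y)
      Disjointᶠ : Tm → Tm → Fm
      Disjointᶠ x y = ∀ᶠ λ z → z ∈ᶠ x ⇒ᶠ ¬ᶠ (z ∈ᶠ y)

      module _ {x y z : V} where
        ∪ˡ : z ∈ x → z ∈ x ∪ y
        ∪ˡ p = from (∪-spec x y z) (inj₁ p)
        ∪ʳ : z ∈ y → z ∈ x ∪ y
        ∪ʳ p = from (∪-spec x y z) (inj₂ p)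
        ∪⁻ : z ∈ x ∪ y → z ∈ x ⊎ z ∈ y
        ∪⁻ = to (∪-spec x y z)
        ∩⁺ : z ∈ x → z ∈ y → z ∈ x ∩ˢ y
        ∩⁺ p q = from (∩-spec x y z) (p , q)
        ∩⁻ : z ∈ x ∩ˢ y → z ∈ x × z ∈ y
        ∩⁻ = to (∩-spec x y z)
        ∖⁺ : z ∈ x → ¬ (z ∈ y) → z ∈ x ∖ y
        ∖⁺ p q = from (∖-spec x y z) (p , q)
        ∖⁻ : z ∈ x ∖ y → z ∈ x × ¬ (z ∈ y)
        ∖⁻ = to (∖-spec x y z)

      ⟪⟫⁺ : ∀ {x z} → z ≈ x → z ∈ ⟪ x ⟫
      ⟪⟫⁺ = from (⟪⟫-spec _ _)
      ⟪⟫⁻ : ∀ {x z} → z ∈ ⟪ x ⟫ → z ≈ x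
      ⟪⟫⁻ = to (⟪⟫-spec _ _)

      ⟨⟩-cong : ∀ {x x′ y y′} → x ≈ x′ → y ≈ y′ → ⟨ x , y ⟩ ≈ ⟨ x′ , y′ ⟩
      ⟨⟩-cong {x′ = x′} {y} p q = ≈-trans (≈-cong (λ x → ⟨ x , ! y ⟩ᶠ) p) (≈-cong (λ y → ⟨ ! x′ , y ⟩ᶠ) q)
      ∪-cong : ∀ {x x′ y y′} → x ≈ x′ → y ≈ y′ → x ∪ y ≈ x′ ∪ y′
      ∪-cong {x′ = x′} {y} p q = ≈-trans (≈-cong (_∪ᶠ ! y) p) (≈-cong (! x′ ∪ᶠ_) q)

      pair-cong : ∀ {x x′ y y′} → x ≈ x′ → y ≈ y′ → pair x y ≈ pair x′ y′
      pair-cong {x′ = x′} {y} p q = ≈-trans (≈-cong (λ x → pairᶠ x (! y)) p) (≈-cong (pairᶠ (! x′)) q)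

      ⟪⟫-inj : ∀ {x y} → ⟪ x ⟫ ≈ ⟪ y ⟫ → x ≈ y
      ⟪⟫-inj e = ⟪⟫⁻ (∈-congʳ e (⟪⟫⁺ ≈-refl))

      pair-sing : ∀ {x y z} → ⟪ x ⟫ ≈ pair y z → x ≈ y × x ≈ z
      pair-sing e = ≈-sym (⟪⟫⁻ (∈-congʳ (≈-sym e) pairˡ)) , ≈-sym (⟪⟫⁻ (∈-congʳ (≈-sym e) pairʳ))

      pair-cancel : ∀ {x y z} → pair x y ≈ pair x z → y ≈ z
      pair-cancel {x} {y} {z} e with pair⁻ (∈-congʳ e pairʳ) | pair⁻ (∈-congʳ (≈-sym e) pairʳ)
      ... | inj₂ p | _      = p
      ... | inj₁ p | inj₂ q = ≈-sym q
      ... | inj₁ p | inj₁ q = ≈-trans p (≈-sym q)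

      ⟨⟩-inj : ∀ {x y x′ y′} → ⟨ x , y ⟩ ≈ ⟨ x′ , y′ ⟩ → x ≈ x′ × y ≈ y′
      ⟨⟩-inj {x} {y} {x′} {y′} e = p , pair-cancel (≈-trans q (≈-cong (λ z → pairᶠ z (! y′)) (≈-sym p)))
        where
          p : x ≈ x′
          p with to (⟨,⟩-spec _ _ _) (∈-congʳ e (from (⟨,⟩-spec x y ⟪ x ⟫) (inj₁ ≈-refl)))
          ... | inj₁ f = ⟪⟫-inj f
          ... | inj₂ f = proj₁ (pair-sing f)
          q : pair x y ≈ pair x′ y′
          q with to (⟨,⟩-spec _ _ _) (∈-congʳ e (from (⟨,⟩-spec x y (pair x y)) (inj₂ ≈-refl)))
          ... | inj₂ f = f
          ... | inj₁ f with to (⟨,⟩-spec _ _ _) (∈-congʳ (≈-sym e) (from (⟨,⟩-spec x′ y′ (pair x′ y′)) (inj₂ ≈-refl)))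
          ...   | inj₂ g = ≈-sym g
          ...   | inj₁ g with pair-sing (≈-sym f) | pair-sing (≈-sym g)
          ...     | a , b | c , d = ≈-trans f (≈-trans (≈-cong ⟪_⟫ᶠ (≈-sym p)) (≈-sym g))

      ⟨⟩-fst : ∀ {x y x′ y′} → ⟨ x , y ⟩ ≈ ⟨ x′ , y′ ⟩ → x ≈ x′
      ⟨⟩-fst e = proj₁ (⟨⟩-inj e)
      ⟨⟩-snd : ∀ {x y x′ y′} → ⟨ x , y ⟩ ≈ ⟨ x′ , y′ ⟩ → y ≈ y′
      ⟨⟩-snd e = proj₂ (⟨⟩-inj e)

      ∈⋃⟨⟩ˡ : ∀ {x y} → x ∈ ⋃ ⟨ x , y ⟩
      ∈⋃⟨⟩ˡ = ⋃⁺ (from (⟨,⟩-spec _ _ _) (inj₁ ≈-refl)) (⟪⟫⁺ ≈-refl)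
      ∈⋃⟨⟩ʳ : ∀ {x y} → y ∈ ⋃ ⟨ x , y ⟩
      ∈⋃⟨⟩ʳ = ⋃⁺ (from (⟨,⟩-spec _ _ _) (inj₂ ≈-refl)) pairʳ

      private
        fst₀ snd₀ : V → V
        fst₀ p = ⋃ (Sep (λ x → ∃ᶠ λ y → ! p ≈ᶠ ⟨ x , y ⟩ᶠ) (⋃ p))
        snd₀ p = ⋃ (Sep (λ y → ∃ᶠ λ x → ! p ≈ᶠ ⟨ x , y ⟩ᶠ) (⋃ p))
        fst₀-β : ∀ {x y} → fst₀ ⟨ x , y ⟩ ≈ x
        fst₀-β {x} {y} = ⊑-antisym
          (λ z (p : z ∈ fst₀ ⟨ x , y ⟩) → let w , q , r = ⋃⁻ p; y′ , e = SepP q in ∈-congʳ (≈-sym (⟨⟩-fst e)) r)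
          (λ z p → ⋃⁺ (∈Sep ∈⋃⟨⟩ˡ (y , ≈-refl)) p)
        snd₀-β : ∀ {x y} → snd₀ ⟨ x , y ⟩ ≈ y
        snd₀-β {x} {y} = ⊑-antisym
          (λ z (p : z ∈ snd₀ ⟨ x , y ⟩) → let w , q , r = ⋃⁻ p; y′ , e = SepP q in ∈-congʳ (≈-sym (⟨⟩-snd e)) r)
          (λ z p → ⋃⁺ (∈Sep ∈⋃⟨⟩ʳ (x , ≈-refl)) p)
        prod : V → V → V
        prod A B = Sep (λ p → ∃ᶠ λ x → ∃ᶠ λ y → x ∈ᶠ ! A ∧ᶠ y ∈ᶠ ! B ∧ᶠ p ≈ᶠ ⟨ x , y ⟩ᶠ) (𝒫 (𝒫 (A ∪ B)))
        prod-spec : ∀ A B p → p ∈ prod A B ⇔ (∃ λ x → ∃ λ y → x ∈ A × y ∈ B × p ≈ ⟨ x , y ⟩)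
        prod-spec A B p = mk⇔ SepP λ (x , y , a , b , e) → ∈Sep (∈-congˡ (≈-sym e) (𝒫⁺ λ z q → 𝒫⁺ λ w r →
          [ (λ f → ∪ˡ (∈-congˡ (≈-sym (⟪⟫⁻ (∈-congʳ f r))) a)) ,
            (λ f → [ (λ g → ∪ˡ (∈-congˡ (≈-sym g) a)) , (λ g → ∪ʳ (∈-congˡ (≈-sym g) b)) ]′ (pair⁻ (∈-congʳ f r))) ]′
          (to (⟨,⟩-spec x y z) q))) (x , y , a , b , e)
        -- Taking the union of all values at `x` makes application total; outside the domain the
        -- result is empty.
        app : V → V → V
        app f x = ⋃ (Sep (λ y → ⟨ ! x , y ⟩ᶠ ∈ᶠ ! f) (⋃ (⋃ f)))
        app-val : ∀ {f x y} → ⟨ x , y ⟩ ∈ f → (∀ y′ → ⟨ x , y′ ⟩ ∈ f → y′ ≈ y) → app f x ≈ y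
        app-val {f} {x} {y} p u = ⊑-antisym
          (λ z (q : z ∈ app f x) → let w , r , s = ⋃⁻ q in ∈-congʳ (u w (SepP r)) s)
          (λ z q → ⋃⁺ (∈Sep (∈⋃⋃ p) p) q)
          where ∈⋃⋃ : ⟨ x , y ⟩ ∈ f → y ∈ ⋃ (⋃ f)
                ∈⋃⋃ p = let w , r , s = ⋃⁻ ∈⋃⟨⟩ʳ in ⋃⁺ (⋃⁺ p r) s
        app-spec : ∀ f x z → z ∈ app f x ⇔ (∃ λ y → ⟨ x , y ⟩ ∈ f × z ∈ y)
        app-spec f x z = mk⇔ (λ p → let y , q , r = ⋃⁻ p in y , SepP q , r)
          (λ (y , p , q) → let w , r , s = ⋃⁻ ∈⋃⟨⟩ʳ in ⋃⁺ (∈Sep (⋃⁺ (⋃⁺ p r) s) p) q)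
        fst₀-spec : ∀ z p → z ∈ fst₀ p ⇔ (∃ λ x → (∃ λ y → p ≈ ⟨ x , y ⟩) × z ∈ x)
        fst₀-spec z p = mk⇔ (λ q → let x , r , s = ⋃⁻ q in x , SepP r , s)
          (λ (x , (y , e) , q) → ⋃⁺ (∈Sep (∈-congʳ (≈-cong ⋃ᶠ (≈-sym e)) ∈⋃⟨⟩ˡ) (y , e)) q)
        snd₀-spec : ∀ z p → z ∈ snd₀ p ⇔ (∃ λ y → (∃ λ x → p ≈ ⟨ x , y ⟩) × z ∈ y)
        snd₀-spec z p = mk⇔ (λ q → let x , r , s = ⋃⁻ q in x , SepP r , s)
          (λ (y , (x , e) , q) → ⋃⁺ (∈Sep (∈-congʳ (≈-cong ⋃ᶠ (≈-sym e)) ∈⋃⟨⟩ʳ) (x , e)) q)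

      infixr 7 _⊗_
      infixl 8 _·_
      abstract
        fst snd : V → V
        fst = fst₀
        snd = snd₀
        fst-β : ∀ {x y} → fst ⟨ x , y ⟩ ≈ x
        fst-β = fst₀-β
        snd-β : ∀ {x y} → snd ⟨ x , y ⟩ ≈ y
        snd-β = snd₀-β
        fst-spec : ∀ z p → z ∈ fst p ⇔ (∃ λ x → (∃ λ y → p ≈ ⟨ x , y ⟩) × z ∈ x)
        fst-spec = fst₀-spec
        snd-spec : ∀ z p → z ∈ snd p ⇔ (∃ λ y → (∃ λ x → p ≈ ⟨ x , y ⟩) × z ∈ y)
        snd-spec = snd₀-spec

        _⊗_ : V → V → V
        _⊗_ = prod
        ⊗-spec : ∀ A B p → p ∈ A ⊗ B ⇔ (∃ λ x → ∃ λ y → x ∈ A × y ∈ B × p ≈ ⟨ x , y ⟩)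
        ⊗-spec = prod-spec

        _·_ : V → V → V
        _·_ = app
        ·-val : ∀ {f x y} → ⟨ x , y ⟩ ∈ f → (∀ y′ → ⟨ x , y′ ⟩ ∈ f → y′ ≈ y) → f · x ≈ y
        ·-val = app-val
        ·-spec : ∀ f x z → z ∈ f · x ⇔ (∃ λ y → ⟨ x , y ⟩ ∈ f × z ∈ y)
        ·-spec = app-spec

      abstract
        fst-T : T 1 (λ ρ → fst (proj₁ ρ))
        fst-T = T₁-by fst (λ z p → ∃ᶠ λ x → (∃ᶠ λ y → p ≈ᶠ ⟨ x , y ⟩ᶠ) ∧ᶠ z ∈ᶠ x) fst-spec
        snd-T : T 1 (λ ρ → snd (proj₁ ρ))
        snd-T = T₁-by snd (λ z p → ∃ᶠ λ y → (∃ᶠ λ x → p ≈ᶠ ⟨ x , y ⟩ᶠ) ∧ᶠ z ∈ᶠ y) snd-spec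
      fstᶠ sndᶠ : Tm → Tm
      fstᶠ = fn₁ᶠ fst fst-T
      sndᶠ = fn₁ᶠ snd snd-T
      abstract
        ⊗-T : T 2 (λ ρ → _⊗_ (proj₁ ρ) (proj₁ (proj₂ ρ)))
        ⊗-T = T₂-by _⊗_ (λ p A B → ∃ᶠ λ x → ∃ᶠ λ y → x ∈ᶠ A ∧ᶠ y ∈ᶠ B ∧ᶠ p ≈ᶠ ⟨ x , y ⟩ᶠ) (λ p A B → ⊗-spec A B p)
        ·-T : T 2 (λ ρ → _·_ (proj₁ ρ) (proj₁ (proj₂ ρ)))
        ·-T = T₂-by _·_ (λ z f x → ∃ᶠ λ y → ⟨ x , y ⟩ᶠ ∈ᶠ f ∧ᶠ z ∈ᶠ y) (λ z f x → ·-spec f x z)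
      infixr 9 _⊗ᶠ_
      infixl 9 _·ᶠ_
      _⊗ᶠ_ _·ᶠ_ : Tm → Tm → Tm
      _⊗ᶠ_ = fn₂ᶠ _⊗_ ⊗-T
      _·ᶠ_ = fn₂ᶠ _·_ ·-T

      private
        lam₀ : V → (Tm → Tm) → V
        lam₀ A f = Img (λ x → ⟨ x , f x ⟩ᶠ) A
        lam₀-spec : ∀ {A} f {p} → p ∈ lam₀ A f ⇔ (∃ λ x → x ∈ A × p ≈ ⟨ x , t₁ f x ⟩)
        lam₀-spec f = Img-spec (λ x → ⟨ x , f x ⟩ᶠ)
      abstract
        lam : V → (Tm → Tm) → V
        lam = lam₀
        lam-spec : ∀ {A} f {p} → p ∈ lam A f ⇔ (∃ λ x → x ∈ A × p ≈ ⟨ x , t₁ f x ⟩)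
        lam-spec = lam₀-spec

      lam-β : ∀ {A} f {x} → x ∈ A → lam A f · x ≈ t₁ f x
      lam-β {A} f {x} a = ·-val (from (lam-spec f) (x , a , ≈-refl))
        (λ y′ p → let x′ , a′ , e = to (lam-spec f) p; g , h = ⟨⟩-inj e in ≈-trans h (≈-cong f (≈-sym g)))

      ⊗⁺ : ∀ {A B x y} → x ∈ A → y ∈ B → ⟨ x , y ⟩ ∈ A ⊗ B
      ⊗⁺ a b = from (⊗-spec _ _ _) (_ , _ , a , b , ≈-refl)
      ⊗⁻ : ∀ {A B x y} → ⟨ x , y ⟩ ∈ A ⊗ B → x ∈ A × y ∈ B
      ⊗⁻ p = let x , y , a , b , e = to (⊗-spec _ _ _) p; f , g = ⟨⟩-inj e in ∈-congˡ (≈-sym f) a , ∈-congˡ (≈-sym g) b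
      ⊗⁻′ : ∀ {A B p} → p ∈ A ⊗ B → ∃ λ x → ∃ λ y → x ∈ A × y ∈ B × p ≈ ⟨ x , y ⟩
      ⊗⁻′ = to (⊗-spec _ _ _)

      ·-cong : ∀ {f f′ x x′} → f ≈ f′ → x ≈ x′ → f · x ≈ f′ · x′
      ·-cong {f′ = f′} {x} p q = ≈-trans (≈-cong (_·ᶠ ! x) p) (≈-cong (! f′ ·ᶠ_) q)
      ·-congʳ : ∀ {f x x′} → x ≈ x′ → f · x ≈ f · x′
      ·-congʳ {f} q = ≈-cong (! f ·ᶠ_) q

    open BasicSets public

    -- Ordinals, natural numbers and transfinite recursion

    module Ordinals where
      ∈-min : ∀ a → (∃ λ x → x ∈ a) → ∃ λ y → y ∈ a × (∀ z → z ∈ y → ¬ (z ∈ a))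
      ∈-min = foundation

      ∈-ind : (f : Tm → Fm) → ∀ a → (∀ x → x ∈ a → (∀ y → y ∈ x → y ∈ a → P₁ f y) → P₁ f x) → ∀ x → x ∈ a → P₁ f x
      ∈-ind f a step x p = dne λ np →
        let m , q , r = ∈-min (Sep (λ x → ¬ᶠ (f x)) a) (x , ∈Sep p np)
        in SepP q (step m (Sep⊑ q) λ y s t → dne λ ny → r y s (∈Sep t ny))

      ∈-irrefl : ∀ {x} → ¬ (x ∈ x)
      ∈-irrefl {x} p = let y , q , r = ∈-min ⟪ x ⟫ (x , ⟪⟫⁺ ≈-refl)
                       in r x (∈-congʳ (≈-sym (⟪⟫⁻ q)) p) (⟪⟫⁺ ≈-refl)

      ∈-irrefl′ : ∀ {x y} → x ≈ y → ¬ (x ∈ y)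
      ∈-irrefl′ e p = ∈-irrefl (∈-congʳ (≈-sym e) p)

      ∈-asym : ∀ {x y} → x ∈ y → ¬ (y ∈ x)
      ∈-asym {x} {y} p q with ∈-min (pair x y) (x , pairˡ)
      ... | m , r , s with pair⁻ r
      ...   | inj₁ e = s y (∈-congʳ (≈-sym e) q) pairʳ
      ...   | inj₂ e = s x (∈-congʳ (≈-sym e) p) pairˡ

      ∈-acyc₃ : ∀ {x y z} → x ∈ y → y ∈ z → ¬ (z ∈ x)
      ∈-acyc₃ {x} {y} {z} p q t with ∈-min (pair x y ∪ ⟪ z ⟫) (x , ∪ˡ pairˡ)
      ... | m , r , s with ∪⁻ r
      ...   | inj₂ e = s y (∈-congʳ (≈-sym (⟪⟫⁻ e)) q) (∪ˡ pairʳ)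
      ...   | inj₁ r′ with pair⁻ r′
      ...     | inj₁ e = s z (∈-congʳ (≈-sym e) t) (∪ʳ (⟪⟫⁺ ≈-refl))
      ...     | inj₂ e = s x (∈-congʳ (≈-sym e) p) (∪ˡ pairˡ)

      Trans : V → Set ℓ
      Trans α = ∀ y → y ∈ α → y ⊑ α
      Transᶠ : Tm → Fm
      Transᶠ α = ∀ᶠ λ y → y ∈ᶠ α ⇒ᶠ y ⊑ᶠ α

      Ord : V → Set ℓ
      Ord α = Trans α × (∀ y z → y ∈ α → z ∈ α → y ∈ z ⊎ y ≈ z ⊎ z ∈ y)
      Ordᶠ : Tm → Fm
      Ordᶠ α = Transᶠ α ∧ᶠ (∀ᶠ λ y → ∀ᶠ λ z → y ∈ᶠ α ⇒ᶠ z ∈ᶠ α ⇒ᶠ y ∈ᶠ z ∨ᶠ y ≈ᶠ z ∨ᶠ z ∈ᶠ y)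

      Ord-resp : ∀ {α β} → α ≈ β → Ord α → Ord β
      Ord-resp = ≈-subst Ordᶠ

      Ord-elem : ∀ {α β} → Ord α → β ∈ α → Ord β
      Ord-elem {α} {β} (tr , cmp) b = tr′ , λ y z p q → cmp y z (tr β b y p) (tr β b z q)
        where
          tr′ : Trans β
          tr′ y p z q with cmp z β (tr y (tr β b y p) z q) b
          ... | inj₁ r = r
          ... | inj₂ (inj₁ e) = ⊥-elim (∈-asym q (∈-congʳ (≈-sym e) p))
          ... | inj₂ (inj₂ r) = ⊥-elim (∈-acyc₃ q p r)

      -- If `γ` is not all of `α`, it coincides with the ∈-least element of `α` that it omits.
      initial : ∀ {α γ} → Ord α → Trans γ → γ ⊑ α → γ ≈ α ⊎ γ ∈ α
      initial {α} {γ} (tr , cmp) trγ sub with em {α ⊑ γ}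
      ... | yes s = inj₁ (⊑-antisym sub s)
      ... | no ns with ¬∀⇒∃¬ ns
      ...   | x , nx with ∈-min (α ∖ γ) (x , ∖⁺ (dne λ na → nx λ p → ⊥-elim (na p)) (λ g → nx λ _ → g))
      ...     | m , p , q = inj₂ (∈-congˡ (≈-sym γ≈m) (proj₁ (∖⁻ p)))
        where
          m∈α = proj₁ (∖⁻ p)
          m∉γ = proj₂ (∖⁻ p)
          γ≈m : γ ≈ m
          γ≈m = ⊑-antisym h λ z r → dne λ ng → q z r (∖⁺ (tr m m∈α z r) ng)
            where
              h : γ ⊑ m
              h z r with cmp z m (sub z r) m∈α
              ... | inj₁ s = s
              ... | inj₂ (inj₁ e) = ⊥-elim (m∉γ (∈-congˡ e r))
              ... | inj₂ (inj₂ s) = ⊥-elim (m∉γ (trγ z r m s))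

      Ord-⊑ : ∀ {α β} → Ord α → Ord β → α ⊑ β → α ≈ β ⊎ α ∈ β
      Ord-⊑ (tr , _) oβ s = initial oβ tr s

      Ord-cmp : ∀ {α β} → Ord α → Ord β → α ∈ β ⊎ α ≈ β ⊎ β ∈ α
      Ord-cmp {α} {β} oα oβ with initial {γ = α ∩ˢ β} oα trγ (λ z p → proj₁ (∩⁻ p)) | initial {γ = α ∩ˢ β} oβ trγ (λ z p → proj₂ (∩⁻ p))
        where trγ : Trans (α ∩ˢ β)
              trγ y p z q = ∩⁺ (proj₁ oα y (proj₁ (∩⁻ p)) z q) (proj₁ oβ y (proj₂ (∩⁻ p)) z q)
      ... | inj₁ e | inj₁ f = inj₂ (inj₁ (≈-trans (≈-sym e) f))
      ... | inj₁ e | inj₂ q = inj₁ (∈-congˡ e q)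
      ... | inj₂ p | inj₁ f = inj₂ (inj₂ (∈-congˡ f p))
      ... | inj₂ p | inj₂ q = ⊥-elim (∈-irrefl (∩⁺ p q))

      Ord-∉⇒⊑ : ∀ {α β} → Ord α → Ord β → ¬ (α ∈ β) → β ⊑ α
      Ord-∉⇒⊑ oα oβ n z p with Ord-cmp oα oβ
      ... | inj₁ q = ⊥-elim (n q)
      ... | inj₂ (inj₁ e) = from (e z) p
      ... | inj₂ (inj₂ q) = proj₁ oα _ q z p

      Ord-set : ∀ {α} → Trans α → (∀ β → β ∈ α → Ord β) → Ord α
      Ord-set tr h = tr , λ y z p q → Ord-cmp (h y p) (h z q)

      Ord-⋃ : ∀ {X} → (∀ α → α ∈ X → Ord α) → Ord (⋃ X)
      Ord-⋃ h = Ord-set (λ y p z q → let α , a , b = ⋃⁻ p in ⋃⁺ a (proj₁ (h α a) y b z q))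
                        (λ β p → let α , a , b = ⋃⁻ p in Ord-elem (h α a) b)

      abstract
        suc′ : V → V
        suc′ x = x ∪ ⟪ x ⟫
        suc-spec : ∀ x z → z ∈ suc′ x ⇔ (z ∈ x ⊎ z ≈ x)
        suc-spec x z = mk⇔ (λ p → [ inj₁ , (λ q → inj₂ (⟪⟫⁻ q)) ]′ (∪⁻ p)) [ ∪ˡ , (λ e → ∪ʳ (⟪⟫⁺ e)) ]′
        suc-T : T 1 (λ ρ → suc′ (proj₁ ρ))
        suc-T = T₁-by suc′ (λ z x → z ∈ᶠ x ∨ᶠ z ≈ᶠ x) (λ z x → suc-spec x z)
      sucᶠ : Tm → Tm
      sucᶠ = fn₁ᶠ suc′ suc-T

      suc⁺ : ∀ {x} → x ∈ suc′ x
      suc⁺ = from (suc-spec _ _) (inj₂ ≈-refl)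
      suc⁺′ : ∀ {x z} → z ∈ x → z ∈ suc′ x
      suc⁺′ p = from (suc-spec _ _) (inj₁ p)
      suc⁻ : ∀ {x z} → z ∈ suc′ x → z ∈ x ⊎ z ≈ x
      suc⁻ = to (suc-spec _ _)

      Ord-suc : ∀ {α} → Ord α → Ord (suc′ α)
      Ord-suc {α} o = Ord-set tr el
        where
          tr : Trans (suc′ α)
          tr y p z q with suc⁻ p
          ... | inj₁ r = suc⁺′ (proj₁ o y r z q)
          ... | inj₂ e = suc⁺′ (∈-congʳ e q)
          el : ∀ β → β ∈ suc′ α → Ord β
          el β p with suc⁻ p
          ... | inj₁ r = Ord-elem o r
          ... | inj₂ e = Ord-resp (≈-sym e) o

      Ord-suc-⊑ : ∀ {α β} → Ord β → α ∈ β → suc′ α ⊑ β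
      Ord-suc-⊑ o p z q with suc⁻ q
      ... | inj₁ r = proj₁ o _ p z r
      ... | inj₂ e = ∈-congˡ (≈-sym e) p

      suc-cong : ∀ {x y} → x ≈ y → suc′ x ≈ suc′ y
      suc-cong = ≈-cong sucᶠ

      suc-inj : ∀ {x y} → suc′ x ≈ suc′ y → x ≈ y
      suc-inj e with suc⁻ (∈-congʳ e suc⁺) | suc⁻ (∈-congʳ (≈-sym e) suc⁺)
      ... | inj₂ f | _ = f
      ... | inj₁ p | inj₂ f = ≈-sym f
      ... | inj₁ p | inj₁ q = ⊥-elim (∈-asym p q)

      private
        Ind : V → Set ℓ
        Ind J = ∅ ∈ J × (∀ y → y ∈ J → suc′ y ∈ J)
        Indᶠ : Tm → Fm
        Indᶠ J = ! ∅ ∈ᶠ J ∧ᶠ (∀ᶠ λ y → y ∈ᶠ J ⇒ᶠ sucᶠ y ∈ᶠ J)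
        Ind⇒ : ∀ {J} → Inductive J → Ind J
        Ind⇒ ((e , h , p) , s) = ∈-congˡ (∅-unique h) p , λ y q → let t , u , v = s y q in
          ∈-congˡ (λ z → ⇔-trans (u z) (⇔-sym (suc-spec y z))) v
        ⇒Ind : ∀ {J} → Ind J → Inductive J
        ⇒Ind (p , s) = (∅ , (λ z → ∅⁻) , p) , λ y q → suc′ y , suc-spec y , s y q
        ω₀ : V
        ω₀ = Sep (λ n → ∀ᶠ λ J → Indᶠ J ⇒ᶠ n ∈ᶠ J) (proj₁ infinity)
        ω₀-spec : ∀ z → z ∈ ω₀ ⇔ (∀ x → Ind x → z ∈ x)
        ω₀-spec z = mk⇔ SepP λ h → ∈Sep (h _ (Ind⇒ (proj₂ infinity))) h

      abstract
        ω : V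
        ω = ω₀
        ω-isOmega : IsOmega ω
        ω-isOmega z = mk⇔ (λ p x i → to (ω₀-spec z) p x (Ind⇒ i)) (λ h → from (ω₀-spec z) λ x i → h x (⇒Ind i))
        private
          ω-spec : ∀ z → z ∈ ω ⇔ (∀ x → Ind x → z ∈ x)
          ω-spec = ω₀-spec
        0∈ω : ∅ ∈ ω
        0∈ω = from (ω-spec _) λ x (p , s) → p
        suc∈ω : ∀ {n} → n ∈ ω → suc′ n ∈ ω
        suc∈ω p = from (ω-spec _) λ x i → proj₂ i _ (to (ω-spec _) p x i)
        ω-least : ∀ J → ∅ ∈ J → (∀ y → y ∈ J → suc′ y ∈ J) → ω ⊑ J
        ω-least J p s n q = to (ω-spec n) q J (p , s)

      ω-ind : (f : Tm → Fm) → P₁ f ∅ → (∀ n → n ∈ ω → P₁ f n → P₁ f (suc′ n)) → ∀ n → n ∈ ω → P₁ f n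
      ω-ind f z s n p = SepP (ω-least (Sep f ω) (∈Sep 0∈ω z) (λ y q → ∈Sep (suc∈ω (Sep⊑ q)) (s y (Sep⊑ q) (SepP q))) n p)

      ω-cases : ∀ n → n ∈ ω → n ≈ ∅ ⊎ (∃ λ m → m ∈ ω × n ≈ suc′ m)
      ω-cases = ω-ind (λ n → n ≈ᶠ ! ∅ ∨ᶠ ∃ᶠ λ m → m ∈ᶠ ! ω ∧ᶠ n ≈ᶠ sucᶠ m) (inj₁ ≈-refl) (λ n p _ → inj₂ (n , p , ≈-refl))

      Ord-∅ : Ord ∅
      Ord-∅ = (λ y p → ⊥-elim (∅⁻ p)) , λ y z p → ⊥-elim (∅⁻ p)

      Ord-nat : ∀ n → n ∈ ω → Ord n
      Ord-nat = ω-ind Ordᶠ Ord-∅ (λ n _ → Ord-suc)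

      ω-trans : ∀ n → n ∈ ω → n ⊑ ω
      ω-trans = ω-ind (λ n → n ⊑ᶠ ! ω) (λ z p → ⊥-elim (∅⁻ p))
        (λ n p h z q → [ h z , (λ e → ∈-congˡ (≈-sym e) p) ]′ (suc⁻ q))

      Ord-ω : Ord ω
      Ord-ω = Ord-set ω-trans Ord-nat

      IsOmega-unique : ∀ {w} → IsOmega w → w ≈ ω
      IsOmega-unique h z = ⇔-trans (h z) (⇔-sym (ω-isOmega z))

      -- Junk outside the domain of R.
      module Description (R : Tm → Tm → Fm) (u : ∀ x y y′ → P₂ R x y → P₂ R x y′ → y ≈ y′) where
        private
          pick : ∀ x → Dec (∃ λ y → P₂ R x y) → V
          pick x (yes (y , _)) = y
          pick x (no _)        = ∅
        abstract
          desc : V → V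
          desc x = pick x em
          desc-spec : ∀ {x y} → P₂ R x y → desc x ≈ y
          desc-spec {x} {y} r with em {∃ λ y → P₂ R x y}
          ... | yes (y′ , r′) = u x y′ y r′ r
          ... | no n          = ⊥-elim (n (y , r))
          private
            desc-mem : ∀ z x → z ∈ desc x ⇔ P₂ (λ z x → ∃ᶠ λ y → rel₂ᶠ (P₂ R) (D₂ R) x y ∧ᶠ z ∈ᶠ y) z x
            desc-mem z x with em {∃ λ y → P₂ R x y}
            ... | yes (y , r) = mk⇔ (λ p → y , r , p) (λ (y′ , r′ , p) → ∈-congʳ (u x y′ y r′ r) p)
            ... | no n        = mk⇔ (λ p → ⊥-elim (∅⁻ p)) (λ (y , r , _) → ⊥-elim (n (y , r)))
          desc-T : T 1 (λ ρ → desc (proj₁ ρ))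
          desc-T = T₁-by desc (λ z x → ∃ᶠ λ y → rel₂ᶠ (P₂ R) (D₂ R) x y ∧ᶠ z ∈ᶠ y) desc-mem
        descᶠ : Tm → Tm
        descᶠ = fn₁ᶠ desc desc-T

      infixl 8 _↾_
      private
        restr₀ : V → V → V
        restr₀ g b = lam b (λ x → ! g ·ᶠ x)
      abstract
        _↾_ : V → V → V
        _↾_ = restr₀
        ↾-spec : ∀ g b p → p ∈ g ↾ b ⇔ (∃ λ x → x ∈ b × p ≈ ⟨ x , g · x ⟩)
        ↾-spec g b p = lam-spec (λ x → ! g ·ᶠ x)
        ↾-β : ∀ {g b x} → x ∈ b → (g ↾ b) · x ≈ g · x
        ↾-β {g} p = lam-β (λ x → ! g ·ᶠ x) p
        ↾-T : T 2 (λ ρ → proj₁ ρ ↾ proj₁ (proj₂ ρ))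
        ↾-T = T₂-by _↾_ (λ p g b → ∃ᶠ λ x → x ∈ᶠ b ∧ᶠ p ≈ᶠ ⟨ x , g ·ᶠ x ⟩ᶠ) (λ p g b → ↾-spec g b p)
      infixl 9 _↾ᶠ_
      _↾ᶠ_ : Tm → Tm → Tm
      _↾ᶠ_ = fn₂ᶠ _↾_ ↾-T

      ↾-cong : ∀ {g h b} → (∀ x → x ∈ b → g · x ≈ h · x) → g ↾ b ≈ h ↾ b
      ↾-cong e = ⊑-antisym
        (λ z p → let x , q , r = to (↾-spec _ _ _) p in from (↾-spec _ _ _) (x , q , ≈-trans r (⟨⟩-cong ≈-refl (e x q))))
        (λ z p → let x , q , r = to (↾-spec _ _ _) p in from (↾-spec _ _ _) (x , q , ≈-trans r (⟨⟩-cong ≈-refl (≈-sym (e x q)))))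

      module Recursion (t : V → V → V) (t-T : T 2 (λ ρ → t (proj₁ ρ) (proj₁ (proj₂ ρ)))) where
        private
          tᶠ = fn₂ᶠ t t-T
          t-congʳ : ∀ {a g h} → g ≈ h → t a g ≈ t a h
          t-congʳ {a} e = ≈-cong (λ g → tᶠ (! a) g) e

          Att : V → V → Set ℓ
          Att β g = ∀ γ → γ ∈ β → g · γ ≈ t γ (g ↾ γ)
          Attᶠ : Tm → Tm → Fm
          Attᶠ β g = ∀ᶠ λ γ → γ ∈ᶠ β ⇒ᶠ g ·ᶠ γ ≈ᶠ tᶠ γ (g ↾ᶠ γ)

          agree : ∀ {β β′ g g′} → Ord β → Ord β′ → Att β g → Att β′ g′ → ∀ γ → γ ∈ β → γ ∈ β′ → g · γ ≈ g′ · γ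
          agree {β} {β′} {g} {g′} o o′ a a′ =
            ∈-ind (λ γ → γ ∈ᶠ ! β′ ⇒ᶠ ! g ·ᶠ γ ≈ᶠ ! g′ ·ᶠ γ) β λ γ p ih q →
              ≈-trans (a γ p) (≈-trans (t-congʳ (↾-cong λ δ r → ih δ r (proj₁ o γ p δ r) (proj₁ o′ γ q δ r))) (≈-sym (a′ γ q)))

          -- The value at `β` is read off any attempt on `β`. Attempts agree, so this is a
          -- description, and the values below `β` can be collected by `lam` into the next attempt
          -- `H β`.
          Valᶠ : Tm → Tm → Fm
          Valᶠ β z = Ordᶠ β ∧ᶠ ∃ᶠ λ g → Attᶠ β g ∧ᶠ z ≈ᶠ tᶠ β (g ↾ᶠ β)

          open Description Valᶠ (λ x y y′ (o , g , a , e) (_ , g′ , a′ , e′) →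
            ≈-trans e (≈-trans (t-congʳ (↾-cong λ γ p → agree o o a a′ γ p p)) (≈-sym e′)))

          H : V → V
          H β = lam β descᶠ

          attempt : ∀ {μ} → Ord μ → ∀ β → β ∈ μ → ∃ λ g → Att β g
          extend : ∀ {β} → Ord β → (∀ γ → γ ∈ β → ∃ λ g → Att γ g) → ∀ γ → γ ∈ β → H β · γ ≈ t γ (H β ↾ γ)
          extend {β} o ih γ p = ≈-trans (lam-β descᶠ p) (≈-trans (desc-spec (oγ , g , a , ≈-refl))
              (t-congʳ (↾-cong λ δ q → ≈-trans (≈-trans (a δ q) (≈-sym (desc-spec (Ord-elem oγ q , g , (λ ε r → a ε (proj₁ oγ δ q ε r)) , ≈-refl))))
                                              (≈-sym (lam-β descᶠ (proj₁ o γ p δ q))))))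
            where
              oγ = Ord-elem o p
              g = proj₁ (ih γ p)
              a = proj₂ (ih γ p)
          attempt {μ} o = ∈-ind (λ β → ∃ᶠ λ g → Attᶠ β g) μ λ β p ih → H β ,
            extend (Ord-elem o p) λ γ q → ih γ q (proj₁ o β p γ q)

        abstract
          recursion : ∀ {μ} → Ord μ → ∃ λ h → ∀ α → α ∈ μ → h · α ≈ t α (h ↾ α)
          recursion {μ} o = H μ , extend o (attempt o)

    open Ordinals public

    -- Choice functions, dependent choices and comparison by injections

    module Choices where
      opair⇔ : ∀ {p x y} → IsOrderedPair p x y ⇔ p ≈ ⟨ x , y ⟩
      opair⇔ {p} {x} {y} = mk⇔
        (λ (s , d , a , b , c) z → ⇔-trans (c z) (⇔-trans (mk⇔
           [ (λ e → inj₁ (≈-trans e (sing a))) , (λ e → inj₂ (≈-trans e (dbl b))) ]′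
           [ (λ e → inj₁ (≈-trans e (≈-sym (sing a)))) , (λ e → inj₂ (≈-trans e (≈-sym (dbl b)))) ]′)
           (⇔-sym (⟨,⟩-spec x y z))))
        (λ e → ⟪ x ⟫ , pair x y , (λ u → ⇔-trans (⟪⟫-spec x u) (mk⇔ inj₁ [ (λ e → e) , (λ e → e) ]′)) , pair-spec x y ,
           λ z → ⇔-trans (e z) (⟨,⟩-spec x y z))
        where
          sing : ∀ {s} → IsPair s x x → s ≈ ⟪ x ⟫
          sing a u = ⇔-trans (a u) (⇔-trans (mk⇔ [ (λ e → e) , (λ e → e) ]′ inj₁) (⇔-sym (⟪⟫-spec x u)))
          dbl : ∀ {d} → IsPair d x y → d ≈ pair x y
          dbl b u = ⇔-trans (b u) (⇔-sym (pair-spec x y u))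

      ⟨⟩∈⇔ : ∀ {x y f} → (⟨ x , y ⟩∈ f) ⇔ ⟨ x , y ⟩ ∈ f
      ⟨⟩∈⇔ = mk⇔ (λ (p , o , q) → ∈-congˡ (to opair⇔ o) q) (λ q → _ , from opair⇔ ≈-refl , q)

      isPair⇔ : ∀ {z x y} → IsPair z x y ⇔ z ≈ pair x y
      isPair⇔ = mk⇔ (λ h u → ⇔-trans (h u) (⇔-sym (pair-spec _ _ u))) (λ e u → ⇔-trans (e u) (pair-spec _ _ u))
      pair-comm : ∀ {x y} → pair x y ≈ pair y x
      pair-comm z = ⇔-trans (pair-spec _ _ z) (⇔-trans (mk⇔ [ inj₂ , inj₁ ]′ [ inj₂ , inj₁ ]′) (⇔-sym (pair-spec _ _ z)))

      -- The crosswise identification of the elements would produce a membership cycle. Colourings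
      -- of unordered pairs can therefore be treated as functions of `α` and `b` with `α ∈ b`.
      pair-ordered : ∀ {α b α′ b′} → α ∈ b → α′ ∈ b′ → pair α b ≈ pair α′ b′ → α ≈ α′ × b ≈ b′
      pair-ordered {α} {b} {α′} {b′} a a′ e = [ (λ u → u , [ (λ v → ⊥-elim (∈-irrefl′ (≈-trans u (≈-sym v)) a)) , (λ v → v) ]′ B) ,
                                  [ (λ v u → ⊥-elim (∈-asym a (∈-congˡ (≈-sym v) (∈-congʳ (≈-sym u) a′)))) , (λ v u → ⊥-elim (∈-irrefl′ (≈-trans u (≈-sym v)) a)) ]′ B ]′ A
        where
          A : α ≈ α′ ⊎ α ≈ b′
          A = pair⁻ (∈-congʳ e pairˡ)
          B : b ≈ α′ ⊎ b ≈ b′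
          B = pair⁻ (∈-congʳ e pairʳ)

      choice-function : ∀ X → ∃ λ c → ∀ y → y ∈ X → (∃ λ z → z ∈ y) → c · y ∈ y
      choice-function X = c , λ y p ne →
          let b , q = proj₁ (proj₂ isf) y (∈Sep p ne)
          in ∈-congˡ (≈-sym (·-val (to ⟨⟩∈⇔ q) λ y′ r → proj₂ (proj₂ isf) y y′ b (from ⟨⟩∈⇔ r) q)) (mem y b q)
        where
          X′ = Sep (λ y → ∃ᶠ λ z → z ∈ᶠ y) X
          ch = choice X′ (λ y p → SepP p)
          c = proj₁ ch
          isf = proj₂ (proj₁ (proj₂ ch))
          mem = proj₂ (proj₂ ch)

      private
        uniformize₀ : ∀ (R : V → V → Set ℓ) (d : D 2 (λ ρ → R (proj₁ ρ) (proj₁ (proj₂ ρ)))) A B →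
          (∀ x → x ∈ A → ∃ λ y → y ∈ B × R x y) → ∃ λ f → ∀ x → x ∈ A → f · x ∈ B × R x (f · x)
        uniformize₀ R d A B h = f , λ x p → let q = to (lem x _) (mem x p); e = ≈-sym (lam-β tm p) in
             ∈-congˡ e (proj₁ q) , ≈-subst (λ y → rel₂ᶠ R d (! x) y) e (proj₂ q)
         where
           c = proj₁ (choice-function (𝒫 B))
           tm : Tm → Tm
           tm x = ! c ·ᶠ sepᶠ (λ y → rel₂ᶠ R d x y) (! B)
           f = lam A tm
           lem : ∀ x y → y ∈ sep (R x) B ⇔ (y ∈ B × R x y)
           lem x y = sep-spec (λ y → rel₂ᶠ R d (! x) y) B y
           mem : ∀ x → x ∈ A → t₁ tm x ∈ sep (R x) B
           mem x p = let y , q , r = h x p in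
             proj₂ (choice-function (𝒫 B)) _ (𝒫⁺ λ z s → proj₁ (to (lem x z) s)) (y , from (lem x y) (q , r))
      abstract
        -- The sets of admissible values are all members of `𝒫 B`, so one choice function on `𝒫 B`
        -- serves every `x`.
        uniformize : ∀ (R : V → V → Set ℓ) (d : D 2 (λ ρ → R (proj₁ ρ) (proj₁ (proj₂ ρ)))) A B →
          (∀ x → x ∈ A → ∃ λ y → y ∈ B × R x y) → ∃ λ f → ∀ x → x ∈ A → f · x ∈ B × R x (f · x)
        uniformize = uniformize₀

      uniformizeᶠ : ∀ (f : Tm → Tm → Fm) A B → (∀ x → x ∈ A → ∃ λ y → y ∈ B × P₂ f x y) →
                    ∃ λ g → ∀ x → x ∈ A → g · x ∈ B × P₂ f x (g · x)
      uniformizeᶠ f = uniformize (P₂ f) (D₂ f)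

      private
        successive₀ : ∀ (R : V → V → V → Set ℓ) (d : D 3 (λ ρ → R (proj₁ ρ) (proj₁ (proj₂ ρ)) (proj₁ (proj₂ (proj₂ ρ))))) {μ} → Ord μ → ∀ Z →
          (∀ α → α ∈ μ → ∀ g → (∀ β → β ∈ α → g · β ∈ Z × R β (g ↾ β) (g · β)) → ∃ λ z → z ∈ Z × R α g z) →
          ∃ λ h → ∀ α → α ∈ μ → h · α ∈ Z × R α (h ↾ α) (h · α)
        successive₀ R d {μ} o Z step = h , ∈-ind goal μ λ α p ih → main α p λ β q → ih β q (proj₁ o α p β q)
         where
           R! = rel₃ᶠ R d
           c = proj₁ (choice-function (𝒫 Z))
           t : Tm → Tm → Tm
           t α g = ! c ·ᶠ sepᶠ (λ z → R! α g z) (! Z)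
           open Recursion (t₂ t) (T₂ t)
           h = proj₁ (recursion o)
           goal : Tm → Fm
           goal α = ! h ·ᶠ α ∈ᶠ ! Z ∧ᶠ R! α (! h ↾ᶠ α) (! h ·ᶠ α)
           lem : ∀ α g z → z ∈ sep (R α g) Z ⇔ (z ∈ Z × R α g z)
           lem α g z = sep-spec (λ z → R! (! α) (! g) z) Z z
           main : ∀ α → α ∈ μ → (∀ β → β ∈ α → P₁ goal β) → P₁ goal α
           main α p ih = ∈-congˡ e (proj₁ r) , ≈-subst (λ z → R! (! α) (! (h ↾ α)) z) e (proj₂ r)
             where
               e : t₂ t α (h ↾ α) ≈ h · α
               e = ≈-sym (proj₂ (recursion o) α p)
               prev : ∀ β → β ∈ α → (h ↾ α) · β ∈ Z × R β ((h ↾ α) ↾ β) ((h ↾ α) · β)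
               prev β q = ∈-congˡ e₁ (proj₁ (ih β q)) , ≈-subst (λ y → R! (! β) (! ((h ↾ α) ↾ β)) y) e₁
                            (≈-subst (λ g → R! (! β) g (! (h · β))) e₂ (proj₂ (ih β q)))
                 where
                   oα = Ord-elem o p
                   e₁ : h · β ≈ (h ↾ α) · β
                   e₁ = ≈-sym (↾-β q)
                   e₂ : h ↾ β ≈ (h ↾ α) ↾ β
                   e₂ = ↾-cong λ γ s → ≈-sym (↾-β (proj₁ oα β q γ s))
               ne = step α p (h ↾ α) prev
               r : t₂ t α (h ↾ α) ∈ Z × R α (h ↾ α) (t₂ t α (h ↾ α))
               r = to (lem α (h ↾ α) _) (proj₂ (choice-function (𝒫 Z)) _ (𝒫⁺ λ z s → proj₁ (to (lem α (h ↾ α) z) s))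
                     (proj₁ ne , from (lem α (h ↾ α) _) (proj₂ ne)))
      abstract
        successive′ : ∀ (R : V → V → V → Set ℓ) (d : D 3 (λ ρ → R (proj₁ ρ) (proj₁ (proj₂ ρ)) (proj₁ (proj₂ (proj₂ ρ))))) {μ} → Ord μ → ∀ Z →
          (∀ α → α ∈ μ → ∀ g → (∀ β → β ∈ α → g · β ∈ Z × R β (g ↾ β) (g · β)) → ∃ λ z → z ∈ Z × R α g z) →
          ∃ λ h → ∀ α → α ∈ μ → h · α ∈ Z × R α (h ↾ α) (h · α)
        successive′ = successive₀

      -- Dependent choice of length `μ`, by recursion with a choice function on `𝒫 Z`. The
      -- requirement at `α` sees the history only below `α`, and the step may assume that all
      -- earlier requirements have been met.
      successive : ∀ (Φ : Tm → Tm → Tm → Fm) {μ} → Ord μ → ∀ Z →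
        (∀ α → α ∈ μ → ∀ g → (∀ β → β ∈ α → g · β ∈ Z × P₃ Φ β (g ↾ β) (g · β)) → ∃ λ z → z ∈ Z × P₃ Φ α g z) →
        ∃ λ h → ∀ α → α ∈ μ → h · α ∈ Z × P₃ Φ α (h ↾ α) (h · α)
      successive Φ = successive′ (P₃ Φ) (D₃ Φ)

      infix 4 _≲_
      -- Only the values of `f` at points of `A` count, so `f` may be any set; `graph` turns it into
      -- a function in the sense of `IsFunction` where the statement asks for one.
      Inj : V → V → V → Set ℓ
      Inj f A B = (∀ x → x ∈ A → f · x ∈ B) × (∀ x y → x ∈ A → y ∈ A → f · x ≈ f · y → x ≈ y)
      Injᶠ : Tm → Tm → Tm → Fm
      Injᶠ f A B = (∀ᶠ λ x → x ∈ᶠ A ⇒ᶠ f ·ᶠ x ∈ᶠ B) ∧ᶠ (∀ᶠ λ x → ∀ᶠ λ y → x ∈ᶠ A ⇒ᶠ y ∈ᶠ A ⇒ᶠ f ·ᶠ x ≈ᶠ f ·ᶠ y ⇒ᶠ x ≈ᶠ y)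
      _≲_ : V → V → Set ℓ
      A ≲ B = ∃ λ f → Inj f A B
      _≲ᶠ_ : Tm → Tm → Fm
      A ≲ᶠ B = ∃ᶠ λ f → Injᶠ f A B
      infix 7 _≲ᶠ_

      ≲-by : ∀ {A B} (t : Tm → Tm) → (∀ x → x ∈ A → t₁ t x ∈ B) →
             (∀ x y → x ∈ A → y ∈ A → t₁ t x ≈ t₁ t y → x ≈ y) → A ≲ B
      ≲-by {A} t h i = lam A t , (λ x p → ∈-congˡ (≈-sym (lam-β t p)) (h x p)) ,
        λ x y p q e → i x y p q (≈-trans (≈-sym (lam-β t p)) (≈-trans e (lam-β t q)))

      ≲-rel : ∀ {A B} (f : Tm → Tm → Fm) → (∀ x → x ∈ A → ∃ λ y → y ∈ B × P₂ f x y) →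
              (∀ x x′ y → x ∈ A → x′ ∈ A → P₂ f x y → P₂ f x′ y → x ≈ x′) → A ≲ B
      ≲-rel {A} {B} f h i = let g , k = uniformizeᶠ f A B h in g , (λ x p → proj₁ (k x p)) ,
        λ x y p q e → i x y (g · y) p q (≈-subst (λ z → rel₂ᶠ (P₂ f) (D₂ f) (! x) z) e (proj₂ (k x p))) (proj₂ (k y q))

      ≲-⊑ : ∀ {A B} → A ⊑ B → A ≲ B
      ≲-⊑ s = ≲-by (λ x → x) s (λ x y _ _ e → e)
      ≲-refl : ∀ {A} → A ≲ A
      ≲-refl = ≲-⊑ (λ _ p → p)
      ≲-trans : ∀ {A B C} → A ≲ B → B ≲ C → A ≲ C
      ≲-trans (f , a , i) (g , b , j) = ≲-by (λ x → ! g ·ᶠ (! f ·ᶠ x)) (λ x p → b _ (a x p))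
        λ x y p q e → i x y p q (j _ _ (a x p) (a y q) e)

      ≲-onto : ∀ {A B} (t : Tm → Tm) → (∀ y → y ∈ B → ∃ λ x → x ∈ A × t₁ t x ≈ y) → B ≲ A
      ≲-onto t h = ≲-rel (λ y x → fn₁ᶠ (t₁ t) (T₁ t) x ≈ᶠ y) h (λ y y′ x _ _ e e′ → ≈-trans (≈-sym e) e′)

    open Choices public

    -- Finite sets, and an injection of ω × ω into ω

    module Finiteness where
      module Iteration (a : V) (s : V → V) (s-T : T 1 (λ ρ → s (proj₁ ρ))) where
        private
          step : V → V → V
          step α g with em {α ≈ ∅}
          ... | yes _ = a
          -- At a successor, `⋃ α` is the predecessor of `α`.
          ... | no  _ = s (g · ⋃ α)
          step-T : T 2 (λ ρ → step (proj₁ ρ) (proj₁ (proj₂ ρ)))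
          step-T = T₂-by step (λ z α g → (α ≈ᶠ ! ∅ ∧ᶠ z ∈ᶠ ! a) ∨ᶠ (¬ᶠ (α ≈ᶠ ! ∅) ∧ᶠ z ∈ᶠ fn₁ᶠ s s-T (g ·ᶠ ⋃ᶠ α))) spec
            where
              spec : ∀ z α g → z ∈ step α g ⇔ ((α ≈ ∅ × z ∈ a) ⊎ (¬ (α ≈ ∅) × z ∈ s (g · ⋃ α)))
              spec z α g with em {α ≈ ∅}
              ... | yes e = mk⇔ (λ p → inj₁ (e , p)) [ proj₂ , (λ (n , _) → ⊥-elim (n e)) ]′
              ... | no n  = mk⇔ (λ p → inj₂ (n , p)) [ (λ (e , _) → ⊥-elim (n e)) , proj₂ ]′
          open Recursion step step-T
          step-0 : ∀ g → step ∅ g ≈ a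
          step-0 g with em {∅ ≈ ∅}
          ... | yes _ = ≈-refl
          ... | no n  = ⊥-elim (n ≈-refl)
          step-s : ∀ n g → step (suc′ n) g ≈ s (g · ⋃ (suc′ n))
          step-s n g with em {suc′ n ≈ ∅}
          ... | yes e = ⊥-elim (∅⁻ (∈-congʳ e suc⁺))
          ... | no _  = ≈-refl

        private
          iter₀ : V
          iter₀ = proj₁ (recursion Ord-ω)
          iter₀-0 : iter₀ · ∅ ≈ a
          iter₀-0 = ≈-trans (proj₂ (recursion Ord-ω) ∅ 0∈ω) (step-0 _)
          iter₀-suc : ∀ n → n ∈ ω → iter₀ · suc′ n ≈ s (iter₀ · n)
          iter₀-suc n p = ≈-trans (proj₂ (recursion Ord-ω) (suc′ n) (suc∈ω p)) (≈-trans (step-s n _)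
            (≈-cong (fn₁ᶠ s s-T) (≈-trans (·-congʳ ⋃suc) (↾-β suc⁺))))
            where
              ⋃suc : ⋃ (suc′ n) ≈ n
              ⋃suc = ⊑-antisym (λ z q → let y , r , t = ⋃⁻ q in
                        [ (λ r → proj₁ (Ord-nat n p) y r z t) , (λ e → ∈-congʳ e t) ]′ (suc⁻ r)) (λ z q → ⋃⁺ suc⁺ q)
        abstract
          iter : V
          iter = iter₀
          iter-0 : iter · ∅ ≈ a
          iter-0 = iter₀-0
          iter-suc : ∀ n → n ∈ ω → iter · suc′ n ≈ s (iter · n)
          iter-suc = iter₀-suc

      suc≉∅ : ∀ {n} → ¬ (suc′ n ≈ ∅)
      suc≉∅ e = ∅⁻ (∈-congʳ e suc⁺)

      -- The injection sends `⟨ m , n ⟩` to 2^m (2n + 1): `d` is doubling, row `∅` of `E` lists the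
      -- odd numbers, and each further row doubles the one before.
      module PairingFunction where
        private
          module Dbl = Iteration ∅ (λ n → suc′ (suc′ n)) (T₁ (λ n → sucᶠ (sucᶠ n)))
          abstract
            d : V
            d = Dbl.iter
            d-0 : d · ∅ ≈ ∅
            d-0 = Dbl.iter-0
            d-suc : ∀ n → n ∈ ω → d · suc′ n ≈ suc′ (suc′ (d · n))
            d-suc = Dbl.iter-suc
          d∈ω : ∀ n → n ∈ ω → d · n ∈ ω
          d∈ω = ω-ind (λ n → ! d ·ᶠ n ∈ᶠ ! ω) (∈-congˡ (≈-sym d-0) 0∈ω) (λ n p q → ∈-congˡ (≈-sym (d-suc n p)) (suc∈ω (suc∈ω q)))

          d-inj : ∀ n → n ∈ ω → ∀ m → m ∈ ω → d · n ≈ d · m → n ≈ m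
          d-inj = ω-ind (λ n → ∀ᶠ λ m → m ∈ᶠ ! ω ⇒ᶠ ! d ·ᶠ n ≈ᶠ ! d ·ᶠ m ⇒ᶠ n ≈ᶠ m) z s
            where
              z : ∀ m → m ∈ ω → d · ∅ ≈ d · m → ∅ ≈ m
              z m p e with ω-cases m p
              ... | inj₁ f = ≈-sym f
              ... | inj₂ (k , q , f) = ⊥-elim (suc≉∅ (≈-sym (≈-trans (≈-sym d-0) (≈-trans e (≈-trans (·-congʳ f) (d-suc k q))))))
              s : ∀ n → n ∈ ω → (∀ m → m ∈ ω → d · n ≈ d · m → n ≈ m) → ∀ m → m ∈ ω → d · suc′ n ≈ d · m → suc′ n ≈ m
              s n pn ih m p e with ω-cases m p
              ... | inj₁ f = ⊥-elim (suc≉∅ (≈-trans (≈-sym (d-suc n pn)) (≈-trans e (≈-trans (·-congʳ f) d-0))))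
              ... | inj₂ (k , q , f) = ≈-trans (suc-cong (ih k q (suc-inj (suc-inj
                      (≈-trans (≈-sym (d-suc n pn)) (≈-trans e (≈-trans (·-congʳ f) (d-suc k q)))))))) (≈-sym f)

          parity : ∀ n → n ∈ ω → ∀ m → m ∈ ω → ¬ (suc′ (d · m) ≈ d · n)
          parity = ω-ind (λ n → ∀ᶠ λ m → m ∈ᶠ ! ω ⇒ᶠ ¬ᶠ (sucᶠ (! d ·ᶠ m) ≈ᶠ ! d ·ᶠ n))
            (λ m p e → suc≉∅ (≈-trans e d-0)) s
            where
              s : ∀ n → n ∈ ω → (∀ m → m ∈ ω → ¬ (suc′ (d · m) ≈ d · n)) → ∀ m → m ∈ ω → ¬ (suc′ (d · m) ≈ d · suc′ n)
              s n pn ih m p e with ω-cases m p | suc-inj (≈-trans e (d-suc n pn))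
              ... | inj₁ f | g = suc≉∅ (≈-trans (≈-sym g) (≈-trans (·-congʳ f) d-0))
              ... | inj₂ (k , q , f) | g = ih k q (suc-inj (≈-trans (≈-sym (d-suc k q)) (≈-trans (·-congʳ (≈-sym f)) g)))

          sh : V → V
          sh F = lam ω (λ n → ! d ·ᶠ (! F ·ᶠ n))
          sh-spec : ∀ z F → z ∈ sh F ⇔ (∃ λ n → n ∈ ω × z ≈ ⟨ n , d · (F · n) ⟩)
          sh-spec z F = lam-spec (λ n → ! d ·ᶠ (! F ·ᶠ n))
          abstract
            sh-T : T 1 (λ ρ → sh (proj₁ ρ))
            sh-T = T₁-by sh (λ z F → ∃ᶠ λ n → n ∈ᶠ ! ω ∧ᶠ z ≈ᶠ ⟨ n , ! d ·ᶠ (F ·ᶠ n) ⟩ᶠ) sh-spec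
          module H₀ = Iteration (lam ω (λ n → sucᶠ (! d ·ᶠ n))) sh sh-T
          abstract
            E : V
            E = H₀.iter
            E-0 : E · ∅ ≈ lam ω (λ n → sucᶠ (! d ·ᶠ n))
            E-0 = H₀.iter-0
            E-suc : ∀ n → n ∈ ω → E · suc′ n ≈ sh (E · n)
            E-suc = H₀.iter-suc
          e : V → V → V
          e m n = E · m · n
          e-0 : ∀ n → n ∈ ω → e ∅ n ≈ suc′ (d · n)
          e-0 n p = ≈-trans (·-cong E-0 ≈-refl) (lam-β (λ n → sucᶠ (! d ·ᶠ n)) p)
          e-s : ∀ m → m ∈ ω → ∀ n → n ∈ ω → e (suc′ m) n ≈ d · e m n
          e-s m q n p = ≈-trans (·-cong (E-suc m q) ≈-refl) (lam-β (λ n → ! d ·ᶠ (! (E · m) ·ᶠ n)) p)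
          e∈ω : ∀ m → m ∈ ω → ∀ n → n ∈ ω → e m n ∈ ω
          e∈ω = ω-ind (λ m → ∀ᶠ λ n → n ∈ᶠ ! ω ⇒ᶠ ! E ·ᶠ m ·ᶠ n ∈ᶠ ! ω) (λ n p → ∈-congˡ (≈-sym (e-0 n p)) (suc∈ω (d∈ω n p)))
            (λ m q ih n p → ∈-congˡ (≈-sym (e-s m q n p)) (d∈ω _ (ih n p)))
          e-inj : ∀ m → m ∈ ω → ∀ m′ n n′ → m′ ∈ ω → n ∈ ω → n′ ∈ ω → e m n ≈ e m′ n′ → m ≈ m′ × n ≈ n′
          e-inj = ω-ind (λ m → ∀ᶠ λ m′ → ∀ᶠ λ n → ∀ᶠ λ n′ → m′ ∈ᶠ ! ω ⇒ᶠ n ∈ᶠ ! ω ⇒ᶠ n′ ∈ᶠ ! ω ⇒ᶠ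
                             ! E ·ᶠ m ·ᶠ n ≈ᶠ ! E ·ᶠ m′ ·ᶠ n′ ⇒ᶠ m ≈ᶠ m′ ∧ᶠ n ≈ᶠ n′) z s
            where
              e-cong : ∀ {m m′ n} → m ≈ m′ → e m n ≈ e m′ n
              e-cong q = ·-cong (·-congʳ q) ≈-refl
              z : ∀ m′ n n′ → m′ ∈ ω → n ∈ ω → n′ ∈ ω → e ∅ n ≈ e m′ n′ → ∅ ≈ m′ × n ≈ n′
              z m′ n n′ p q r h with ω-cases m′ p
              ... | inj₁ f = ≈-sym f , d-inj n q n′ r (suc-inj (≈-trans (≈-sym (e-0 n q)) (≈-trans h (≈-trans (e-cong f) (e-0 n′ r)))))
              ... | inj₂ (k , t , f) = ⊥-elim (parity _ (e∈ω k t n′ r) n q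
                      (≈-trans (≈-sym (e-0 n q)) (≈-trans h (≈-trans (e-cong f) (e-s k t n′ r)))))
              s : ∀ m → m ∈ ω → (∀ m′ n n′ → m′ ∈ ω → n ∈ ω → n′ ∈ ω → e m n ≈ e m′ n′ → m ≈ m′ × n ≈ n′) →
                  ∀ m′ n n′ → m′ ∈ ω → n ∈ ω → n′ ∈ ω → e (suc′ m) n ≈ e m′ n′ → suc′ m ≈ m′ × n ≈ n′
              s m pm ih m′ n n′ p q r h with ω-cases m′ p
              ... | inj₁ f = ⊥-elim (parity _ (e∈ω m pm n q) n′ r
                      (≈-trans (≈-sym (e-0 n′ r)) (≈-trans (e-cong (≈-sym f)) (≈-trans (≈-sym h) (e-s m pm n q)))))
              ... | inj₂ (k , t , f) =
                      let g , g′ = ih k n n′ t q r (d-inj _ (e∈ω m pm n q) _ (e∈ω k t n′ r)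
                                     (≈-trans (≈-sym (e-s m pm n q)) (≈-trans h (≈-trans (e-cong f) (e-s k t n′ r)))))
                      in ≈-trans (suc-cong g) (≈-sym f) , g′

        ω⊗ω≲ω : ω ⊗ ω ≲ ω
        ω⊗ω≲ω = ≲-by (λ p → ! E ·ᶠ fstᶠ p ·ᶠ sndᶠ p)
          (λ p q → let m , n , a , b , g = ⊗⁻′ q in ∈-congˡ (≈-sym (ev≈ g)) (e∈ω m a n b))
          (λ p p′ q q′ h → let m , n , a , b , g = ⊗⁻′ q; m′ , n′ , a′ , b′ , g′ = ⊗⁻′ q′
                               u , v = e-inj m a m′ n n′ a′ b b′ (≈-trans (≈-sym (ev≈ g)) (≈-trans h (ev≈ g′)))
                           in ≈-trans g (≈-trans (⟨⟩-cong u v) (≈-sym g′)))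
          where
            ev≈ : ∀ {p m n} → p ≈ ⟨ m , n ⟩ → E · fst p · snd p ≈ e m n
            ev≈ g = ·-cong (·-congʳ (≈-trans (≈-cong fstᶠ g) fst-β)) (≈-trans (≈-cong sndᶠ g) snd-β)
      open PairingFunction public

      Finite : V → Set ℓ
      Finite x = ∃ λ n → n ∈ ω × x ≲ n
      Finiteᶠ : Tm → Fm
      Finiteᶠ x = ∃ᶠ λ n → n ∈ᶠ ! ω ∧ᶠ x ≲ᶠ n

      -- An element other than `x` that is sent to `n` is rerouted to the value that `x` leaves
      -- vacant.
      ≲-remove : ∀ {y x n} → y ≲ suc′ n → x ∈ y → y ∖ ⟪ x ⟫ ≲ n
      ≲-remove {y} {x} {n} (f , m , i) p = ≲-rel
        (λ u v → (! f ·ᶠ u ∈ᶠ ! n ∧ᶠ v ≈ᶠ ! f ·ᶠ u) ∨ᶠ (! f ·ᶠ u ≈ᶠ ! n ∧ᶠ v ≈ᶠ ! f ·ᶠ ! x)) tot inj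
        where
          R : V → V → Set ℓ
          R u v = (f · u ∈ n × v ≈ f · u) ⊎ (f · u ≈ n × v ≈ f · x)
          ≉ : ∀ {u} → u ∈ y ∖ ⟪ x ⟫ → ¬ (u ≈ x)
          ≉ q e = proj₂ (∖⁻ q) (⟪⟫⁺ e)
          tot : ∀ u → u ∈ y ∖ ⟪ x ⟫ → ∃ λ v → v ∈ n × R u v
          tot u q with suc⁻ (m u (proj₁ (∖⁻ q)))
          ... | inj₁ r = f · u , r , inj₁ (r , ≈-refl)
          ... | inj₂ e with suc⁻ (m x p)
          ...   | inj₁ r = f · x , r , inj₂ (e , ≈-refl)
          ...   | inj₂ e′ = ⊥-elim (≉ q (i u x (proj₁ (∖⁻ q)) p (≈-trans e (≈-sym e′))))
          inj : ∀ u u′ v → u ∈ y ∖ ⟪ x ⟫ → u′ ∈ y ∖ ⟪ x ⟫ → R u v → R u′ v → u ≈ u′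
          inj u u′ v q q′ (inj₁ (_ , e)) (inj₁ (_ , e′)) = i u u′ (proj₁ (∖⁻ q)) (proj₁ (∖⁻ q′)) (≈-trans (≈-sym e) e′)
          inj u u′ v q q′ (inj₂ (e , _)) (inj₂ (e′ , _)) = i u u′ (proj₁ (∖⁻ q)) (proj₁ (∖⁻ q′)) (≈-trans e (≈-sym e′))
          inj u u′ v q q′ (inj₁ (_ , e)) (inj₂ (_ , e′)) = ⊥-elim (≉ q (i u x (proj₁ (∖⁻ q)) p (≈-trans (≈-sym e) e′)))
          inj u u′ v q q′ (inj₂ (_ , e)) (inj₁ (_ , e′)) = ⊥-elim (≉ q′ (i u′ x (proj₁ (∖⁻ q′)) p (≈-trans (≈-sym e′) e)))

      ≲-extend : ∀ {x y z w} → x ≲ y → ¬ (w ∈ y) → x ∪ ⟪ z ⟫ ≲ y ∪ ⟪ w ⟫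
      ≲-extend {x} {y} {z} {w} (f , m , i) w∉ = ≲-rel (λ u v → (u ∈ᶠ ! x ∧ᶠ v ≈ᶠ ! f ·ᶠ u) ∨ᶠ (¬ᶠ (u ∈ᶠ ! x) ∧ᶠ v ≈ᶠ ! w)) tot inj
        where
          R : V → V → Set ℓ
          R u v = (u ∈ x × v ≈ f · u) ⊎ (¬ (u ∈ x) × v ≈ w)
          tot : ∀ u → u ∈ x ∪ ⟪ z ⟫ → ∃ λ v → v ∈ y ∪ ⟪ w ⟫ × R u v
          tot u q with em {u ∈ x}
          ... | yes r = f · u , ∪ˡ (m u r) , inj₁ (r , ≈-refl)
          ... | no r  = w , ∪ʳ (⟪⟫⁺ ≈-refl) , inj₂ (r , ≈-refl)
          is-z : ∀ {u} → u ∈ x ∪ ⟪ z ⟫ → ¬ (u ∈ x) → u ≈ z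
          is-z q r = [ (λ s → ⊥-elim (r s)) , ⟪⟫⁻ ]′ (∪⁻ q)
          inj : ∀ u u′ v → u ∈ x ∪ ⟪ z ⟫ → u′ ∈ x ∪ ⟪ z ⟫ → R u v → R u′ v → u ≈ u′
          inj u u′ v q q′ (inj₁ (r , e)) (inj₁ (r′ , e′)) = i u u′ r r′ (≈-trans (≈-sym e) e′)
          inj u u′ v q q′ (inj₂ (r , _)) (inj₂ (r′ , _)) = ≈-trans (is-z q r) (≈-sym (is-z q′ r′))
          inj u u′ v q q′ (inj₁ (r , e)) (inj₂ (_ , e′)) = ⊥-elim (w∉ (∈-congˡ (≈-trans (≈-sym e) e′) (m u r)))
          inj u u′ v q q′ (inj₂ (_ , e)) (inj₁ (r , e′)) = ⊥-elim (w∉ (∈-congˡ (≈-trans (≈-sym e′) e) (m u′ r)))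

      suc≈∪ : ∀ {n} → suc′ n ≈ n ∪ ⟪ n ⟫
      suc≈∪ = ⊑-antisym (λ z p → [ ∪ˡ , (λ e → ∪ʳ (⟪⟫⁺ e)) ]′ (suc⁻ p))
                        (λ z p → [ suc⁺′ , (λ q → from (suc-spec _ _) (inj₂ (⟪⟫⁻ q))) ]′ (∪⁻ p))
      ≲-add : ∀ {x n z} → x ≲ n → x ∪ ⟪ z ⟫ ≲ suc′ n
      ≲-add h = ≲-trans (≲-extend h ∈-irrefl) (≲-⊑ λ z → from (suc≈∪ z))
      add-≲ : ∀ {x n z} → n ≲ x → ¬ (z ∈ x) → suc′ n ≲ x ∪ ⟪ z ⟫
      add-≲ h n = ≲-trans (≲-⊑ λ z → to (suc≈∪ z)) (≲-extend h n)

      ≲-cong : ∀ {A A′ B B′} → A ≈ A′ → B ≈ B′ → A ≲ B → A′ ≲ B′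
      ≲-cong p q h = ≲-trans (≲-⊑ (λ z → from (p z))) (≲-trans h (≲-⊑ (λ z → to (q z))))

      fin-∅ : Finite ∅
      fin-∅ = ∅ , 0∈ω , ≲-refl
      fin-sub : ∀ {x y} → x ≲ y → Finite y → Finite x
      fin-sub s (n , p , t) = n , p , ≲-trans s t
      fin-⊑ : ∀ {x y} → x ⊑ y → Finite y → Finite x
      fin-⊑ s = fin-sub (≲-⊑ s)
      fin-add : ∀ {x z} → Finite x → Finite (x ∪ ⟪ z ⟫)
      fin-add (n , p , t) = suc′ n , suc∈ω p , ≲-add t
      fin-nat : ∀ {n} → n ∈ ω → Finite n
      fin-nat p = _ , p , ≲-refl
      fin-resp : ∀ {x y} → x ≈ y → Finite x → Finite y
      fin-resp = ≈-subst Finiteᶠ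

      ≲∅ : ∀ {x} → x ≲ ∅ → x ≈ ∅
      ≲∅ (f , m , _) = ∅-unique λ z p → ∅⁻ (m z p)

      -- In contrast to `fin-ind`, the step itself chooses the element to be removed: `𝓕-generic`
      -- removes the largest ordinal in this way, and `assign` the last vertex.
      fin-rem : (f : Tm → Fm) → P₁ f ∅ → (∀ y → Finite y → (∃ λ z → z ∈ y) → ∃ λ z → z ∈ y × (P₁ f (y ∖ ⟪ z ⟫) → P₁ f y)) →
                ∀ x → Finite x → P₁ f x
      fin-rem f z s x (n , p , t) = ω-ind (λ n → ∀ᶠ λ x → x ≲ᶠ n ⇒ᶠ f! x) (λ x t → ≈-subst f! (≈-sym (≲∅ t)) z) stp n p x t
        where
          f! = rel₁ᶠ (P₁ f) (D₁ f)
          stp : ∀ n → n ∈ ω → (∀ x → x ≲ n → P₁ f x) → ∀ x → x ≲ suc′ n → P₁ f x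
          stp n p ih x t with em {x ≈ ∅}
          ... | yes e = ≈-subst f! (≈-sym e) z
          ... | no ne with s x (suc′ n , suc∈ω p , t) (nonempty ne)
          ...   | y , q , k = k (ih _ (≲-remove t q))

      ∖∪ : ∀ {y z} → z ∈ y → (y ∖ ⟪ z ⟫) ∪ ⟪ z ⟫ ≈ y
      ∖∪ {y} {z} p = ⊑-antisym (λ u q → [ (λ r → proj₁ (∖⁻ r)) , (λ r → ∈-congˡ (≈-sym (⟪⟫⁻ r)) p) ]′ (∪⁻ q)) h
        where h : y ⊑ (y ∖ ⟪ z ⟫) ∪ ⟪ z ⟫
              h u q with em {u ∈ ⟪ z ⟫}
              ... | yes r = ∪ʳ r
              ... | no r  = ∪ˡ (∖⁺ q r)

      fin-ind : (f : Tm → Fm) → P₁ f ∅ → (∀ y z → Finite y → P₁ f y → P₁ f (y ∪ ⟪ z ⟫)) → ∀ x → Finite x → P₁ f x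
      fin-ind f z s = fin-rem f z λ y p (u , q) → u , q , λ h →
        ≈-subst (rel₁ᶠ (P₁ f) (D₁ f)) (∖∪ q) (s _ u (fin-⊑ (λ w r → proj₁ (∖⁻ r)) p) h)

      fin-∪ : ∀ {x y} → Finite x → Finite y → Finite (x ∪ y)
      fin-∪ {x} {y} p q = fin-ind (λ y → Finiteᶠ (! x ∪ᶠ y)) (fin-⊑ (λ z r → [ (λ s → s) , (λ s → ⊥-elim (∅⁻ s)) ]′ (∪⁻ r)) p)
        (λ y z _ h → fin-⊑ (λ u r → [ (λ s → ∪ˡ (∪ˡ s)) , (λ s → [ (λ t → ∪ˡ (∪ʳ t)) , ∪ʳ ]′ (∪⁻ s)) ]′ (∪⁻ r)) (fin-add h)) y q

      fin-⟪⟫ : ∀ {z} → Finite ⟪ z ⟫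
      fin-⟪⟫ = fin-⊑ (λ u → ∪ʳ) (fin-add {z = _} fin-∅)

      fin-pair : ∀ {x y} → Finite (pair x y)
      fin-pair = fin-⊑ (λ u p → [ (λ e → ∪ˡ (⟪⟫⁺ e)) , (λ e → ∪ʳ (⟪⟫⁺ e)) ]′ (pair⁻ p)) (fin-∪ fin-⟪⟫ fin-⟪⟫)

      fin-onto : ∀ {A B} (t : Tm → Tm) → (∀ y → y ∈ B → ∃ λ x → x ∈ A × t₁ t x ≈ y) → Finite A → Finite B
      fin-onto t h = fin-sub (≲-onto t h)

      fin-⋃ : ∀ {X} → Finite X → (∀ x → x ∈ X → Finite x) → Finite (⋃ X)
      fin-⋃ {X} p = fin-ind (λ X → (∀ᶠ λ x → x ∈ᶠ X ⇒ᶠ Finiteᶠ x) ⇒ᶠ Finiteᶠ (⋃ᶠ X))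
        (λ _ → fin-resp (≈-sym (∅-unique λ z q → let y , r , _ = ⋃⁻ q in ∅⁻ r)) fin-∅)
        (λ Y z _ h k → fin-⊑ (λ u q → let y , r , s = ⋃⁻ q in
           [ (λ r → ∪ˡ (⋃⁺ r s)) , (λ r → ∪ʳ (∈-congʳ (⟪⟫⁻ r) s)) ]′ (∪⁻ r)) (fin-∪ (h (λ x q → k x (∪ˡ q))) (k z (∪ʳ (⟪⟫⁺ ≈-refl))))) X p

      fin-max : ∀ {F} → Finite F → (∀ x → x ∈ F → Ord x) → (∃ λ x → x ∈ F) → ∃ λ m → m ∈ F × (∀ x → x ∈ F → x ∈ m ⊎ x ≈ m)
      fin-max {F} p o ne = fin-ind (λ F → (∀ᶠ λ x → x ∈ᶠ F ⇒ᶠ Ordᶠ x) ⇒ᶠ (∃ᶠ λ x → x ∈ᶠ F) ⇒ᶠ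
          ∃ᶠ λ m → m ∈ᶠ F ∧ᶠ (∀ᶠ λ x → x ∈ᶠ F ⇒ᶠ x ∈ᶠ m ∨ᶠ x ≈ᶠ m)) (λ _ (x , q) → ⊥-elim (∅⁻ q)) s F p o ne
        where
          Max : V → Set ℓ
          Max F = ∃ λ m → m ∈ F × (∀ x → x ∈ F → x ∈ m ⊎ x ≈ m)
          s : ∀ y z → Finite y → ((∀ x → x ∈ y → Ord x) → (∃ λ x → x ∈ y) → Max y) →
              (∀ x → x ∈ y ∪ ⟪ z ⟫ → Ord x) → (∃ λ x → x ∈ y ∪ ⟪ z ⟫) → Max (y ∪ ⟪ z ⟫)
          s y z _ ih o _ with em {∃ λ x → x ∈ y}
          ... | no n = z , ∪ʳ (⟪⟫⁺ ≈-refl) , λ x q → [ (λ r → ⊥-elim (n (x , r))) , (λ r → inj₂ (⟪⟫⁻ r)) ]′ (∪⁻ q)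
          ... | yes e with ih (λ x q → o x (∪ˡ q)) e
          ...   | m , q , h with Ord-cmp (o m (∪ˡ q)) (o z (∪ʳ (⟪⟫⁺ ≈-refl)))
          ...     | inj₁ r = z , ∪ʳ (⟪⟫⁺ ≈-refl) , λ x t → [ (λ t → inj₁ ([ (λ u → proj₁ (o z (∪ʳ (⟪⟫⁺ ≈-refl))) m r x u) , (λ u → ∈-congˡ (≈-sym u) r) ]′ (h x t))) , (λ t → inj₂ (⟪⟫⁻ t)) ]′ (∪⁻ t)
          ...     | inj₂ (inj₁ f) = m , ∪ˡ q , λ x t → [ h x , (λ t → inj₂ (≈-trans (⟪⟫⁻ t) (≈-sym f))) ]′ (∪⁻ t)
          ...     | inj₂ (inj₂ r) = m , ∪ˡ q , λ x t → [ h x , (λ t → inj₁ (∈-congˡ (≈-sym (⟪⟫⁻ t)) r)) ]′ (∪⁻ t)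

      -- Shifting the indices by one frees the value `f · ∅`, which serves the one index that is
      -- sent to the removed point `z`.
      ω≴fin : ∀ {x} → Finite x → ¬ (ω ≲ x)
      ω≴fin {x} p = fin-ind (λ x → ¬ᶠ (! ω ≲ᶠ x)) (λ t → ∅⁻ (∈-congʳ (≲∅ t) 0∈ω)) s x p
        where
          s : ∀ y z → Finite y → ¬ (ω ≲ y) → ¬ (ω ≲ y ∪ ⟪ z ⟫)
          s y z _ ih (f , m , i) = ih (≲-rel (λ n v → (! f ·ᶠ sucᶠ n ∈ᶠ ! y ∧ᶠ v ≈ᶠ ! f ·ᶠ sucᶠ n) ∨ᶠ (¬ᶠ (! f ·ᶠ sucᶠ n ∈ᶠ ! y) ∧ᶠ v ≈ᶠ ! f ·ᶠ ! ∅)) tot inj)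
            where
              R : V → V → Set ℓ
              R n v = (f · suc′ n ∈ y × v ≈ f · suc′ n) ⊎ (¬ (f · suc′ n ∈ y) × v ≈ f · ∅)
              out : ∀ {n} → n ∈ ω → ¬ (f · n ∈ y) → f · n ≈ z
              out p q = [ (λ r → ⊥-elim (q r)) , ⟪⟫⁻ ]′ (∪⁻ (m _ p))
              tot : ∀ n → n ∈ ω → ∃ λ v → v ∈ y × R n v
              tot n p with em {f · suc′ n ∈ y}
              ... | yes q = _ , q , inj₁ (q , ≈-refl)
              ... | no q with em {f · ∅ ∈ y}
              ...   | yes r = _ , r , inj₂ (q , ≈-refl)
              ...   | no r  = ⊥-elim (suc≉∅ (i _ _ (suc∈ω p) 0∈ω (≈-trans (out (suc∈ω p) q) (≈-sym (out 0∈ω r)))))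
              inj : ∀ n n′ v → n ∈ ω → n′ ∈ ω → R n v → R n′ v → n ≈ n′
              inj n n′ v p p′ (inj₁ (_ , e)) (inj₁ (_ , e′)) = suc-inj (i _ _ (suc∈ω p) (suc∈ω p′) (≈-trans (≈-sym e) e′))
              inj n n′ v p p′ (inj₂ (q , _)) (inj₂ (q′ , _)) = suc-inj (i _ _ (suc∈ω p) (suc∈ω p′) (≈-trans (out (suc∈ω p) q) (≈-sym (out (suc∈ω p′) q′))))
              inj n n′ v p p′ (inj₁ (_ , e)) (inj₂ (_ , e′)) = ⊥-elim (suc≉∅ (i _ _ (suc∈ω p) 0∈ω (≈-trans (≈-sym e) e′)))
              inj n n′ v p p′ (inj₂ (_ , e)) (inj₁ (_ , e′)) = ⊥-elim (suc≉∅ (i _ _ (suc∈ω p′) 0∈ω (≈-trans (≈-sym e′) e)))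

    open Finiteness public

    -- Countable sets, Hartogs numbers and a characterisation of ω₁

    module Cardinality where
      Ctb : V → Set ℓ
      Ctb x = x ≲ ω
      Ctbᶠ : Tm → Fm
      Ctbᶠ x = x ≲ᶠ ! ω

      fin⇒ctb : ∀ {x} → Finite x → Ctb x
      fin⇒ctb (n , p , t) = ≲-trans t (≲-⊑ (ω-trans n p))
      ctb-⊑ : ∀ {x y} → x ⊑ y → Ctb y → Ctb x
      ctb-⊑ s = ≲-trans (≲-⊑ s)
      ctb-onto : ∀ {A B} (t : Tm → Tm) → (∀ y → y ∈ B → ∃ λ x → x ∈ A × t₁ t x ≈ y) → Ctb A → Ctb B
      ctb-onto t h = ≲-trans (≲-onto t h)
      ctb-Img : ∀ {A} (t : Tm → Tm) → Ctb A → Ctb (Img t A)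
      ctb-Img t = ctb-onto t λ y p → let x , q , e = Img⁻ p in x , q , ≈-sym e

      ≲-⊗ : ∀ {A A′ B B′} → A ≲ A′ → B ≲ B′ → A ⊗ B ≲ A′ ⊗ B′
      ≲-⊗ {A} {A′} {B} {B′} (f , a , i) (g , b , j) = ≲-by (λ p → ⟨ ! f ·ᶠ fstᶠ p , ! g ·ᶠ sndᶠ p ⟩ᶠ)
        (λ p q → let x , y , r , s , e = ⊗⁻′ q in ⊗⁺ (∈-congˡ (·-congʳ (≈-sym (fst≈ e))) (a x r)) (∈-congˡ (·-congʳ (≈-sym (snd≈ e))) (b y s)))
        (λ p p′ q q′ h → let x , y , r , s , e = ⊗⁻′ q; x′ , y′ , r′ , s′ , e′ = ⊗⁻′ q′; u , v = ⟨⟩-inj h in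
           ≈-trans e (≈-trans (⟨⟩-cong (i x x′ r r′ (≈-trans (·-congʳ (≈-sym (fst≈ e))) (≈-trans u (·-congʳ (fst≈ e′)))))
                                      (j y y′ s s′ (≈-trans (·-congʳ (≈-sym (snd≈ e))) (≈-trans v (·-congʳ (snd≈ e′)))))) (≈-sym e′)))
        where
          fst≈ : ∀ {p x y} → p ≈ ⟨ x , y ⟩ → fst p ≈ x
          fst≈ e = ≈-trans (≈-cong fstᶠ e) fst-β
          snd≈ : ∀ {p x y} → p ≈ ⟨ x , y ⟩ → snd p ≈ y
          snd≈ e = ≈-trans (≈-cong sndᶠ e) snd-β

      ctb-⊗ : ∀ {A B} → Ctb A → Ctb B → Ctb (A ⊗ B)
      ctb-⊗ p q = ≲-trans (≲-⊗ p q) ω⊗ω≲ω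

      inj-↾ : ∀ {f x B} → Inj f x B → Inj (f ↾ x) x B
      inj-↾ (m , i) = (λ u p → ∈-congˡ (≈-sym (↾-β p)) (m u p)) ,
        λ u v p q e → i u v p q (≈-trans (≈-sym (↾-β p)) (≈-trans e (↾-β q)))

      ↾⊑⊗ : ∀ {f x A B} → x ⊑ A → (∀ u → u ∈ x → f · u ∈ B) → f ↾ x ⊑ A ⊗ B
      ↾⊑⊗ s m p q = let u , r , e = to (↾-spec _ _ _) q in ∈-congˡ (≈-sym e) (⊗⁺ (s u r) (m u r))

      ≲-⋃ : ∀ {X κ} → X ≲ κ → (∀ x → x ∈ X → Ctb x) → ⋃ X ≲ κ ⊗ ω
      ≲-⋃ {X} {κ} (i , im , ii) h = main
        -- Restricting each injection to `x` puts all of them into one set, from which they can be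
        -- chosen.
        (uniformizeᶠ (λ x f → Injᶠ f x (! ω)) X (𝒫 (⋃ X ⊗ ω)) (λ x p → let f , m , j = h x p in
           f ↾ x , 𝒫⁺ (↾⊑⊗ (λ u q → ⋃⁺ p q) m) , inj-↾ (m , j)))
        (uniformizeᶠ (λ z x → z ∈ᶠ x) (⋃ X) X (λ z p → ⋃⁻ p))
        where
          main : (∃ λ G → ∀ x → x ∈ X → G · x ∈ 𝒫 (⋃ X ⊗ ω) × Inj (G · x) x ω) →
                 (∃ λ s → ∀ z → z ∈ ⋃ X → s · z ∈ X × z ∈ s · z) → ⋃ X ≲ κ ⊗ ω
          main (G , g) (s , k) = ≲-by (λ z → ⟨ ! i ·ᶠ (! s ·ᶠ z) , ! G ·ᶠ (! s ·ᶠ z) ·ᶠ z ⟩ᶠ)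
            (λ z p → let a , b = k z p in ⊗⁺ (im _ a) (proj₁ (proj₂ (g _ a)) z b))
            (λ z z′ p p′ e → let u , v = ⟨⟩-inj e; a , b = k z p; a′ , b′ = k z′ p′; w = ii _ _ a a′ u in
               proj₂ (proj₂ (g _ a)) z z′ b (∈-congʳ (≈-sym w) b′) (≈-trans v (·-cong (·-congʳ (≈-sym w)) ≈-refl)))

      ctb-⋃ : ∀ {X} → Ctb X → (∀ x → x ∈ X → Ctb x) → Ctb (⋃ X)
      ctb-⋃ p h = ≲-trans (≲-⋃ p h) ω⊗ω≲ω

      ctb-pair : ∀ {x y} → Ctb (pair x y)
      ctb-pair = fin⇒ctb fin-pair

      ctb-∪ : ∀ {x y} → Ctb x → Ctb y → Ctb (x ∪ y)
      ctb-∪ {x} {y} p q = ctb-⊑ (λ z r → [ (λ s → ⋃⁺ pairˡ s) , (λ s → ⋃⁺ pairʳ s) ]′ (∪⁻ r))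
        (ctb-⋃ {pair x y} ctb-pair (λ z r → [ (λ e → ≲-cong (≈-sym e) ≈-refl p) , (λ e → ≲-cong (≈-sym e) ≈-refl q) ]′ (pair⁻ r)))

      ctb-⋃Img : ∀ {A} (t : Tm → Tm) → Ctb A → (∀ x → x ∈ A → Ctb (t₁ t x)) → Ctb (⋃ (Img t A))
      ctb-⋃Img t p h = ctb-⋃ (ctb-Img t p) λ y q → let x , r , e = Img⁻ q in ≲-cong (≈-sym e) ≈-refl (h x r)

      fin-𝒫 : ∀ {x} → Finite x → Finite (𝒫 x)
      fin-𝒫 {x} = fin-ind (λ x → Finiteᶠ (𝒫ᶠ x)) (fin-⊑ (λ u p → ⟪⟫⁺ (∅-unique λ z q → ∅⁻ (𝒫⁻ p z q))) fin-⟪⟫)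
        (λ y z _ h → fin-⊑ (split y z) (fin-∪ h (fin-onto (λ u → u ∪ᶠ ! ⟪ z ⟫) (λ v q → let u , r , e = Img⁻ q in u , r , ≈-sym e) h))) x
        where
          split : ∀ y z → 𝒫 (y ∪ ⟪ z ⟫) ⊑ 𝒫 y ∪ Img (λ u → u ∪ᶠ ! ⟪ z ⟫) (𝒫 y)
          split y z u p with em {z ∈ u}
          ... | no n  = ∪ˡ (𝒫⁺ λ w q → [ (λ r → r) , (λ r → ⊥-elim (n (∈-congˡ (⟪⟫⁻ r) q))) ]′ (∪⁻ (𝒫⁻ p w q)))
          ... | yes q = ∪ʳ (∈-congˡ (∖∪ q) (∈Img {λ u → u ∪ᶠ ! ⟪ z ⟫} (𝒫⁺ λ w r →
                            [ (λ s → s) , (λ s → ⊥-elim (proj₂ (∖⁻ r) s)) ]′ (∪⁻ (𝒫⁻ p w (proj₁ (∖⁻ r)))))))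

      private
        Fin₀ : V → V
        Fin₀ A = Sep Finiteᶠ (𝒫 A)
      abstract
        𝔽 : V → V
        𝔽 = Fin₀
        𝔽-spec : ∀ A x → x ∈ 𝔽 A ⇔ (x ⊑ A × Finite x)
        𝔽-spec A x = mk⇔ (λ p → 𝒫⁻ (Sep⊑ {Finiteᶠ} p) , SepP {Finiteᶠ} p) (λ (s , p) → ∈Sep {Finiteᶠ} (𝒫⁺ s) p)
        𝔽-T : T 1 (λ ρ → 𝔽 (proj₁ ρ))
        𝔽-T = T₁-by 𝔽 (λ x A → x ⊑ᶠ A ∧ᶠ Finiteᶠ x) (λ x A → 𝔽-spec A x)
      𝔽ᶠ : Tm → Tm
      𝔽ᶠ = fn₁ᶠ 𝔽 𝔽-T
      𝔽⁺ : ∀ {A x} → x ⊑ A → Finite x → x ∈ 𝔽 A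
      𝔽⁺ s p = from (𝔽-spec _ _) (s , p)
      𝔽⁻ : ∀ {A x} → x ∈ 𝔽 A → x ⊑ A × Finite x
      𝔽⁻ = to (𝔽-spec _ _)

      fin-bounded : ∀ {F} → Finite F → F ⊑ ω → ∃ λ n → n ∈ ω × F ⊑ n
      fin-bounded {F} = fin-ind (λ F → F ⊑ᶠ ! ω ⇒ᶠ ∃ᶠ λ n → n ∈ᶠ ! ω ∧ᶠ F ⊑ᶠ n) (λ _ → ∅ , 0∈ω , λ z p → p) s F
        where
          s : ∀ y z → Finite y → (y ⊑ ω → ∃ λ n → n ∈ ω × y ⊑ n) → y ∪ ⟪ z ⟫ ⊑ ω → ∃ λ n → n ∈ ω × y ∪ ⟪ z ⟫ ⊑ n
          s y z _ ih h with ih (λ u p → h u (∪ˡ p))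
          ... | n , p , k with Ord-cmp (Ord-nat n p) (Ord-nat z (h z (∪ʳ (⟪⟫⁺ ≈-refl))))
          ...   | inj₁ q = suc′ z , suc∈ω (h z (∪ʳ (⟪⟫⁺ ≈-refl))) ,
                    λ u r → [ (λ t → suc⁺′ (proj₁ (Ord-nat z (h z (∪ʳ (⟪⟫⁺ ≈-refl)))) n q u (k u t))) , (λ t → from (suc-spec _ _) (inj₂ (⟪⟫⁻ t))) ]′ (∪⁻ r)
          ...   | inj₂ (inj₁ e) = suc′ n , suc∈ω p , λ u r → [ (λ t → suc⁺′ (k u t)) , (λ t → from (suc-spec _ _) (inj₂ (≈-trans (⟪⟫⁻ t) (≈-sym e)))) ]′ (∪⁻ r)
          ...   | inj₂ (inj₂ q) = n , p , λ u r → [ k u , (λ t → ∈-congˡ (≈-sym (⟪⟫⁻ t)) q) ]′ (∪⁻ r)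

      ctb-𝔽 : ∀ {A} → Ctb A → Ctb (𝔽 A)
      ctb-𝔽 {A} (i , m , j) = ≲-trans (≲-rel (λ F G → ∀ᶠ λ y → y ∈ᶠ G ⇔ᶠ ∃ᶠ λ x → x ∈ᶠ F ∧ᶠ y ≈ᶠ ! i ·ᶠ x)
          (λ F p → G F , 𝔽⁺ (λ y q → let x , r , e = Img⁻ q in ∈-congˡ (≈-sym e) (m x (proj₁ (𝔽⁻ p) x r)))
                           (fin-onto (λ x → ! i ·ᶠ x) (λ y q → let x , r , e = Img⁻ q in x , r , ≈-sym e) (proj₂ (𝔽⁻ p))) , λ y → Img-spec (λ x → ! i ·ᶠ x))
          (λ F F′ G p p′ a b → ⊑-antisym (half F F′ G (proj₁ (𝔽⁻ p)) (proj₁ (𝔽⁻ p′)) a b) (half F′ F G (proj₁ (𝔽⁻ p′)) (proj₁ (𝔽⁻ p)) b a)))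
        -- A finite subset of ω is bounded, hence a member of one of the finite sets `𝒫 n`.
        (ctb-⊑ {y = ⋃ (Img 𝒫ᶠ ω)} (λ F p → let n , q , s = fin-bounded (proj₂ (𝔽⁻ p)) (proj₁ (𝔽⁻ p)) in ⋃⁺ (∈Img {𝒫ᶠ} q) (𝒫⁺ s))
          (ctb-⋃Img 𝒫ᶠ ≲-refl (λ n p → fin⇒ctb (fin-𝒫 (fin-nat p)))))
        where
          G : V → V
          G F = Img (λ x → ! i ·ᶠ x) F
          R : V → V → Set ℓ
          R F G = ∀ y → y ∈ G ⇔ (∃ λ x → x ∈ F × y ≈ i · x)
          half : ∀ F F′ G → F ⊑ A → F′ ⊑ A → R F G → R F′ G → F ⊑ F′
          half F F′ G s s′ a b x p = let x′ , q , e = to (b (i · x)) (from (a (i · x)) (x , p , ≈-refl))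
                                    in ∈-congˡ (≈-sym (j x x′ (s x p) (s′ x′ q) e)) q

      module Hartogs (κ : V) where
        private
          -- `R` is the reflexive order that `f` transports to `κ`. Reflexivity makes the range of
          -- `f` readable off the diagonal; a strict order would not tell the ordinals 0 and 1
          -- apart.
          Codes : V → V → Set ℓ
          Codes R α = Ord α × ∃ λ f → Inj f α κ ×
            (∀ x → ⟨ x , x ⟩ ∈ R ⇔ (∃ λ β → β ∈ α × x ≈ f · β)) ×
            (∀ β γ → β ∈ α → γ ∈ α → ⟨ f · β , f · γ ⟩ ∈ R ⇔ (β ∈ γ ⊎ β ≈ γ))
          Codesᶠ : Tm → Tm → Fm
          Codesᶠ R α = Ordᶠ α ∧ᶠ ∃ᶠ λ f → Injᶠ f α (! κ) ∧ᶠ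
            (∀ᶠ λ x → ⟨ x , x ⟩ᶠ ∈ᶠ R ⇔ᶠ ∃ᶠ λ β → β ∈ᶠ α ∧ᶠ x ≈ᶠ f ·ᶠ β) ∧ᶠ
            (∀ᶠ λ β → ∀ᶠ λ γ → β ∈ᶠ α ⇒ᶠ γ ∈ᶠ α ⇒ᶠ ⟨ f ·ᶠ β , f ·ᶠ γ ⟩ᶠ ∈ᶠ R ⇔ᶠ β ∈ᶠ γ ∨ᶠ β ≈ᶠ γ)

          -- The two enumerations have the same range and transport the same order, so by induction
          -- they take the same value at the same ordinal.
          match : ∀ {R α α′} → Codes R α → Codes R α′ → α ⊑ α′
          match {R} {α} {α′} (o , f , (m , i) , d , r) (o′ , f′ , (m′ , i′) , d′ , r′) β p =
              let β′ , p′ , e = partner β p in ∈-congˡ (≈-sym (same β p β′ p′ e)) p′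
            where
              partner : ∀ β → β ∈ α → ∃ λ β′ → β′ ∈ α′ × f · β ≈ f′ · β′
              partner β p = to (d′ (f · β)) (from (d (f · β)) (β , p , ≈-refl))
              partner′ : ∀ β → β ∈ α′ → ∃ λ β′ → β′ ∈ α × f′ · β ≈ f · β′
              partner′ β p = to (d (f′ · β)) (from (d′ (f′ · β)) (β , p , ≈-refl))
              same : ∀ β → β ∈ α → ∀ β′ → β′ ∈ α′ → f · β ≈ f′ · β′ → β ≈ β′
              same = ∈-ind (λ β → ∀ᶠ λ β′ → β′ ∈ᶠ ! α′ ⇒ᶠ ! f ·ᶠ β ≈ᶠ ! f′ ·ᶠ β′ ⇒ᶠ β ≈ᶠ β′) α λ β p ih β′ p′ e → ⊑-antisym
                (λ γ q → let pγ = proj₁ o β p γ q; γ′ , pγ′ , eγ = partner γ pγ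
                             u = to (r′ γ′ β′ pγ′ p′) (∈-congˡ (⟨⟩-cong eγ e) (from (r γ β pγ p) (inj₁ q)))
                             v = ih γ q pγ γ′ pγ′ eγ
                         in [ (λ w → ∈-congˡ (≈-sym v) w) , (λ w → ⊥-elim (∈-irrefl′ (i γ β pγ p (≈-trans eγ (≈-trans (·-congʳ w) (≈-sym e)))) q)) ]′ u)
                (λ γ′ q → let pγ′ = proj₁ o′ β′ p′ γ′ q; γ , pγ , eγ = partner′ γ′ pγ′
                              u = to (r γ β pγ p) (∈-congˡ (⟨⟩-cong eγ (≈-sym e)) (from (r′ γ′ β′ pγ′ p′) (inj₁ q)))
                          in [ (λ w → ∈-congˡ (ih γ w pγ γ′ pγ′ (≈-sym eγ)) w) ,
                               (λ w → ⊥-elim (∈-irrefl′ (i′ γ′ β′ pγ′ p′ (≈-trans eγ (≈-trans (·-congʳ w) e))) q)) ]′ u)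

          open Description Codesᶠ (λ R α α′ a b → ⊑-antisym (match {R} a b) (match {R} b a))

          code : ∀ {α} → Ord α → α ≲ κ → ∃ λ R → R ∈ 𝒫 (κ ⊗ κ) × Codes R α
          code {α} o (f , m , i) = R , 𝒫⁺ (λ z → Sep⊑ {Rᶠ}) , o , f , (m , i) ,
              (λ x → mk⇔ (λ p → let β , γ , q , q′ , e , _ = SepP {Rᶠ} p in β , q , ⟨⟩-fst e)
                         (λ (β , q , e) → ∈Sep {Rᶠ} (⊗⁺ (∈-congˡ (≈-sym e) (m β q)) (∈-congˡ (≈-sym e) (m β q))) (β , β , q , q , ⟨⟩-cong e e , inj₂ ≈-refl))) ,
              λ β γ q q′ → mk⇔ (λ p → let β′ , γ′ , u , u′ , e , h = SepP {Rᶠ} p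
                                          e₁ = i β β′ q u (⟨⟩-fst e); e₂ = i γ γ′ q′ u′ (⟨⟩-snd e) in
                                      [ (λ h → inj₁ (∈-congˡ (≈-sym e₁) (∈-congʳ (≈-sym e₂) h))) , (λ h → inj₂ (≈-trans e₁ (≈-trans h (≈-sym e₂)))) ]′ h)
                               (λ h → ∈Sep {Rᶠ} (⊗⁺ (m β q) (m γ q′)) (β , γ , q , q′ , ≈-refl , h))
            where
              Rᶠ : Tm → Fm
              Rᶠ p = ∃ᶠ λ β → ∃ᶠ λ γ → β ∈ᶠ ! α ∧ᶠ γ ∈ᶠ ! α ∧ᶠ p ≈ᶠ ⟨ ! f ·ᶠ β , ! f ·ᶠ γ ⟩ᶠ ∧ᶠ (β ∈ᶠ γ ∨ᶠ β ≈ᶠ γ)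
              R = Sep Rᶠ (κ ⊗ κ)

          H₀ : V
          H₀ = Sep (λ α → Ordᶠ α ∧ᶠ α ≲ᶠ ! κ) (Img descᶠ (𝒫 (κ ⊗ κ)))
          H₀-spec : ∀ α → α ∈ H₀ ⇔ (Ord α × α ≲ κ)
          H₀-spec α = mk⇔ SepP λ (o , l) → let R , p , c = code o l in
            ∈Sep (∈-congˡ (desc-spec c) (∈Img {descᶠ} p)) (o , l)
        abstract
          _⁺ : V
          _⁺ = H₀
          ⁺-spec : ∀ α → α ∈ _⁺ ⇔ (Ord α × α ≲ κ)
          ⁺-spec = H₀-spec
      open Hartogs public using (_⁺; ⁺-spec)

      Ord-⁺ : ∀ κ → Ord (κ ⁺)
      Ord-⁺ κ = Ord-set (λ α p β q → let o , l = to (⁺-spec κ α) p in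
          from (⁺-spec κ β) (Ord-elem o q , ≲-trans (≲-⊑ (proj₁ o β q)) l)) (λ α p → proj₁ (to (⁺-spec κ α) p))
      ⁺-≴ : ∀ κ → ¬ (κ ⁺ ≲ κ)
      ⁺-≴ κ l = ∈-irrefl (from (⁺-spec κ (κ ⁺)) (Ord-⁺ κ , l))
      ⁺-elem : ∀ {κ α} → α ∈ κ ⁺ → α ≲ κ
      ⁺-elem p = proj₂ (to (⁺-spec _ _) p)

      ω₁ ω₂ : V
      ω₁ = ω ⁺
      ω₂ = ω₁ ⁺
      Ord-ω₁ : Ord ω₁
      Ord-ω₁ = Ord-⁺ ω

      -- Every clause but unctb is upward absolute, in contrast to IsOmega₁.
      record Isω₁ (w : V) : Set ℓ where
        field
          ord   : Ord w
          elem  : ∀ {β} → β ∈ w → Ctb β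
          unctb : ¬ Ctb w

        ⊑-ord : ∀ {α} → α ∈ w → Ord α
        ⊑-ord = Ord-elem ord
        mem : ∀ {β} → Ord β → Ctb β → β ∈ w
        mem o c with Ord-cmp o ord
        ... | inj₁ p = p
        ... | inj₂ (inj₁ e) = ⊥-elim (unctb (≲-cong e ≈-refl c))
        ... | inj₂ (inj₂ p) = ⊥-elim (unctb (ctb-⊑ (proj₁ o w p) c))
        suc-mem : ∀ {β} → β ∈ w → suc′ β ∈ w
        suc-mem p = mem (Ord-suc (⊑-ord p)) (ctb-⊑ (λ z q → [ ∪ˡ , (λ e → ∪ʳ (⟪⟫⁺ e)) ]′ (suc⁻ q)) (ctb-∪ (elem p) (fin⇒ctb fin-⟪⟫)))
        bounded : ∀ {X} → X ⊑ w → Ctb X → ∃ λ δ → δ ∈ w × (∀ x → x ∈ X → x ∈ δ)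
        bounded {X} s c = suc′ (⋃ X) , suc-mem (mem o (ctb-⋃ c λ x p → elem (s x p))) , λ x p →
            from (suc-spec _ _) ([ inj₂ , inj₁ ]′ (Ord-⊑ (⊑-ord (s x p)) o (λ z q → ⋃⁺ p q)))
          where o : Ord (⋃ X)
                o = Ord-⋃ λ x p → ⊑-ord (s x p)
        unbounded : ∀ {T} → T ⊑ w → (∀ γ → γ ∈ w → ∃ λ δ → δ ∈ T × γ ∈ δ) → ¬ Ctb T
        unbounded s u c = let δ , p , h = bounded s c; ε , q , r = u δ p in ∈-asym r (h ε q)
        cofinal : ∀ {T} → T ⊑ w → ¬ Ctb T → ∀ γ → γ ∈ w → ∃ λ δ → δ ∈ T × γ ∈ δ
        cofinal {T} s n γ p = dne λ h → n (ctb-⊑ (λ z q → dne λ k → h (z , q ,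
            [ (λ r → ⊥-elim (k (suc⁺′ r))) , [ (λ e → ⊥-elim (k (from (suc-spec _ _) (inj₂ e)))) , (λ r → r) ]′ ]′
              (Ord-cmp (⊑-ord (s z q)) (⊑-ord p)))) (elem (suc-mem p)))
        ω∈ : ω ∈ w
        ω∈ = mem Ord-ω ≲-refl
        ω⊑ : ω ⊑ w
        ω⊑ = proj₁ ord ω ω∈
        0∈ : ∅ ∈ w
        0∈ = ω⊑ ∅ 0∈ω
        max-mem : ∀ {α β} → α ∈ w → β ∈ w → ∃ λ δ → δ ∈ w × α ∈ δ × β ∈ δ
        max-mem {α} {β} p q = let δ , r , h = bounded {pair α β} (λ z s → [ (λ e → ∈-congˡ (≈-sym e) p) , (λ e → ∈-congˡ (≈-sym e) q) ]′ (pair⁻ s)) ctb-pair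
                              in δ , r , h α pairˡ , h β pairʳ

      ω₁-isω₁ : Isω₁ ω₁
      ω₁-isω₁ = record { ord = Ord-ω₁ ; elem = ⁺-elem ; unctb = ⁺-≴ ω }

    open Cardinality public

    -- Cantor-Bernstein, successor cardinals and consequences of GCH

    module Continuum where
      Ord⇒ : ∀ {α} → IsOrdinal α → Ord α
      Ord⇒ (tr , c) = (λ y p z q → tr y p q) , c
      ⇒Ord : ∀ {α} → Ord α → IsOrdinal α
      ⇒Ord (tr , c) = (λ y p q → tr y p _ q) , c

      module _ {f A B : V} {D C : Class} (dom : ∀ x → D x ⇔ x ∈ A) (cod : ∀ y → y ∈ B → C y)
               (m : ∀ x → x ∈ A → f · x ∈ B) where
        private
          g : V
          g = lam A (λ x → ! f ·ᶠ x)
        graph : V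
        graph = g
        graph⁻ : ∀ {x y} → ⟨ x , y ⟩∈ g → x ∈ A × f · x ≈ y
        graph⁻ p = let x′ , q , e = to (lam-spec (λ x → ! f ·ᶠ x)) (to ⟨⟩∈⇔ p); u , v = ⟨⟩-inj e
                   in ∈-congˡ (≈-sym u) q , ≈-trans (·-congʳ u) (≈-sym v)
        graph⁺ : ∀ {x y} → x ∈ A → f · x ≈ y → ⟨ x , y ⟩∈ g
        graph⁺ p e = from ⟨⟩∈⇔ (from (lam-spec (λ x → ! f ·ᶠ x)) (_ , p , ⟨⟩-cong ≈-refl (≈-sym e)))
        graph-function : IsFunction g D C
        graph-function = (λ p q → let x , r , e = to (lam-spec (λ x → ! f ·ᶠ x)) q in
                            x , f · x , from (dom x) r , cod _ (m x r) , from opair⇔ e) ,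
                         (λ a d → f · a , graph⁺ (to (dom a) d) ≈-refl) ,
                         λ a b b′ p q → ≈-trans (≈-sym (proj₂ (graph⁻ p))) (proj₂ (graph⁻ q))

      ≼-by : ∀ {A B} {D C : Class} → (∀ x → D x ⇔ x ∈ A) → (∀ y → y ∈ B → C y) → A ≲ B → D ≼ C
      ≼-by {A} dom cod (f , m , i) = graph {f} {A} dom cod m , graph-function {f} {A} dom cod m ,
        λ a a′ b d d′ p q → i a a′ (to (dom a) d) (to (dom a′) d′)
          (≈-trans (proj₂ (graph⁻ {f} {A} dom cod m p)) (≈-sym (proj₂ (graph⁻ {f} {A} dom cod m q))))

      ≃-by : ∀ {A B} f → Inj f A B → (∀ y → y ∈ B → ∃ λ x → x ∈ A × f · x ≈ y) → ⌊ A ⌋ ≃ ⌊ B ⌋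
      ≃-by {A} f (m , i) o = let j , a , b = ≼-by {D = ⌊ A ⌋} (λ _ → ⇔-refl) (λ _ p → p) (f , m , i) in j , a , b ,
        λ y p → let x , q , e = o y p in x , graph⁺ {f} {A} {D = ⌊ A ⌋} (λ _ → ⇔-refl) (λ _ p → p) m q e

      fun-val : ∀ {f} {D C : Class} → IsFunction f D C → ∀ {x y} → ⟨ x , y ⟩∈ f → f · x ≈ y
      fun-val (_ , _ , u) p = ·-val (to ⟨⟩∈⇔ p) (λ y′ q → u _ _ _ (from ⟨⟩∈⇔ q) p)
      fun-graph : ∀ {f} {D C : Class} → IsFunction f D C → ∀ {x} → D x → ⟨ x , f · x ⟩∈ f
      fun-graph {f} F@(_ , t , _) d = let b , p = t _ d in from ⟨⟩∈⇔ (∈-congˡ (⟨⟩-cong ≈-refl (≈-sym (fun-val F p))) (to ⟨⟩∈⇔ p))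
      fun-cod : ∀ {f B} {D : Class} → IsFunction f D ⌊ B ⌋ → ∀ {x} → D x → f · x ∈ B
      fun-cod F@(h , t , _) d = let a , b , _ , q , e = h _ (to ⟨⟩∈⇔ (fun-graph F d)) in ∈-congˡ (≈-sym (⟨⟩-snd (to opair⇔ e))) q

      ≲-by-≼ : ∀ {A B} {D : Class} → (∀ x → x ∈ A → D x) → D ≼ ⌊ B ⌋ → A ≲ B
      ≲-by-≼ h (f , F , i) = f , (λ x p → fun-cod F (h x p)) , λ x y p q e →
        i x y (f · x) (h x p) (h y q) (fun-graph F (h x p)) (from ⟨⟩∈⇔ (∈-congˡ (⟨⟩-cong ≈-refl (≈-sym e)) (to ⟨⟩∈⇔ (fun-graph F (h y q)))))

      ≃⇒≲ : ∀ {A B} → ⌊ A ⌋ ≃ ⌊ B ⌋ → A ≲ B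
      ≃⇒≲ (f , F , i , _) = ≲-by-≼ (λ _ p → p) (f , F , i)
      ≃⇒≳ : ∀ {A B} → ⌊ A ⌋ ≃ ⌊ B ⌋ → B ≲ A
      ≃⇒≳ {A} (f , F , i , o) = ≲-onto (λ x → ! f ·ᶠ x) λ y p → let a , q = o y p; a′ , b , r , _ , e = proj₁ F _ (to ⟨⟩∈⇔ q)
        in a , ∈-congˡ (≈-sym (⟨⟩-fst (to opair⇔ e))) r , fun-val F q

      -- The bijection of `ν` with `κ` is `f` on the closure under `f` of the part of `ν` outside
      -- `κ`, and the identity elsewhere; its inverse is what is returned.
      bernstein : ∀ {κ ν} → κ ⊑ ν → ν ≲ κ → ⌊ κ ⌋ ≃ ⌊ ν ⌋
      bernstein {κ} {ν} s (f , m , i) = fin (uniformizeᶠ (λ y x → Gᶠ x y) κ ν onto)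
        where
          Clᶠ : Tm → Fm
          Clᶠ c = (! ν ∖ᶠ ! κ) ⊑ᶠ c ∧ᶠ (∀ᶠ λ y → y ∈ᶠ c ⇒ᶠ ! f ·ᶠ y ∈ᶠ c)
          Cᶠ : Tm → Fm
          Cᶠ x = ∀ᶠ λ c → Clᶠ c ⇒ᶠ x ∈ᶠ c
          In : V → Set ℓ
          In = P₁ Cᶠ
          Gᶠ : Tm → Tm → Fm
          Gᶠ x y = (Cᶠ x ∧ᶠ y ≈ᶠ ! f ·ᶠ x) ∨ᶠ (¬ᶠ (Cᶠ x) ∧ᶠ y ≈ᶠ x)
          G : V → V → Set ℓ
          G x y = P₂ (λ y x → Gᶠ x y) y x
          In-f : ∀ {x} → In x → In (f · x)
          In-f h c cl = proj₂ cl _ (h c cl)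
          out : ∀ {x} → x ∈ ν → ¬ In x → x ∈ κ
          out p n = dne λ k → n λ c cl → proj₁ cl _ (∖⁺ p k)
          onto : ∀ y → y ∈ κ → ∃ λ x → x ∈ ν × G x y
          onto y p with em {In y}
          ... | no n = y , s y p , inj₂ (n , ≈-refl)
          ... | yes h with em {∃ λ x → x ∈ ν × In x × y ≈ f · x}
          ...   | yes (x , q , k , e) = x , q , inj₁ (k , e)
          -- Otherwise `y` could be dropped from the closure, and the rest would still be closed and
          -- contain the part outside `κ`.
          ...   | no n = ⊥-elim (SepP (h c (cl₁ , cl₂)) ≈-refl)
            where
              c : V
              c = Sep (λ z → ¬ᶠ (z ≈ᶠ ! y)) (Sep Cᶠ ν)
              cl₁ : ν ∖ κ ⊑ c
              cl₁ z q = ∈Sep (∈Sep {Cᶠ} (proj₁ (∖⁻ q)) (λ c cl → proj₁ cl z q)) (λ e → proj₂ (∖⁻ q) (∈-congˡ (≈-sym e) p))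
              cl₂ : ∀ z → z ∈ c → f · z ∈ c
              cl₂ z q = let q′ = Sep⊑ q; zν = Sep⊑ {Cᶠ} q′; k = SepP {Cᶠ} q′ in
                ∈Sep (∈Sep {Cᶠ} (s _ (m z zν)) (In-f k)) (λ e → n (z , zν , k , ≈-sym e))
          fun : ∀ {x y y′} → G x y → G x y′ → y ≈ y′
          fun (inj₁ (_ , e)) (inj₁ (_ , e′)) = ≈-trans e (≈-sym e′)
          fun (inj₂ (_ , e)) (inj₂ (_ , e′)) = ≈-trans e (≈-sym e′)
          fun (inj₁ (h , _)) (inj₂ (n , _)) = ⊥-elim (n h)
          fun (inj₂ (n , _)) (inj₁ (h , _)) = ⊥-elim (n h)
          In-resp : ∀ {x y} → x ≈ y → In x → In y
          In-resp = ≈-subst Cᶠ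
          inj : ∀ {x x′ y} → x ∈ ν → x′ ∈ ν → G x y → G x′ y → x ≈ x′
          inj p q (inj₁ (_ , e)) (inj₁ (_ , e′)) = i _ _ p q (≈-trans (≈-sym e) e′)
          inj p q (inj₂ (_ , e)) (inj₂ (_ , e′)) = ≈-trans (≈-sym e) e′
          inj p q (inj₁ (h , e)) (inj₂ (n , e′)) = ⊥-elim (n (In-resp (≈-trans (≈-sym e) e′) (In-f h)))
          inj p q (inj₂ (n , e)) (inj₁ (h , e′)) = ⊥-elim (n (In-resp (≈-trans (≈-sym e′) e) (In-f h)))
          tot : ∀ x → x ∈ ν → ∃ λ y → y ∈ κ × G x y
          tot x p with em {In x}
          ... | yes h = f · x , m x p , inj₁ (h , ≈-refl)
          ... | no n  = x , out p n , inj₂ (n , ≈-refl)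
          fin : (∃ λ h → ∀ y → y ∈ κ → h · y ∈ ν × G (h · y) y) → ⌊ κ ⌋ ≃ ⌊ ν ⌋
          fin (h , k) = ≃-by h ((λ y p → proj₁ (k y p)) ,
              λ y y′ p q e → fun (proj₂ (k y p)) (G-x (≈-sym e) (proj₂ (k y′ q))))
            λ x p → let y , q , g = tot x p in y , q , inj (proj₁ (k y q)) p (proj₂ (k y q)) g
            where G-x : ∀ {x x′ y} → x ≈ x′ → G x y → G x′ y
                  G-x e (inj₁ (h , k)) = inj₁ (In-resp e h , ≈-trans k (·-congʳ e))
                  G-x e (inj₂ (n , k)) = inj₂ ((λ h → n (In-resp (≈-sym e) h)) , ≈-trans k e)

      -- A cardinal above `κ` that belonged to `w` would inject into its own element `κ`, which
      -- `bernstein` turns into a bijection.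
      successor-cardinal : ∀ {κ w} → Ord κ → Ord w → κ ∈ w → (∀ β → β ∈ w → β ≲ κ) → ¬ (w ≲ κ) → IsSuccessorCardinal w κ
      successor-cardinal {κ} {w} oκ o k el n = (⇒Ord o , λ β p e → n (≲-trans (≃⇒≳ e) (el β p))) , k , min
        where
          min : ∀ ν → IsCardinal ν → κ ∈ ν → ∀ {x} → x ∈ w → x ∈ ν
          min ν (oν , c) q {x} p with Ord-cmp (Ord⇒ oν) o
          ... | inj₁ r = ⊥-elim (c κ q (bernstein (proj₁ (Ord⇒ oν) κ q) (el ν r)))
          ... | inj₂ (inj₁ e) = from (e x) p
          ... | inj₂ (inj₂ r) = proj₁ (Ord⇒ oν) w r x p

      cardinal-ω : IsCardinal ω
      cardinal-ω = ⇒Ord Ord-ω , λ n p e → ω≴fin (fin-nat p) (≃⇒≳ e)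

      ω₁-successor : ∀ {w} → Isω₁ w → IsSuccessorCardinal w ω
      ω₁-successor h = successor-cardinal Ord-ω (Isω₁.ord h) (Isω₁.ω∈ h) (λ _ → Isω₁.elem h) (Isω₁.unctb h)

      isOmega₁ : ∀ {w} → Isω₁ w → IsOmega₁ w
      isOmega₁ h = ω , ω-isOmega , ω₁-successor h

      ≲-𝒫 : ∀ {A B} → A ≲ B → 𝒫 A ≲ 𝒫 B
      ≲-𝒫 {A} {B} (i , m , j) = ≲-rel (λ F G → ∀ᶠ λ y → y ∈ᶠ G ⇔ᶠ ∃ᶠ λ x → x ∈ᶠ F ∧ᶠ y ≈ᶠ ! i ·ᶠ x)
          (λ F p → Img (λ x → ! i ·ᶠ x) F , 𝒫⁺ (λ y q → let x , r , e = Img⁻ q in ∈-congˡ (≈-sym e) (m x (𝒫⁻ p x r))) , λ y → Img-spec (λ x → ! i ·ᶠ x))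
          (λ F F′ G p p′ a b → ⊑-antisym (half F F′ G (𝒫⁻ p) (𝒫⁻ p′) a b) (half F′ F G (𝒫⁻ p′) (𝒫⁻ p) b a))
        where
          R : V → V → Set ℓ
          R F G = ∀ y → y ∈ G ⇔ (∃ λ x → x ∈ F × y ≈ i · x)
          half : ∀ F F′ G → F ⊑ A → F′ ⊑ A → R F G → R F′ G → F ⊑ F′
          half F F′ G s s′ a b x p = let x′ , q , e = to (b (i · x)) (from (a (i · x)) (x , p , ≈-refl))
                                    in ∈-congˡ (≈-sym (j x x′ (s x p) (s′ x′ q) e)) q

      private
        ℂ₀ : V → V
        ℂ₀ A = Sep Ctbᶠ (𝒫 A)
      abstract
        ℂ : V → V
        ℂ = ℂ₀
        ℂ-spec : ∀ A x → x ∈ ℂ A ⇔ (x ⊑ A × Ctb x)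
        ℂ-spec A x = mk⇔ (λ p → 𝒫⁻ (Sep⊑ {Ctbᶠ} p) , SepP {Ctbᶠ} p) (λ (s , p) → ∈Sep {Ctbᶠ} (𝒫⁺ s) p)
      ℂ⁺ : ∀ {A x} → x ⊑ A → Ctb x → x ∈ ℂ A
      ℂ⁺ s p = from (ℂ-spec _ _) (s , p)
      ℂ⁻ : ∀ {A x} → x ∈ ℂ A → x ⊑ A × Ctb x
      ℂ⁻ = to (ℂ-spec _ _)

      module CH (gch : GCH) where
        private
          𝒫ω≃ω₁ : ⌊ 𝒫 ω ⌋ ≃ ⌊ ω₁ ⌋
          𝒫ω≃ω₁ = gch ω ω ω₁ (𝒫 ω) ω-isOmega cardinal-ω (λ p → p) (ω₁-successor ω₁-isω₁)
                    (λ z → ⇔-trans (𝒫-spec ω z) (mk⇔ (λ h {x} → h x) (λ h x → h {x})))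

        𝒫ω₁≲ω₂ : 𝒫 ω₁ ≲ ω₂
        𝒫ω₁≲ω₂ = ≃⇒≲ (gch ω ω₁ ω₂ (𝒫 ω₁) ω-isOmega (proj₁ (ω₁-successor ω₁-isω₁)) (λ p → Isω₁.ω⊑ ω₁-isω₁ _ p)
                    (successor-cardinal Ord-ω₁ (Ord-⁺ ω₁) (from (⁺-spec ω₁ ω₁) (Ord-ω₁ , ≲-refl)) (λ β → ⁺-elem) (⁺-≴ ω₁))
                    (λ z → ⇔-trans (𝒫-spec ω₁ z) (mk⇔ (λ h {x} → h x) (λ h x → h {x}))))

        -- A countable subset of 𝒫 ω is coded by an enumeration; the extra element ω marks the indices in use.
        ℂ≲ω₁ : ∀ {Z} → Z ≲ ω₁ → ℂ Z ≲ ω₁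
        ℂ≲ω₁ {Z} l = main (≲-trans l (≃⇒≳ 𝒫ω≃ω₁))
            (uniformizeᶠ (λ X g → Injᶠ g X (! ω)) (ℂ Z) (𝒫 (Z ⊗ ω)) (λ X p → let g , m , j = proj₂ (ℂ⁻ p) in
               g ↾ X , 𝒫⁺ (↾⊑⊗ (proj₁ (ℂ⁻ p)) m) , inj-↾ (m , j)))
          where
            main : Z ≲ 𝒫 ω → (∃ λ G → ∀ X → X ∈ ℂ Z → G · X ∈ 𝒫 (Z ⊗ ω) × Inj (G · X) X ω) → ℂ Z ≲ ω₁
            main (i , m , j) (G , g) = ≲-trans (≲-rel Rᶠ (λ X p → S X , 𝒫⁺ (λ z → Sep⊑ {codeᶠ X}) , λ p′ → mk⇔ (SepP {codeᶠ X}) (S-in X p p′))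
                  (λ X Y S p q a b → ⊑-antisym (half X Y S p q a b) (half Y X S q p b a)))
                (≲-trans (≲-𝒫 (ctb-⊗ ≲-refl (ctb-⊑ (λ z p → [ ∪ˡ , (λ e → ∪ʳ (⟪⟫⁺ e)) ]′ (suc⁻ p)) (ctb-∪ ≲-refl (fin⇒ctb fin-⟪⟫))))) (≃⇒≲ 𝒫ω≃ω₁))
              where
                codeᶠ : V → Tm → Fm
                codeᶠ X p = ∃ᶠ λ x → ∃ᶠ λ n → x ∈ᶠ ! X ∧ᶠ (n ∈ᶠ ! i ·ᶠ x ∨ᶠ n ≈ᶠ ! ω) ∧ᶠ p ≈ᶠ ⟨ ! G ·ᶠ ! X ·ᶠ x , n ⟩ᶠ
                Rᶠ : Tm → Tm → Fm
                Rᶠ X S = ∀ᶠ λ p → p ∈ᶠ S ⇔ᶠ ∃ᶠ λ x → ∃ᶠ λ n → x ∈ᶠ X ∧ᶠ (n ∈ᶠ ! i ·ᶠ x ∨ᶠ n ≈ᶠ ! ω) ∧ᶠ p ≈ᶠ ⟨ ! G ·ᶠ X ·ᶠ x , n ⟩ᶠ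
                Code : V → V → Set ℓ
                Code X p = ∃ λ x → ∃ λ n → x ∈ X × (n ∈ i · x ⊎ n ≈ ω) × p ≈ ⟨ G · X · x , n ⟩
                S : V → V
                S X = Sep (codeᶠ X) (ω ⊗ suc′ ω)
                iω : ∀ {X x n} → X ∈ ℂ Z → x ∈ X → n ∈ i · x → n ∈ ω
                iω p q r = 𝒫⁻ (m _ (proj₁ (ℂ⁻ p) _ q)) _ r
                S-in : ∀ X → X ∈ ℂ Z → ∀ p → Code X p → p ∈ S X
                S-in X p p′ c@(x , n , q , r , e) = ∈Sep {codeᶠ X} (∈-congˡ (≈-sym e) (⊗⁺ (proj₁ (proj₂ (g X p)) x q)
                    (from (suc-spec _ _) ([ (λ r → inj₁ (iω p q r)) , inj₂ ]′ r)))) c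
                transfer : ∀ X Y S → X ∈ ℂ Z → Y ∈ ℂ Z → (∀ p → p ∈ S ⇔ Code X p) → (∀ p → p ∈ S ⇔ Code Y p) →
                           ∀ x y → x ∈ X → y ∈ Y → G · X · x ≈ G · Y · y → i · x ⊑ i · y
                transfer X Y S p q a b x y xX yY e n r =
                  let y′ , n′ , y′Y , h , e′ = to (b ⟨ G · X · x , n ⟩) (from (a _) (x , n , xX , inj₁ r , ≈-refl))
                      u , v = ⟨⟩-inj e′
                      y≈y′ = proj₂ (proj₂ (g Y q)) y y′ yY y′Y (≈-trans (≈-sym e) u)
                  in [ (λ k → ∈-congˡ (≈-sym v) (∈-congʳ (·-congʳ (≈-sym y≈y′)) k)) ,
                       (λ k → ⊥-elim (∈-irrefl′ (≈-trans v k) (iω p xX r))) ]′ h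
                half : ∀ X Y S → X ∈ ℂ Z → Y ∈ ℂ Z → (∀ p → p ∈ S ⇔ Code X p) → (∀ p → p ∈ S ⇔ Code Y p) → X ⊑ Y
                half X Y S p q a b x xX =
                  let y , n , yY , h , e = to (b ⟨ G · X · x , ω ⟩) (from (a _) (x , ω , xX , inj₂ ≈-refl , ≈-refl))
                      u = ⟨⟩-fst e
                      i≈ = ⊑-antisym (transfer X Y S p q a b x y xX yY u) (transfer Y X S q p b a y x yY xX (≈-sym u))
                  in ∈-congˡ (≈-sym (j x y (proj₁ (ℂ⁻ p) x xX) (proj₁ (ℂ⁻ q) y yY) i≈)) yY

        𝔽≲ω₁ : ∀ {Z} → Z ≲ ω₁ → 𝔽 Z ≲ ω₁
        𝔽≲ω₁ l = ≲-trans (≲-⊑ λ x p → ℂ⁺ (proj₁ (𝔽⁻ p)) (fin⇒ctb (proj₂ (𝔽⁻ p)))) (ℂ≲ω₁ l)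

    open Continuum public

    -- Transitive closures

    module TransitiveClosure where
      private
        module It (x : V) where
          s : V → V
          s y = y ∪ ⋃ y
          open Iteration ⟪ x ⟫ s (T₁ (λ y → y ∪ᶠ ⋃ᶠ y)) public
          itᶠ : Tm → Tm
          itᶠ n = ! iter ·ᶠ n

      transitive-closure : ∀ x → ∃ λ t → Trans t × x ∈ t
      transitive-closure x = t , tr , ⋃⁺ (∈Img {itᶠ} 0∈ω) (∈-congʳ (≈-sym iter-0) (⟪⟫⁺ ≈-refl))
        where
          open It x
          t : V
          t = ⋃ (Img itᶠ ω)
          tr : Trans t
          tr y p z q = let w , a , b = ⋃⁻ p; n , c , e = Img⁻ a in
            ⋃⁺ (∈Img {itᶠ} (suc∈ω c)) (∈-congʳ (≈-sym (iter-suc n c)) (∪ʳ (⋃⁺ (∈-congʳ e b) q)))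

    open TransitiveClosure public

  module Combinatorics {ℓ} (em : ExcludedMiddle ℓ) (M : Model ℓ) where
    open SetTheory em M public

    -- Closure points and the construction of the families 𝓕

    module Families where
      module ClosurePoints {w : V} (isω₁ : Isω₁ w) where
        open Isω₁ isω₁

        Closed : (V → V → Set ℓ) → V → Set ℓ
        Closed R δ = ∀ ξ → ξ ∈ δ → suc′ ξ ∈ δ × ∃ λ η → η ∈ δ × R ξ η

        -- `δ` is the supremum of an ω-sequence starting at `ζ`, each term of which bounds the
        -- chosen witnesses of all ordinals below the preceding term.
        closure : (Φ : Tm → Tm → Fm) → (∀ ξ → ξ ∈ w → ∃ λ η → η ∈ w × P₂ Φ ξ η) →
                  ∀ ζ → ζ ∈ w → ∃ λ δ → δ ∈ w × ζ ∈ δ × Closed (P₂ Φ) δ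
        closure Φ h ζ ζ∈ = step (uniformizeᶠ Φ w w h)
          where
            Goal : Set ℓ
            Goal = ∃ λ δ → δ ∈ w × ζ ∈ δ × Closed (P₂ Φ) δ
            step : (∃ λ m → ∀ ξ → ξ ∈ w → m · ξ ∈ w × P₂ Φ ξ (m · ξ)) → Goal
            step (m , m-spec) = step₂ (uniformizeᶠ (λ ξ η → ξ ∈ᶠ η ∧ᶠ (∀ᶠ λ γ → γ ∈ᶠ ξ ⇒ᶠ ! m ·ᶠ γ ∈ᶠ η)) w w bnd)
              where
                bnd : ∀ ξ → ξ ∈ w → ∃ λ η → η ∈ w × ξ ∈ η × (∀ γ → γ ∈ ξ → m · γ ∈ η)
                bnd ξ p = let δ , q , k = bounded {Img (λ γ → ! m ·ᶠ γ) ξ}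
                                (λ z r → let γ , s , e = Img⁻ r in ∈-congˡ (≈-sym e) (proj₁ (m-spec γ (proj₁ ord ξ p γ s))))
                                (ctb-Img (λ γ → ! m ·ᶠ γ) (elem p))
                              η , r , a , b = max-mem p q
                          in η , r , a , λ γ s → proj₁ (⊑-ord r) δ b _ (k _ (∈Img {λ γ → ! m ·ᶠ γ} s))
                step₂ : (∃ λ N → ∀ ξ → ξ ∈ w → N · ξ ∈ w × ξ ∈ N · ξ × (∀ γ → γ ∈ ξ → m · γ ∈ N · ξ)) → Goal
                step₂ (N , N-spec) = δ , mem Ord-δ ctb-δ , ζ∈δ , λ ξ p → suc∈ ξ p , m · ξ , m∈ ξ p , proj₂ (m-spec ξ (δ⊑ ξ p))
                  where
                    open Iteration ζ (λ ξ → N · ξ) (T₁ (λ ξ → ! N ·ᶠ ξ))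
                    it∈ : ∀ n → n ∈ ω → iter · n ∈ w
                    it∈ = ω-ind (λ n → ! iter ·ᶠ n ∈ᶠ ! w) (∈-congˡ (≈-sym iter-0) ζ∈)
                            (λ n p q → ∈-congˡ (≈-sym (iter-suc n p)) (proj₁ (N-spec _ q)))
                    it : Tm → Tm
                    it n = ! iter ·ᶠ n
                    δ : V
                    δ = ⋃ (Img it ω)
                    δ⁻ : ∀ {ξ} → ξ ∈ δ → ∃ λ n → n ∈ ω × ξ ∈ iter · n
                    δ⁻ p = let y , q , r = ⋃⁻ p; n , s , e = Img⁻ q in n , s , ∈-congʳ e r
                    δ⁺ : ∀ {ξ n} → n ∈ ω → ξ ∈ iter · n → ξ ∈ δ
                    δ⁺ p q = ⋃⁺ (∈Img {it} p) q
                    Ord-δ : Ord δ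
                    Ord-δ = Ord-⋃ λ α p → let n , q , e = Img⁻ p in Ord-resp (≈-sym e) (⊑-ord (it∈ n q))
                    ctb-δ : Ctb δ
                    ctb-δ = ctb-⋃Img it ≲-refl (λ n p → elem (it∈ n p))
                    δ⊑ : δ ⊑ w
                    δ⊑ ξ p = let n , q , r = δ⁻ p in proj₁ ord _ (it∈ n q) ξ r
                    up : ∀ n → n ∈ ω → iter · n ∈ iter · suc′ n
                    up n p = ∈-congʳ (≈-sym (iter-suc n p)) (proj₁ (proj₂ (N-spec _ (it∈ n p))))
                    ζ∈δ : ζ ∈ δ
                    ζ∈δ = δ⁺ (suc∈ω 0∈ω) (∈-congˡ iter-0 (up ∅ 0∈ω))
                    m∈ : ∀ ξ → ξ ∈ δ → m · ξ ∈ δ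
                    m∈ ξ p = let n , q , r = δ⁻ p in δ⁺ (suc∈ω q) (∈-congʳ (≈-sym (iter-suc n q)) (proj₂ (proj₂ (N-spec _ (it∈ n q))) ξ r))
                    suc∈ : ∀ ξ → ξ ∈ δ → suc′ ξ ∈ δ
                    suc∈ ξ p = let n , q , r = δ⁻ p in [ (λ e → δ⁺ (suc∈ω q) (∈-congˡ (≈-sym e) (up n q))) ,
                        (λ s → proj₁ Ord-δ (iter · suc′ n) (δ⁺ (suc∈ω (suc∈ω q)) (up _ (suc∈ω q))) _ (proj₁ (⊑-ord (it∈ _ (suc∈ω q))) _ (up n q) _ s)) ]′
                      (Ord-⊑ (Ord-suc (Ord-elem (⊑-ord (it∈ n q)) r)) (⊑-ord (it∈ n q)) (Ord-suc-⊑ (⊑-ord (it∈ n q)) r))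

      module Family (gch : GCH) (k : V) where
        open CH gch
        open Isω₁ ω₁-isω₁

        Fam : V → Set ℓ
        Fam z = (∀ s t x → s ∈ z → t ∈ z → x ∈ s → x ∈ t → s ≈ t) × (∀ s → s ∈ z → s ≲ k)
        Famᶠ : Tm → Fm
        Famᶠ z = (∀ᶠ λ s → ∀ᶠ λ t → ∀ᶠ λ x → s ∈ᶠ z ⇒ᶠ t ∈ᶠ z ⇒ᶠ x ∈ᶠ s ⇒ᶠ x ∈ᶠ t ⇒ᶠ s ≈ᶠ t) ∧ᶠ (∀ᶠ λ s → s ∈ᶠ z ⇒ᶠ s ≲ᶠ ! k)

        private
          Pat₀ : V
          Pat₀ = Sep Famᶠ (𝔽 (𝔽 ω₁))
        abstract
          Pat : V
          Pat = Pat₀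
          Pat-spec : ∀ π → π ∈ Pat ⇔ (π ∈ 𝔽 (𝔽 ω₁) × Fam π)
          Pat-spec π = Sep-spec Famᶠ

        Pat-supp : ∀ {π} → π ∈ Pat → ⋃ π ∈ 𝔽 ω₁
        Pat-supp p = let q = proj₁ (to (Pat-spec _) p); s , f = 𝔽⁻ q in
          𝔽⁺ (λ x r → let y , a , b = ⋃⁻ r in proj₁ (𝔽⁻ (s y a)) x b) (fin-⋃ f (λ y a → proj₂ (𝔽⁻ (s y a))))

        Fam-∅ : Fam ∅
        Fam-∅ = (λ s t x p → ⊥-elim (∅⁻ p)) , λ s p → ⊥-elim (∅⁻ p)
        ∅∈Pat : ∅ ∈ Pat
        ∅∈Pat = from (Pat-spec ∅) (𝔽⁺ (λ z p → ⊥-elim (∅⁻ p)) fin-∅ , Fam-∅)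

        -- The genericity that the recursion passes on: the members of `Σ` realised in every family
        -- with index in `e` cannot be blocked by a finite set of points. Stage `b` turns freeness
        -- for `e` into freeness for `e` together with `b`.
        Free : V → V → V → Set ℓ
        Free Σ e g = ∀ F → F ∈ 𝔽 ω₁ → ∃ λ π → π ∈ Σ × (∀ c → c ∈ e → π ⊑ g · c) × Disjoint (⋃ π) F
        Freeᶠ : Tm → Tm → Tm → Fm
        Freeᶠ Σ e g = ∀ᶠ λ F → F ∈ᶠ ! (𝔽 ω₁) ⇒ᶠ ∃ᶠ λ π → π ∈ᶠ Σ ∧ᶠ (∀ᶠ λ c → c ∈ᶠ e ⇒ᶠ π ⊑ᶠ g ·ᶠ c) ∧ᶠ Disjointᶠ (⋃ᶠ π) F

        private
          Pat≲ : Pat ≲ ω₁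
          Pat≲ = ≲-trans (≲-⊑ λ π p → proj₁ (to (Pat-spec π) p)) (𝔽≲ω₁ (𝔽≲ω₁ ≲-refl))
        abstract
          j : V
          j = proj₁ (ℂ≲ω₁ Pat≲)
          j-inj : Inj j (ℂ Pat) ω₁
          j-inj = proj₂ (ℂ≲ω₁ Pat≲)

        -- By CH, `j` numbers the countable sets of patterns by countable ordinals, and stage `b`
        -- attends to those numbered below `b`. Together with the finite sets `e` and the parts of
        -- `F` below `b` this makes countably many requests, which can be answered one after another
        -- by disjoint patterns.
        Spec : V → V → V → Set ℓ
        Spec b g z = Fam z × z ⊑ 𝒫 b × (∀ Σ e → Σ ∈ ℂ Pat → j · Σ ∈ b → ⋃ (⋃ Σ) ⊑ b → e ∈ 𝔽 b → Free Σ e g →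
          ∀ F → F ∈ 𝔽 ω₁ → ∃ λ π → π ∈ Σ × (∀ c → c ∈ e → π ⊑ g · c) × π ⊑ z × Disjoint (⋃ π) F)
        Specᶠ : Tm → Tm → Tm → Fm
        Specᶠ b g z = Famᶠ z ∧ᶠ z ⊑ᶠ 𝒫ᶠ b ∧ᶠ (∀ᶠ λ Σ → ∀ᶠ λ e → Σ ∈ᶠ ! (ℂ Pat) ⇒ᶠ ! j ·ᶠ Σ ∈ᶠ b ⇒ᶠ ⋃ᶠ (⋃ᶠ Σ) ⊑ᶠ b ⇒ᶠ e ∈ᶠ 𝔽ᶠ b ⇒ᶠ Freeᶠ Σ e g ⇒ᶠ
          ∀ᶠ λ F → F ∈ᶠ ! (𝔽 ω₁) ⇒ᶠ ∃ᶠ λ π → π ∈ᶠ Σ ∧ᶠ (∀ᶠ λ c → c ∈ᶠ e ⇒ᶠ π ⊑ᶠ g ·ᶠ c) ∧ᶠ π ⊑ᶠ z ∧ᶠ Disjointᶠ (⋃ᶠ π) F)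

        private
         module Step (b : V) (b∈ : b ∈ ω₁) (g : V) where
          Reqᶠ : Tm → Fm
          Reqᶠ r = ∃ᶠ λ Σ → ∃ᶠ λ e → ∃ᶠ λ F → r ≈ᶠ ⟨ Σ , ⟨ e , F ⟩ᶠ ⟩ᶠ ∧ᶠ ⋃ᶠ (⋃ᶠ Σ) ⊑ᶠ ! b ∧ᶠ Freeᶠ Σ e (! g)
          early : Tm → Fm
          early Σ = ! j ·ᶠ Σ ∈ᶠ ! b
          Req : V
          Req = Sep Reqᶠ (Sep early (ℂ Pat) ⊗ (𝔽 b ⊗ 𝔽 b))
          Req-ctb : Ctb Req
          Req-ctb = ctb-⊑ (λ z → Sep⊑ {Reqᶠ}) (ctb-⊗ (≲-trans (j , (λ Σ p → SepP {early} p) ,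
                       λ x y p q → proj₂ j-inj x y (Sep⊑ {early} p) (Sep⊑ {early} q)) (elem b∈)) (ctb-⊗ (ctb-𝔽 (elem b∈)) (ctb-𝔽 (elem b∈))))
          Meets : V → V → Set ℓ
          Meets r π = ∀ Σ e F → r ≈ ⟨ Σ , ⟨ e , F ⟩ ⟩ → π ∈ Σ × (∀ c → c ∈ e → π ⊑ g · c) × Disjoint (⋃ π) F
          Meetsᶠ : Tm → Tm → Fm
          Meetsᶠ r π = ∀ᶠ λ Σ → ∀ᶠ λ e → ∀ᶠ λ F → r ≈ᶠ ⟨ Σ , ⟨ e , F ⟩ᶠ ⟩ᶠ ⇒ᶠ π ∈ᶠ Σ ∧ᶠ (∀ᶠ λ c → c ∈ᶠ e ⇒ᶠ π ⊑ᶠ ! g ·ᶠ c) ∧ᶠ Disjointᶠ (⋃ᶠ π) F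
          Meets⁺ : ∀ {Σ e F π} → π ∈ Σ → (∀ c → c ∈ e → π ⊑ g · c) → Disjoint (⋃ π) F → Meets ⟨ Σ , ⟨ e , F ⟩ ⟩ π
          Meets⁺ p q r Σ e F h = ∈-congʳ (⟨⟩-fst h) p , (λ c s → q c (∈-congʳ (≈-sym (⟨⟩-fst (⟨⟩-snd h))) s)) ,
            λ x s t → r x s (∈-congʳ (≈-sym (⟨⟩-snd (⟨⟩-snd h))) t)

          module Build (c : V) (c-inj : Inj c Req ω) where
            Φ : V → V → V → Set ℓ
            Φ n h π = ⋃ π ⊑ b × (∀ m → m ∈ n → Disjoint (⋃ π) (⋃ (h · m))) × (∀ r → r ∈ Req → c · r ≈ n → Meets r π)
            Φᶠ : Tm → Tm → Tm → Fm
            Φᶠ n h π = ⋃ᶠ π ⊑ᶠ ! b ∧ᶠ (∀ᶠ λ m → m ∈ᶠ n ⇒ᶠ Disjointᶠ (⋃ᶠ π) (⋃ᶠ (h ·ᶠ m))) ∧ᶠ (∀ᶠ λ r → r ∈ᶠ ! Req ⇒ᶠ ! c ·ᶠ r ≈ᶠ n ⇒ᶠ Meetsᶠ r π)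
            used : V → V → V
            used n h = ⋃ (Img (λ m → ⋃ᶠ (! h ·ᶠ m)) n)
            used-fin : ∀ n h → n ∈ ω → (∀ m → m ∈ n → h · m ∈ Pat) → used n h ∈ 𝔽 ω₁
            used-fin n h p q = 𝔽⁺ (λ x r → let y , s , t = ⋃⁻ r; m , u , e = Img⁻ s in proj₁ (𝔽⁻ (Pat-supp (q m u))) x (∈-congʳ e t))
              (fin-⋃ (fin-onto (λ m → ⋃ᶠ (! h ·ᶠ m)) (λ y r → let m , u , e = Img⁻ r in m , u , ≈-sym e) (fin-nat p))
                     (λ y r → let m , u , e = Img⁻ r in fin-resp (≈-sym e) (proj₂ (𝔽⁻ (Pat-supp (q m u))))))
            used⁺ : ∀ {n h m x} → m ∈ n → x ∈ ⋃ (h · m) → x ∈ used n h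
            used⁺ {h = h} p q = ⋃⁺ (∈Img {λ m → ⋃ᶠ (! h ·ᶠ m)} p) q

            extend : ∀ n → n ∈ ω → ∀ h → (∀ m → m ∈ n → h · m ∈ Pat × Φ m (h ↾ m) (h · m)) → ∃ λ π → π ∈ Pat × Φ n h π
            extend n p h ih with em {∃ λ r → r ∈ Req × c · r ≈ n}
            -- Numbers that code no request contribute the empty pattern.
            ... | no none = ∅ , ∅∈Pat , (λ x q → ⊥-elim (⋃∅ q)) , (λ m q x r → ⊥-elim (⋃∅ r)) , λ r q e → ⊥-elim (none (r , q , e))
              where ⋃∅ : ∀ {x} → ¬ (x ∈ ⋃ ∅)
                    ⋃∅ q = let y , r , _ = ⋃⁻ q in ∅⁻ r
            ... | yes (r , q , e) = found (SepP {Reqᶠ} q)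
              where
                U = used n h
                found : P₁ Reqᶠ r → ∃ λ π → π ∈ Pat × Φ n h π
                found (Σ , d , F , re , sΣ , free) =
                  let u , v = ⊗⁻ (∈-congˡ re (Sep⊑ {Reqᶠ} q)); _ , vF = ⊗⁻ v
                      F∈ = 𝔽⁺ {ω₁} (λ x s → proj₁ ord b b∈ x (proj₁ (𝔽⁻ vF) x s)) (proj₂ (𝔽⁻ vF))
                      U∈ = used-fin n h p (λ m s → proj₁ (ih m s))
                      -- Avoiding `U`, the points used so far, keeps the union of all the patterns a
                      -- disjoint family.
                      π , π∈ , ok , dis = free (F ∪ U) (𝔽⁺ (λ x s → [ proj₁ (𝔽⁻ F∈) x , proj₁ (𝔽⁻ U∈) x ]′ (∪⁻ s)) (fin-∪ (proj₂ (𝔽⁻ F∈)) (proj₂ (𝔽⁻ U∈))))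
                  in π , proj₁ (ℂ⁻ (Sep⊑ {early} u)) π π∈ ,
                     (λ x s → let y , t , t′ = ⋃⁻ s in sΣ x (⋃⁺ (⋃⁺ π∈ t) t′)) ,
                     (λ m s x t t′ → dis x t (∪ʳ (used⁺ s t′))) ,
                     λ r′ q′ e′ Σ′ d′ F′ re′ → Meets⁺ π∈ ok (λ x s t → dis x s (∪ˡ t)) Σ′ d′ F′
                       (≈-trans (≈-sym re) (≈-trans (proj₂ c-inj r r′ q q′ (≈-trans e (≈-sym e′))) re′))

            module _ (h : V) (hs : ∀ n → n ∈ ω → h · n ∈ Pat × Φ n (h ↾ n) (h · n)) where
              hᶠ : Tm → Tm
              hᶠ n = ! h ·ᶠ n
              z : V
              z = ⋃ (Img hᶠ ω)
              z⁻ : ∀ {s} → s ∈ z → ∃ λ n → n ∈ ω × s ∈ h · n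
              z⁻ p = let y , q , r = ⋃⁻ p; n , t , e = Img⁻ q in n , t , ∈-congʳ e r
              apart : ∀ {m n s t x} → m ∈ ω → n ∈ ω → m ∈ n → s ∈ h · n → t ∈ h · m → x ∈ s → ¬ (x ∈ t)
              apart {m} p q r a b u v = proj₁ (proj₂ (proj₂ (hs _ q))) m r _ (⋃⁺ a u) (∈-congʳ (≈-cong ⋃ᶠ (≈-sym (↾-β r))) (⋃⁺ b v))
              fam : Fam z
              fam = (λ s t x p q u v → let n , a , c = z⁻ p; m , a′ , c′ = z⁻ q in
                       [ (λ r → ⊥-elim (apart a a′ r c′ c v u)) , [ (λ e → proj₁ (proj₂ (to (Pat-spec _) (proj₁ (hs n a)))) s t x c (∈-congʳ (·-congʳ (≈-sym e)) c′) u v) ,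
                         (λ r → ⊥-elim (apart a′ a r c c′ u v)) ]′ ]′ (Ord-cmp (Ord-nat n a) (Ord-nat m a′))) ,
                    λ s p → let n , a , c = z⁻ p in proj₂ (proj₂ (to (Pat-spec _) (proj₁ (hs n a)))) s c
              result : Spec b g z
              result = fam , (λ s p → let n , a , c = z⁻ p in 𝒫⁺ λ x q → proj₁ (proj₂ (hs n a)) x (⋃⁺ c q)) ,
                λ Σ e pΣ jΣ sΣ pe free F pF →
                  -- A pattern answering this request has all its points below `b`, so avoiding `Fb`
                  -- amounts to avoiding `F`; and there are only countably many such parts.
                  let Fb = F ∩ˢ b
                      r = ⟨ Σ , ⟨ e , Fb ⟩ ⟩
                      r∈ = ∈Sep {Reqᶠ} (⊗⁺ (∈Sep {early} pΣ jΣ) (⊗⁺ pe (𝔽⁺ (λ x s → proj₂ (∩⁻ s)) (fin-⊑ (λ x s → proj₁ (∩⁻ s)) (proj₂ (𝔽⁻ pF))))))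
                             (Σ , e , Fb , ≈-refl , sΣ , free)
                      n = c · r
                      n∈ = proj₁ c-inj r r∈
                      _ , sb , _ , meets = hs n n∈
                      a , a′ , a″ = meets r r∈ ≈-refl Σ e Fb ≈-refl
                  in h · n , a , a′ , (λ s q → ⋃⁺ (∈Img {hᶠ} n∈) q) , λ x q t → a″ x q (∩⁺ t (sb x q))

            built : ∃ λ z → Spec b g z
            built = let h , hs = successive Φᶠ Ord-ω Pat extend in _ , result h hs

          spec-ex : ∃ λ z → z ∈ 𝒫 (𝒫 b) × Spec b g z
          spec-ex = let z , s = Build.built (proj₁ Req-ctb) (proj₂ Req-ctb) in z , 𝒫⁺ (proj₁ (proj₂ s)) , s

        private
          fam-ex : ∃ λ f → ∀ b → b ∈ ω₁ → f · b ∈ 𝒫 (𝒫 ω₁) × Spec b (f ↾ b) (f · b)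
          fam-ex = successive Specᶠ Ord-ω₁ (𝒫 (𝒫 ω₁)) λ b p g _ → let z , q , s = Step.spec-ex b p g in
            z , 𝒫⁺ (λ x r → 𝒫⁺ λ y t → proj₁ ord b p y (𝒫⁻ (𝒫⁻ q x r) y t)) , s

        abstract
          𝓕 : V
          𝓕 = proj₁ fam-ex
          𝓕-spec : ∀ b → b ∈ ω₁ → Spec b (𝓕 ↾ b) (𝓕 · b)
          𝓕-spec b p = proj₂ (proj₂ fam-ex b p)
        𝓕-fam : ∀ {b} → b ∈ ω₁ → Fam (𝓕 · b)
        𝓕-fam p = proj₁ (𝓕-spec _ p)
        𝓕-⊑ : ∀ {b s} → b ∈ ω₁ → s ∈ 𝓕 · b → s ⊑ b
        𝓕-⊑ p q = 𝒫⁻ (proj₁ (proj₂ (𝓕-spec _ p)) _ q)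

        -- By induction on `e`, removing its largest element `b`: the rest lies below `b`, the
        -- induction hypothesis is the freeness that `Spec` asks for at stage `b`, and `Spec`
        -- returns it with `b` included. The bound `ξ` exceeds the number of `Σ` and all its points,
        -- so every stage from `ξ` on attends to `Σ`.
        𝓕-generic : ∀ {Σ} → Σ ∈ ℂ Pat → (∀ F → F ∈ 𝔽 ω₁ → ∃ λ π → π ∈ Σ × Disjoint (⋃ π) F) →
          ∃ λ ξ → ξ ∈ ω₁ × (∀ e → e ∈ 𝔽 ω₁ → (∀ b → b ∈ e → ¬ (b ∈ ξ)) →
            ∀ F → F ∈ 𝔽 ω₁ → ∃ λ π → π ∈ Σ × (∀ b → b ∈ e → π ⊑ 𝓕 · b) × Disjoint (⋃ π) F)
        𝓕-generic {Σ} pΣ un = let δ , δ∈ , h = bounded supp-⊑ supp-ctb; ξ , ξ∈ , u , v = max-mem (proj₁ j-inj Σ pΣ) δ∈ in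
            ξ , ξ∈ , from-ξ ξ ξ∈ u (λ x p → proj₁ (⊑-ord ξ∈) δ v x (h x p))
          where
            supp-⊑ : ⋃ (⋃ Σ) ⊑ ω₁
            supp-⊑ x p = let s , q , r = ⋃⁻ p; π , t , u = ⋃⁻ q in proj₁ (𝔽⁻ (Pat-supp (proj₁ (ℂ⁻ pΣ) π t))) x (⋃⁺ u r)
            supp-ctb : Ctb (⋃ (⋃ Σ))
            supp-ctb = ctb-⋃ (ctb-⋃ (proj₂ (ℂ⁻ pΣ)) λ π t → fin⇒ctb (proj₂ (𝔽⁻ (proj₁ (to (Pat-spec π) (proj₁ (ℂ⁻ pΣ) π t))))))
              λ s q → let π , t , u = ⋃⁻ q in fin⇒ctb (proj₂ (𝔽⁻ (proj₁ (𝔽⁻ (proj₁ (to (Pat-spec π) (proj₁ (ℂ⁻ pΣ) π t)))) s u)))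
            module _ (ξ : V) (ξ∈ : ξ ∈ ω₁) (jΣ∈ξ : j · Σ ∈ ξ) (supp∈ξ : ⋃ (⋃ Σ) ⊑ ξ) where
              Q : Tm → Fm
              Q e = e ⊑ᶠ ! ω₁ ⇒ᶠ (∀ᶠ λ b → b ∈ᶠ e ⇒ᶠ ¬ᶠ (b ∈ᶠ ! ξ)) ⇒ᶠ Freeᶠ (! Σ) e (! 𝓕)
              base : P₁ Q ∅
              base _ _ F p = let π , q , d = un F p in π , q , (λ c r → ⊥-elim (∅⁻ r)) , d
              remove-max : ∀ y → Finite y → y ⊑ ω₁ → ∀ b → b ∈ y → (∀ x → x ∈ y → x ∈ b ⊎ x ≈ b) → P₁ Q (y ∖ ⟪ b ⟫) → P₁ Q y
              step : ∀ y → Finite y → (∃ λ z → z ∈ y) → ∃ λ z → z ∈ y × (P₁ Q (y ∖ ⟪ z ⟫) → P₁ Q y)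
              step y fy (z , z∈) with em {y ⊑ ω₁}
              ... | no n = z , z∈ , λ _ s → ⊥-elim (n s)
              ... | yes s = let b , b∈ , mxb = fin-max fy (λ x p → ⊑-ord (s x p)) (z , z∈) in b , b∈ , remove-max y fy s b b∈ mxb
              remove-max y fy s b b∈ mxb ih _ h F pF =
                let b∈ω₁ = s b b∈
                    ξ⊑b = Ord-∉⇒⊑ (⊑-ord b∈ω₁) (⊑-ord ξ∈) (h b b∈)
                    e′ = y ∖ ⟪ b ⟫
                    below : e′ ⊑ b
                    below x p = [ (λ r → r) , (λ e → ⊥-elim (proj₂ (∖⁻ p) (⟪⟫⁺ e))) ]′ (mxb x (proj₁ (∖⁻ p)))
                    fr = ih (λ x p → s x (proj₁ (∖⁻ p))) (λ x p → h x (proj₁ (∖⁻ p)))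
                    fr′ : Free Σ e′ (𝓕 ↾ b)
                    fr′ F pF = let π , q , r , t = fr F pF in π , q , (λ c u v x → ∈-congʳ (≈-sym (↾-β (below c u))) (r c u v x)) , t
                    π , q , r , u , t = proj₂ (proj₂ (𝓕-spec b b∈ω₁)) Σ e′ pΣ (ξ⊑b _ jΣ∈ξ) (λ x p → ξ⊑b x (supp∈ξ x p))
                                          (𝔽⁺ below (fin-⊑ (λ x p → proj₁ (∖⁻ p)) fy)) fr′ F pF
                in π , q , (λ c p → case c p π r u below) , t
                where
                  case : ∀ c → c ∈ y → ∀ π → (∀ c → c ∈ y ∖ ⟪ b ⟫ → π ⊑ (𝓕 ↾ b) · c) → π ⊑ 𝓕 · b → (y ∖ ⟪ b ⟫ ⊑ b) → π ⊑ 𝓕 · c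
                  case c p π r u below with em {c ≈ b}
                  ... | yes e = λ x v → ∈-congʳ (·-congʳ (≈-sym e)) (u x v)
                  ... | no ne = let q = ∖⁺ p (λ v → ne (⟪⟫⁻ v)) in λ x v → ∈-congʳ (↾-β (below c q)) (r c q x v)
              from-ξ : ∀ e → e ∈ 𝔽 ω₁ → (∀ b → b ∈ e → ¬ (b ∈ ξ)) → ∀ F → F ∈ 𝔽 ω₁ → ∃ λ π → π ∈ Σ × (∀ b → b ∈ e → π ⊑ 𝓕 · b) × Disjoint (⋃ π) F
              from-ξ e p h = fin-rem Q base step e (proj₂ (𝔽⁻ p)) (proj₁ (𝔽⁻ p)) h

    open Families public

    -- Roots of sequences of finite sets, and amalgamation

    module Amalgamation where
      Img-fin : ∀ {A} (t : Tm → Tm) → Finite A → Finite (Img t A)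
      Img-fin t = fin-onto t λ y p → let x , q , e = Img⁻ p in x , q , ≈-sym e

      module Roots {w : V} (isω₁ : Isω₁ w) where
        open Isω₁ isω₁
        open ClosurePoints isω₁

        Xᶠ : V → Tm → Tm
        Xᶠ Y β = ! Y ·ᶠ β
        stage : V → V → V
        stage Y γ = ⋃ (Img (Xᶠ Y) γ)

        stage⁺ : ∀ {Y γ β x} → β ∈ γ → x ∈ Y · β → x ∈ stage Y γ
        stage⁺ {Y} p q = ⋃⁺ (∈Img {Xᶠ Y} p) q
        stage⁻ : ∀ {Y γ x} → x ∈ stage Y γ → ∃ λ β → β ∈ γ × x ∈ Y · β
        stage⁻ p = let y , q , r = ⋃⁻ p; β , s , e = Img⁻ q in β , s , ∈-congʳ e r

        fin-stage : ∀ {Y δ} → δ ∈ w → ∅ ∈ δ → (∀ ξ → ξ ∈ δ → suc′ ξ ∈ δ) → ∀ F → Finite F → F ⊑ stage Y δ →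
                    ∃ λ γ → γ ∈ δ × F ⊑ stage Y γ
        fin-stage {Y} {δ} δ∈ z∈ lim = fin-ind (λ F → F ⊑ᶠ ! (stage Y δ) ⇒ᶠ ∃ᶠ λ γ → γ ∈ᶠ ! δ ∧ᶠ ∀ᶠ λ x → x ∈ᶠ F ⇒ᶠ
            ∃ᶠ λ β → β ∈ᶠ γ ∧ᶠ x ∈ᶠ ! Y ·ᶠ β) (λ _ → ∅ , z∈ , λ x p → ⊥-elim (∅⁻ p)) step′ |> λ h F f s →
              let γ , p , k = h F f s in γ , p , λ x q → let β , r , t = k x q in stage⁺ r t
          where
            infixl 1 _|>_
            _|>_ : ∀ {a b} {A : Set a} {B : Set b} → A → (A → B) → B
            x |> f = f x
            St : V → V → Set ℓ
            St F γ = ∀ x → x ∈ F → ∃ λ β → β ∈ γ × x ∈ Y · β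
            step′ : ∀ y z → Finite y → (y ⊑ stage Y δ → ∃ λ γ → γ ∈ δ × St y γ) → y ∪ ⟪ z ⟫ ⊑ stage Y δ → ∃ λ γ → γ ∈ δ × St (y ∪ ⟪ z ⟫) γ
            step′ y z _ ih s = let γ , p , k = ih (λ x q → s x (∪ˡ q)); β , q , r = stage⁻ (s z (∪ʳ (⟪⟫⁺ ≈-refl))) in
              join γ p k β q r (Ord-cmp (Ord-elem (⊑-ord δ∈) p) (Ord-elem (⊑-ord δ∈) q))
              where
                join : ∀ γ → γ ∈ δ → St y γ → ∀ β → β ∈ δ → z ∈ Y · β → γ ∈ β ⊎ γ ≈ β ⊎ β ∈ γ → ∃ λ γ → γ ∈ δ × St (y ∪ ⟪ z ⟫) γ
                join γ p k β q r c = [ (λ l → go (suc′ β) (lim β q) (λ ε m → suc⁺′ (proj₁ (Ord-elem (⊑-ord δ∈) q) γ l ε m)) suc⁺) ,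
                    [ (λ e → go (suc′ γ) (lim γ p) (λ ε m → suc⁺′ m) (from (suc-spec _ _) (inj₂ (≈-sym e)))) , (λ l → go γ p (λ ε m → m) l) ]′ ]′ c
                  where
                    go : ∀ ε → ε ∈ δ → γ ⊑ ε → β ∈ ε → ∃ λ γ → γ ∈ δ × St (y ∪ ⟪ z ⟫) γ
                    go ε u v t = ε , u , λ x m → [ (λ m → let β′ , a , b = k x m in β′ , v β′ a , b) , (λ m → β , t , ∈-congˡ (≈-sym (⟪⟫⁻ m)) r) ]′ (∪⁻ m)

        stage-ctb : ∀ {Y γ} → (∀ β → β ∈ w → Ctb (Y · β)) → γ ∈ w → Ctb (stage Y γ)
        stage-ctb {Y} h p = ctb-⋃Img (Xᶠ Y) (elem p) λ β q → h β (proj₁ ord _ p β q)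

        Trace : V → V → V → V → Set ℓ
        Trace q Y γ r = ∀ x → x ∈ r ⇔ (x ∈ q · γ × ∃ λ β → β ∈ γ × x ∈ Y · β)

        -- A pressing-down argument, with closure points in place of a stationary set.
        root : ∀ q Y → (∀ γ → γ ∈ w → Finite (q · γ)) → (∀ β → β ∈ w → Ctb (Y · β)) →
               ∃ λ r → ∃ λ T → T ⊑ w × (∀ ζ → ζ ∈ w → ∃ λ γ → γ ∈ T × ζ ∈ γ) × (∀ γ → γ ∈ T → Trace q Y γ r)
        root q Y qf Yc = let r , h = root₀ in r , Sep (λ γ → Trᶠ γ (! r)) w , (λ γ → Sep⊑ {λ γ → Trᶠ γ (! r)}) ,
            (λ ζ p → let γ , p′ , l , t = h ζ p in γ , ∈Sep {λ γ → Trᶠ γ (! r)} p′ t , l) , (λ γ → SepP {λ γ → Trᶠ γ (! r)})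
          where
            Z = stage Y w
            Trᶠ : Tm → Tm → Fm
            Trᶠ γ r = ∀ᶠ λ x → x ∈ᶠ r ⇔ᶠ x ∈ᶠ ! q ·ᶠ γ ∧ᶠ ∃ᶠ λ β → β ∈ᶠ γ ∧ᶠ x ∈ᶠ ! Y ·ᶠ β
            Tr : V → V → Set ℓ
            Tr = Trace q Y
            trace : ∀ γ → Tr γ (q · γ ∩ˢ stage Y γ)
            trace γ x = mk⇔ (λ p → let a , b = ∩⁻ p in a , stage⁻ b) (λ (a , β , b , c) → ∩⁺ a (stage⁺ b c))
            Hit′ : V → V → Set ℓ
            Hit′ r ζ = ∀ γ → γ ∈ w → ζ ∈ γ → ¬ Tr γ r
            Hitᶠ : Tm → Tm → Fm
            Hitᶠ r ζ = ∀ᶠ λ γ → γ ∈ᶠ ! w ⇒ᶠ ζ ∈ᶠ γ ⇒ᶠ ¬ᶠ (Trᶠ γ r)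
            miss : ¬ (∃ λ r → ∀ ζ → ζ ∈ w → ∃ λ γ → γ ∈ w × ζ ∈ γ × Tr γ r) → ∀ r → ∃ λ ζ → ζ ∈ w × Hit′ r ζ
            miss none r = dne λ h → none (r , λ ζ p → dne λ k → h (ζ , p , λ γ p′ l t → k (γ , p′ , l , t)))
            root₀ : ∃ λ r → ∀ ζ → ζ ∈ w → ∃ λ γ → γ ∈ w × ζ ∈ γ × Tr γ r
            -- `ζ · r` bounds the indices whose trace is `r`. If `δ` is closed under `ζ` on the
            -- finite subsets of earlier stages, then the trace at `δ` is itself such a subset, by
            -- `fin-stage`, and occurs beyond its own bound.
            bad : (ζ : V) → (∀ r → r ∈ 𝔽 Z → ζ · r ∈ w × Hit′ r (ζ · r)) → ⊥
            bad ζ ζs = contra (closure Φᶠ bnd ∅ 0∈)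
              where
                Small : V → V → Set ℓ
                Small r ξ = ∀ x → x ∈ r → ∃ λ β → β ∈ ξ × x ∈ Y · β
                Φ : V → V → Set ℓ
                Φ ξ η = ∀ r → Small r ξ → Finite r → ζ · r ∈ η
                Φᶠ : Tm → Tm → Fm
                Φᶠ ξ η = ∀ᶠ λ r → (∀ᶠ λ x → x ∈ᶠ r ⇒ᶠ ∃ᶠ λ β → β ∈ᶠ ξ ∧ᶠ x ∈ᶠ ! Y ·ᶠ β) ⇒ᶠ Finiteᶠ r ⇒ᶠ ! ζ ·ᶠ r ∈ᶠ η
                ζᶠ : Tm → Tm
                ζᶠ r = ! ζ ·ᶠ r
                small : ∀ {r ξ} → ξ ∈ w → Small r ξ → Finite r → r ∈ 𝔽 Z
                small p s f = 𝔽⁺ (λ x v → let β , a , b = s x v in stage⁺ (proj₁ ord _ p β a) b) f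
                bnd : ∀ ξ → ξ ∈ w → ∃ λ η → η ∈ w × Φ ξ η
                bnd ξ p = let η , η∈ , k = bounded sub (ctb-Img ζᶠ (ctb-𝔽 (stage-ctb Yc p)))
                          in η , η∈ , λ r s f → k (ζ · r) (∈Img {ζᶠ} (𝔽⁺ (λ x v → let β , a , b = s x v in stage⁺ a b) f))
                  where
                    sub : Img ζᶠ (𝔽 (stage Y ξ)) ⊑ w
                    sub z t = let r , u , e = Img⁻ t; s , f = 𝔽⁻ u in
                      ∈-congˡ (≈-sym e) (proj₁ (ζs r (small p (λ x v → stage⁻ (s x v)) f)))
                contra : (∃ λ δ → δ ∈ w × ∅ ∈ δ × Closed Φ δ) → ⊥
                contra (δ , δ∈ , z∈ , cl) = at (fin-stage δ∈ z∈ (λ ξ p → proj₁ (cl ξ p)) r rf (λ x p → proj₂ (∩⁻ p)))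
                  where
                    r = q · δ ∩ˢ stage Y δ
                    rf : Finite r
                    rf = fin-⊑ (λ x p → proj₁ (∩⁻ p)) (qf δ δ∈)
                    at : (∃ λ γ → γ ∈ δ × r ⊑ stage Y γ) → ⊥
                    at (γ , γ∈ , s) =
                      let η , η∈ , k = proj₂ (cl γ γ∈)
                          r-small : Small r γ
                          r-small x p = stage⁻ (s x p)
                      in proj₂ (ζs r (small (proj₁ ord δ δ∈ γ γ∈) r-small rf)) δ δ∈
                           (proj₁ (⊑-ord δ∈) η η∈ (ζ · r) (k r r-small rf)) (trace δ)
            root₀ = dne λ none → let ζ , ζs = uniformizeᶠ Hitᶠ (𝔽 Z) w (λ r p → miss none r) in bad ζ ζs

      module Amalgam (gch : GCH) (k : V) where
        open Family gch k public
        open Isω₁ ω₁-isω₁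
        open ClosurePoints ω₁-isω₁

        -- The engine of both chain conditions. Below a suitable closure point `δ` the patterns of
        -- the indices in `T` form a countable set that no finite set blocks, since the pattern of
        -- `γ` lies above `γ`. By `𝓕-generic`, one of them is contained in all the families indexed
        -- by `e · γ′` as soon as `γ′` is large enough.
        amalgamate : ∀ T → T ⊑ ω₁ → (∀ γ → γ ∈ ω₁ → ∃ λ δ → δ ∈ T × γ ∈ δ) →
          (A : Tm → Tm → Fm) → (∀ γ → γ ∈ T → ∃ λ π → π ∈ Pat × Disjoint (⋃ π) γ × P₂ A γ π) →
          ∀ e → (∀ γ → γ ∈ T → e · γ ∈ 𝔽 ω₁ × Disjoint (e · γ) γ) → ∀ d → (∀ γ → γ ∈ ω₁ → d · γ ∈ ω₁) →
          ∃ λ γ → ∃ λ γ′ → γ ∈ T × γ′ ∈ T × γ ∈ γ′ × d · γ ∈ γ′ × ∃ λ π → P₂ A γ π × (∀ b → b ∈ e · γ′ → π ⊑ 𝓕 · b)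
        amalgamate T T⊑ unb A hA e he d hd = with-a (uniformizeᶠ (λ γ π → Disjointᶠ (⋃ᶠ π) γ ∧ᶠ rel₂ᶠ (P₂ A) (D₂ A) γ π) T Pat hA)
          where
            Goal : Set ℓ
            Goal = ∃ λ γ → ∃ λ γ′ → γ ∈ T × γ′ ∈ T × γ ∈ γ′ × d · γ ∈ γ′ × ∃ λ π → P₂ A γ π × (∀ b → b ∈ e · γ′ → π ⊑ 𝓕 · b)
            with-a : (∃ λ a → ∀ γ → γ ∈ T → a · γ ∈ Pat × Disjoint (⋃ (a · γ)) γ × P₂ A γ (a · γ)) → Goal
            with-a (a , ha) = with-δ (closure Φᶠ bnd ∅ 0∈)
              where
                Φᶠ : Tm → Tm → Fm
                Φᶠ ξ η = ∃ᶠ λ γ → γ ∈ᶠ ! T ∧ᶠ ξ ∈ᶠ γ ∧ᶠ γ ∈ᶠ η ∧ᶠ ⋃ᶠ (! a ·ᶠ γ) ⊑ᶠ η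
                Φ : V → V → Set ℓ
                Φ ξ η = ∃ λ γ → γ ∈ T × ξ ∈ γ × γ ∈ η × ⋃ (a · γ) ⊑ η
                bnd : ∀ ξ → ξ ∈ ω₁ → ∃ λ η → η ∈ ω₁ × Φ ξ η
                bnd ξ p = let γ , q , r = unb ξ p; s , f = 𝔽⁻ (Pat-supp (proj₁ (ha γ q))); δ , δ∈ , h = bounded s (fin⇒ctb f)
                              η , η∈ , u , v = max-mem (T⊑ γ q) δ∈
                          in η , η∈ , γ , q , r , u , λ x y → proj₁ (⊑-ord η∈) δ v x (h x y)
                with-δ : (∃ λ δ → δ ∈ ω₁ × ∅ ∈ δ × Closed Φ δ) → Goal
                with-δ (δ , δ∈ , z∈ , cl) = with-ξ (𝓕-generic Σ∈ untrapped)
                  where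
                    aᶠ : Tm → Tm
                    aᶠ γ = ! a ·ᶠ γ
                    Σ : V
                    Σ = Img aᶠ (T ∩ˢ δ)
                    Σ∈ : Σ ∈ ℂ Pat
                    Σ∈ = ℂ⁺ (λ π p → let γ , q , e = Img⁻ p in ∈-congˡ (≈-sym e) (proj₁ (ha γ (proj₁ (∩⁻ q)))))
                            (ctb-Img aᶠ (ctb-⊑ (λ x p → proj₂ (∩⁻ p)) (elem δ∈)))
                    fin-below : ∀ F → Finite F → F ⊑ δ → ∃ λ ξ → ξ ∈ δ × F ⊑ ξ
                    fin-below F f s with em {∃ λ x → x ∈ F}
                    ... | no n  = ∅ , z∈ , λ x p → ⊥-elim (n (x , p))
                    ... | yes n = let m , p , mx = fin-max f (λ x q → Ord-elem (⊑-ord δ∈) (s x q)) n in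
                          suc′ m , proj₁ (cl m (s m p)) , λ x q → from (suc-spec _ _) (mx x q)
                    untrapped : ∀ F → F ∈ 𝔽 ω₁ → ∃ λ π → π ∈ Σ × Disjoint (⋃ π) F
                    untrapped F pF =
                      let ξ , ξ∈ , below = fin-below (F ∩ˢ δ) (fin-⊑ (λ x q → proj₁ (∩⁻ q)) (proj₂ (𝔽⁻ pF))) (λ x q → proj₂ (∩⁻ q))
                          _ , η , η∈ , γ , γ∈T , ξ∈γ , γ∈η , sub = cl ξ ξ∈
                          γ∈δ = proj₁ (⊑-ord δ∈) η η∈ γ γ∈η
                          pγ = ha γ γ∈T
                      in a · γ , ∈Img {aᶠ} (∩⁺ γ∈T γ∈δ) , λ x q r → proj₁ (proj₂ pγ) x q
                           (proj₁ (⊑-ord (T⊑ γ γ∈T)) ξ ξ∈γ x (below x (∩⁺ r (proj₁ (⊑-ord δ∈) η η∈ x (sub x q)))))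
                    with-ξ : (∃ λ ξ → ξ ∈ ω₁ × (∀ e → e ∈ 𝔽 ω₁ → (∀ b → b ∈ e → ¬ (b ∈ ξ)) →
                                ∀ F → F ∈ 𝔽 ω₁ → ∃ λ π → π ∈ Σ × (∀ b → b ∈ e → π ⊑ 𝓕 · b) × Disjoint (⋃ π) F)) → Goal
                    -- `γ` is found only after `γ′` has been fixed, so `γ′` is made to exceed
                    -- `d · γ` for every `γ` below `δ`.
                    with-ξ (ξ , ξ∈ , gen) = with-ν (bounded {ξ ∪ δ ∪ Img dᶠ δ}
                        (λ x m → [ proj₁ ord ξ ξ∈ x , (λ m → [ proj₁ ord δ δ∈ x , (λ m → let γ , u , e = Img⁻ m in ∈-congˡ (≈-sym e) (hd γ (proj₁ ord δ δ∈ γ u))) ]′ (∪⁻ m)) ]′ (∪⁻ m))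
                        (ctb-∪ (elem ξ∈) (ctb-∪ (elem δ∈) (ctb-Img dᶠ (elem δ∈)))))
                      where
                        dᶠ : Tm → Tm
                        dᶠ γ = ! d ·ᶠ γ
                        with-ν : (∃ λ ν → ν ∈ ω₁ × (∀ x → x ∈ ξ ∪ δ ∪ Img dᶠ δ → x ∈ ν)) → Goal
                        with-ν (ν , ν∈ , below) = with-γ′ (unb ν ν∈)
                          where
                            with-γ′ : (∃ λ γ′ → γ′ ∈ T × ν ∈ γ′) → Goal
                            with-γ′ (γ′ , γ′∈T , l) = with-π (gen (e · γ′) (proj₁ (he γ′ γ′∈T)) (λ b p q → proj₂ (he γ′ γ′∈T) b p (up b (∪ˡ q)))
                                                               ∅ (𝔽⁺ (λ x p → ⊥-elim (∅⁻ p)) fin-∅))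
                              where
                                up : ξ ∪ δ ∪ Img dᶠ δ ⊑ γ′
                                up x m = proj₁ (⊑-ord (T⊑ γ′ γ′∈T)) ν l x (below x m)
                                with-π : (∃ λ π → π ∈ Σ × (∀ b → b ∈ e · γ′ → π ⊑ 𝓕 · b) × Disjoint (⋃ π) ∅) → Goal
                                with-π (π , q , r , _) = with-γ (Img⁻ q)
                                  where
                                    with-γ : (∃ λ γ → γ ∈ T ∩ˢ δ × π ≈ a · γ) → Goal
                                    with-γ (γ , m , e′) = γ , γ′ , proj₁ (∩⁻ m) , γ′∈T , up γ (∪ʳ (∪ˡ (proj₂ (∩⁻ m)))) ,
                                      up _ (∪ʳ (∪ʳ (∈Img {dᶠ} (proj₂ (∩⁻ m))))) ,
                                      a · γ , proj₂ (proj₂ (ha γ (proj₁ (∩⁻ m)))) , λ b p x s → r b p x (∈-congʳ (≈-sym e′) s)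

    open Amalgamation public

    -- Posets of finite cliques, and the chain condition of Q

    module CliquePosets where
      module Clique (U Γ : V) where
        private
          clᶠ : Tm → Fm
          clᶠ p = ∀ᶠ λ u → ∀ᶠ λ v → u ∈ᶠ p ⇒ᶠ v ∈ᶠ p ⇒ᶠ u ≈ᶠ v ∨ᶠ ⟨ u , v ⟩ᶠ ∈ᶠ ! Γ
          leᶠ : Tm → Fm
          leᶠ z = ∃ᶠ λ p → ∃ᶠ λ q → z ≈ᶠ ⟨ p , q ⟩ᶠ ∧ᶠ q ⊑ᶠ p
        IsClique : V → Set ℓ
        IsClique p = ∀ u v → u ∈ p → v ∈ p → u ≈ v ⊎ ⟨ u , v ⟩ ∈ Γ
        abstract
          Cl Le : V
          Cl = Sep clᶠ (𝔽 U)
          Le = Sep leᶠ (Sep clᶠ (𝔽 U) ⊗ Sep clᶠ (𝔽 U))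
          Cl-spec : ∀ p → p ∈ Cl ⇔ (p ∈ 𝔽 U × IsClique p)
          Cl-spec p = Sep-spec clᶠ
          Le-spec₀ : ∀ z → z ∈ Le ⇔ (z ∈ Cl ⊗ Cl × ∃ λ p → ∃ λ q → z ≈ ⟨ p , q ⟩ × q ⊑ p)
          Le-spec₀ z = Sep-spec leᶠ

        Le⁺ : ∀ {p q} → p ∈ Cl → q ∈ Cl → q ⊑ p → ⟨ p , q ⟩ ∈ Le
        Le⁺ a b s = from (Le-spec₀ _) (⊗⁺ a b , _ , _ , ≈-refl , s)
        Le⁻ : ∀ {p q} → ⟨ p , q ⟩ ∈ Le → p ∈ Cl × q ∈ Cl × q ⊑ p
        Le⁻ h = let a , p , q , e , s = to (Le-spec₀ _) h; u , v = ⊗⁻ a in u , v ,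
          λ x y → from (⟨⟩-fst e x) (s x (to (⟨⟩-snd e x) y))

        Cl-⊑U : ∀ {p} → p ∈ Cl → p ⊑ U
        Cl-⊑U h = proj₁ (𝔽⁻ (proj₁ (to (Cl-spec _) h)))
        Cl-fin : ∀ {p} → p ∈ Cl → Finite p
        Cl-fin h = proj₂ (𝔽⁻ (proj₁ (to (Cl-spec _) h)))
        Cl-clique : ∀ {p} → p ∈ Cl → IsClique p
        Cl-clique h = proj₂ (to (Cl-spec _) h)
        Cl⁺ : ∀ {p} → p ⊑ U → Finite p → IsClique p → p ∈ Cl
        Cl⁺ s f c = from (Cl-spec _) (𝔽⁺ s f , c)
        ∅∈Cl : ∅ ∈ Cl
        ∅∈Cl = Cl⁺ (λ x p → ⊥-elim (∅⁻ p)) fin-∅ (λ u v p → ⊥-elim (∅⁻ p))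
        Cl-sub : ∀ {p q} → q ⊑ p → p ∈ Cl → q ∈ Cl
        Cl-sub s h = Cl⁺ (λ x p → Cl-⊑U h x (s x p)) (fin-⊑ s (Cl-fin h)) (λ u v p q → Cl-clique h u v (s u p) (s v q))

        isPoset : IsPoset Cl Le
        isPoset = (∅ , ∅∈Cl) ,
          (λ z h → let a , _ = to (Le-spec₀ z) h; p , q , u , v , e = ⊗⁻′ a in p , q , u , v , from opair⇔ e) ,
          (λ p h → from ⟨⟩∈⇔ (Le⁺ h h (λ _ x → x))) ,
          (λ p q r h k → let a , b , s = Le⁻ (to ⟨⟩∈⇔ h); b′ , c , t = Le⁻ (to ⟨⟩∈⇔ k) in from ⟨⟩∈⇔ (Le⁺ a c (λ x y → s x (t x y)))) ,
          λ p q h k → ⊑-antisym (proj₂ (proj₂ (Le⁻ (to ⟨⟩∈⇔ k)))) (proj₂ (proj₂ (Le⁻ (to ⟨⟩∈⇔ h))))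

        ∪-Cl : (∀ u v → ⟨ u , v ⟩ ∈ Γ → ⟨ v , u ⟩ ∈ Γ) → ∀ {p q} → p ∈ Cl → q ∈ Cl →
               (∀ u v → u ∈ p → v ∈ q → u ≈ v ⊎ ⟨ u , v ⟩ ∈ Γ) → p ∪ q ∈ Cl
        ∪-Cl sm {p} {q} hp hq c = Cl⁺ (λ x m → [ Cl-⊑U hp x , Cl-⊑U hq x ]′ (∪⁻ m)) (fin-∪ (Cl-fin hp) (Cl-fin hq)) λ u v m n →
          [ (λ m → [ Cl-clique hp u v m , c u v m ]′ (∪⁻ n)) , (λ m → [ (λ n → [ (λ e → inj₁ (≈-sym e)) , (λ g → inj₂ (sm v u g)) ]′ (c v u n m)) , Cl-clique hq u v m ]′ (∪⁻ n)) ]′ (∪⁻ m)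

        compatible : ∀ {p q} → p ∈ Cl → q ∈ Cl → p ∪ q ∈ Cl → Compatible Le p q
        compatible hp hq h = _ , from ⟨⟩∈⇔ (Le⁺ h hp (λ x → ∪ˡ)) , from ⟨⟩∈⇔ (Le⁺ h hq (λ x → ∪ʳ))

        -- A form of the c.c.c. in which the second index can be made to exceed a bound `d · γ` that
        -- depends on the first; `thick` needs this freedom.
        SC : Set ℓ
        SC = ∀ q d → (∀ γ → γ ∈ ω₁ → q · γ ∈ Cl) → (∀ γ → γ ∈ ω₁ → d · γ ∈ ω₁) →
             ∃ λ γ → ∃ λ γ′ → γ ∈ ω₁ × γ′ ∈ ω₁ × γ ∈ γ′ × d · γ ∈ γ′ × q · γ ∪ q · γ′ ∈ Cl

        open Isω₁ ω₁-isω₁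

        -- An uncountable antichain could be listed without repetition along ω₁, and two of its
        -- members would be compatible.
        SC⇒CCC : SC → CCC Cl Le
        SC⇒CCC sc A A⊑ anti = ω , ω-isOmega , ≼-by (λ _ → ⇔-refl) (λ _ p → p) (dne λ n → enumerated (successive Φᶠ Ord-ω₁ A (pick n)))
          where
            Φᶠ : Tm → Tm → Tm → Fm
            Φᶠ γ h z = ∀ᶠ λ β → β ∈ᶠ γ ⇒ᶠ ¬ᶠ (h ·ᶠ β ≈ᶠ z)
            Φ : V → V → V → Set ℓ
            Φ γ h z = ∀ β → β ∈ γ → ¬ (h · β ≈ z)
            pick : ¬ Ctb A → ∀ γ → γ ∈ ω₁ → ∀ h → (∀ β → β ∈ γ → h · β ∈ A × Φ β (h ↾ β) (h · β)) → ∃ λ z → z ∈ A × Φ γ h z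
            pick n γ p h _ = dne λ k → n (ctb-⊑ (λ z q → dne λ m → k (z , q , λ β r e → m (∈-congˡ e (∈Img {λ β → ! h ·ᶠ β} r))))
                                             (ctb-Img (λ β → ! h ·ᶠ β) (elem p)))
            enumerated : (∃ λ h → ∀ γ → γ ∈ ω₁ → h · γ ∈ A × Φ γ (h ↾ γ) (h · γ)) → ⊥
            enumerated (h , hs) =
              let γ , γ′ , p , p′ , l , _ , c = sc h (lam ω₁ (λ γ → γ)) (λ γ p → A⊑ (proj₁ (hs γ p))) (λ γ p → ∈-congˡ (≈-sym (lam-β (λ γ → γ) p)) p)
              in anti _ _ (proj₁ (hs γ p)) (proj₁ (hs γ′ p′)) (λ e → proj₂ (hs γ′ p′) γ l (≈-trans (↾-β l) e))
                   (compatible (A⊑ (proj₁ (hs γ p))) (A⊑ (proj₁ (hs γ′ p′))) c)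

        isCCCPoset : SC → IsCCCPoset Cl Le
        isCCCPoset sc = isPoset , SC⇒CCC sc

        -- Some member of an ω₁-sequence of conditions forces that uncountably many members are in the generic filter.
        thick : SC → ∀ p → (∀ γ → γ ∈ ω₁ → p · γ ∈ Cl) → ∃ λ γ → γ ∈ ω₁ ×
                (∀ q → q ∈ Cl → p · γ ⊑ q → ∀ ζ → ζ ∈ ω₁ → ∃ λ γ′ → γ′ ∈ ω₁ × ζ ∈ γ′ × q ∪ p · γ′ ∈ Cl)
        thick sc p hp = dne λ n → with-a (uniformizeᶠ (λ γ q → ∃ᶠ λ ζ → ζ ∈ᶠ ! ω₁ ∧ᶠ Badᶠ γ q ζ) ω₁ Cl (bad n))
          where
            Bad : V → V → V → Set ℓ
            Bad γ q ζ = p · γ ⊑ q × (∀ γ′ → γ′ ∈ ω₁ → ζ ∈ γ′ → ¬ (q ∪ p · γ′ ∈ Cl))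
            Badᶠ : Tm → Tm → Tm → Fm
            Badᶠ γ q ζ = ! p ·ᶠ γ ⊑ᶠ q ∧ᶠ (∀ᶠ λ γ′ → γ′ ∈ᶠ ! ω₁ ⇒ᶠ ζ ∈ᶠ γ′ ⇒ᶠ ¬ᶠ ((q ∪ᶠ ! p ·ᶠ γ′) ∈ᶠ ! Cl))
            Good : V → Set ℓ
            Good γ = ∀ q → q ∈ Cl → p · γ ⊑ q → ∀ ζ → ζ ∈ ω₁ → ∃ λ γ′ → γ′ ∈ ω₁ × ζ ∈ γ′ × q ∪ p · γ′ ∈ Cl
            bad : ¬ (∃ λ γ → γ ∈ ω₁ × Good γ) → ∀ γ → γ ∈ ω₁ → ∃ λ q → q ∈ Cl × ∃ λ ζ → ζ ∈ ω₁ × Bad γ q ζ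
            bad n γ pγ = dne λ k → n (γ , pγ , λ q q∈ s ζ ζ∈ → dne λ m → k (q , q∈ , ζ , ζ∈ , s , λ γ′ r l c → m (γ′ , r , l , c)))
            with-a : (∃ λ a → ∀ γ → γ ∈ ω₁ → a · γ ∈ Cl × ∃ λ ζ → ζ ∈ ω₁ × Bad γ (a · γ) ζ) → ⊥
            with-a (a , ha) = with-d (uniformizeᶠ (λ γ ζ → Badᶠ γ (! a ·ᶠ γ) ζ) ω₁ ω₁ (λ γ p → proj₂ (ha γ p)))
              where
                with-d : (∃ λ d → ∀ γ → γ ∈ ω₁ → d · γ ∈ ω₁ × Bad γ (a · γ) (d · γ)) → ⊥
                with-d (d , hd) = contra (sc a d (λ γ p → proj₁ (ha γ p)) (λ γ p → proj₁ (hd γ p)))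
                  where
                    contra : (∃ λ γ → ∃ λ γ′ → γ ∈ ω₁ × γ′ ∈ ω₁ × γ ∈ γ′ × d · γ ∈ γ′ × a · γ ∪ a · γ′ ∈ Cl) → ⊥
                    -- `a · γ` was chosen incompatible with every `p · γ′` beyond `d · γ`, but it is
                    -- compatible with `a · γ′`, which contains `p · γ′`.
                    contra (γ , γ′ , r , r′ , _ , l , c) = proj₂ (proj₂ (hd γ r)) γ′ r′ l
                      (Cl-sub (λ x m → [ ∪ˡ , (λ m → ∪ʳ (proj₁ (proj₂ (hd γ′ r′)) x m)) ]′ (∪⁻ m)) c)

      module QGraph (gch : GCH) (k : V) (k≉∅ : ¬ Empty k) where
        open Amalgam gch k
        open Isω₁ ω₁-isω₁
        open Roots ω₁-isω₁ using (root; Trace)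

        private
          edgeᶠ : Tm → Tm → Fm
          edgeᶠ u v = ¬ᶠ (fstᶠ u ≈ᶠ fstᶠ v) ∧ᶠ (sndᶠ u ≈ᶠ sndᶠ v ⇒ᶠ
            (fstᶠ u ∈ᶠ fstᶠ v ⇒ᶠ ⟪ fstᶠ u ⟫ᶠ ∈ᶠ ! 𝓕 ·ᶠ fstᶠ v) ∧ᶠ (fstᶠ v ∈ᶠ fstᶠ u ⇒ᶠ ⟪ fstᶠ v ⟫ᶠ ∈ᶠ ! 𝓕 ·ᶠ fstᶠ u))
          gᶠ : Tm → Fm
          gᶠ z = edgeᶠ (fstᶠ z) (sndᶠ z)
        Edge : V → V → Set ℓ
        Edge u v = ¬ (fst u ≈ fst v) × (snd u ≈ snd v → (fst u ∈ fst v → ⟪ fst u ⟫ ∈ 𝓕 · fst v) × (fst v ∈ fst u → ⟪ fst v ⟫ ∈ 𝓕 · fst u))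
        UQ : V
        UQ = ω₁ ⊗ ω
        abstract
          ΓQ : V
          ΓQ = Sep gᶠ (UQ ⊗ UQ)
          ΓQ-spec : ∀ z → z ∈ ΓQ ⇔ (z ∈ UQ ⊗ UQ × Edge (fst z) (snd z))
          ΓQ-spec z = Sep-spec gᶠ
        Edge-resp : ∀ {u v u′ v′} → u ≈ u′ → v ≈ v′ → Edge u v → Edge u′ v′
        Edge-resp {v = v} {u′} e f h = ≈-subst (λ v → edgeᶠ (! u′) v) f (≈-subst (λ u → edgeᶠ u (! v)) e h)
        ΓQ⁺ : ∀ {u v} → u ∈ UQ → v ∈ UQ → Edge u v → ⟨ u , v ⟩ ∈ ΓQ
        ΓQ⁺ a b h = from (ΓQ-spec _) (⊗⁺ a b , Edge-resp (≈-sym fst-β) (≈-sym snd-β) h)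
        ΓQ⁻ : ∀ {u v} → ⟨ u , v ⟩ ∈ ΓQ → u ∈ UQ × v ∈ UQ × Edge u v
        ΓQ⁻ h = let a , b = to (ΓQ-spec _) h; u , v = ⊗⁻ a in u , v , Edge-resp fst-β snd-β b
        ΓQ-sym : ∀ u v → ⟨ u , v ⟩ ∈ ΓQ → ⟨ v , u ⟩ ∈ ΓQ
        ΓQ-sym u v h = let a , b , n , c = ΓQ⁻ h in ΓQ⁺ b a ((λ e → n (≈-sym e)) , λ e → let p , q = c (≈-sym e) in q , p)

        open Clique UQ ΓQ public

        fst-UQ : ∀ {u} → u ∈ UQ → fst u ∈ ω₁
        fst-UQ h = let x , y , a , b , e = ⊗⁻′ h in ∈-congˡ (≈-sym (≈-trans (≈-cong fstᶠ e) fst-β)) a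

        private
          singᶠ : Tm → Tm
          singᶠ u = ⟪ fstᶠ u ⟫ᶠ
          dom : V → V
          dom = Img fstᶠ
          abstract
            dom-T : T 1 (λ ρ → dom (proj₁ ρ))
            dom-T = T₁-by dom (λ y A → ∃ᶠ λ x → x ∈ᶠ A ∧ᶠ y ≈ᶠ fstᶠ x) (λ y A → Img-spec fstᶠ)
          domᶠ : Tm → Tm
          domᶠ = fn₁ᶠ dom dom-T

        -- With these stages `Y`, every vertex outside the root has its ordinal at or above the
        -- index. The pattern of `γ` consists of the singletons of the new ordinals of `q · γ`, and
        -- `e · γ′` of the new ordinals of `q · γ′`. After amalgamation the new vertices of the two
        -- conditions are joined to each other, whatever their second coordinates.
        sc : SC
        sc q d hq hd = from-root (uniformizeᶠ (λ γ η → ! d ·ᶠ γ ∈ᶠ η ∧ᶠ (∀ᶠ λ u → u ∈ᶠ ! q ·ᶠ γ ⇒ᶠ fstᶠ u ∈ᶠ η)) ω₁ ω₁ big) (root q Y (λ γ p → Cl-fin (hq γ p)) λ β p → ≲-cong (≈-sym (Yβ p)) ≈-refl (ctb-⊗ (fin⇒ctb fin-⟪⟫) ≲-refl))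
          where
            yᶠ : Tm → Tm
            yᶠ β = ⟪ β ⟫ᶠ ⊗ᶠ ! ω
            Y : V
            Y = lam ω₁ yᶠ
            Yβ : ∀ {β} → β ∈ ω₁ → Y · β ≈ ⟪ β ⟫ ⊗ ω
            Yβ = lam-β yᶠ
            Goal : Set ℓ
            Goal = ∃ λ γ → ∃ λ γ′ → γ ∈ ω₁ × γ′ ∈ ω₁ × γ ∈ γ′ × d · γ ∈ γ′ × q · γ ∪ q · γ′ ∈ Cl
            -- `d′` will dominate both `d` and the ordinals of `q · γ`; this puts all ordinals of
            -- the smaller condition below those that are new in the larger one.
            big : ∀ γ → γ ∈ ω₁ → ∃ λ η → η ∈ ω₁ × d · γ ∈ η × (∀ u → u ∈ q · γ → fst u ∈ η)
            big γ p = let δ , δ∈ , h = bounded {Img fstᶠ (q · γ)} (λ x m → let u , a , f = Img⁻ m in ∈-congˡ (≈-sym f) (fst-UQ (Cl-⊑U (hq γ p) u a)))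
                                         (ctb-Img fstᶠ (fin⇒ctb (Cl-fin (hq γ p))))
                          η , η∈ , a , b = max-mem (hd γ p) δ∈
                      in η , η∈ , a , λ u m → proj₁ (⊑-ord η∈) δ b _ (h _ (∈Img {fstᶠ} m))
            from-root : (∃ λ d′ → ∀ γ → γ ∈ ω₁ → d′ · γ ∈ ω₁ × d · γ ∈ d′ · γ × (∀ u → u ∈ q · γ → fst u ∈ d′ · γ)) → (∃ λ r → ∃ λ T → T ⊑ ω₁ × (∀ ζ → ζ ∈ ω₁ → ∃ λ γ → γ ∈ T × ζ ∈ γ) × (∀ γ → γ ∈ T → Trace q Y γ r)) → Goal
            from-root (d′ , hd′) (r , T , T⊑ , unb , tr) = finish (amalgamate T T⊑ unb Aᶠ hA e he d′ (λ γ p → proj₁ (hd′ γ p)))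
              where
                Aᶠ : Tm → Tm → Fm
                Aᶠ γ π = ∀ᶠ λ u → u ∈ᶠ ! q ·ᶠ γ ⇒ᶠ ¬ᶠ (u ∈ᶠ ! r) ⇒ᶠ ⟪ fstᶠ u ⟫ᶠ ∈ᶠ π
                A : V → V → Set ℓ
                A γ π = ∀ u → u ∈ q · γ → ¬ (u ∈ r) → ⟪ fst u ⟫ ∈ π
                eᶠ : Tm → Tm
                eᶠ γ = domᶠ ((! q ·ᶠ γ) ∖ᶠ ! r)
                e = lam ω₁ eᶠ
                in-stage : ∀ {γ u} → u ∈ UQ → fst u ∈ γ → γ ∈ ω₁ → ∃ λ β → β ∈ γ × u ∈ Y · β
                in-stage h p pγ = let x , y , a , b , f = ⊗⁻′ h in _ , p , ∈-congʳ (≈-sym (Yβ (proj₁ ord _ pγ _ p)))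
                  (∈-congˡ (≈-sym f) (⊗⁺ (⟪⟫⁺ (≈-trans (≈-sym fst-β) (≈-cong fstᶠ (≈-sym f)))) b))
                new : ∀ {γ u} → γ ∈ T → u ∈ q · γ → ¬ (u ∈ r) → ¬ (fst u ∈ γ)
                new p m n l = n (from (tr _ p _) (m , in-stage (Cl-⊑U (hq _ (T⊑ _ p)) _ m) l (T⊑ _ p)))
                hA : ∀ γ → γ ∈ T → ∃ λ π → π ∈ Pat × Disjoint (⋃ π) γ × A γ π
                hA γ p = π , from (Pat-spec π) (𝔽⁺ (λ s m → let u , n , f = Img⁻ m in
                       ∈-congˡ (≈-sym f) (𝔽⁺ (λ x l → ∈-congˡ (≈-sym (⟪⟫⁻ l)) (fst-UQ (Cl-⊑U (hq γ (T⊑ γ p)) u (proj₁ (∖⁻ n))))) fin-⟪⟫))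
                     (Img-fin singᶠ (fin-⊑ (λ x m → proj₁ (∖⁻ m)) (Cl-fin (hq γ (T⊑ γ p))))) , fam) ,
                    (λ x m l → let s , a , b = ⋃⁻ m; u , n , f = Img⁻ a; a′ , b′ = ∖⁻ n in
                       new p a′ b′ (∈-congˡ (⟪⟫⁻ (∈-congʳ f b)) l)) ,
                    λ u m n → ∈Img {singᶠ} (∖⁺ m n)
                  where
                    π = Img singᶠ (q · γ ∖ r)
                    fam : Fam π
                    fam = (λ s t x a b c d → let u , _ , f = Img⁻ a; v , _ , g = Img⁻ b in
                            ≈-trans f (≈-trans (≈-cong ⟪_⟫ᶠ (≈-trans (≈-sym (⟪⟫⁻ (∈-congʳ f c))) (⟪⟫⁻ (∈-congʳ g d)))) (≈-sym g))) ,
                          λ s a → let u , _ , f = Img⁻ a; z , z∈ = dne {∃ λ z → z ∈ k} (λ n → k≉∅ λ z p → n (z , p)) in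
                            ≲-cong (≈-sym f) ≈-refl (≲-by (λ _ → ! z) (λ _ _ → z∈) λ x y p q _ → ≈-trans (⟪⟫⁻ p) (≈-sym (⟪⟫⁻ q)))
                he : ∀ γ → γ ∈ T → e · γ ∈ 𝔽 ω₁ × Disjoint (e · γ) γ
                he γ p = 𝔽⁺ (λ x m → let u , a , _ , f = member x m in ∈-congˡ (≈-sym f) (fst-UQ (Cl-⊑U (hq γ (T⊑ γ p)) u a)))
                            (fin-resp (≈-sym eγ) (Img-fin fstᶠ (fin-⊑ (λ x m → proj₁ (∖⁻ m)) (Cl-fin (hq γ (T⊑ γ p)))))) ,
                         λ x m l → let u , a , b , f = member x m in new p a b (∈-congˡ f l)
                  where
                    eγ : e · γ ≈ dom (q · γ ∖ r)
                    eγ = lam-β eᶠ (T⊑ γ p)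
                    member : ∀ x → x ∈ e · γ → ∃ λ u → u ∈ q · γ × ¬ (u ∈ r) × x ≈ fst u
                    member x m = let u , n , f = Img⁻ (∈-congʳ eγ m); a , b = ∖⁻ n in u , a , b , f
                finish : (∃ λ γ → ∃ λ γ′ → γ ∈ T × γ′ ∈ T × γ ∈ γ′ × d′ · γ ∈ γ′ × ∃ λ π → A γ π × (∀ b → b ∈ e · γ′ → π ⊑ 𝓕 · b)) → Goal
                finish (γ , γ′ , p , p′ , l , l′ , π , a , g) =
                    γ , γ′ , T⊑ γ p , T⊑ γ′ p′ , l , up _ (proj₁ (proj₂ (hd′ γ (T⊑ γ p)))) , ∪-Cl ΓQ-sym (hq γ (T⊑ γ p)) (hq γ′ (T⊑ γ′ p′)) cross
                  where
                    up : ∀ x → x ∈ d′ · γ → x ∈ γ′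
                    up = proj₁ (⊑-ord (T⊑ γ′ p′)) _ l′
                    Q = Cl-⊑U (hq γ (T⊑ γ p))
                    Q′ = Cl-⊑U (hq γ′ (T⊑ γ′ p′))
                    cross : ∀ u v → u ∈ q · γ → v ∈ q · γ′ → u ≈ v ⊎ ⟨ u , v ⟩ ∈ ΓQ
                    cross u v m n with em {u ∈ r} | em {v ∈ r}
                    ... | yes i | _ = Cl-clique (hq γ′ (T⊑ γ′ p′)) u v (proj₁ (to (tr γ′ p′ u) i)) n
                    ... | no _ | yes i = Cl-clique (hq γ (T⊑ γ p)) u v m (proj₁ (to (tr γ p v) i))
                    ... | no i | no i′ = inj₂ (ΓQ⁺ (Q u m) (Q′ v n) ((λ f → ∈-irrefl′ f u∈v) , λ _ →
                            (λ _ → g (fst v) v∈e _ (a u m i)) , λ h → ⊥-elim (∈-asym h u∈v)))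
                      where
                        v≥ : ¬ (fst v ∈ γ′)
                        v≥ = new p′ n i′
                        u∈v : fst u ∈ fst v
                        u∈v = Ord-∉⇒⊑ (⊑-ord (fst-UQ (Q′ v n))) (⊑-ord (T⊑ γ′ p′)) v≥ _ (up _ (proj₂ (proj₂ (hd′ γ (T⊑ γ p))) u m))
                        v∈e : fst v ∈ e · γ′
                        v∈e = ∈-congʳ (≈-sym (lam-β eᶠ (T⊑ γ′ p′))) (∈Img {fstᶠ} (∖⁺ n i′))

    open CliquePosets public

    -- Triples, supplies of rows, and separation by saturated sets

    module Forests where
      module Edges (gch : GCH) (k : V) where
        open Amalgam gch k public
        open CH gch
        open Isω₁ ω₁-isω₁

        -- ⟨ ⟨ s , t ⟩ , b ⟩: the set s ∪ t is an edge, and whichever single point of it is dropped,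
        -- one of the disjoint k-element sets s and t survives.
        S₁ S₂ B pts : V → V
        S₁ d = fst (fst d)
        S₂ d = snd (fst d)
        B d  = snd d
        pts d = S₁ d ∪ S₂ d
        S₁ᶠ S₂ᶠ Bᶠ ptsᶠ : Tm → Tm
        S₁ᶠ d = fstᶠ (fstᶠ d)
        S₂ᶠ d = sndᶠ (fstᶠ d)
        Bᶠ d  = sndᶠ d
        ptsᶠ d = S₁ᶠ d ∪ᶠ S₂ᶠ d

        private
          IsDatum : V → Set ℓ
          IsDatum d = Disjoint (S₁ d) (S₂ d) × (S₁ d ≲ k × k ≲ S₁ d) × (S₂ d ≲ k × k ≲ S₂ d)
          datᶠ : Tm → Fm
          datᶠ d = Disjointᶠ (S₁ᶠ d) (S₂ᶠ d) ∧ᶠ (S₁ᶠ d ≲ᶠ ! k ∧ᶠ ! k ≲ᶠ S₁ᶠ d) ∧ᶠ (S₂ᶠ d ≲ᶠ ! k ∧ᶠ ! k ≲ᶠ S₂ᶠ d)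
          Base : V
          Base = (𝔽 ω₁ ⊗ 𝔽 ω₁) ⊗ ω₁
        abstract
          Data : V
          Data = Sep datᶠ Base
          Data-spec : ∀ d → d ∈ Data ⇔ (d ∈ Base × IsDatum d)
          Data-spec d = Sep-spec datᶠ

        Data⁺ : ∀ {s t b} → s ∈ 𝔽 ω₁ → t ∈ 𝔽 ω₁ → b ∈ ω₁ → Disjoint s t → s ≲ k × k ≲ s → t ≲ k × k ≲ t → ⟨ ⟨ s , t ⟩ , b ⟩ ∈ Data
        Data⁺ {s} {t} {b} p q r dis (a , a′) (c , c′) = from (Data-spec _) (⊗⁺ (⊗⁺ p q) r , (λ x m n → dis x (to (e₁ x) m) (to (e₂ x) n)) ,
            (≲-cong (≈-sym e₁) ≈-refl a , ≲-cong ≈-refl (≈-sym e₁) a′) , (≲-cong (≈-sym e₂) ≈-refl c , ≲-cong ≈-refl (≈-sym e₂) c′))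
          where
            e₁ : S₁ ⟨ ⟨ s , t ⟩ , b ⟩ ≈ s
            e₁ = ≈-trans (≈-cong fstᶠ fst-β) fst-β
            e₂ : S₂ ⟨ ⟨ s , t ⟩ , b ⟩ ≈ t
            e₂ = ≈-trans (≈-cong sndᶠ fst-β) snd-β
        module _ {d : V} (p : d ∈ Data) where
          private
            form : ∃ λ s → ∃ λ t → s ∈ 𝔽 ω₁ × t ∈ 𝔽 ω₁ × fst d ≈ ⟨ s , t ⟩ × B d ∈ ω₁
            form = let x , b , q , r , e = ⊗⁻′ (proj₁ (to (Data-spec d) p)); s , t , u , v , f = ⊗⁻′ q in
              s , t , u , v , ≈-trans (≈-cong fstᶠ e) (≈-trans fst-β f) , ∈-congˡ (≈-sym (≈-trans (≈-cong sndᶠ e) snd-β)) r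
          S₁∈ : S₁ d ∈ 𝔽 ω₁
          S₁∈ = let s , t , u , v , e , _ = form in ∈-congˡ (≈-sym (≈-trans (≈-cong fstᶠ e) fst-β)) u
          S₂∈ : S₂ d ∈ 𝔽 ω₁
          S₂∈ = let s , t , u , v , e , _ = form in ∈-congˡ (≈-sym (≈-trans (≈-cong sndᶠ e) snd-β)) v
          B∈ : B d ∈ ω₁
          B∈ = let s , t , u , v , e , b = form in b
          S-disjoint : Disjoint (S₁ d) (S₂ d)
          S-disjoint = proj₁ (proj₂ (to (Data-spec d) p))
          S₁-size : S₁ d ≲ k × k ≲ S₁ d
          S₁-size = proj₁ (proj₂ (proj₂ (to (Data-spec d) p)))
          S₂-size : S₂ d ≲ k × k ≲ S₂ d
          S₂-size = proj₂ (proj₂ (proj₂ (to (Data-spec d) p)))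
          pts-⊑ : pts d ⊑ ω₁
          pts-⊑ x m = [ proj₁ (𝔽⁻ S₁∈) x , proj₁ (𝔽⁻ S₂∈) x ]′ (∪⁻ m)
          pts-fin : Finite (pts d)
          pts-fin = fin-∪ (proj₂ (𝔽⁻ S₁∈)) (proj₂ (𝔽⁻ S₂∈))

        -- A Kuratowski pair of countable ordinals is a finite set of finite sets, so the product
        -- embeds into `𝔽 (𝔽 ω₁)`.
        ⊗≲ω₁ : ∀ {A C} → A ≲ ω₁ → C ≲ ω₁ → A ⊗ C ≲ ω₁
        ⊗≲ω₁ a c = ≲-trans (≲-⊗ a c) (≲-trans (≲-⊑ λ z p → let x , y , q , r , e = ⊗⁻′ p in ∈-congˡ (≈-sym e)
          (𝔽⁺ {𝔽 ω₁} (λ w m → [ (λ f → ∈-congˡ (≈-sym f) (𝔽⁺ (λ u n → ∈-congˡ (≈-sym (⟪⟫⁻ n)) q) fin-⟪⟫)) ,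
                               (λ f → ∈-congˡ (≈-sym f) (𝔽⁺ (λ u n → [ (λ g → ∈-congˡ (≈-sym g) q) , (λ g → ∈-congˡ (≈-sym g) r) ]′ (pair⁻ n)) fin-pair)) ]′
                              (to (⟨,⟩-spec x y w) m))
             (fin-⊑ (λ w m → from (pair-spec _ _ _) (to (⟨,⟩-spec x y w) m)) (fin-pair {⟪ x ⟫} {pair x y})))) (𝔽≲ω₁ (𝔽≲ω₁ ≲-refl)))

        Data≲ω₁ : Data ≲ ω₁
        Data≲ω₁ = ≲-trans (≲-⊑ λ d p → proj₁ (to (Data-spec d) p)) (⊗≲ω₁ (⊗≲ω₁ (𝔽≲ω₁ ≲-refl) (𝔽≲ω₁ ≲-refl)) ≲-refl)

        -- Subsets of Data, each repeated once for every subset of ω₁, are indexed by ordinals below ω₂.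
        𝟙 : V
        𝟙 = suc′ ∅
        𝟙≉∅ : ¬ (𝟙 ≈ ∅)
        𝟙≉∅ = suc≉∅
        J : V
        J = ⟪ ∅ ⟫ ⊗ Data ∪ ⟪ 𝟙 ⟫ ⊗ ω₁
        private
          J≲ω₁ : J ≲ ω₁
          J≲ω₁ = ≲-trans (≲-by (λ x → x) sub (λ _ _ _ _ e → e)) (⊗≲ω₁ {pair ∅ 𝟙} (≲-trans (fin⇒ctb fin-pair) (≲-⊑ ω⊑))
                    (≲-trans (cup Data≲ω₁ ≲-refl) (≲-trans (≲-refl) (⊗≲ω₁ {ω} (≲-⊑ ω⊑) ≲-refl))))
            where
              sub : ∀ x → x ∈ J → x ∈ pair ∅ 𝟙 ⊗ (Data ∪ ω₁)
              sub x m = [ (λ m → let a , b , p , q , e = ⊗⁻′ m in ∈-congˡ (≈-sym e) (⊗⁺ (∈-congˡ (≈-sym (⟪⟫⁻ p)) pairˡ) (∪ˡ q))) ,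
                          (λ m → let a , b , p , q , e = ⊗⁻′ m in ∈-congˡ (≈-sym e) (⊗⁺ (∈-congˡ (≈-sym (⟪⟫⁻ p)) pairʳ) (∪ʳ q))) ]′ (∪⁻ m)
              cup : ∀ {A C} → A ≲ ω₁ → C ≲ ω₁ → A ∪ C ≲ ω ⊗ ω₁
              cup {A} {C} (f , fm , fi) (g , gm , gi) = ≲-rel
                  (λ x z → (x ∈ᶠ ! A ∧ᶠ z ≈ᶠ ⟨ ! ∅ , ! f ·ᶠ x ⟩ᶠ) ∨ᶠ (¬ᶠ (x ∈ᶠ ! A) ∧ᶠ z ≈ᶠ ⟨ ! 𝟙 , ! g ·ᶠ x ⟩ᶠ)) tot inj
                where
                  R : V → V → Set ℓ
                  R x z = (x ∈ A × z ≈ ⟨ ∅ , f · x ⟩) ⊎ (¬ (x ∈ A) × z ≈ ⟨ 𝟙 , g · x ⟩)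
                  inC : ∀ {x} → x ∈ A ∪ C → ¬ (x ∈ A) → x ∈ C
                  inC m n = [ (λ a → ⊥-elim (n a)) , (λ c → c) ]′ (∪⁻ m)
                  tot : ∀ x → x ∈ A ∪ C → ∃ λ z → z ∈ ω ⊗ ω₁ × R x z
                  tot x m with em {x ∈ A}
                  ... | yes p = _ , ⊗⁺ 0∈ω (fm x p) , inj₁ (p , ≈-refl)
                  ... | no n  = _ , ⊗⁺ (suc∈ω 0∈ω) (gm x (inC m n)) , inj₂ (n , ≈-refl)
                  inj : ∀ x x′ z → x ∈ A ∪ C → x′ ∈ A ∪ C → R x z → R x′ z → x ≈ x′
                  inj x x′ z _ _ (inj₁ (p , e)) (inj₁ (p′ , e′)) = fi x x′ p p′ (⟨⟩-snd (≈-trans (≈-sym e) e′))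
                  inj x x′ z m m′ (inj₂ (n , e)) (inj₂ (n′ , e′)) = gi x x′ (inC m n) (inC m′ n′) (⟨⟩-snd (≈-trans (≈-sym e) e′))
                  inj x x′ z _ _ (inj₁ (_ , e)) (inj₂ (_ , e′)) = ⊥-elim (𝟙≉∅ (≈-sym (⟨⟩-fst (≈-trans (≈-sym e) e′))))
                  inj x x′ z _ _ (inj₂ (_ , e)) (inj₁ (_ , e′)) = ⊥-elim (𝟙≉∅ (⟨⟩-fst (≈-trans (≈-sym e) e′)))
          𝒫J≲ω₂ : 𝒫 J ≲ ω₂
          𝒫J≲ω₂ = ≲-trans (≲-𝒫 J≲ω₁) 𝒫ω₁≲ω₂
        abstract
          ix : V
          ix = proj₁ 𝒫J≲ω₂
          ix-inj : Inj ix (𝒫 J) ω₂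
          ix-inj = proj₂ 𝒫J≲ω₂

        InW : V → V → Set ℓ
        InW ξ d = ∃ λ Z → Z ∈ 𝒫 J × ix · Z ≈ ξ × ⟨ ∅ , d ⟩ ∈ Z
        InWᶠ : Tm → Tm → Fm
        InWᶠ ξ d = ∃ᶠ λ Z → Z ∈ᶠ ! (𝒫 J) ∧ᶠ ! ix ·ᶠ Z ≈ᶠ ξ ∧ᶠ ⟨ ! ∅ , d ⟩ᶠ ∈ᶠ Z

        -- Diagonalisation: each set `Z` whose index lies in `U` has its own ordinal `j · (ix · Z)`,
        -- at which the second component `y` of `Z₀` is made to differ from that of `Z`.
        fresh-index : ∀ {W U} → W ⊑ Data → U ≲ ω₁ → ∃ λ ξ → ξ ∈ ω₂ × ¬ (ξ ∈ U) × (∀ d → InW ξ d ⇔ d ∈ W)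
        fresh-index {W} {U} W⊑ (j , jm , ji) = ξ₀ , proj₁ ix-inj Z₀ Z₀∈ , no-U , λ d → mk⇔
            (λ (Z , p , e , q) → inW (∈-congʳ (proj₂ ix-inj Z Z₀ p Z₀∈ e) q)) (λ q → Z₀ , Z₀∈ , ≈-refl , ∪ˡ (⊗⁺ (⟪⟫⁺ ≈-refl) q))
          where
            yᶠ : Tm → Fm
            yᶠ α = ∃ᶠ λ Z → Z ∈ᶠ ! (𝒫 J) ∧ᶠ ! ix ·ᶠ Z ∈ᶠ ! U ∧ᶠ ! j ·ᶠ (! ix ·ᶠ Z) ≈ᶠ α ∧ᶠ ¬ᶠ (⟨ ! 𝟙 , α ⟩ᶠ ∈ᶠ Z)
            y Z₀ ξ₀ : V
            y = Sep yᶠ ω₁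
            Z₀ = ⟪ ∅ ⟫ ⊗ W ∪ ⟪ 𝟙 ⟫ ⊗ y
            ξ₀ = ix · Z₀
            Z₀∈ : Z₀ ∈ 𝒫 J
            Z₀∈ = 𝒫⁺ λ z m → [ (λ m → let a , b , p , q , e = ⊗⁻′ m in ∪ˡ (∈-congˡ (≈-sym e) (⊗⁺ p (W⊑ b q)))) ,
                                (λ m → let a , b , p , q , e = ⊗⁻′ m in ∪ʳ (∈-congˡ (≈-sym e) (⊗⁺ p (Sep⊑ {yᶠ} q)))) ]′ (∪⁻ m)
            inW : ∀ {d} → ⟨ ∅ , d ⟩ ∈ Z₀ → d ∈ W
            inW m = [ (λ m → proj₂ (⊗⁻ m)) , (λ m → ⊥-elim (𝟙≉∅ (≈-sym (⟪⟫⁻ (proj₁ (⊗⁻ m)))))) ]′ (∪⁻ m)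
            iny : ∀ {α} → ⟨ 𝟙 , α ⟩ ∈ Z₀ → α ∈ y
            iny m = [ (λ m → ⊥-elim (𝟙≉∅ (⟪⟫⁻ (proj₁ (⊗⁻ m))))) , (λ m → proj₂ (⊗⁻ m)) ]′ (∪⁻ m)
            no-U : ¬ (ξ₀ ∈ U)
            no-U u = n (∪ʳ (⊗⁺ (⟪⟫⁺ ≈-refl) (∈Sep {yᶠ} (jm ξ₀ u) (Z₀ , Z₀∈ , u , ≈-refl , n))))
              where
                n : ¬ (⟨ 𝟙 , j · ξ₀ ⟩ ∈ Z₀)
                n m = let Z , p , q , e , h = SepP {yᶠ} (iny m) in
                  h (∈-congʳ (proj₂ ix-inj _ _ Z₀∈ p (ji _ _ u q (≈-sym e))) m)

        Unbounded : V → Set ℓ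
        Unbounded C = C ⊑ ω₁ × (∀ ζ → ζ ∈ ω₁ → ∃ λ c → c ∈ C × ζ ∈ c)
        High : V → V → Set ℓ
        High γ d = Disjoint (pts d) γ × ¬ (B d ∈ γ)
        -- If every `c` in `C`, as the set of smaller ordinals, is a union of components of some
        -- graph, then the points of a spread `d` lie in different components.
        Spread : V → V → Set ℓ
        Spread C d = ∀ x y → x ∈ pts d → y ∈ pts d → x ∈ y → ∃ λ c → c ∈ C × x ∈ c × ¬ (y ∈ c)
        -- The richness demanded of a supply. It quantifies over unbounded sets `C` of this model
        -- only, which is what allows it to be verified for triples drawn from sets of a later
        -- extension.
        Large : V → Set ℓ
        Large ξ = ∀ C → Unbounded C → ∀ γ → γ ∈ ω₁ → ∃ λ d → d ∈ Data × InW ξ d × High γ d × Spread C d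
        Unboundedᶠ : Tm → Fm
        Unboundedᶠ C = C ⊑ᶠ ! ω₁ ∧ᶠ (∀ᶠ λ ζ → ζ ∈ᶠ ! ω₁ ⇒ᶠ ∃ᶠ λ c → c ∈ᶠ C ∧ᶠ ζ ∈ᶠ c)
        Highᶠ Spreadᶠ : Tm → Tm → Fm
        Highᶠ γ d = Disjointᶠ (ptsᶠ d) γ ∧ᶠ ¬ᶠ (Bᶠ d ∈ᶠ γ)
        Spreadᶠ C d = ∀ᶠ λ x → ∀ᶠ λ y → x ∈ᶠ ptsᶠ d ⇒ᶠ y ∈ᶠ ptsᶠ d ⇒ᶠ x ∈ᶠ y ⇒ᶠ ∃ᶠ λ c → c ∈ᶠ C ∧ᶠ x ∈ᶠ c ∧ᶠ ¬ᶠ (y ∈ᶠ c)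
        Largeᶠ : Tm → Fm
        Largeᶠ ξ = ∀ᶠ λ C → Unboundedᶠ C ⇒ᶠ ∀ᶠ λ γ → γ ∈ᶠ ! ω₁ ⇒ᶠ ∃ᶠ λ d → d ∈ᶠ ! Data ∧ᶠ InWᶠ ξ d ∧ᶠ Highᶠ γ d ∧ᶠ Spreadᶠ C d

        -- K is a union of components as far as the edge s is concerned.
        Saturated : V → V → Set ℓ
        Saturated K s = ∀ x y → x ∈ s → y ∈ s → x ∈ K → y ∈ K
        Saturatedᶠ : Tm → Tm → Fm
        Saturatedᶠ K s = ∀ᶠ λ x → ∀ᶠ λ y → x ∈ᶠ s ⇒ᶠ y ∈ᶠ s ⇒ᶠ x ∈ᶠ K ⇒ᶠ y ∈ᶠ K
        Splits : V → V → V → Set ℓ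
        Splits K x y = (x ∈ K × ¬ (y ∈ K)) ⊎ (y ∈ K × ¬ (x ∈ K))
        Splitsᶠ : Tm → Tm → Tm → Fm
        Splitsᶠ K x y = (x ∈ᶠ K ∧ᶠ ¬ᶠ (y ∈ᶠ K)) ∨ᶠ (y ∈ᶠ K ∧ᶠ ¬ᶠ (x ∈ᶠ K))

        abstract
          private
            E-ex : ∃ λ E → ∀ ξ → ξ ∈ ω₂ → E · ξ ∈ 𝒫 (ω₂ ⊗ ω₁) × Inj (E · ξ) ξ ω₁
            E-ex = uniformizeᶠ (λ ξ e → Injᶠ e ξ (! ω₁)) ω₂ (𝒫 (ω₂ ⊗ ω₁)) λ ξ p → let e , m , i = ⁺-elem p in
              e ↾ ξ , 𝒫⁺ (↾⊑⊗ (proj₁ (Ord-⁺ ω₁) ξ p) m) , inj-↾ (m , i)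
          E : V
          E = proj₁ E-ex
          E-inj : ∀ {ξ} → ξ ∈ ω₂ → Inj (E · ξ) ξ ω₁
          E-inj p = proj₂ (proj₂ E-ex _ p)

        -- Row `ξ` may have ω₁ many predecessors, too many for one closure argument. Stage `γ`
        -- respects all edges of countably many of them, namely of those that `E · ξ` numbers below
        -- `γ`. The others are left to later stages, and `Ordered` singles out the sets of vertices
        -- for which this suffices.
        Old : V → V → V → V → Set ℓ
        Old ξ g γ K = ∀ η → η ∈ ξ → Large η → E · ξ · η ∈ γ → ∀ δ → δ ∈ ω₁ → Saturated K (pts (g · η · δ))
        Recent : V → V → V → Set ℓ
        Recent x γ K = ∀ δ → δ ∈ γ → Saturated K (pts (x · δ))
        Oldᶠ : Tm → Tm → Tm → Tm → Fm
        Oldᶠ ξ g γ K = ∀ᶠ λ η → η ∈ᶠ ξ ⇒ᶠ Largeᶠ η ⇒ᶠ ! E ·ᶠ ξ ·ᶠ η ∈ᶠ γ ⇒ᶠ ∀ᶠ λ δ → δ ∈ᶠ ! ω₁ ⇒ᶠ Saturatedᶠ K (ptsᶠ (g ·ᶠ η ·ᶠ δ))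
        Recentᶠ : Tm → Tm → Tm → Fm
        Recentᶠ x γ K = ∀ᶠ λ δ → δ ∈ᶠ γ ⇒ᶠ Saturatedᶠ K (ptsᶠ (x ·ᶠ δ))
        -- The points of d lie in different components of the graph of the edges chosen so far.
        Loose : V → V → V → V → V → Set ℓ
        Loose ξ g γ x d = ∀ u v → u ∈ pts d → v ∈ pts d → ¬ (u ≈ v) → ∃ λ K → Splits K u v × Old ξ g γ K × Recent x γ K
        Looseᶠ : Tm → Tm → Tm → Tm → Tm → Fm
        Looseᶠ ξ g γ x d = ∀ᶠ λ u → ∀ᶠ λ v → u ∈ᶠ ptsᶠ d ⇒ᶠ v ∈ᶠ ptsᶠ d ⇒ᶠ ¬ᶠ (u ≈ᶠ v) ⇒ᶠ ∃ᶠ λ K → Splitsᶠ K u v ∧ᶠ Oldᶠ ξ g γ K ∧ᶠ Recentᶠ x γ K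
        Next : V → V → V → V → V → Set ℓ
        Next ξ g γ x d = d ∈ Data × InW ξ d × High γ d × Loose ξ g γ x d
        Nextᶠ : Tm → Tm → Tm → Tm → Tm → Fm
        Nextᶠ ξ g γ x d = d ∈ᶠ ! Data ∧ᶠ InWᶠ ξ d ∧ᶠ Highᶠ γ d ∧ᶠ Looseᶠ ξ g γ x d
        Row : V → V → V → Set ℓ
        Row ξ g x = Large ξ → ∀ γ → γ ∈ ω₁ → Next ξ g γ x (x · γ)
        Rowᶠ : Tm → Tm → Tm → Fm
        Rowᶠ ξ g x = Largeᶠ ξ ⇒ᶠ ∀ᶠ λ γ → γ ∈ᶠ ! ω₁ ⇒ᶠ Nextᶠ ξ g γ x (x ·ᶠ γ)

    open Forests public

    -- Recursive choice of the rows

    module Rows where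
      module Forest (gch : GCH) (k : V) where
        open Edges gch k public
        open Isω₁ ω₁-isω₁
        open ClosurePoints ω₁-isω₁
        Ord-ω₂ : Ord ω₂
        Ord-ω₂ = Ord-⁺ ω₁

        pts-cong : ∀ {d d′} → d ≈ d′ → pts d ≈ pts d′
        pts-cong = ≈-cong ptsᶠ

        private
         module Row-step (ξ : V) (ξ∈ : ξ ∈ ω₂) (g : V) (large : Large ξ)
                         (old : ∀ η → η ∈ ξ → Large η → ∀ δ → δ ∈ ω₁ → g · η · δ ∈ Data × High δ (g · η · δ)) where
          module _ (γ : V) (γ∈ : γ ∈ ω₁) (h : V) (hd : ∀ δ → δ ∈ γ → h · δ ∈ Data) where
            Touch : V → V → Set ℓ
            Touch ζ ε = (∀ η → η ∈ ξ → Large η → E · ξ · η ∈ γ → ∀ δ → δ ∈ ω₁ → ζ ∈ pts (g · η · δ) → pts (g · η · δ) ⊑ ε)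
                      × (∀ δ → δ ∈ γ → ζ ∈ pts (h · δ) → pts (h · δ) ⊑ ε)
            Touchᶠ : Tm → Tm → Fm
            Touchᶠ ζ ε = (∀ᶠ λ η → η ∈ᶠ ! ξ ⇒ᶠ Largeᶠ η ⇒ᶠ ! E ·ᶠ ! ξ ·ᶠ η ∈ᶠ ! γ ⇒ᶠ ∀ᶠ λ δ → δ ∈ᶠ ! ω₁ ⇒ᶠ ζ ∈ᶠ ptsᶠ (! g ·ᶠ η ·ᶠ δ) ⇒ᶠ ptsᶠ (! g ·ᶠ η ·ᶠ δ) ⊑ᶠ ε)
                      ∧ᶠ (∀ᶠ λ δ → δ ∈ᶠ ! γ ⇒ᶠ ζ ∈ᶠ ptsᶠ (! h ·ᶠ δ) ⇒ᶠ ptsᶠ (! h ·ᶠ δ) ⊑ᶠ ε)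
            aᶠ : Tm → Fm
            aᶠ η = Largeᶠ η ∧ᶠ ! E ·ᶠ ! ξ ·ᶠ η ∈ᶠ ! γ
            oldᶠ : Tm → Tm
            oldᶠ z = ptsᶠ (! g ·ᶠ fstᶠ z ·ᶠ sndᶠ z)
            newᶠ : Tm → Tm
            newᶠ δ = ptsᶠ (! h ·ᶠ δ)
            A : V
            A = Sep aᶠ ξ
            A-ctb : Ctb A
            A-ctb = ≲-trans (E · ξ , (λ η p → proj₂ (SepP {aᶠ} p)) , λ x y p q → proj₂ (E-inj ξ∈) x y (Sep⊑ {aᶠ} p) (Sep⊑ {aᶠ} q)) (elem γ∈)
            -- Only countably many of the edges concerned contain `ζ`: an edge of stage `δ` has no
            -- points below `δ`, so in each of the countably many earlier rows only the stages up to
            -- `ζ` matter, and the present row has countably many edges so far.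
            touch : ∀ ζ → ζ ∈ ω₁ → ∃ λ ε → ε ∈ ω₁ × Touch ζ ε
            touch ζ ζ∈ = ε , proj₁ (proj₂ bd) , (λ η p l q δ r m → below₁ η p l q δ r m) , λ δ p m x n → sub x (∪ʳ (⋃⁺ (∈Img {newᶠ} p) n))
              where
                Old-edges : V
                Old-edges = Img oldᶠ (A ⊗ suc′ ζ)
                old≈ : ∀ {η δ} → t₁ oldᶠ ⟨ η , δ ⟩ ≈ pts (g · η · δ)
                old≈ = pts-cong (·-cong (·-congʳ fst-β) snd-β)
                at : ∀ {z} → z ∈ A ⊗ suc′ ζ → t₁ oldᶠ z ⊑ ω₁ × Finite (t₁ oldᶠ z)
                at p = let η , δ , q , r , e = ⊗⁻′ p; d∈ = proj₁ (old η (Sep⊑ {aᶠ} q) (proj₁ (SepP {aᶠ} q)) δ (proj₁ ord _ (suc-mem ζ∈) δ r))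
                           e′ = ≈-trans (≈-cong oldᶠ e) old≈
                       in (λ x m → pts-⊑ d∈ x (to (e′ x) m)) , fin-resp (≈-sym e′) (pts-fin d∈)
                U : V
                U = ⋃ Old-edges ∪ ⋃ (Img newᶠ γ)
                U⊑ : U ⊑ ω₁
                U⊑ x m = [ (λ m → let y , a , b = ⋃⁻ m; z , c , e = Img⁻ a in proj₁ (at c) x (∈-congʳ e b)) ,
                           (λ m → let y , a , b = ⋃⁻ m; δ , c , e = Img⁻ a in pts-⊑ (hd δ c) x (∈-congʳ e b)) ]′ (∪⁻ m)
                U-ctb : Ctb U
                U-ctb = ctb-∪ (ctb-⋃Img oldᶠ (ctb-⊗ A-ctb (elem (suc-mem ζ∈))) λ z p → fin⇒ctb (proj₂ (at p)))
                              (ctb-⋃Img newᶠ (elem γ∈) λ δ p → fin⇒ctb (pts-fin (hd δ p)))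
                bd : ∃ λ ε → ε ∈ ω₁ × (∀ x → x ∈ U → x ∈ ε)
                bd = bounded U⊑ U-ctb
                ε = proj₁ bd
                sub : ∀ x → x ∈ U → x ∈ ε
                sub = proj₂ (proj₂ bd)
                below₁ : ∀ η → η ∈ ξ → Large η → E · ξ · η ∈ γ → ∀ δ → δ ∈ ω₁ → ζ ∈ pts (g · η · δ) → pts (g · η · δ) ⊑ ε
                below₁ η p l q δ r m x n = sub x (∪ˡ (⋃⁺ (∈Img {oldᶠ} (⊗⁺ (∈Sep {aᶠ} p (l , q)) δ∈)) (from (old≈ x) n)))
                  where
                    δ∈ : δ ∈ suc′ ζ
                    δ∈ = [ (λ i → suc⁺′ i) , [ (λ e → from (suc-spec _ _) (inj₂ e)) , (λ i → ⊥-elim (proj₁ (proj₂ (old η p l δ r)) ζ m i)) ]′ ]′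
                           (Ord-cmp (⊑-ord r) (⊑-ord ζ∈))
            cᶠ : Tm → Fm
            cᶠ c = Oldᶠ (! ξ) (! g) (! γ) c ∧ᶠ Recentᶠ (! h) (! γ) c
            C : V
            C = Sep cᶠ ω₁
            -- An ordinal closed under the bounds of `touch` contains every edge that it meets.
            C-unb : Unbounded C
            C-unb = (λ x → Sep⊑ {cᶠ}) , λ ζ p → from-closed ζ (closure Touchᶠ touch ζ p)
              where
                from-closed : ∀ ζ → (∃ λ δ → δ ∈ ω₁ × ζ ∈ δ × Closed Touch δ) → ∃ λ c → c ∈ C × ζ ∈ c
                from-closed ζ (δ , δ∈ , l , cl) = δ , ∈Sep {cᶠ} δ∈ (
                    (λ η p l q δ′ r x y m n i → let ε , ε∈ , t , _ = proj₂ (cl x i) in proj₁ (⊑-ord δ∈) ε ε∈ y (t η p l q δ′ r m y n)) ,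
                    λ δ′ p x y m n i → let ε , ε∈ , _ , t = proj₂ (cl x i) in proj₁ (⊑-ord δ∈) ε ε∈ y (t δ′ p m y n)) , l
            -- Richness is applied to `C`, whose elements are saturated for all edges to be
            -- respected; they separate any two points of the new edge.
            next : ∃ λ d → d ∈ Data × Next ξ g γ h d
            next = let d , d∈ , w , hi , sp = large C C-unb γ γ∈ in d , d∈ , d∈ , w , hi , loose d d∈ sp
              where
                loose : ∀ d → d ∈ Data → Spread C d → Loose ξ g γ h d
                loose d d∈ sp u v p q ne = [ (λ l → let c , i , a , b = sp u v p q l; o , r = SepP {cᶠ} i in c , inj₁ (a , b) , o , r) ,
                    [ (λ e → ⊥-elim (ne e)) , (λ l → let c , i , a , b = sp v u q p l; o , r = SepP {cᶠ} i in c , inj₂ (a , b) , o , r) ]′ ]′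
                    (Ord-cmp (⊑-ord (pts-⊑ d∈ u p)) (⊑-ord (pts-⊑ d∈ v q)))

          -- `successive` works with restricted histories, and the requirement at `γ` depends only
          -- on the values below `γ`.
          Next-resp : ∀ {γ h h′ d d′} → (∀ δ → δ ∈ γ → h · δ ≈ h′ · δ) → d ≈ d′ → Next ξ g γ h d → Next ξ g γ h′ d′
          Next-resp {γ} {h} {h′} {d} {d′} e f n = change (≈-subst (λ d → Nextᶠ (! ξ) (! g) (! γ) (! h) d) f n)
            where
              change : Next ξ g γ h d′ → Next ξ g γ h′ d′
              change (a , b , c , l) = a , b , c , λ u v p q ne → let K , s , o , r = l u v p q ne in
                K , s , o , λ δ i x y m n → r δ i x y (from (pts-cong (e δ i) x) m) (from (pts-cong (e δ i) y) n)

          row : ∃ λ x → x ∈ 𝒫 (ω₁ ⊗ Data) × Row ξ g x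
          row = let x , hx = built in x ↾ ω₁ , 𝒫⁺ (↾⊑⊗ (λ _ p → p) (λ γ p → proj₁ (hx γ p))) ,
                  λ _ γ p → Next-resp (λ δ q → ≈-trans (↾-β q) (≈-sym (↾-β (proj₁ ord γ p δ q)))) (≈-sym (↾-β p)) (proj₂ (hx γ p))
            where
              built : ∃ λ x → ∀ γ → γ ∈ ω₁ → x · γ ∈ Data × Next ξ g γ (x ↾ γ) (x · γ)
              built = successive (λ γ h d → Nextᶠ (! ξ) (! g) γ h d) Ord-ω₁ Data
                        (λ γ p h ih → next γ p h (λ δ q → proj₁ (ih δ q)))

         rows : ∃ λ X → ∀ ξ → ξ ∈ ω₂ → X · ξ ∈ 𝒫 (ω₁ ⊗ Data) × Row ξ (X ↾ ξ) (X · ξ)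
         rows = successive Rowᶠ Ord-ω₂ (𝒫 (ω₁ ⊗ Data)) build
           where
             build : ∀ ξ → ξ ∈ ω₂ → ∀ g → (∀ η → η ∈ ξ → g · η ∈ 𝒫 (ω₁ ⊗ Data) × Row η (g ↾ η) (g · η)) → ∃ λ x → x ∈ 𝒫 (ω₁ ⊗ Data) × Row ξ g x
             build ξ p g ih with em {Large ξ}
             -- Rows with a poor supply stay empty, and `UP` has no vertices in them.
             ... | no n  = ∅ , 𝒫⁺ (λ z q → ⊥-elim (∅⁻ q)) , λ l → ⊥-elim (n l)
             ... | yes l = Row-step.row ξ p g l λ η q lη δ r → let a , _ , c , _ = proj₂ (ih η q) lη δ r in a , c

        abstract
          X : V
          X = proj₁ rows
          X-row : ∀ ξ → ξ ∈ ω₂ → Row ξ (X ↾ ξ) (X · ξ)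
          X-row ξ p = proj₂ (proj₂ rows ξ p)

        X-next : ∀ {ξ} → ξ ∈ ω₂ → Large ξ → ∀ {γ} → γ ∈ ω₁ → X · ξ · γ ∈ Data × InW ξ (X · ξ · γ) × High γ (X · ξ · γ) × Loose ξ X γ (X · ξ) (X · ξ · γ)
        X-next {ξ} p l {γ} q = let a , b , c , d = X-row ξ p l γ q in a , b , c , λ u v m n ne → let K , s , o , r = d u v m n ne in
          K , s , (λ η i l′ e δ j x y m n → o η i l′ e δ j x y (from (E≈ i δ x) m) (from (E≈ i δ y) n)) , r
          where
            E≈ : ∀ {η} → η ∈ ξ → ∀ δ → pts ((X ↾ ξ) · η · δ) ≈ pts (X · η · δ)
            E≈ i δ = pts-cong (·-cong (↾-β i) ≈-refl)

    open Rows public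

    -- Choosing disjoint halves in a forest

    module EdgeGraph where
      module PGraph (gch : GCH) (k : V) where
        open Forest gch k public
        open Isω₁ ω₁-isω₁
        open Roots ω₁-isω₁ using (root; Trace)

        private
          largeᶠ : Tm → Fm
          largeᶠ u = Largeᶠ (fstᶠ u)
        abstract
          UP : V
          UP = Sep largeᶠ (ω₂ ⊗ ω₁)
          UP-spec : ∀ u → u ∈ UP ⇔ (u ∈ ω₂ ⊗ ω₁ × Large (fst u))
          UP-spec u = Sep-spec largeᶠ

        datum : V → V
        datum u = X · fst u · snd u
        datumᶠ : Tm → Tm
        datumᶠ u = ! X ·ᶠ fstᶠ u ·ᶠ sndᶠ u

        module _ {u : V} (p : u ∈ UP) where
          private
            form = ⊗⁻′ (proj₁ (to (UP-spec u) p))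
          UP-pair : u ≈ ⟨ fst u , snd u ⟩
          UP-pair = let x , y , a , b , e = form in ≈-trans e (⟨⟩-cong (≈-sym (≈-trans (≈-cong fstᶠ e) fst-β)) (≈-sym (≈-trans (≈-cong sndᶠ e) snd-β)))
          UP-fst : fst u ∈ ω₂
          UP-fst = let x , y , a , b , e = form in ∈-congˡ (≈-sym (≈-trans (≈-cong fstᶠ e) fst-β)) a
          UP-snd : snd u ∈ ω₁
          UP-snd = let x , y , a , b , e = form in ∈-congˡ (≈-sym (≈-trans (≈-cong sndᶠ e) snd-β)) b
          UP-large : Large (fst u)
          UP-large = proj₂ (to (UP-spec u) p)
          UP-next = X-next UP-fst UP-large UP-snd
          UP-data : datum u ∈ Data
          UP-data = proj₁ UP-next
          UP-high : High (snd u) (datum u)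
          UP-high = proj₁ (proj₂ (proj₂ UP-next))
          UP-loose : Loose (fst u) X (snd u) (X · fst u) (datum u)
          UP-loose = proj₂ (proj₂ (proj₂ UP-next))

        UP⁺ : ∀ {ξ γ} → ξ ∈ ω₂ → Large ξ → γ ∈ ω₁ → ⟨ ξ , γ ⟩ ∈ UP
        UP⁺ p l q = from (UP-spec _) (⊗⁺ p q , ≈-subst Largeᶠ (≈-sym fst-β) l)

        -- Ensures that when the edge of `v` was chosen, the row of `u` was already among those
        -- respected by `Old`.
        Ordered : V → Set ℓ
        Ordered F = ∀ u v → u ∈ F → v ∈ F → fst u ∈ fst v → E · fst v · fst u ∈ snd v
        -- Components are handled through saturated sets in place of paths: a set `K` saturated for
        -- every edge is a union of components, so a split by `K` shows that two points are not
        -- connected.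
        Indep : V → V → Set ℓ
        Indep F W = ∀ x y → x ∈ W → y ∈ W → ¬ (x ≈ y) → ∃ λ K → Splits K x y × (∀ v → v ∈ F → Saturated K (pts (datum v)))
        Half : V → V → Set ℓ
        Half s v = s ≈ S₁ (datum v) ⊎ s ≈ S₂ (datum v)
        Assignment : V → V → V → Set ℓ
        Assignment F W π = Finite π × (∀ s → s ∈ π → ∃ λ v → v ∈ F × Half s v) × (∀ v → v ∈ F → ∃ λ s → s ∈ π × Half s v) ×
          (∀ s t x → s ∈ π → t ∈ π → x ∈ s → x ∈ t → s ≈ t) × (∀ s → s ∈ π → Disjoint s W)
        Orderedᶠ : Tm → Fm
        Orderedᶠ F = ∀ᶠ λ u → ∀ᶠ λ v → u ∈ᶠ F ⇒ᶠ v ∈ᶠ F ⇒ᶠ fstᶠ u ∈ᶠ fstᶠ v ⇒ᶠ ! E ·ᶠ fstᶠ v ·ᶠ fstᶠ u ∈ᶠ sndᶠ v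
        Indepᶠ : Tm → Tm → Fm
        Indepᶠ F W = ∀ᶠ λ x → ∀ᶠ λ y → x ∈ᶠ W ⇒ᶠ y ∈ᶠ W ⇒ᶠ ¬ᶠ (x ≈ᶠ y) ⇒ᶠ ∃ᶠ λ K → Splitsᶠ K x y ∧ᶠ (∀ᶠ λ v → v ∈ᶠ F ⇒ᶠ Saturatedᶠ K (ptsᶠ (datumᶠ v)))
        Halfᶠ : Tm → Tm → Fm
        Halfᶠ s v = s ≈ᶠ S₁ᶠ (datumᶠ v) ∨ᶠ s ≈ᶠ S₂ᶠ (datumᶠ v)
        Assignmentᶠ : Tm → Tm → Tm → Fm
        Assignmentᶠ F W π = Finiteᶠ π ∧ᶠ (∀ᶠ λ s → s ∈ᶠ π ⇒ᶠ ∃ᶠ λ v → v ∈ᶠ F ∧ᶠ Halfᶠ s v) ∧ᶠ (∀ᶠ λ v → v ∈ᶠ F ⇒ᶠ ∃ᶠ λ s → s ∈ᶠ π ∧ᶠ Halfᶠ s v) ∧ᶠ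
          (∀ᶠ λ s → ∀ᶠ λ t → ∀ᶠ λ x → s ∈ᶠ π ⇒ᶠ t ∈ᶠ π ⇒ᶠ x ∈ᶠ s ⇒ᶠ x ∈ᶠ t ⇒ᶠ s ≈ᶠ t) ∧ᶠ (∀ᶠ λ s → s ∈ᶠ π ⇒ᶠ Disjointᶠ s W)

        Last : V → V → Set ℓ
        Last F v = ∀ u → u ∈ F → fst u ∈ fst v ⊎ (fst u ≈ fst v × (snd u ∈ snd v ⊎ u ≈ v))

        last : ∀ F → Finite F → F ⊑ UP → (∃ λ v → v ∈ F) → ∃ λ v → v ∈ F × Last F v
        last F f s (v₀ , v₀∈) = with-ξ (fin-max (Img-fin fstᶠ f) (λ x m → let u , p , e = Img⁻ m in Ord-resp (≈-sym e) (Ord-elem Ord-ω₂ (UP-fst (s u p)))) (_ , ∈Img {fstᶠ} v₀∈))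
          where
            with-ξ : (∃ λ ξ → ξ ∈ Img fstᶠ F × (∀ x → x ∈ Img fstᶠ F → x ∈ ξ ⊎ x ≈ ξ)) → ∃ λ v → v ∈ F × Last F v
            with-ξ (ξ , m , mx) = let v₁ , p₁ , e₁ = Img⁻ m in
                with-γ (fin-max (Img-fin sndᶠ (fin-⊑ (λ x → Sep⊑ {topᶠ}) f))
                  (λ x n → let u , p , e = Img⁻ n in Ord-resp (≈-sym e) (⊑-ord (UP-snd (s u (Sep⊑ {topᶠ} p))))) (_ , ∈Img {sndᶠ} (∈Sep {topᶠ} p₁ (≈-sym e₁))))
              where
                topᶠ : Tm → Fm
                topᶠ u = fstᶠ u ≈ᶠ ! ξ
                G : V
                G = Sep topᶠ F
                with-γ : (∃ λ γ → γ ∈ Img sndᶠ G × (∀ x → x ∈ Img sndᶠ G → x ∈ γ ⊎ x ≈ γ)) → ∃ λ v → v ∈ F × Last F v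
                with-γ (γ , n , mxγ) = v , Sep⊑ {topᶠ} p , isLast
                  where
                    v = proj₁ (Img⁻ n)
                    p : v ∈ G
                    p = proj₁ (proj₂ (Img⁻ n))
                    e : γ ≈ snd v
                    e = proj₂ (proj₂ (Img⁻ n))
                    eξ : fst v ≈ ξ
                    eξ = SepP {topᶠ} p
                    isLast : Last F v
                    isLast u q = [ (λ l → inj₁ (∈-congʳ (≈-sym eξ) l)) , (λ f → inj₂ (≈-trans f (≈-sym eξ) ,
                        [ (λ l → inj₁ (∈-congʳ e l)) , (λ g → inj₂ (≈-trans (UP-pair (s u q)) (≈-trans (⟨⟩-cong (≈-trans f (≈-sym eξ)) (≈-trans g e))
                             (≈-sym (UP-pair (s v (Sep⊑ {topᶠ} p))))))) ]′ (mxγ (snd u) (∈Img {sndᶠ} (∈Sep {topᶠ} q f))))) ]′ (mx (fst u) (∈Img {fstᶠ} q))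

        -- An acyclic family of edges has disjoint halves. The induction removes the last edge,
        -- whose points lie in different components of the rest; W holds points already used, at most one in each component.
        assign : ∀ F → Finite F → F ⊑ UP → Ordered F → ∀ W → Indep F W → ∃ λ π → Assignment F W π
        assign = fin-rem (λ F → F ⊑ᶠ ! UP ⇒ᶠ Orderedᶠ F ⇒ᶠ ∀ᶠ λ W → Indepᶠ F W ⇒ᶠ ∃ᶠ λ π → Assignmentᶠ F W π)
          (λ _ _ W _ → ∅ , fin-∅ , (λ s p → ⊥-elim (∅⁻ p)) , (λ v p → ⊥-elim (∅⁻ p)) , (λ s t x p → ⊥-elim (∅⁻ p)) , λ s p → ⊥-elim (∅⁻ p))
          stp
          where
            Goal : V → Set ℓ
            Goal F = F ⊑ UP → Ordered F → ∀ W → Indep F W → ∃ λ π → Assignment F W π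
            module Remove (F v : V) (Ff : Finite F) (v∈ : v ∈ F) (lst : Last F v) (ih : Goal (F ∖ ⟪ v ⟫)) (s : F ⊑ UP) (ordF : Ordered F) (W : V) (ind : Indep F W) where
              F′ = F ∖ ⟪ v ⟫
              F′⊑ : F′ ⊑ F
              F′⊑ u m = proj₁ (∖⁻ m)
              vU : v ∈ UP
              vU = s v v∈
              D∈ : datum v ∈ Data
              D∈ = UP-data vU
              -- All other vertices come before `v`, in an earlier row or at an earlier stage of the
              -- same row, so that `Loose` covers their edges.
              ind-v : Indep F′ (pts (datum v))
              ind-v x y p q ne = let K , sp , o , r = UP-loose vU x y p q ne in K , sp , λ u m → sat K o r u m (lst u (F′⊑ u m))
                where
                  sat : ∀ K → Old (fst v) X (snd v) K → Recent (X · fst v) (snd v) K → ∀ u → u ∈ F′ →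
                        fst u ∈ fst v ⊎ (fst u ≈ fst v × (snd u ∈ snd v ⊎ u ≈ v)) → Saturated K (pts (datum u))
                  sat K o r u m (inj₁ l) = o (fst u) l (UP-large uU) (ordF u v (F′⊑ u m) v∈ l) (snd u) (UP-snd uU)
                    where uU = s u (F′⊑ u m)
                  sat K o r u m (inj₂ (e , inj₂ f)) = ⊥-elim (proj₂ (∖⁻ m) (⟪⟫⁺ f))
                  sat K o r u m (inj₂ (e , inj₁ l)) a b p q i = r (snd u) l a b (to (≈pts a) p) (to (≈pts b) q) i
                    where ≈pts : pts (datum u) ≈ pts (X · fst v · snd u)
                          ≈pts = pts-cong (·-cong (·-congʳ e) ≈-refl)
              Conn : V → V → Set ℓ
              Conn x y = ¬ (∃ λ K → Splits K x y × (∀ u → u ∈ F′ → Saturated K (pts (datum u))))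
              extend-sat : ∀ {K} → (∀ u → u ∈ F → Saturated K (pts (datum u))) → ∀ u → u ∈ F′ → Saturated K (pts (datum u))
              extend-sat h u m = h u (F′⊑ u m)
              conn-iff : ∀ {K x y} → Conn x y → (∀ u → u ∈ F′ → Saturated K (pts (datum u))) → x ∈ K ⇔ y ∈ K
              conn-iff {K} c h = mk⇔ (λ p → dne λ n → c (K , inj₁ (p , n) , h)) (λ p → dne λ n → c (K , inj₂ (p , n) , h))
              no-split : ∀ {K x y} → x ∈ K ⇔ y ∈ K → ¬ Splits K x y
              no-split e (inj₁ (p , n)) = n (to e p)
              no-split e (inj₂ (p , n)) = n (from e p)
              -- If `x` and `x′` differed, the last edge would connect them through `y` and `y′`,
              -- against the independence of `W`. So they coincide, and then `y` and `y′` are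
              -- connected through them without the last edge, which `ind-v` allows only for equal
              -- points.
              conn-unique : ∀ {x x′ y y′} → x ∈ W → x′ ∈ W → y ∈ pts (datum v) → y′ ∈ pts (datum v) → Conn x y → Conn x′ y′ → y ≈ y′
              conn-unique {x} {x′} {y} {y′} p p′ q q′ c c′ = dne λ ne →
                let x≈ : x ≈ x′
                    x≈ = dne λ nx → let K , sp , h = ind x x′ p p′ nx; h′ = extend-sat h in
                      no-split (⇔-trans (conn-iff c h′) (⇔-trans (mk⇔ (h v v∈ y y′ q q′) (h v v∈ y′ y q′ q)) (⇔-sym (conn-iff c′ h′)))) sp
                    K , sp , h = ind-v y y′ q q′ ne
                in no-split (⇔-trans (⇔-sym (conn-iff c h)) (⇔-trans (mk⇔ (∈-congˡ x≈) (∈-congˡ (≈-sym x≈))) (conn-iff c′ h))) sp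
              Good : V → Set ℓ
              Good t = Half t v × t ⊑ pts (datum v) × (∀ x y → x ∈ W → y ∈ t → ¬ Conn x y)
              choose : ∃ λ t → Good t
              choose with em {∃ λ y → y ∈ pts (datum v) × ∃ λ x → x ∈ W × Conn x y}
              ... | no n = S₁ (datum v) , inj₁ ≈-refl , (λ x → ∪ˡ) , λ x y p q c → n (y , ∪ˡ q , x , p , c)
              -- `y` is the only point of the edge connected to `W`, so the half without `y` is
              -- free.
              ... | yes (y , q , x , p , c) with em {y ∈ S₁ (datum v)}
              ...   | yes i = S₂ (datum v) , inj₂ ≈-refl , (λ x → ∪ʳ) , λ x′ y′ p′ q′ c′ →
                        S-disjoint D∈ y′ (∈-congˡ (conn-unique p p′ q (∪ʳ q′) c c′) i) q′
              ...   | no i = S₁ (datum v) , inj₁ ≈-refl , (λ x → ∪ˡ) , λ x′ y′ p′ q′ c′ → i (∈-congˡ (≈-sym (conn-unique p p′ q (∪ˡ q′) c c′)) q′)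
              -- Adding `t` to `W` keeps the halves chosen for the remaining edges away from `t`.
              -- The enlarged set is independent because no point of `t` is connected to `W`.
              finish : (∃ λ t → Good t) → ∃ λ π → Assignment F W π
              finish (t , half , t⊑ , free) = with-π (ih (λ u m → s u (F′⊑ u m)) (λ u w a b → ordF u w (F′⊑ u a) (F′⊑ w b)) (W ∪ t) ind′)
                where
                  disW : Disjoint t W
                  disW x m n = free x x n m λ (K , sp , _) → no-split ⇔-refl sp
                  ind′ : Indep F′ (W ∪ t)
                  ind′ x y p q ne = [ (λ a → [ (λ b → let K , sp , h = ind x y a b ne in K , sp , extend-sat h) , (λ b → dne (free x y a b)) ]′ (∪⁻ q)) ,
                      (λ a → [ (λ b → let K , sp , h = dne (free y x b a) in K , flip sp , h) , (λ b → ind-v x y (t⊑ x a) (t⊑ y b) ne) ]′ (∪⁻ q)) ]′ (∪⁻ p)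
                    where flip : ∀ {K x y} → Splits K x y → Splits K y x
                          flip = [ inj₂ , inj₁ ]′
                  with-π : (∃ λ π → Assignment F′ (W ∪ t) π) → ∃ λ π → Assignment F W π
                  with-π (π , pf , a , b , c , d) = π ∪ ⟪ t ⟫ , fin-add pf , a′ , b′ , c′ , d′
                    where
                      a′ : ∀ s → s ∈ π ∪ ⟪ t ⟫ → ∃ λ u → u ∈ F × Half s u
                      a′ s m = [ (λ m → let u , p , h = a s m in u , F′⊑ u p , h) ,
                                 (λ m → v , v∈ , [ (λ e → inj₁ (≈-trans (⟪⟫⁻ m) e)) , (λ e → inj₂ (≈-trans (⟪⟫⁻ m) e)) ]′ half) ]′ (∪⁻ m)
                      b′ : ∀ u → u ∈ F → ∃ λ s → s ∈ π ∪ ⟪ t ⟫ × Half s u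
                      b′ u m = by (em {u ≈ v})
                        where
                          by : Dec (u ≈ v) → ∃ λ s → s ∈ π ∪ ⟪ t ⟫ × Half s u
                          by (yes e) = t , ∪ʳ (⟪⟫⁺ ≈-refl) , ≈-subst (λ u → Halfᶠ (! t) u) (≈-sym e) half
                          by (no ne) = let s , p , h = b u (∖⁺ m (λ q → ne (⟪⟫⁻ q))) in s , ∪ˡ p , h
                      c′ : ∀ s s′ x → s ∈ π ∪ ⟪ t ⟫ → s′ ∈ π ∪ ⟪ t ⟫ → x ∈ s → x ∈ s′ → s ≈ s′
                      c′ s s′ x m n p q = [ (λ m → [ (λ n → c s s′ x m n p q) , (λ n → ⊥-elim (d s m x p (∪ʳ (∈-congʳ (⟪⟫⁻ n) q)))) ]′ (∪⁻ n)) ,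
                          (λ m → [ (λ n → ⊥-elim (d s′ n x q (∪ʳ (∈-congʳ (⟪⟫⁻ m) p)))) , (λ n → ≈-trans (⟪⟫⁻ m) (≈-sym (⟪⟫⁻ n))) ]′ (∪⁻ n)) ]′ (∪⁻ m)
                      d′ : ∀ s → s ∈ π ∪ ⟪ t ⟫ → Disjoint s W
                      d′ s m x p q = [ (λ m → d s m x p (∪ˡ q)) , (λ m → disW x (∈-congʳ (⟪⟫⁻ m) p) q) ]′ (∪⁻ m)
            stp : ∀ F → Finite F → (∃ λ z → z ∈ F) → ∃ λ z → z ∈ F × (Goal (F ∖ ⟪ z ⟫) → Goal F)
            stp F f (z , z∈) with em {F ⊑ UP}
            ... | no n  = z , z∈ , λ _ s → ⊥-elim (n s)
            ... | yes s = let v , v∈ , l = last F f s (z , z∈) in v , v∈ , λ ih s o W i → Remove.finish F v f v∈ l ih s o W i (Remove.choose F v f v∈ l ih s o W i)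

    open EdgeGraph public

    -- The chain condition of P

    module CatchingPoset where
      module PPoset (gch : GCH) (k : V) where
        open PGraph gch k public
        open Isω₁ ω₁-isω₁
        open Roots ω₁-isω₁ using (root; Trace)

        Catch : V → V → Set ℓ
        Catch u v = ∃ λ s → Half s u × s ∈ 𝓕 · B (datum v)
        Catchᶠ : Tm → Tm → Fm
        Catchᶠ u v = ∃ᶠ λ s → Halfᶠ s u ∧ᶠ s ∈ᶠ ! 𝓕 ·ᶠ Bᶠ (datumᶠ v)
        private
          edgeᶠ : Tm → Tm → Fm
          edgeᶠ u v = fstᶠ u ≈ᶠ fstᶠ v ⇒ᶠ Catchᶠ u v ∨ᶠ Catchᶠ v u
          gᶠ : Tm → Fm
          gᶠ z = edgeᶠ (fstᶠ z) (sndᶠ z)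
        Edge : V → V → Set ℓ
        Edge u v = fst u ≈ fst v → Catch u v ⊎ Catch v u
        abstract
          ΓP : V
          ΓP = Sep gᶠ (UP ⊗ UP)
          ΓP-spec : ∀ z → z ∈ ΓP ⇔ (z ∈ UP ⊗ UP × Edge (fst z) (snd z))
          ΓP-spec z = Sep-spec gᶠ
        Edge-resp : ∀ {u v u′ v′} → u ≈ u′ → v ≈ v′ → Edge u v → Edge u′ v′
        Edge-resp {v = v} {u′} e f h = ≈-subst (λ v → edgeᶠ (! u′) v) f (≈-subst (λ u → edgeᶠ u (! v)) e h)
        ΓP⁺ : ∀ {u v} → u ∈ UP → v ∈ UP → Edge u v → ⟨ u , v ⟩ ∈ ΓP
        ΓP⁺ a b h = from (ΓP-spec _) (⊗⁺ a b , Edge-resp (≈-sym fst-β) (≈-sym snd-β) h)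
        ΓP⁻ : ∀ {u v} → ⟨ u , v ⟩ ∈ ΓP → u ∈ UP × v ∈ UP × Edge u v
        ΓP⁻ h = let a , b = to (ΓP-spec _) h; u , v = ⊗⁻ a in u , v , Edge-resp fst-β snd-β b
        ΓP-sym : ∀ u v → ⟨ u , v ⟩ ∈ ΓP → ⟨ v , u ⟩ ∈ ΓP
        ΓP-sym u v h = let a , b , c = ΓP⁻ h in ΓP⁺ b a λ e → [ inj₂ , inj₁ ]′ (c (≈-sym e))

        open Clique UP ΓP public

        private
          -- A tag makes the use of a row visible to the root, which then also decides which rows
          -- are shared. Levels of vertices are elements of `ω₁`, so no tag is a vertex.
          tagᶠ : Tm → Tm
          tagᶠ u = ⟨ fstᶠ u , ! ω₁ ⟩ᶠ
          tagged : V → V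
          tagged p = p ∪ Img tagᶠ p
          abstract
            tagged-T : T 1 (λ ρ → tagged (proj₁ ρ))
            tagged-T = T₁-by tagged (λ z p → z ∈ᶠ p ∨ᶠ ∃ᶠ λ u → u ∈ᶠ p ∧ᶠ z ≈ᶠ tagᶠ u)
              (λ z p → ⇔-trans (∪-spec _ _ _) (mk⇔ [ inj₁ , (λ m → inj₂ (Img⁻ m)) ]′ [ inj₁ , (λ m → inj₂ (from (Img-spec tagᶠ) m)) ]′))
          taggedᶠ : Tm → Tm
          taggedᶠ = fn₁ᶠ tagged tagged-T

        -- Rows that are not shared ask for no edges, and in a shared row the vertices of level
        -- below the index belong to the root. The edges of the remaining vertices, `New`, form a
        -- forest, so `assign` yields disjoint halves as the pattern of `γ`; amalgamation places
        -- them in the families at the ordinals `B` of the new vertices of `γ′`.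
        sc : SC
        sc q d hq hd = from-root (root q⁺ Y (λ γ p → fin-resp (≈-sym (q⁺≈ p)) (fin-∪ (Cl-fin (hq γ p)) (Img-fin tagᶠ (Cl-fin (hq γ p)))))
                                    (λ β p → ≲-cong (≈-sym (Y≈ p)) ≈-refl (ctb-⊗ (rows-ctb p) (ctb-∪ (elem (suc-mem p)) (fin⇒ctb fin-⟪⟫)))))
          where
            qᶠ : Tm → Tm
            qᶠ γ = ! q ·ᶠ γ
            q⁺ᶠ : Tm → Tm
            q⁺ᶠ γ = taggedᶠ (qᶠ γ)
            q⁺ : V
            q⁺ = lam ω₁ q⁺ᶠ
            q⁺≈ : ∀ {γ} → γ ∈ ω₁ → q⁺ · γ ≈ tagged (q · γ)
            q⁺≈ = lam-β q⁺ᶠ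
            rows-of : V → V
            rows-of β = Img fstᶠ (⋃ (Img qᶠ (suc′ β)))
            rows-spec : ∀ z β → z ∈ rows-of β ⇔ (∃ λ u → (∃ λ γ → γ ∈ suc′ β × u ∈ q · γ) × z ≈ fst u)
            rows-spec z β = mk⇔ (λ m → let u , a , e = Img⁻ m; y , b , c = ⋃⁻ a; γ , g , f = Img⁻ b in u , (γ , g , ∈-congʳ f c) , e)
              (λ (u , (γ , g , c) , e) → from (Img-spec fstᶠ) (u , ⋃⁺ (∈Img {qᶠ} g) c , e))
            abstract
              rows-T : T 1 (λ ρ → rows-of (proj₁ ρ))
              rows-T = T₁-by rows-of (λ z β → ∃ᶠ λ u → (∃ᶠ λ γ → γ ∈ᶠ sucᶠ β ∧ᶠ u ∈ᶠ ! q ·ᶠ γ) ∧ᶠ z ≈ᶠ fstᶠ u) rows-spec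
            rows-ctb : ∀ {β} → β ∈ ω₁ → Ctb (rows-of β)
            rows-ctb p = ctb-Img fstᶠ (ctb-⋃Img qᶠ (elem (suc-mem p)) λ γ g → fin⇒ctb (Cl-fin (hq γ (proj₁ ord _ (suc-mem p) γ g))))
            yᶠ : Tm → Tm
            yᶠ β = fn₁ᶠ rows-of rows-T β ⊗ᶠ (sucᶠ β ∪ᶠ ! ⟪ ω₁ ⟫)
            Y : V
            Y = lam ω₁ yᶠ
            Y≈ : ∀ {β} → β ∈ ω₁ → Y · β ≈ rows-of β ⊗ (suc′ β ∪ ⟪ ω₁ ⟫)
            Y≈ = lam-β yᶠ
            Goal : Set ℓ
            Goal = ∃ λ γ → ∃ λ γ′ → γ ∈ ω₁ × γ′ ∈ ω₁ × γ ∈ γ′ × d · γ ∈ γ′ × q · γ ∪ q · γ′ ∈ Cl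
            inUP : ∀ {γ u} → γ ∈ ω₁ → u ∈ q · γ → u ∈ UP
            inUP p m = Cl-⊑U (hq _ p) _ m
            q⁺-tag : ∀ {γ u} → γ ∈ ω₁ → u ∈ q · γ → ⟨ fst u , ω₁ ⟩ ∈ q⁺ · γ
            q⁺-tag p m = ∈-congʳ (≈-sym (q⁺≈ p)) (∪ʳ (∈Img {tagᶠ} m))
            q⁺-in : ∀ {γ u} → γ ∈ ω₁ → u ∈ q · γ → u ∈ q⁺ · γ
            q⁺-in p m = ∈-congʳ (≈-sym (q⁺≈ p)) (∪ˡ m)
            -- Among the members of q⁺ γ, vertices are distinguished from tags by their second coordinate.
            q⁺-out : ∀ {γ u} → γ ∈ ω₁ → u ∈ UP → u ∈ q⁺ · γ → u ∈ q · γ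
            q⁺-out p uU m = [ (λ n → n) , (λ n → let w , a , e = Img⁻ n in
                ⊥-elim (∈-irrefl (∈-congˡ (≈-trans (≈-cong sndᶠ e) snd-β) (UP-snd uU)))) ]′ (∪⁻ (∈-congʳ (q⁺≈ p) m))
            Y-tag : ∀ {β γ u} → β ∈ ω₁ → γ ∈ suc′ β → u ∈ q · γ → ⟨ fst u , ω₁ ⟩ ∈ Y · β
            Y-tag p g m = ∈-congʳ (≈-sym (Y≈ p)) (⊗⁺ (from (rows-spec _ _) (_ , (_ , g , m) , ≈-refl)) (∪ʳ (⟪⟫⁺ ≈-refl)))
            Y-in : ∀ {β γ u v} → β ∈ ω₁ → γ ∈ suc′ β → u ∈ q · γ → v ∈ UP → fst v ≈ fst u → snd v ∈ suc′ β → v ∈ Y · β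
            Y-in p g m vU e l = ∈-congʳ (≈-sym (Y≈ p)) (∈-congˡ (≈-sym (UP-pair vU)) (⊗⁺ (from (rows-spec _ _) (_ , (_ , g , m) , e)) (∪ˡ l)))
            Y-row : ∀ {β z} → β ∈ ω₁ → z ∈ Y · β → ∃ λ u → (∃ λ γ → γ ∈ suc′ β × u ∈ q · γ) × fst z ≈ fst u
            Y-row p m = let x , y , a , b , e = ⊗⁻′ (∈-congʳ (Y≈ p) m); u , g , f = to (rows-spec _ _) a in u , g , ≈-trans (≈-cong fstᶠ e) (≈-trans fst-β f)

            from-root : (∃ λ r → ∃ λ T → T ⊑ ω₁ × (∀ ζ → ζ ∈ ω₁ → ∃ λ γ → γ ∈ T × ζ ∈ γ) × (∀ γ → γ ∈ T → Trace q⁺ Y γ r)) → Goal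
            from-root (r , T₀ , T₀⊑ , unb₀ , tr₀) = with-ρ (bounded (λ x → Sep⊑ {eᶠ}) E-ctb)
              where
                evᶠ : Tm → Tm
                evᶠ z = ! E ·ᶠ fstᶠ z ·ᶠ sndᶠ z
                Dom : V
                Dom = Img fstᶠ r
                eᶠ : Tm → Fm
                eᶠ x = x ∈ᶠ ! (Img evᶠ (Dom ⊗ Dom))
                Es : V
                Es = Sep eᶠ ω₁
                r-ctb : Ctb r
                r-ctb = let γ , p , _ = unb₀ ∅ 0∈ in ctb-⊑ (λ x m → proj₁ (to (tr₀ γ p x) m))
                  (≲-cong (≈-sym (q⁺≈ (T₀⊑ γ p))) ≈-refl (fin⇒ctb (fin-∪ (Cl-fin (hq γ (T₀⊑ γ p))) (Img-fin tagᶠ (Cl-fin (hq γ (T₀⊑ γ p)))))))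
                E-ctb : Ctb Es
                E-ctb = ctb-⊑ (λ x m → SepP {eᶠ} m) (ctb-Img evᶠ (ctb-⊗ (ctb-Img fstᶠ r-ctb) (ctb-Img fstᶠ r-ctb)))
                with-ρ : (∃ λ ρ → ρ ∈ ω₁ × (∀ x → x ∈ Es → x ∈ ρ)) → Goal
                -- `ρ` bounds the numbers that `E` assigns to one shared row among the predecessors
                -- of another; keeping only the indices beyond `ρ` makes the new vertices `Ordered`.
                with-ρ (ρ , ρ∈ , Es⊑) = finish (amalgamate T′ T⊑ unb Aᶠ hA e he d hd)
                  where
                    tᶠ : Tm → Fm
                    tᶠ γ = ! ρ ∈ᶠ γ
                    T′ : V
                    T′ = Sep tᶠ T₀
                    T⊑ : T′ ⊑ ω₁
                    T⊑ x m = T₀⊑ x (Sep⊑ {tᶠ} m)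
                    tr : ∀ γ → γ ∈ T′ → Trace q⁺ Y γ r
                    tr γ p = tr₀ γ (Sep⊑ {tᶠ} p)
                    unb : ∀ ζ → ζ ∈ ω₁ → ∃ λ γ → γ ∈ T′ × ζ ∈ γ
                    unb ζ p = let μ , μ∈ , a , b = max-mem p ρ∈; γ , g , l = unb₀ μ μ∈; tγ = proj₁ (⊑-ord (T₀⊑ γ g)) μ l in
                      γ , ∈Sep {tᶠ} g (tγ ρ b) , tγ ζ a
                    nᶠ : Tm → Tm → Fm
                    nᶠ γ u = ⟨ fstᶠ u , ! ω₁ ⟩ᶠ ∈ᶠ ! r ∧ᶠ ¬ᶠ (sndᶠ u ∈ᶠ γ)
                    New : V → V → Set ℓ
                    New γ u = u ∈ q · γ × ⟨ fst u , ω₁ ⟩ ∈ r × ¬ (snd u ∈ γ)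
                    N : V → V
                    N γ = Sep (λ u → nᶠ (! γ) u) (q · γ)
                    N-spec : ∀ {γ u} → u ∈ N γ ⇔ New γ u
                    N-spec {γ} = Sep-spec (λ u → nᶠ (! γ) u)
                    N-fin : ∀ {γ} → γ ∈ T′ → Finite (N γ)
                    N-fin p = fin-⊑ (λ u m → proj₁ (to N-spec m)) (Cl-fin (hq _ (T⊑ _ p)))
                    N-UP : ∀ {γ} → γ ∈ T′ → N γ ⊑ UP
                    N-UP p u m = inUP (T⊑ _ p) (proj₁ (to N-spec m))
                    Aᶠ : Tm → Tm → Fm
                    Aᶠ γ π = ∀ᶠ λ u → (u ∈ᶠ ! q ·ᶠ γ ∧ᶠ nᶠ γ u) ⇒ᶠ ∃ᶠ λ s → s ∈ᶠ π ∧ᶠ Halfᶠ s u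
                    A : V → V → Set ℓ
                    A γ π = ∀ u → New γ u → ∃ λ s → s ∈ π × Half s u
                    ordered : ∀ {γ} → γ ∈ T′ → Ordered (N γ)
                    ordered {γ} p u v m n l =
                      let uU = N-UP p u m; vU = N-UP p v n
                          inD = λ w (i : w ∈ N γ) → ∈-congˡ {y = Dom} fst-β (∈Img {fstᶠ} (proj₁ (proj₂ (to N-spec i))))
                          x∈ = proj₁ (E-inj (UP-fst vU)) (fst u) l
                          x∈ρ = Es⊑ _ (∈Sep {eᶠ} x∈ (from (Img-spec evᶠ) (⟨ fst v , fst u ⟩ , ⊗⁺ (inD v n) (inD u m) ,
                                  ·-cong (·-congʳ (≈-sym fst-β)) (≈-sym snd-β))))
                          γ⊑ = Ord-∉⇒⊑ (⊑-ord (UP-snd vU)) (⊑-ord (T⊑ γ p)) (proj₂ (proj₂ (to N-spec n)))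
                      in γ⊑ _ (proj₁ (⊑-ord (T⊑ γ p)) ρ (SepP {tᶠ} p) _ x∈ρ)
                    above : ∀ {γ u x} → γ ∈ T′ → u ∈ N γ → ¬ (x ∈ snd u) → ¬ (x ∈ γ)
                    above p m n l = n (Ord-∉⇒⊑ (⊑-ord (UP-snd (N-UP p _ m))) (⊑-ord (T⊑ _ p)) (proj₂ (proj₂ (to N-spec m))) _ l)
                    half-⊑ : ∀ {s u} → Half s u → s ⊑ pts (datum u)
                    half-⊑ (inj₁ e) x m = ∪ˡ (to (e x) m)
                    half-⊑ (inj₂ e) x m = ∪ʳ (to (e x) m)
                    half-𝔽 : ∀ {s u} → u ∈ UP → Half s u → s ∈ 𝔽 ω₁ × s ≲ k
                    half-𝔽 p (inj₁ e) = ∈-congˡ (≈-sym e) (S₁∈ (UP-data p)) , ≲-cong (≈-sym e) ≈-refl (proj₁ (S₁-size (UP-data p)))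
                    half-𝔽 p (inj₂ e) = ∈-congˡ (≈-sym e) (S₂∈ (UP-data p)) , ≲-cong (≈-sym e) ≈-refl (proj₁ (S₂-size (UP-data p)))
                    hA : ∀ γ → γ ∈ T′ → ∃ λ π → π ∈ Pat × Disjoint (⋃ π) γ × A γ π
                    hA γ p = pattern′ (assign (N γ) (N-fin p) (N-UP p) (ordered p) ∅ (λ x y m → ⊥-elim (∅⁻ m)))
                      where
                        pattern′ : (∃ λ π → Assignment (N γ) ∅ π) → ∃ λ π → π ∈ Pat × Disjoint (⋃ π) γ × A γ π
                        pattern′ (π , pf , a , b , c , _) = π ,
                          from (Pat-spec π) (𝔽⁺ (λ s m → let u , i , h = a s m in proj₁ (half-𝔽 (N-UP p u i) h)) pf ,
                            c , λ s m → let u , i , h = a s m in proj₂ (half-𝔽 (N-UP p u i) h)) ,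
                          (λ x m → let s , i , j = ⋃⁻ m; u , n , h = a s i in above p n (proj₁ (UP-high (N-UP p u n)) x (half-⊑ h x j))) ,
                          λ u n → b u (from N-spec n)
                    bᶠ : Tm → Tm
                    bᶠ u = Bᶠ (datumᶠ u)
                    eγ : V → V
                    eγ γ = Img bᶠ (N γ)
                    eγ-spec : ∀ z γ → z ∈ eγ γ ⇔ (∃ λ u → New γ u × z ≈ B (datum u))
                    eγ-spec z γ = mk⇔ (λ m → let u , n , f = Img⁻ m in u , to N-spec n , f) (λ (u , n , f) → from (Img-spec bᶠ) (u , from N-spec n , f))
                    abstract
                      eγ-T : T 1 (λ ρ → eγ (proj₁ ρ))
                      eγ-T = T₁-by eγ (λ z γ → ∃ᶠ λ u → (u ∈ᶠ ! q ·ᶠ γ ∧ᶠ nᶠ γ u) ∧ᶠ z ≈ᶠ Bᶠ (datumᶠ u)) eγ-spec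
                    e : V
                    e = lam ω₁ (fn₁ᶠ eγ eγ-T)
                    e≈ : ∀ {γ} → γ ∈ ω₁ → e · γ ≈ eγ γ
                    e≈ = lam-β (fn₁ᶠ eγ eγ-T)
                    he : ∀ γ → γ ∈ T′ → e · γ ∈ 𝔽 ω₁ × Disjoint (e · γ) γ
                    he γ p = 𝔽⁺ (λ x m → let u , n , f = member x m in ∈-congˡ (≈-sym f) (B∈ (UP-data (N-UP p u (from N-spec n)))))
                                (fin-resp (≈-sym (e≈ (T⊑ γ p))) (Img-fin bᶠ (N-fin p))) ,
                             λ x m l → let u , n , f = member x m; n′ = from N-spec n in above p n′ (proj₂ (UP-high (N-UP p u n′))) (∈-congˡ f l)
                      where
                        member : ∀ x → x ∈ e · γ → ∃ λ u → New γ u × x ≈ B (datum u)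
                        member x m = to (eγ-spec x γ) (∈-congʳ (e≈ (T⊑ γ p)) m)
                    finish : (∃ λ γ → ∃ λ γ′ → γ ∈ T′ × γ′ ∈ T′ × γ ∈ γ′ × d · γ ∈ γ′ × ∃ λ π → A γ π × (∀ b → b ∈ e · γ′ → π ⊑ 𝓕 · b)) → Goal
                    finish (γ , γ′ , p , p′ , l , l′ , π , a , g) =
                        γ , γ′ , γ∈ , γ′∈ , l , l′ , ∪-Cl ΓP-sym (hq γ γ∈) (hq γ′ γ′∈) cross
                      where
                        γ∈ = T⊑ γ p
                        γ′∈ = T⊑ γ′ p′
                        γ′-ord = ⊑-ord γ′∈
                        -- Membership in the root needs one `μ` below `δ` with `v` in `Y · μ`. The
                        -- larger of `β` and the level of `v` serves, because the row of `v` occurs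
                        -- by index `β`.
                        old-in-root : ∀ {δ ε u v β} → δ ∈ T′ → β ∈ δ → ε ∈ suc′ β → u ∈ q · ε → v ∈ q · δ → fst v ≈ fst u → snd v ∈ δ → v ∈ r
                        old-in-root {δ} {ε} {u} {v} {β} pδ b h m n f s = by (Ord-cmp oβ oσ)
                          where
                            δ∈ = T⊑ δ pδ
                            oδ = ⊑-ord δ∈
                            oβ = Ord-elem oδ b
                            oσ = Ord-elem oδ s
                            vU = inUP δ∈ n
                            mk : ∀ μ → μ ∈ δ → ε ∈ suc′ μ → snd v ∈ suc′ μ → v ∈ r
                            mk μ μ∈ h′ t = from (tr δ pδ v) (q⁺-in δ∈ n , μ , μ∈ , Y-in (proj₁ ord δ δ∈ μ μ∈) h′ m vU f t)
                            by : β ∈ snd v ⊎ β ≈ snd v ⊎ snd v ∈ β → v ∈ r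
                            by (inj₁ c) = mk (snd v) s ([ (λ i → suc⁺′ (proj₁ oσ β c ε i)) , (λ i → suc⁺′ (∈-congˡ (≈-sym i) c)) ]′ (suc⁻ h)) suc⁺
                            by (inj₂ (inj₁ c)) = mk β b h (from (suc-spec _ _) (inj₂ (≈-sym c)))
                            by (inj₂ (inj₂ c)) = mk β b h (suc⁺′ c)
                        cross : ∀ u v → u ∈ q · γ → v ∈ q · γ′ → u ≈ v ⊎ ⟨ u , v ⟩ ∈ ΓP
                        cross u v m n = by-row (em {fst u ≈ fst v})
                          where
                            uU = inUP γ∈ m
                            vU = inUP γ′∈ n
                            both : u ∈ q · γ′ ⊎ v ∈ q · γ → u ≈ v ⊎ ⟨ u , v ⟩ ∈ ΓP
                            both (inj₁ i) = Cl-clique (hq γ′ γ′∈) u v i n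
                            both (inj₂ i) = Cl-clique (hq γ γ∈) u v m i
                            by-row : Dec (fst u ≈ fst v) → u ≈ v ⊎ ⟨ u , v ⟩ ∈ ΓP
                            by-row (no ne) = inj₂ (ΓP⁺ uU vU (λ e → ⊥-elim (ne e)))
                            by-row (yes f) = levels (em {snd v ∈ γ′}) (em {snd u ∈ γ})
                              where
                                tag∈r : ⟨ fst v , ω₁ ⟩ ∈ r
                                tag∈r = from (tr γ′ p′ _) (q⁺-tag γ′∈ n , γ , l , ∈-congˡ (⟨⟩-cong f ≈-refl) (Y-tag γ∈ suc⁺ m))
                                tagu∈r : ⟨ fst u , ω₁ ⟩ ∈ r
                                tagu∈r = ∈-congˡ (⟨⟩-cong (≈-sym f) ≈-refl) tag∈r
                                levels : Dec (snd v ∈ γ′) → Dec (snd u ∈ γ) → u ≈ v ⊎ ⟨ u , v ⟩ ∈ ΓP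
                                levels (yes s) _ = both (inj₂ (q⁺-out γ∈ vU (proj₁ (to (tr γ p v) (old-in-root p′ l suc⁺ m n (≈-sym f) s)))))
                                levels (no _) (yes s) = both (inj₁ (q⁺-out γ′∈ uU (proj₁ (to (tr γ′ p′ u) inr))))
                                  where
                                    inr : u ∈ r
                                    -- The tag of the shared row lies in the root, hence in some
                                    -- `Y · β` with `β` below `γ`; so a condition with index below
                                    -- `γ` uses the row.
                                    inr = let _ , β , b , y = to (tr γ p _) tagu∈r
                                              w , (ε , h , i) , f′ = Y-row (proj₁ ord γ γ∈ β b) y
                                          in old-in-root p b h i m (≈-trans (≈-sym fst-β) f′) s
                                levels (no s) (no s′) = inj₂ (ΓP⁺ uU vU λ _ →
                                    let t , i , h = a u (m , tagu∈r , s′) in inj₁ (t , h , g _ (∈-congʳ (≈-sym (e≈ γ′∈)) (from (eγ-spec _ γ′) (v , (n , tag∈r , s) , ≈-refl))) t i))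

    open CatchingPoset public

    -- The colouring

    module Colourings where
      module Colouring (gch : GCH) (k : V) (k∈ω : k ∈ ω) (k≉∅ : ¬ Empty k) where
        open Amalgam gch k
        open CH gch
        open Isω₁ ω₁-isω₁

        private
          clsᶠ : Tm → Tm → Tm → Fm
          clsᶠ x b α = x ∈ᶠ ! ω₁ ∧ᶠ (x ≈ᶠ α ∨ᶠ ∃ᶠ λ s → s ∈ᶠ ! 𝓕 ·ᶠ b ∧ᶠ α ∈ᶠ s ∧ᶠ x ∈ᶠ s)
          cls₀ : V → V → V
          cls₀ b α = Sep (λ x → x ≈ᶠ ! α ∨ᶠ ∃ᶠ λ s → s ∈ᶠ ! 𝓕 ·ᶠ ! b ∧ᶠ ! α ∈ᶠ s ∧ᶠ x ∈ᶠ s) ω₁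
        abstract
          cls : V → V → V
          cls = cls₀
          cls-spec : ∀ b α x → x ∈ cls b α ⇔ (x ∈ ω₁ × (x ≈ α ⊎ ∃ λ s → s ∈ 𝓕 · b × α ∈ s × x ∈ s))
          cls-spec b α x = Sep-spec (λ x → x ≈ᶠ ! α ∨ᶠ ∃ᶠ λ s → s ∈ᶠ ! 𝓕 ·ᶠ ! b ∧ᶠ ! α ∈ᶠ s ∧ᶠ x ∈ᶠ s)
          cls-T : T 2 (λ ρ → cls (proj₁ ρ) (proj₁ (proj₂ ρ)))
          cls-T = T₂-by cls clsᶠ (λ x b α → cls-spec b α x)
          hue : V
          hue = proj₁ (𝔽≲ω₁ {ω₁} ≲-refl)
          hue-inj : Inj hue (𝔽 ω₁) ω₁
          hue-inj = proj₂ (𝔽≲ω₁ {ω₁} ≲-refl)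

        cls-self : ∀ {b α} → α ∈ ω₁ → α ∈ cls b α
        cls-self a = from (cls-spec _ _ _) (a , inj₁ ≈-refl)
        cls-fam : ∀ {b α s} → b ∈ ω₁ → s ∈ 𝓕 · b → α ∈ s → cls b α ≈ s
        cls-fam {b} {α} {s} p q a = ⊑-antisym
          (λ x m → [ (λ e → ∈-congˡ (≈-sym e) a) , (λ (t , r , c , d) → ∈-congʳ (≈-sym (proj₁ (𝓕-fam p) s t α q r a c)) d) ]′ (proj₂ (to (cls-spec b α x) m)))
          λ x m → from (cls-spec b α x) (proj₁ ord b p x (𝓕-⊑ p q x m) , inj₂ (s , q , a , m))
        cls-cases : ∀ {b α} → b ∈ ω₁ → α ∈ ω₁ → cls b α ≈ ⟪ α ⟫ ⊎ (∃ λ s → s ∈ 𝓕 · b × α ∈ s × cls b α ≈ s)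
        cls-cases {b} {α} p a = go (em {∃ λ s → s ∈ 𝓕 · b × α ∈ s})
          where
            go : Dec (∃ λ s → s ∈ 𝓕 · b × α ∈ s) → cls b α ≈ ⟪ α ⟫ ⊎ (∃ λ s → s ∈ 𝓕 · b × α ∈ s × cls b α ≈ s)
            go (yes (s , q , m)) = inj₂ (s , q , m , cls-fam p q m)
            go (no n) = inj₁ (⊑-antisym (λ x m → [ ⟪⟫⁺ , (λ (s , q , c , _) → ⊥-elim (n (s , q , c))) ]′ (proj₂ (to (cls-spec b α x) m)))
              λ x m → ∈-congˡ (≈-sym (⟪⟫⁻ m)) (cls-self a))
        cls-size : ∀ {b α} → b ∈ ω₁ → α ∈ ω₁ → cls b α ≲ k
        cls-size p a = [ (λ e → ≲-cong (≈-sym e) ≈-refl (≲-by (λ _ → ! z) (λ _ _ → z∈) λ x y q r _ → ≈-trans (⟪⟫⁻ q) (≈-sym (⟪⟫⁻ r)))) ,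
                         (λ (s , q , _ , e) → ≲-cong (≈-sym e) ≈-refl (proj₂ (𝓕-fam p) s q)) ]′ (cls-cases p a)
          where
            z∃ : ∃ λ z → z ∈ k
            z∃ = dne (λ n → k≉∅ λ z p → n (z , p))
            z = proj₁ z∃
            z∈ = proj₂ z∃
        cls-⊑ : ∀ {b α} → b ∈ ω₁ → α ∈ b → cls b α ⊑ b
        cls-⊑ {b} {α} p a x m = [ (λ e → ∈-congˡ (≈-sym e) a) , (λ (s , q , _ , c) → 𝓕-⊑ p q x c) ]′ (proj₂ (to (cls-spec b α x) m))

        -- The class of `α` lies below `b`, so `b` is the largest element of this set, which thus
        -- determines both the class and `b`.
        code : V → V → V
        code b α = cls b α ∪ ⟪ b ⟫
        codeᶠ : Tm → Tm → Tm
        codeᶠ b α = fn₂ᶠ cls cls-T b α ∪ᶠ ⟪ b ⟫ᶠ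
        code∈ : ∀ {b α} → b ∈ ω₁ → α ∈ b → code b α ∈ 𝔽 ω₁
        code∈ {b} {α} p a = 𝔽⁺ (λ x m → [ (λ m → proj₁ ord b p x (cls-⊑ p a x m)) , (λ m → ∈-congˡ (≈-sym (⟪⟫⁻ m)) p) ]′ (∪⁻ m))
          (fin-∪ (fin-sub (cls-size p (proj₁ ord b p α a)) (fin-nat k∈ω)) fin-⟪⟫)
        code-inj : ∀ {b α b′ α′} → b ∈ ω₁ → α ∈ b → b′ ∈ ω₁ → α′ ∈ b′ → hue · code b α ≈ hue · code b′ α′ → b ≈ b′ × cls b α ≈ cls b′ α′
        code-inj {b} {α} {b′} {α′} p a p′ a′ e = b≈ , ⊑-antisym (half p a b≈ e₀) (half p′ a′ (≈-sym b≈) (≈-sym e₀))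
          where
            e₀ : code b α ≈ code b′ α′
            e₀ = proj₂ hue-inj _ _ (code∈ p a) (code∈ p′ a′) e
            below : ∀ {b α b′ α′} → b′ ∈ ω₁ → α′ ∈ b′ → code b α ≈ code b′ α′ → b ∈ b′ ⊎ b ≈ b′
            below p′ a′ e = [ (λ m → inj₁ (cls-⊑ p′ a′ _ m)) , (λ m → inj₂ (⟪⟫⁻ m)) ]′ (∪⁻ (∈-congʳ e (∪ʳ (⟪⟫⁺ ≈-refl))))
            b≈ : b ≈ b′
            b≈ = [ (λ l → [ (λ l′ → ⊥-elim (∈-asym l l′)) , ≈-sym ]′ (below p a (≈-sym e₀))) , (λ e → e) ]′ (below p′ a′ e₀)
            half : ∀ {b α b′ α′} → b ∈ ω₁ → α ∈ b → b ≈ b′ → code b α ≈ code b′ α′ → cls b α ⊑ cls b′ α′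
            half p a f e x m = [ (λ m → m) , (λ n → ⊥-elim (∈-irrefl′ (≈-trans (⟪⟫⁻ n) (≈-sym f)) (cls-⊑ p a x m))) ]′ (∪⁻ (∈-congʳ e (∪ˡ m)))

        private
          Col : V → V → Set ℓ
          Col z ξ = ∃ λ α → ∃ λ b → α ∈ b × b ∈ ω₁ × z ≈ pair α b × ξ ≈ hue · code b α
          colᶠ : Tm → Tm → Fm
          colᶠ z ξ = ∃ᶠ λ α → ∃ᶠ λ b → α ∈ᶠ b ∧ᶠ b ∈ᶠ ! ω₁ ∧ᶠ z ≈ᶠ pairᶠ α b ∧ᶠ ξ ≈ᶠ ! hue ·ᶠ codeᶠ b α
          fᶠ : Tm → Fm
          fᶠ z = colᶠ (fstᶠ z) (sndᶠ z)
        abstract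
          f : V
          f = Sep fᶠ (𝒫 ω₁ ⊗ ω₁)
          f-spec₀ : ∀ z → z ∈ f ⇔ (z ∈ 𝒫 ω₁ ⊗ ω₁ × Col (fst z) (snd z))
          f-spec₀ z = Sep-spec fᶠ
        f-spec : ∀ z ξ → ⟨ z , ξ ⟩ ∈ f ⇔ Col z ξ
        f-spec z ξ = mk⇔
          (λ m → let _ , α , b , a , p , e , g = to (f-spec₀ _) m in α , b , a , p , ≈-trans (≈-sym fst-β) e , ≈-trans (≈-sym snd-β) g)
          λ (α , b , a , p , e , g) → from (f-spec₀ _) (⊗⁺
              (𝒫⁺ λ x m → [ (λ h → ∈-congˡ (≈-sym h) (proj₁ ord b p α a)) , (λ h → ∈-congˡ (≈-sym h) p) ]′ (pair⁻ (∈-congʳ e m)))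
              (∈-congˡ (≈-sym g) (proj₁ hue-inj _ (code∈ p a))) ,
            α , b , a , p , ≈-trans fst-β e , ≈-trans snd-β g)

        isColouring : IsColouring f ω₁ ω₁
        isColouring =
          (λ p m → let q , _ = to (f-spec₀ p) m; z , ξ , _ , ξ∈ , e = ⊗⁻′ q
                       α , b , a , b∈ , g , _ = to (f-spec z ξ) (∈-congˡ e m)
                   in z , ξ , (α , b , proj₁ ord b b∈ α a , b∈ , (λ h → ∈-irrefl′ h a) , from isPair⇔ g) , ξ∈ , from opair⇔ e) ,
          (λ z (α , b , a , b∈ , ne , e) → total z α b a b∈ ne (to isPair⇔ e)) ,
          λ z ξ ξ′ m m′ → let α , b , a , b∈ , e , g = to (f-spec z ξ) (to ⟨⟩∈⇔ m)
                              α′ , b′ , a′ , _ , e′ , g′ = to (f-spec z ξ′) (to ⟨⟩∈⇔ m′)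
                              u , v = pair-ordered a a′ (≈-trans (≈-sym e) e′)
                          in ≈-trans g (≈-trans (≈-cong (λ α → ! hue ·ᶠ codeᶠ (! b) α) u) (≈-trans (≈-cong (λ b → ! hue ·ᶠ codeᶠ b (! α′)) v) (≈-sym g′)))
          where
            total : ∀ z α b → α ∈ ω₁ → b ∈ ω₁ → ¬ (α ≈ b) → z ≈ pair α b → ∃ λ ξ → ⟨ z , ξ ⟩∈ f
            total z α b a b∈ ne e = [ (λ l → _ , from ⟨⟩∈⇔ (from (f-spec z _) (α , b , l , b∈ , e , ≈-refl))) ,
                [ (λ h → ⊥-elim (ne h)) , (λ l → _ , from ⟨⟩∈⇔ (from (f-spec z _) (b , α , l , a , ≈-trans e pair-comm , ≈-refl))) ]′ ]′
              (Ord-cmp (⊑-ord a) (⊑-ord b∈))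

        bounded-f : Bounded k f
        bounded-f ξ = go (em {∃ λ z → ⟨ z , ξ ⟩ ∈ f})
          where
            φᶠ : Tm → Fm
            φᶠ z = ⟨ z , ! ξ ⟩ᶠ ∈ᶠ ! f
            Fib : V
            Fib = Sep φᶠ (𝒫 ω₁)
            dom : ∀ z → fiber f ξ z ⇔ z ∈ Fib
            dom z = mk⇔ (λ m → ∈Sep {φᶠ} (proj₁ (⊗⁻ (proj₁ (to (f-spec₀ _) (to ⟨⟩∈⇔ m))))) (to ⟨⟩∈⇔ m)) (λ m → from ⟨⟩∈⇔ (SepP {φᶠ} m))
            go : Dec (∃ λ z → ⟨ z , ξ ⟩ ∈ f) → fiber f ξ ≼ ⌊ k ⌋
            go (no n) = ≼-by {Fib} {k} dom (λ _ p → p) (≲-by (λ x → x) (λ z m → ⊥-elim (n (z , SepP {φᶠ} m))) (λ z _ m → ⊥-elim (n (z , SepP {φᶠ} m))))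
            go (yes (z₀ , m₀)) = by (to (f-spec z₀ ξ) m₀)
              where
                by : Col z₀ ξ → fiber f ξ ≼ ⌊ k ⌋
                by (α₀ , b₀ , a₀ , p₀ , _ , g₀) = sized (cls-size p₀ (proj₁ ord b₀ p₀ α₀ a₀))
                  where
                    sized : cls b₀ α₀ ≲ k → fiber f ξ ≼ ⌊ k ⌋
                    sized (i , im , ii) = ≼-by {Fib} {k} dom (λ _ p → p) (≲-rel (λ z y → ∃ᶠ λ α → α ∈ᶠ ! cls b₀ α₀ ∧ᶠ z ≈ᶠ pairᶠ α (! b₀) ∧ᶠ y ≈ᶠ ! i ·ᶠ α)
                      (λ z m → let α , b , a , p , e , g = to (f-spec z ξ) (SepP {φᶠ} m)
                                   u , v = code-inj p a p₀ a₀ (≈-trans (≈-sym g) g₀)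
                                   α∈ = ∈-congʳ v (cls-self (proj₁ ord b p α a))
                               in i · α , im α α∈ , α , α∈ , ≈-trans e (≈-cong (pairᶠ (! α)) u) , ≈-refl)
                      λ z z′ y _ _ (α , m , e , g) (α′ , m′ , e′ , g′) →
                        ≈-trans e (≈-trans (≈-cong (λ α → pairᶠ α (! b₀)) (ii α α′ m m′ (≈-trans (≈-sym g) g′))) (≈-sym e′)))

        colour-constant : ∀ {b s α} → b ∈ ω₁ → s ∈ 𝓕 · b → α ∈ s → ⟨ pair α b , hue · (s ∪ ⟪ b ⟫) ⟩ ∈ f
        colour-constant {b} {s} {α} p q a = from (f-spec _ _) (α , b , 𝓕-⊑ p q α a , p , ≈-refl , ·-congʳ (∪-cong (≈-sym (cls-fam p q a)) ≈-refl))

        -- Equal colours have equal upper ordinals and equal classes, and a singleton class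
        -- determines its point. This is what makes the rows of a generic clique for Q rainbow.
        colour-singletons : ∀ {α b α′ b′ ξ} → α ∈ b → b ∈ ω₁ → α′ ∈ b′ → b′ ∈ ω₁ → ⟪ α ⟫ ∈ 𝓕 · b → ⟪ α′ ⟫ ∈ 𝓕 · b′ →
          ⟨ pair α b , ξ ⟩ ∈ f → ⟨ pair α′ b′ , ξ ⟩ ∈ f → α ≈ α′ × b ≈ b′
        colour-singletons {α} {b} {α′} {b′} a p a′ p′ s s′ m m′ =
          let α₁ , b₁ , a₁ , _ , e , g = to (f-spec _ _) m; α₂ , b₂ , a₂ , _ , e′ , g′ = to (f-spec _ _) m′
              u , v = pair-ordered a a₁ e; u′ , v′ = pair-ordered a′ a₂ e′
              same = ≈-trans (at u v) (≈-trans (≈-sym g) (≈-trans g′ (≈-sym (at u′ v′))))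
              b≈ , c≈ = code-inj p a p′ a′ same
          in ⟪⟫-inj (≈-trans (≈-sym (cls-fam p s (⟪⟫⁺ ≈-refl))) (≈-trans c≈ (cls-fam p′ s′ (⟪⟫⁺ ≈-refl)))) , b≈
          where
            at : ∀ {α b α₁ b₁} → α ≈ α₁ → b ≈ b₁ → hue · code b α ≈ hue · code b₁ α₁
            at {α} {b} {α₁} {b₁} u v = ≈-trans (≈-cong (λ α → ! hue ·ᶠ codeᶠ (! b) α) u) (≈-cong (λ b → ! hue ·ᶠ codeᶠ b (! α₁)) v)

    open Colourings public

    -- Rows that meet a named set uncountably often

    module GenericRows where
      module GenericRow (gch : GCH) (k : V) where
        open PPoset gch k public
        open Isω₁ ω₁-isω₁

        module _ (Y : V) where
          Witness : V → V → Set ℓ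
          Witness p d = ∃ λ p′ → ⟨ p′ , p ⟩ ∈ Le × ⟨ d , p′ ⟩ ∈ Y
          Witnessᶠ : Tm → Tm → Fm
          Witnessᶠ p d = ∃ᶠ λ p′ → ⟨ p′ , p ⟩ᶠ ∈ᶠ ! Le ∧ᶠ ⟨ d , p′ ⟩ᶠ ∈ᶠ ! Y
          -- `Y` plays the role of a name for a set of triples. Richness of the named set in the
          -- extension makes the conditions in the filter wide, and width of `p` is the richness, in
          -- the ground model, of the set of triples still possible below `p`.
          Wide : V → Set ℓ
          Wide p = ∀ C → Unbounded C → ∀ γ → γ ∈ ω₁ → ∃ λ d → d ∈ Data × Witness p d × High γ d × Spread C d
          Wideᶠ : Tm → Fm
          Wideᶠ p = ∀ᶠ λ C → Unboundedᶠ C ⇒ᶠ ∀ᶠ λ γ → γ ∈ᶠ ! ω₁ ⇒ᶠ ∃ᶠ λ d → d ∈ᶠ ! Data ∧ᶠ Witnessᶠ p d ∧ᶠ Highᶠ γ d ∧ᶠ Spreadᶠ C d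

          -- q forces the ξ-th row to meet the set named by Y unboundedly often, at vertices in the generic clique.
          Hits : V → V → Set ℓ
          Hits ξ q = ∀ ζ → ζ ∈ ω₁ → ∀ q′ → ⟨ q′ , q ⟩ ∈ Le → ∃ λ q″ → ⟨ q″ , q′ ⟩ ∈ Le × ∃ λ γ → γ ∈ ω₁ × ζ ∈ γ × ⟨ ξ , γ ⟩ ∈ q″ × ⟨ X · ξ · γ , q″ ⟩ ∈ Y
          Hitsᶠ : Tm → Tm → Fm
          Hitsᶠ ξ q = ∀ᶠ λ ζ → ζ ∈ᶠ ! ω₁ ⇒ᶠ ∀ᶠ λ q′ → ⟨ q′ , q ⟩ᶠ ∈ᶠ ! Le ⇒ᶠ ∃ᶠ λ q″ → ⟨ q″ , q′ ⟩ᶠ ∈ᶠ ! Le ∧ᶠ ∃ᶠ λ γ → γ ∈ᶠ ! ω₁ ∧ᶠ ζ ∈ᶠ γ ∧ᶠ ⟨ ξ , γ ⟩ᶠ ∈ᶠ q″ ∧ᶠ ⟨ ! X ·ᶠ ξ ·ᶠ γ , q″ ⟩ᶠ ∈ᶠ ! Y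
          Hit : V → Set ℓ
          Hit q = ∃ λ ξ → ξ ∈ ω₂ × Hits ξ q

          -- The conditions `c · d` chosen for the possible triples involve at most ω₁ rows, so some
          -- row outside `U` has exactly these triples as its supply. Its vertices can be added to
          -- the corresponding `c · d` without any new obligation, and `thick` gives one of the
          -- enlarged conditions that forces uncountably many of them into the filter.
          wide⇒hit : (∀ d p q → ⟨ d , p ⟩ ∈ Y → ⟨ q , p ⟩ ∈ Le → ⟨ d , q ⟩ ∈ Y) → ∀ {p} → p ∈ Cl → Wide p → ∃ λ q → ⟨ q , p ⟩ ∈ Le × Hit q
          wide⇒hit Y-down {p} p∈ wide = chosen (uniformizeᶠ (λ d p′ → ⟨ p′ , ! p ⟩ᶠ ∈ᶠ ! Le ∧ᶠ ⟨ d , p′ ⟩ᶠ ∈ᶠ ! Y) W Cl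
              (λ d m → let p′ , l , y = SepP {witᶠ} m in p′ , proj₁ (Le⁻ l) , l , y))
            where
              witᶠ : Tm → Fm
              witᶠ d = Witnessᶠ (! p) d
              W : V
              W = Sep witᶠ Data
              Goal : Set ℓ
              Goal = ∃ λ q → ⟨ q , p ⟩ ∈ Le × Hit q
              chosen : (∃ λ c → ∀ d → d ∈ W → c · d ∈ Cl × ⟨ c · d , p ⟩ ∈ Le × ⟨ d , c · d ⟩ ∈ Y) → Goal
              chosen (c , hc) = indexed (fresh-index {W} {U} (λ d → Sep⊑ {witᶠ}) U≲)
                where
                  cᶠ : Tm → Tm
                  cᶠ d = ! c ·ᶠ d
                  U : V
                  U = Img fstᶠ (⋃ (Img cᶠ W))
                  U≲ : U ≲ ω₁
                  U≲ = ≲-trans (≲-onto fstᶠ (λ y m → let u , i , e = Img⁻ m in u , i , ≈-sym e))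
                    (≲-trans (≲-⋃ {κ = ω₁} (≲-trans (≲-onto cᶠ (λ y m → let d , i , e = Img⁻ m in d , i , ≈-sym e)) (≲-trans (≲-⊑ (λ d → Sep⊑ {witᶠ})) Data≲ω₁))
                                (λ x m → let d , i , e = Img⁻ m in ≲-cong (≈-sym e) ≈-refl (fin⇒ctb (Cl-fin (proj₁ (hc d i))))))
                             (⊗≲ω₁ ≲-refl (≲-⊑ ω⊑)))
                  indexed : (∃ λ ξ → ξ ∈ ω₂ × ¬ (ξ ∈ U) × (∀ d → InW ξ d ⇔ d ∈ W)) → Goal
                  indexed (ξ , ξ∈ , new , inW) = caught (thick sc p⁺ (λ γ i → ∈-congˡ (≈-sym (p⁺≈ i)) (p⁺∈ i)))
                    where
                      large : Large ξ
                      large C un γ i = let d , d∈ , w , h , s = wide C un γ i in d , d∈ , from (inW d) (∈Sep {witᶠ} d∈ w) , h , s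
                      d : V → V
                      d γ = X · ξ · γ
                      d∈W : ∀ {γ} → γ ∈ ω₁ → d γ ∈ W
                      d∈W i = to (inW _) (proj₁ (proj₂ (X-next ξ∈ large i)))
                      pᶠ : Tm → Tm
                      pᶠ γ = (! c ·ᶠ (! X ·ᶠ ! ξ ·ᶠ γ)) ∪ᶠ ⟪ ⟨ ! ξ , γ ⟩ᶠ ⟫ᶠ
                      p⁺ : V
                      p⁺ = lam ω₁ pᶠ
                      p⁺≈ : ∀ {γ} → γ ∈ ω₁ → p⁺ · γ ≈ c · d γ ∪ ⟪ ⟨ ξ , γ ⟩ ⟫
                      p⁺≈ = lam-β pᶠ
                      p⁺∈ : ∀ {γ} → γ ∈ ω₁ → c · d γ ∪ ⟪ ⟨ ξ , γ ⟩ ⟫ ∈ Cl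
                      p⁺∈ {γ} i = ∪-Cl ΓP-sym c∈ (Cl⁺ (λ x m → ∈-congˡ (≈-sym (⟪⟫⁻ m)) v∈) fin-⟪⟫ (λ u v m m′ → inj₁ (≈-trans (⟪⟫⁻ m) (≈-sym (⟪⟫⁻ m′)))))
                          λ u v m m′ → inj₂ (ΓP⁺ (Cl-⊑U c∈ u m) (∈-congˡ (≈-sym (⟪⟫⁻ m′)) v∈) λ e → ⊥-elim (new (from (Img-spec fstᶠ)
                            (u , ⋃⁺ (∈Img {cᶠ} (d∈W i)) m , ≈-sym (≈-trans e (≈-trans (≈-cong fstᶠ (⟪⟫⁻ m′)) fst-β))))))
                        where
                          c∈ = proj₁ (hc _ (d∈W i))
                          v∈ = UP⁺ ξ∈ large i
                      part : ∀ {γ} → γ ∈ ω₁ → c · d γ ⊑ p⁺ · γ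
                      part i x m = ∈-congʳ (≈-sym (p⁺≈ i)) (∪ˡ m)
                      caught : (∃ λ γ → γ ∈ ω₁ × (∀ q → q ∈ Cl → p⁺ · γ ⊑ q → ∀ ζ → ζ ∈ ω₁ → ∃ λ γ′ → γ′ ∈ ω₁ × ζ ∈ γ′ × q ∪ p⁺ · γ′ ∈ Cl)) → Goal
                      caught (γ , i , h) = q , Le⁺ q∈ p∈ (λ x m → part i x (proj₂ (proj₂ (Le⁻ (proj₁ (proj₂ (hc _ (d∈W i)))))) x m)) , ξ , ξ∈ , hits
                        where
                          q = p⁺ · γ
                          q∈ : q ∈ Cl
                          q∈ = ∈-congˡ (≈-sym (p⁺≈ i)) (p⁺∈ i)
                          hits : Hits ξ q
                          hits ζ ζ∈ q′ l = let q′∈ , _ , s = Le⁻ l; γ′ , i′ , j , r = h q′ q′∈ s ζ ζ∈ in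
                            q′ ∪ p⁺ · γ′ , Le⁺ r q′∈ (λ x → ∪ˡ) , γ′ , i′ , j , ∪ʳ (∈-congʳ (≈-sym (p⁺≈ i′)) (∪ʳ (⟪⟫⁺ ≈-refl))) ,
                            Y-down _ _ _ (proj₂ (proj₂ (hc _ (d∈W i′)))) (Le⁺ r (proj₁ (hc _ (d∈W i′))) (λ x m → ∪ʳ (part i′ x m)))

    open GenericRows public

  -- Absoluteness between a model and a transitive extension

  module Embedding {ℓ} (em : ExcludedMiddle ℓ) (M N : Model ℓ) (ι : Model.Carrier M → Model.Carrier N)
    (preserves  : ∀ x y → Model._∈_ M x y → Model._∈_ N (ι x) (ι y))
    (reflects   : ∀ x y → Model._∈_ N (ι x) (ι y) → Model._∈_ M x y)
    (transitive : ∀ x y → Model._∈_ N y (ι x) → ∃ λ x′ → Model._≈_ N y (ι x′)) where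

    module M = SetTheory em M
    module N = SetTheory em N
    open N using (_∈_; _≈_; ≈-sym; ≈-trans; ≈-refl; ∈-congˡ; ∈-congʳ; ≈-cong; ⟨_,_⟩)
    private
      VM = M.V
      VN = N.V

    ∈ι : ∀ {x y} → y ∈ ι x → ∃ λ x′ → x′ M.∈ x × y ≈ ι x′
    ∈ι {x} {y} p = let x′ , e = transitive x y p in x′ , reflects x′ x (∈-congˡ e p) , e

    ι-cong : ∀ {x y} → x M.≈ y → ι x ≈ ι y
    ι-cong {x} {y} e = N.⊑-antisym (λ z p → let x′ , q , f = ∈ι p in ∈-congˡ (≈-sym f) (preserves _ _ (to (e x′) q)))
                                   (λ z p → let x′ , q , f = ∈ι p in ∈-congˡ (≈-sym f) (preserves _ _ (from (e x′) q)))
    ι-inj : ∀ {x y} → ι x ≈ ι y → x M.≈ y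
    ι-inj e z = mk⇔ (λ p → reflects _ _ (to (e (ι z)) (preserves _ _ p))) (λ p → reflects _ _ (from (e (ι z)) (preserves _ _ p)))

    ι-ext : ∀ {a B} → (∀ x → x M.∈ a → ι x ∈ B) → (∀ z → z ∈ B → ∃ λ x → x M.∈ a × z ≈ ι x) → ι a ≈ B
    ι-ext h k = N.⊑-antisym (λ z p → let x , q , e = ∈ι p in ∈-congˡ (≈-sym e) (h x q))
                            (λ z p → let x , q , e = k z p in ∈-congˡ (≈-sym e) (preserves _ _ q))

    ι-⊑ : ∀ {x y} → x M.⊑ y → ι x N.⊑ ι y
    ι-⊑ s z p = let x , q , e = ∈ι p in ∈-congˡ (≈-sym e) (preserves _ _ (s x q))

    ι-∅ : ι M.∅ ≈ N.∅
    ι-∅ = ι-ext (λ x p → ⊥-elim (M.∅⁻ p)) (λ z p → ⊥-elim (N.∅⁻ p))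
    ι-pair : ∀ {x y} → ι (M.pair x y) ≈ N.pair (ι x) (ι y)
    ι-pair = ι-ext (λ z p → from (N.pair-spec _ _ _) ([ (λ e → inj₁ (ι-cong e)) , (λ e → inj₂ (ι-cong e)) ]′ (M.pair⁻ p)))
                   (λ z p → [ (λ e → _ , M.pairˡ , e) , (λ e → _ , M.pairʳ , e) ]′ (N.pair⁻ p))
    ι-⟪⟫ : ∀ {x} → ι M.⟪ x ⟫ ≈ N.⟪ ι x ⟫
    ι-⟪⟫ = ι-ext (λ z p → N.⟪⟫⁺ (ι-cong (M.⟪⟫⁻ p))) (λ z p → _ , M.⟪⟫⁺ M.≈-refl , N.⟪⟫⁻ p)
    ι-⟨⟩ : ∀ {x y} → ι M.⟨ x , y ⟩ ≈ ⟨ ι x , ι y ⟩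
    ι-⟨⟩ {x} {y} = ι-ext
      (λ z p → from (N.⟨,⟩-spec _ _ _) ([ (λ e → inj₁ (≈-trans (ι-cong e) ι-⟪⟫)) , (λ e → inj₂ (≈-trans (ι-cong e) ι-pair)) ]′ (to (M.⟨,⟩-spec _ _ _) p)))
      (λ z p → [ (λ e → _ , from (M.⟨,⟩-spec _ _ _) (inj₁ M.≈-refl) , ≈-trans e (≈-sym ι-⟪⟫)) ,
                 (λ e → _ , from (M.⟨,⟩-spec _ _ _) (inj₂ M.≈-refl) , ≈-trans e (≈-sym ι-pair)) ]′ (to (N.⟨,⟩-spec _ _ _) p))
    ι-suc : ∀ {x} → ι (M.suc′ x) ≈ N.suc′ (ι x)
    ι-suc = ι-ext (λ z p → [ (λ q → N.suc⁺′ (preserves _ _ q)) , (λ e → from (N.suc-spec _ _) (inj₂ (ι-cong e))) ]′ (M.suc⁻ p))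
                  (λ z p → [ (λ q → let x , r , e = ∈ι q in x , M.suc⁺′ r , e) , (λ e → _ , M.suc⁺ , e) ]′ (N.suc⁻ p))

    ⟨⟩∈ι : ∀ {f x y} → ⟨ x , y ⟩ ∈ ι f → ∃ λ x′ → ∃ λ y′ → M.⟨ x′ , y′ ⟩ M.∈ f × x ≈ ι x′ × y ≈ ι y′
    ⟨⟩∈ι {f} {x} {y} p =
      let z , q , e = ∈ι p
          w₁ , r₁ , s₁ = N.⋃⁻ (N.∈⋃⟨⟩ˡ {x} {y})
          w₂ , r₂ , s₂ = N.⋃⁻ (N.∈⋃⟨⟩ʳ {x} {y})
          w₁′ , _ , e₁ = ∈ι (∈-congʳ e r₁)
          w₂′ , _ , e₂ = ∈ι (∈-congʳ e r₂)
          x′ , _ , ex = ∈ι (∈-congʳ e₁ s₁)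
          y′ , _ , ey = ∈ι (∈-congʳ e₂ s₂)
      in x′ , y′ , reflects _ _ (∈-congˡ (≈-trans (N.⟨⟩-cong ex ey) (≈-sym ι-⟨⟩)) p) , ex , ey

    ι⟨⟩⁺ : ∀ {f x y} → M.⟨ x , y ⟩ M.∈ f → ⟨ ι x , ι y ⟩ ∈ ι f
    ι⟨⟩⁺ p = ∈-congˡ ι-⟨⟩ (preserves _ _ p)
    ι⟨⟩⁻ : ∀ {f x y} → ⟨ ι x , ι y ⟩ ∈ ι f → M.⟨ x , y ⟩ M.∈ f
    ι⟨⟩⁻ p = reflects _ _ (∈-congˡ (≈-sym ι-⟨⟩) p)

    ι-· : ∀ {f x} → ι (f M.· x) ≈ ι f N.· ι x
    ι-· {f} {x} = ι-ext (λ z p → let y , q , r = to (M.·-spec f x z) p in from (N.·-spec _ _ _) (ι y , ι⟨⟩⁺ q , preserves _ _ r))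
      (λ z p → let y , q , r = to (N.·-spec _ _ _) p; x′ , y′ , q′ , e , e′ = ⟨⟩∈ι q; z′ , r′ , e″ = ∈ι (∈-congʳ e′ r) in
         z′ , from (M.·-spec f x z′) (y′ , M.∈-congˡ (M.⟨⟩-cong (M.≈-sym (ι-inj e)) M.≈-refl) q′ , r′) , e″)

    ι-Inj : ∀ {f A B} → M.Inj f A B → N.Inj (ι f) (ι A) (ι B)
    ι-Inj (m , i) = (λ x p → let x′ , q , e = ∈ι p in ∈-congˡ (≈-trans ι-· (N.·-congʳ (≈-sym e))) (preserves _ _ (m x′ q))) ,
      λ x y p q e → let x′ , p′ , f = ∈ι p; y′ , q′ , g = ∈ι q in
        ≈-trans f (≈-trans (ι-cong (i x′ y′ p′ q′ (ι-inj (≈-trans ι-· (≈-trans (N.·-congʳ (≈-sym f)) (≈-trans e (≈-trans (N.·-congʳ g) (≈-sym ι-·)))))))) (≈-sym g))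
    ι-≲ : ∀ {A B} → A M.≲ B → ι A N.≲ ι B
    ι-≲ (f , i) = ι f , ι-Inj i

    ι-Ord : ∀ {α} → M.Ord α → N.Ord (ι α)
    ι-Ord (tr , c) = (λ y p z q → let y′ , p′ , e = ∈ι p; z′ , q′ , f = ∈ι (∈-congʳ e q) in ∈-congˡ (≈-sym f) (preserves _ _ (tr y′ p′ z′ q′))) ,
      λ y z p q → let y′ , p′ , e = ∈ι p; z′ , q′ , f = ∈ι q in
        [ (λ l → inj₁ (N.∈-resp (≈-sym e) (≈-sym f) (preserves _ _ l))) ,
          [ (λ l → inj₂ (inj₁ (≈-trans e (≈-trans (ι-cong l) (≈-sym f))))) , (λ l → inj₂ (inj₂ (N.∈-resp (≈-sym f) (≈-sym e) (preserves _ _ l)))) ]′ ]′ (c y′ z′ p′ q′)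

    ι-ω : ι M.ω ≈ N.ω
    ι-ω = N.⊑-antisym (λ z p → N.∈-ind (λ z → z N.∈ᶠ N.! N.ω) (ι M.ω) step z p)
            (N.ω-least (ι M.ω) (∈-congˡ ι-∅ (preserves _ _ M.0∈ω))
              (λ y p → let n , q , e = ∈ι p in ∈-congˡ (≈-trans ι-suc (N.suc-cong (≈-sym e))) (preserves _ _ (M.suc∈ω q))))
      where
        step : ∀ z → z ∈ ι M.ω → (∀ y → y ∈ z → y ∈ ι M.ω → y ∈ N.ω) → z ∈ N.ω
        step z p ih = let n , q , e = ∈ι p in
          [ (λ f → ∈-congˡ (≈-sym (≈-trans e (≈-trans (ι-cong f) ι-∅))) N.0∈ω) ,
            (λ (m , r , f) → ∈-congˡ (≈-sym (≈-trans e (≈-trans (ι-cong f) ι-suc)))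
               (N.suc∈ω (ih (ι m) (∈-congʳ (≈-sym (≈-trans e (≈-trans (ι-cong f) ι-suc))) N.suc⁺) (preserves _ _ r)))) ]′ (M.ω-cases n q)

    ι-Ctb : ∀ {x} → M.Ctb x → N.Ctb (ι x)
    ι-Ctb h = N.≲-cong ≈-refl ι-ω (ι-≲ h)

    ι-Isω₁ : ∀ {w} → M.Isω₁ w → ¬ N.Ctb (ι w) → N.Isω₁ (ι w)
    ι-Isω₁ h n = record { ord = ι-Ord (M.Isω₁.ord h)
                        ; elem = λ p → let x , q , e = ∈ι p in N.≲-cong (≈-sym e) ≈-refl (ι-Ctb (M.Isω₁.elem h q))
                        ; unctb = n }

    ι-IsColouring : ∀ {f X C} → M.IsColouring f X C → N.IsColouring (ι f) (ι X) (ι C)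
    ι-IsColouring {f} {X} {C} (dom , total , unique) =
      (λ p m → let p′ , m′ , e = ∈ι m; z , ξ , z∈ , ξ∈ , o = dom p′ m′ in
         ι z , ι ξ , up z∈ , preserves _ _ ξ∈ , from N.opair⇔ (≈-trans e (≈-trans (ι-cong (to M.opair⇔ o)) ι-⟨⟩))) ,
      (λ z h → let z′ , h′ , e = down h; ξ , m = total z′ h′ in ι ξ , from N.⟨⟩∈⇔ (∈-congˡ (N.⟨⟩-cong (≈-sym e) ≈-refl) (ι⟨⟩⁺ (to M.⟨⟩∈⇔ m)))) ,
      λ z ξ ξ′ m m′ → let z₁ , ξ₁ , m₁ , e , g = ⟨⟩∈ι (to N.⟨⟩∈⇔ m); z₂ , ξ₂ , m₂ , e′ , g′ = ⟨⟩∈ι (to N.⟨⟩∈⇔ m′)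
                          u = unique z₁ ξ₁ ξ₂ (from M.⟨⟩∈⇔ m₁) (from M.⟨⟩∈⇔ (M.∈-congˡ (M.⟨⟩-cong (ι-inj (≈-trans (≈-sym e′) e)) M.≈-refl) m₂))
                      in ≈-trans g (≈-trans (ι-cong u) (≈-sym g′))
      where
        up : ∀ {z} → M.[ X ]² z → N.[ ι X ]² (ι z)
        up (α , β , a , b , ne , e) = ι α , ι β , preserves _ _ a , preserves _ _ b , (λ g → ne (ι-inj g)) , from N.isPair⇔ (≈-trans (ι-cong (to M.isPair⇔ e)) ι-pair)
        down : ∀ {z} → N.[ ι X ]² z → ∃ λ z′ → M.[ X ]² z′ × z ≈ ι z′
        down (α , β , a , b , ne , e) = let α′ , a′ , g = ∈ι a; β′ , b′ , h = ∈ι b in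
          M.pair α′ β′ , (α′ , β′ , a′ , b′ , (λ i → ne (≈-trans g (≈-trans (ι-cong i) (≈-sym h)))) , from M.isPair⇔ M.≈-refl) ,
          ≈-trans (to N.isPair⇔ e) (≈-trans (N.pair-cong g h) (≈-sym ι-pair))

    ι-Bounded : ∀ {k f} → M.Bounded k f → N.Bounded (ι k) (ι f)
    ι-Bounded {k} {f} h c = go (em {∃ λ z → ⟨ z , c ⟩ ∈ ι f})
      where
        go : Dec (∃ λ z → ⟨ z , c ⟩ ∈ ι f) → N.fiber (ι f) c N.≼ N.⌊ ι k ⌋
        -- A set of the extension that is not in the range of the colouring has an empty fibre,
        -- whether or not it comes from the ground model.
        go (no n) = N.≼-by {N.∅} {ι k} (λ z → mk⇔ (λ m → ⊥-elim (n (z , to N.⟨⟩∈⇔ m))) (λ m → ⊥-elim (N.∅⁻ m))) (λ _ p → p)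
                      (N.≲-⊑ λ z m → ⊥-elim (N.∅⁻ m))
        go (yes (z₀ , m₀)) = let _ , ξ , _ , _ , g = ⟨⟩∈ι m₀ in at ξ g
          where
            at : ∀ ξ → c ≈ ι ξ → N.fiber (ι f) c N.≼ N.⌊ ι k ⌋
            at ξ g = N.≼-by {ι Fib} {ι k} dom (λ _ p → p) (ι-≲ (M.≲-by-≼ (λ z m → from M.⟨⟩∈⇔ (M.SepP {φᶠ} m)) (h ξ)))
              where
                φᶠ : M.Tm → M.Fm
                φᶠ z = M.⟨ z , M.! ξ ⟩ᶠ M.∈ᶠ M.! f
                Fib : VM
                Fib = M.Sep φᶠ (M.⋃ (M.⋃ f))
                dom : ∀ z → N.fiber (ι f) c z ⇔ z ∈ ι Fib
                dom z = mk⇔ (λ m → let z′ , ξ′ , m′ , e , g′ = ⟨⟩∈ι (to N.⟨⟩∈⇔ m)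
                                       m″ = M.∈-congˡ (M.⟨⟩-cong M.≈-refl (ι-inj (≈-trans (≈-sym g′) g))) m′
                                       w , a , b = M.⋃⁻ (M.∈⋃⟨⟩ˡ {z′} {ξ})
                                   in ∈-congˡ (≈-sym e) (preserves _ _ (M.∈Sep {φᶠ} (M.⋃⁺ (M.⋃⁺ m″ a) b) m″)))
                            (λ m → let z′ , m′ , e = ∈ι m in from N.⟨⟩∈⇔ (∈-congˡ (N.⟨⟩-cong (≈-sym e) (≈-sym g)) (ι⟨⟩⁺ (M.SepP {φᶠ} m′))))

    -- Finite ground-model subsets of a set in the extension

    module SpreadSubsets where
      open M using (V; _≲_; ω; ω₁; 𝔽; 𝔽⁺; 𝔽⁻; Disjoint; ∅; ∅⁻; _∪_; ∪⁻; ⟪_⟫; ⟪⟫⁻; suc′; ∈-irrefl′; ∈-asym; fin-∅; fin-∪; fin-⟪⟫;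
        add-≲; ≲-add; ≲-refl; Isω₁; ω₁-isω₁; Tm; Fm; ⊗⁻; ⊗⁺; _⊗_; Sep; _⊑_)
      open Isω₁ ω₁-isω₁

      module _ (C : V) (C⊑ : C ⊑ ω₁) (C-unb : ∀ ζ → ζ M.∈ ω₁ → ∃ λ c → c M.∈ C × ζ M.∈ c)
               (A : N.V) (A-unb : ∀ δ → δ M.∈ ω₁ → ∃ λ a → a M.∈ ω₁ × δ M.∈ a × ι a N.∈ A) where
        open M using (_∈ᶠ_; _∧ᶠ_; _⇒ᶠ_; ∀ᶠ; ∃ᶠ; !_; ¬ᶠ; _≲ᶠ_; ⟨_,_⟩ᶠ; fstᶠ; sndᶠ)
        Good : V → V → V → Set ℓ
        Good n δ s = s ≲ n × n ≲ s × (∀ x y → x M.∈ s → y M.∈ s → x M.∈ y → ∃ λ c → c M.∈ C × x M.∈ c × ¬ (y M.∈ c)) × Disjoint s δ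
        private
          goodᶠ : Tm → Tm → Tm → Fm
          goodᶠ n δ s = s ≲ᶠ n ∧ᶠ n ≲ᶠ s ∧ᶠ (∀ᶠ λ x → ∀ᶠ λ y → x ∈ᶠ s ⇒ᶠ y ∈ᶠ s ⇒ᶠ x ∈ᶠ y ⇒ᶠ ∃ᶠ λ c → c ∈ᶠ ! C ∧ᶠ x ∈ᶠ c ∧ᶠ ¬ᶠ (y ∈ᶠ c)) ∧ᶠ
                           (∀ᶠ λ z → z ∈ᶠ s ⇒ᶠ ¬ᶠ (z ∈ᶠ δ))
          good! : Tm → Tm → Tm → Fm
          good! = M.rel₃ᶠ Good (M.D₃ goodᶠ)
          qᶠ : Tm → Fm
          qᶠ z = good! (fstᶠ (fstᶠ z)) (sndᶠ (fstᶠ z)) (sndᶠ z)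
          abstract
            -- Packing `Good` into a set of the ground model lets the extension, which alone knows
            -- `A`, speak of it in the induction on `n`.
            Q : V
            Q = Sep qᶠ ((ω ⊗ ω₁) ⊗ 𝔽 ω₁)
            Q-spec : ∀ z → z M.∈ Q ⇔ (z M.∈ (ω ⊗ ω₁) ⊗ 𝔽 ω₁ × Good (M.fst (M.fst z)) (M.snd (M.fst z)) (M.snd z))
            Q-spec z = M.Sep-spec qᶠ
          Good-resp : ∀ {n δ s n′ δ′ s′} → n M.≈ n′ → δ M.≈ δ′ → s M.≈ s′ → Good n δ s → Good n′ δ′ s′
          Good-resp {n} {δ} {s} {n′} {δ′} e f g h = M.≈-subst (λ s → good! (! n′) (! δ′) s) g (M.≈-subst (λ δ → good! (! n′) δ (! s)) f (M.≈-subst (λ n → good! n (! δ) (! s)) e h))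
          e₁ : ∀ {n δ s} → M.fst (M.fst M.⟨ M.⟨ n , δ ⟩ , s ⟩) M.≈ n
          e₁ = M.≈-trans (M.≈-cong fstᶠ M.fst-β) M.fst-β
          e₂ : ∀ {n δ s} → M.snd (M.fst M.⟨ M.⟨ n , δ ⟩ , s ⟩) M.≈ δ
          e₂ = M.≈-trans (M.≈-cong sndᶠ M.fst-β) M.snd-β
          Q⁺ : ∀ {n δ s} → n M.∈ ω → δ M.∈ ω₁ → s M.∈ 𝔽 ω₁ → Good n δ s → M.⟨ M.⟨ n , δ ⟩ , s ⟩ M.∈ Q
          Q⁺ a b c h = from (Q-spec _) (⊗⁺ (⊗⁺ a b) c , Good-resp (M.≈-sym e₁) (M.≈-sym e₂) (M.≈-sym M.snd-β) h)
          Q⁻ : ∀ {n δ s} → M.⟨ M.⟨ n , δ ⟩ , s ⟩ M.∈ Q → s M.∈ 𝔽 ω₁ × Good n δ s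
          Q⁻ h = let a , b = to (Q-spec _) h in proj₂ (⊗⁻ a) , Good-resp e₁ e₂ M.snd-β b

          Found : V → Set ℓ
          Found n = ∀ δ → δ M.∈ ω₁ → ∃ λ s → M.⟨ M.⟨ n , δ ⟩ , s ⟩ M.∈ Q × ι s N.⊑ A
          FoundN : N.V → Set ℓ
          FoundN n = ∀ δ → δ N.∈ ι ω₁ → ∃ λ s → N.⟨ N.⟨ n , δ ⟩ , s ⟩ N.∈ ι Q × s N.⊑ A
          foundᶠ : N.Tm → N.Fm
          foundᶠ n = N.∀ᶠ λ δ → δ N.∈ᶠ N.! (ι ω₁) N.⇒ᶠ N.∃ᶠ λ s → N.⟨ N.⟨ n , δ ⟩ᶠ , s ⟩ᶠ N.∈ᶠ N.! (ι Q) N.∧ᶠ s N.⊑ᶠ N.! A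
          up : ∀ {n} → Found n → FoundN (ι n)
          up {n} h δ d = let δ′ , d′ , e = ∈ι d; s , q , a = h δ′ d′ in
            ι s , N.∈-congˡ (N.≈-trans ι-⟨⟩ (N.⟨⟩-cong (N.≈-trans ι-⟨⟩ (N.⟨⟩-cong N.≈-refl (N.≈-sym e))) N.≈-refl)) (preserves _ _ q) , a
          down : ∀ {n m} → m N.≈ ι n → FoundN m → Found n
          down {n} e h δ d = let s , q , a = h (ι δ) (preserves _ _ d); z , s′ , q′ , f , g = ⟨⟩∈ι q in
            s′ , M.∈-congˡ (M.⟨⟩-cong (ι-inj (N.≈-trans (N.≈-sym f) (N.≈-trans (N.⟨⟩-cong e N.≈-refl) (N.≈-sym ι-⟨⟩)))) M.≈-refl) q′ , λ z m → a z (N.∈-congʳ (N.≈-sym g) m)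

          base : Found ∅
          base δ d = ∅ , Q⁺ M.0∈ω d (𝔽⁺ (λ x m → ⊥-elim (∅⁻ m)) fin-∅) (≲-refl , ≲-refl , (λ x y m → ⊥-elim (∅⁻ m)) , λ x m → ⊥-elim (∅⁻ m)) ,
            λ z m → let x , i , _ = ∈ι m in ⊥-elim (∅⁻ i)
          step : ∀ n → n M.∈ ω → Found n → Found (suc′ n)
          step n n∈ ih δ d =
            -- The new point is added at the bottom: `a` above `δ`, a separating `c` above `a`, and
            -- the smaller set above `c`.
            let a , a∈ , δ∈a , aA = A-unb δ d
                c , c∈ , a∈c = C-unb a a∈
                s , q , sA = ih c (C⊑ c c∈)
                s∈ , l , l′ , spr , dis = Q⁻ q
                oc = ⊑-ord (C⊑ c c∈)
                above : ∀ x → x M.∈ s → ¬ (x M.∈ a)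
                above x m i = dis x m (proj₁ oc a a∈c x i)
                a∉s : ¬ (a M.∈ s)
                a∉s m = dis a m a∈c
                t = s ∪ ⟪ a ⟫
                spread : ∀ x y → x M.∈ t → y M.∈ t → x M.∈ y → ∃ λ c → c M.∈ C × x M.∈ c × ¬ (y M.∈ c)
                spread x y m m′ i =
                  [ (λ m → [ (λ m′ → spr x y m m′ i) , (λ m′ → ⊥-elim (above x m (M.∈-congʳ (⟪⟫⁻ m′) i))) ]′ (∪⁻ m′)) ,
                    (λ m → [ (λ m′ → c , c∈ , M.∈-congˡ (M.≈-sym (⟪⟫⁻ m)) a∈c , dis y m′) , (λ m′ → ⊥-elim (∈-irrefl′ (M.≈-trans (⟪⟫⁻ m) (M.≈-sym (⟪⟫⁻ m′))) i)) ]′ (∪⁻ m′)) ]′ (∪⁻ m)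
                disj : Disjoint t δ
                disj x m i = [ (λ m → above x m (proj₁ (⊑-ord a∈) δ δ∈a x i)) , (λ m → ∈-asym (M.∈-congˡ (⟪⟫⁻ m) i) δ∈a) ]′ (∪⁻ m)
            in t , Q⁺ (M.suc∈ω n∈) d (𝔽⁺ (λ x m → [ proj₁ (𝔽⁻ s∈) x , (λ m → M.∈-congˡ (M.≈-sym (⟪⟫⁻ m)) a∈) ]′ (∪⁻ m)) (fin-∪ (proj₂ (𝔽⁻ s∈)) fin-⟪⟫))
                     (≲-add l , add-≲ l′ a∉s , spread , disj) ,
               λ z m → let x , i , e = ∈ι m in [ (λ i → sA z (N.∈-congˡ (N.≈-sym e) (preserves _ _ i))) ,
                                                 (λ i → N.∈-congˡ (N.≈-sym (N.≈-trans e (ι-cong (⟪⟫⁻ i)))) aA) ]′ (∪⁻ i)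

        spread-subset : ∀ {n δ} → n M.∈ ω → δ M.∈ ω₁ → ∃ λ s → s M.∈ 𝔽 ω₁ × Good n δ s × ι s N.⊑ A
        spread-subset {n} {δ} n∈ d = let s , q , a = down N.≈-refl (N.ω-ind foundᶠ (up′ base) stepN (ι n) (N.∈-congʳ ι-ω (preserves _ _ n∈))) δ d
                                         s∈ , g = Q⁻ q in s , s∈ , g , a
          where
            up′ : Found ∅ → FoundN N.∅
            up′ h = N.≈-subst foundᶠ ι-∅ (up h)
            stepN : ∀ m → m N.∈ N.ω → FoundN m → FoundN (N.suc′ m)
            stepN m m∈ h = let n , n∈ , e = ∈ι (N.∈-congʳ (N.≈-sym ι-ω) m∈) in
              N.≈-subst foundᶠ (N.≈-trans ι-suc (N.suc-cong (N.≈-sym e))) (up (step n n∈ (down e h)))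

  -- Generic filters, names and a truth lemma

  module GenericNames {ℓ} (em : ExcludedMiddle ℓ) (M : Model ℓ) (P L : Model.Carrier M) (poset : Model.IsPoset M P L)
                      (Ext : GenericExtension M P L) where
    open GenericExtension Ext using (extension; embed; preserves; reflects; transitive; G; filter; generic; generated) public
    open Embedding em M extension embed preserves reflects transitive public
    private
      ι = embed
    open M using (_≈_; ≈-refl; ≈-sym; ≈-trans; ∈-congˡ; ∈-congʳ)

    infix 4 _≤_
    _≤_ : M.V → M.V → Set ℓ
    p ≤ q = M.⟨ p , q ⟩ M.∈ L
    _≤ᶠ_ : M.Tm → M.Tm → M.Fm
    p ≤ᶠ q = M.⟨ p , q ⟩ᶠ M.∈ᶠ M.! L
    infix 7 _≤ᶠ_

    ≤-refl : ∀ {p} → p M.∈ P → p ≤ p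
    ≤-refl p = to M.⟨⟩∈⇔ (proj₁ (proj₂ (proj₂ poset)) _ p)
    ≤-trans : ∀ {p q r} → p ≤ q → q ≤ r → p ≤ r
    ≤-trans a b = to M.⟨⟩∈⇔ (proj₁ (proj₂ (proj₂ (proj₂ poset))) _ _ _ (from M.⟨⟩∈⇔ a) (from M.⟨⟩∈⇔ b))
    ≤-dom : ∀ {p q} → p ≤ q → p M.∈ P × q M.∈ P
    ≤-dom a = let p′ , q′ , b , c , e = proj₁ (proj₂ poset) _ a; f , g = M.⟨⟩-inj (to M.opair⇔ e)
              in ∈-congˡ (≈-sym f) b , ∈-congˡ (≈-sym g) c

    -- Membership in the generic filter, not the forcing relation.
    ⊩ : M.V → Set ℓ
    ⊩ p = ι p N.∈ G
    ⊩-P : ∀ {p} → ⊩ p → p M.∈ P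
    ⊩-P h = reflects _ _ (proj₁ filter h)
    ⊩-up : ∀ {p q} → ⊩ p → p ≤ q → ⊩ q
    ⊩-up h l = proj₁ (proj₂ (proj₂ filter)) _ _ h (from N.⟨⟩∈⇔ (ι⟨⟩⁺ l))
    ⊩-ex : ∃ λ p → ⊩ p
    ⊩-ex = let g , h = proj₁ (proj₂ filter); p , _ , e = ∈ι (proj₁ filter h) in p , N.∈-congˡ e h
    ⊩-dir : ∀ {p q} → ⊩ p → ⊩ q → ∃ λ r → ⊩ r × r ≤ p × r ≤ q
    ⊩-dir a b = let r , h , l , l′ = proj₂ (proj₂ (proj₂ filter)) _ _ a b
                    r′ , _ , e = ∈ι (proj₁ filter h)
                in r′ , N.∈-congˡ e h , ι⟨⟩⁻ (N.∈-congˡ (N.⟨⟩-cong e N.≈-refl) (to N.⟨⟩∈⇔ l)) , ι⟨⟩⁻ (N.∈-congˡ (N.⟨⟩-cong e N.≈-refl) (to N.⟨⟩∈⇔ l′))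

    dense-meets : ∀ {D} → D M.⊑ P → (∀ p → p M.∈ P → ∃ λ q → q M.∈ D × q ≤ p) → ∃ λ p → p M.∈ D × ⊩ p
    dense-meets {D} s h = generic D ((λ {x} → s x) , λ p q → let r , a , b = h p q in r , a , from M.⟨⟩∈⇔ b)

    -- Adding the conditions incompatible with `p₀` makes the set dense everywhere, and the filter
    -- contains none of these.
    dense-below : ∀ (f : M.Tm → M.Fm) {p₀} → ⊩ p₀ → (∀ q → q ≤ p₀ → ∃ λ q′ → q′ ≤ q × M.P₁ f q′) → ∃ λ p → ⊩ p × M.P₁ f p
    dense-below f {p₀} h d = let p , q , g = dense-meets {D} (λ x → M.Sep⊑ {dᶠ}) dns in p , g , by p g (M.SepP {dᶠ} q)
      where
        Comp : M.V → Set ℓ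
        Comp p = ∃ λ q → q ≤ p × q ≤ p₀
        dᶠ : M.Tm → M.Fm
        dᶠ p = M.rel₁ᶠ (M.P₁ f) (M.D₁ f) p M.∨ᶠ M.¬ᶠ (M.∃ᶠ λ q → q ≤ᶠ p M.∧ᶠ q ≤ᶠ M.! p₀)
        D : M.V
        D = M.Sep dᶠ P
        by : ∀ p → ⊩ p → M.P₁ f p ⊎ ¬ Comp p → M.P₁ f p
        by p g (inj₁ a) = a
        by p g (inj₂ n) = let r , _ , a , b = ⊩-dir g h in ⊥-elim (n (r , a , b))
        dns : ∀ p → p M.∈ P → ∃ λ q → q M.∈ D × q ≤ p
        dns p p∈ = go (em {Comp p})
          where
            go : Dec (Comp p) → ∃ λ q → q M.∈ D × q ≤ p
            go (yes (q , a , b)) = let q′ , l , c = d q b in q′ , M.∈Sep {dᶠ} (proj₁ (≤-dom l)) (inj₁ c) , ≤-trans l a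
            go (no n) = p , M.∈Sep {dᶠ} p∈ (inj₂ n) , ≤-refl p∈

    -- Each condition either has an extension satisfying `f` or has none, so the conditions deciding
    -- the matter are dense.
    decide : ∀ (f : M.Tm → M.Fm) → (∃ λ p → ⊩ p × M.P₁ f p) ⊎ (∃ λ p → ⊩ p × ∀ q → q ≤ p → ¬ M.P₁ f q)
    decide f = let p , g , h = dense-below dᶠ (proj₂ ⊩-ex) (λ q l → dns q (proj₁ (≤-dom l))) in [ (λ a → inj₁ (p , g , a)) , (λ n → inj₂ (p , g , n)) ]′ h
      where
        F! = M.rel₁ᶠ (M.P₁ f) (M.D₁ f)
        dᶠ : M.Tm → M.Fm
        dᶠ p = F! p M.∨ᶠ (M.∀ᶠ λ q → q ≤ᶠ p M.⇒ᶠ M.¬ᶠ (F! q))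
        dns : ∀ q → q M.∈ P → ∃ λ q′ → q′ ≤ q × (M.P₁ f q′ ⊎ (∀ r → r ≤ q′ → ¬ M.P₁ f r))
        dns q p = go (em {∃ λ r → r ≤ q × M.P₁ f r})
          where
            go : Dec (∃ λ r → r ≤ q × M.P₁ f r) → ∃ λ q′ → q′ ≤ q × (M.P₁ f q′ ⊎ (∀ r → r ≤ q′ → ¬ M.P₁ f r))
            go (yes (r , l , a)) = r , l , inj₁ a
            go (no n) = q , ≤-refl p , inj₂ (λ r l a → n (r , l , a))

    -- Forcing equality of a ground-model set with the value of a name, as the greatest bisimulation.
    module Forcing (F₁ F₂ : M.V) (tr₁ : M.Trans F₁) (tr₂ : M.Trans F₂) where
      Step : M.V → M.V → M.V → M.V → Set ℓ
      Step B t σ p =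
          (∀ u q → u M.∈ t → q ≤ p → ∃ λ q′ → q′ ≤ q × ∃ λ ρ → ∃ λ s → M.⟨ ρ , s ⟩ M.∈ σ × q′ ≤ s × M.⟨ u , M.⟨ ρ , q′ ⟩ ⟩ M.∈ B)
        × (∀ ρ s q → M.⟨ ρ , s ⟩ M.∈ σ → q ≤ p → q ≤ s → ∃ λ q′ → q′ ≤ q × ∃ λ u → u M.∈ t × M.⟨ u , M.⟨ ρ , q′ ⟩ ⟩ M.∈ B)
      private
        open M using (_∈ᶠ_; _∧ᶠ_; _⇒ᶠ_; ∀ᶠ; ∃ᶠ; !_; ⟨_,_⟩ᶠ; _≈ᶠ_; Tm; Fm; _⊑ᶠ_; ¬ᶠ; _∨ᶠ_)
        Tr : M.V
        Tr = F₁ M.⊗ (F₂ M.⊗ P)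
        Stepᶠ : Tm → Tm → Tm → Tm → Fm
        Stepᶠ B t σ p =
            (∀ᶠ λ u → ∀ᶠ λ q → u ∈ᶠ t ⇒ᶠ q ≤ᶠ p ⇒ᶠ ∃ᶠ λ q′ → q′ ≤ᶠ q ∧ᶠ ∃ᶠ λ ρ → ∃ᶠ λ s → ⟨ ρ , s ⟩ᶠ ∈ᶠ σ ∧ᶠ q′ ≤ᶠ s ∧ᶠ ⟨ u , ⟨ ρ , q′ ⟩ᶠ ⟩ᶠ ∈ᶠ B)
          ∧ᶠ (∀ᶠ λ ρ → ∀ᶠ λ s → ∀ᶠ λ q → ⟨ ρ , s ⟩ᶠ ∈ᶠ σ ⇒ᶠ q ≤ᶠ p ⇒ᶠ q ≤ᶠ s ⇒ᶠ ∃ᶠ λ q′ → q′ ≤ᶠ q ∧ᶠ ∃ᶠ λ u → u ∈ᶠ t ∧ᶠ ⟨ u , ⟨ ρ , q′ ⟩ᶠ ⟩ᶠ ∈ᶠ B)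
        Bis : M.V → Set ℓ
        Bis B = ∀ t σ p → M.⟨ t , M.⟨ σ , p ⟩ ⟩ M.∈ B → Step B t σ p
        rᶠ : Tm → Fm
        rᶠ z = ∃ᶠ λ B → B ⊑ᶠ ! Tr ∧ᶠ (∀ᶠ λ t → ∀ᶠ λ σ → ∀ᶠ λ p → ⟨ t , ⟨ σ , p ⟩ᶠ ⟩ᶠ ∈ᶠ B ⇒ᶠ Stepᶠ B t σ p) ∧ᶠ z ∈ᶠ B
        Step-mono : ∀ {B B′ t σ p} → B M.⊑ B′ → Step B t σ p → Step B′ t σ p
        Step-mono s (a , b) = (λ u q i l → let q′ , m , ρ , r , c , d , e = a u q i l in q′ , m , ρ , r , c , d , s _ e) ,
          λ ρ r q i l l′ → let q′ , m , u , c , e = b ρ r q i l l′ in q′ , m , u , c , s _ e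
      abstract
        R : M.V
        R = M.Sep rᶠ Tr
        R-spec : ∀ z → z M.∈ R ⇔ (z M.∈ Tr × ∃ λ B → B M.⊑ Tr × Bis B × z M.∈ B)
        R-spec z = M.Sep-spec rᶠ
      R-step : ∀ {t σ p} → M.⟨ t , M.⟨ σ , p ⟩ ⟩ M.∈ R → Step R t σ p
      R-step h = let _ , B , s , b , i = to (R-spec _) h in Step-mono (λ z j → from (R-spec z) (s z j , B , s , b , j)) (b _ _ _ i)
      R-dom : ∀ {t σ p} → M.⟨ t , M.⟨ σ , p ⟩ ⟩ M.∈ R → t M.∈ F₁ × σ M.∈ F₂ × p M.∈ P
      R-dom h = let a , b = M.⊗⁻ (proj₁ (to (R-spec _) h)); c , d = M.⊗⁻ b in a , c , d
      -- Adding one triple that satisfies `Step` to a union of bisimulations gives a bisimulation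
      -- again.
      R-closed : ∀ {t σ p} → t M.∈ F₁ → σ M.∈ F₂ → p M.∈ P → Step R t σ p → M.⟨ t , M.⟨ σ , p ⟩ ⟩ M.∈ R
      R-closed {t} {σ} {p} a b c st = from (R-spec _) (M.⊗⁺ a (M.⊗⁺ b c) , B , sub , bis , M.∪ʳ (M.⟪⟫⁺ ≈-refl))
        where
          z = M.⟨ t , M.⟨ σ , p ⟩ ⟩
          B = R M.∪ M.⟪ z ⟫
          sub : B M.⊑ Tr
          sub w i = [ (λ i → proj₁ (to (R-spec w) i)) , (λ i → ∈-congˡ (≈-sym (M.⟪⟫⁻ i)) (M.⊗⁺ a (M.⊗⁺ b c))) ]′ (M.∪⁻ i)
          bis : Bis B
          bis t′ σ′ p′ i = [ (λ i → Step-mono (λ _ → M.∪ˡ) (R-step i)) , (λ i → new i) ]′ (M.∪⁻ i)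
            where
              new : M.⟨ t′ , M.⟨ σ′ , p′ ⟩ ⟩ M.∈ M.⟪ z ⟫ → Step B t′ σ′ p′
              new i = let e , f = M.⟨⟩-inj (M.⟪⟫⁻ i); g , h = M.⟨⟩-inj f; x , y = st in
                (λ u q j l → let q′ , m , ρ , s , k , n , o = x u q (∈-congʳ e j) (∈-congˡ (M.⟨⟩-cong ≈-refl h) l) in
                   q′ , m , ρ , s , ∈-congʳ (≈-sym g) k , n , M.∪ˡ o) ,
                λ ρ s q j l l′ → let q′ , m , u , k , o = y ρ s q (∈-congʳ g j) (∈-congˡ (M.⟨⟩-cong ≈-refl h) l) l′ in
                   q′ , m , u , ∈-congʳ (≈-sym e) k , M.∪ˡ o
      R-down : ∀ {t σ p q} → M.⟨ t , M.⟨ σ , p ⟩ ⟩ M.∈ R → q ≤ p → M.⟨ t , M.⟨ σ , q ⟩ ⟩ M.∈ R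
      R-down h l = let a , b , c = R-dom h; x , y = R-step h in R-closed a b (proj₁ (≤-dom l))
        ((λ u r i m → x u r i (≤-trans m l)) , λ ρ s r i m m′ → y ρ s r i (≤-trans m l) m′)

      name-elem : ∀ {ρ s σ} → σ M.∈ F₂ → M.⟨ ρ , s ⟩ M.∈ σ → ρ M.∈ F₂
      name-elem h i = let w , a , b = M.⋃⁻ (M.∈⋃⟨⟩ˡ) in tr₂ _ (tr₂ _ (tr₂ _ h _ i) _ a) _ b

      -- `v` is the evaluation on the transitive set `t` that comes with `IsValue`. It is known to
      -- be correct on `t` only, hence the hypothesis that `ι σ` belongs to `t` throughout.
      module Truth (t v : N.V) (tr : N.Trans t)
                   (v-spec : ∀ σ → σ N.∈ t → ∀ y → y N.∈ v N.· σ ⇔ (∃ λ ρ → ∃ λ p → N.⟨ ρ , p ⟩ N.∈ σ × p N.∈ G × ρ N.∈ t × y N.≈ v N.· ρ)) where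
        ι-v : ∀ {σ} → ι σ N.∈ t → ∀ {y} → y N.∈ v N.· ι σ → ∃ λ ρ → ∃ λ s → M.⟨ ρ , s ⟩ M.∈ σ × ⊩ s × ι ρ N.∈ t × y N.≈ v N.· ι ρ
        ι-v h i = let ρ , p , a , b , c , e = to (v-spec _ h _) i; ρ′ , s , d , f , g = ⟨⟩∈ι a in
          ρ′ , s , d , N.∈-congˡ g b , N.∈-congˡ f c , N.≈-trans e (N.·-congʳ f)
        v-ι : ∀ {σ ρ s} → ι σ N.∈ t → M.⟨ ρ , s ⟩ M.∈ σ → ⊩ s → ι ρ N.∈ t × v N.· ι ρ N.∈ v N.· ι σ
        v-ι {σ} {ρ} h i g = ρ∈ , from (v-spec _ h _) (ι ρ , _ , ι⟨⟩⁺ i , g , ρ∈ , N.≈-refl)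
          where
            ρ∈ : ι ρ N.∈ t
            ρ∈ = let w , a , b = N.⋃⁻ N.∈⋃⟨⟩ˡ in tr _ (tr _ (tr _ h _ (ι⟨⟩⁺ i)) _ a) _ b

        Agree : M.V → M.V → Set ℓ
        Agree u σ = v N.· ι σ N.≈ ι u ⇔ (∃ λ p → ⊩ p × M.⟨ u , M.⟨ σ , p ⟩ ⟩ M.∈ R)

        module Case (u₀ : M.V) (u₀∈ : u₀ M.∈ F₁) (ih : ∀ u → u M.∈ u₀ → ∀ σ → σ M.∈ F₂ → ι σ N.∈ t → Agree u σ)
                    (σ₀ : M.V) (σ₀∈ : σ₀ M.∈ F₂) (σ₀∈t : ι σ₀ N.∈ t) where
          sound : (∃ λ p → ⊩ p × M.⟨ u₀ , M.⟨ σ₀ , p ⟩ ⟩ M.∈ R) → v N.· ι σ₀ N.≈ ι u₀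
          sound (p₀ , g₀ , r₀) = N.⊑-antisym fwd bwd
            where
              stp = R-step r₀
              fwd : v N.· ι σ₀ N.⊑ ι u₀
              fwd z i = let ρ , s , a , b , c , e = ι-v σ₀∈t i
                            q , gq , l , l′ = ⊩-dir g₀ b
                            q′ , g′ , u , j , k = dense-below (λ q′ → ∃ᶠ λ u → u ∈ᶠ ! u₀ ∧ᶠ ⟨ u , ⟨ ! ρ , q′ ⟩ᶠ ⟩ᶠ ∈ᶠ ! R) gq
                               (λ r m → proj₂ stp ρ s r a (≤-trans m l) (≤-trans m l′))
                        in N.∈-congˡ (N.≈-sym (N.≈-trans e (from (ih u j ρ (name-elem σ₀∈ a) c) (q′ , g′ , k)))) (preserves _ _ j)
              bwd : ι u₀ N.⊑ v N.· ι σ₀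
              bwd z i = let u , j , e = ∈ι i
                            q′ , g′ , ρ , s , a , l , k = dense-below (λ q′ → ∃ᶠ λ ρ → ∃ᶠ λ s → ⟨ ρ , s ⟩ᶠ ∈ᶠ ! σ₀ ∧ᶠ q′ ≤ᶠ s ∧ᶠ ⟨ ! u , ⟨ ρ , q′ ⟩ᶠ ⟩ᶠ ∈ᶠ ! R) g₀
                               (λ r m → proj₁ stp u r j m)
                            c , d = v-ι σ₀∈t a (⊩-up g′ l)
                        in N.∈-congˡ (N.≈-trans (from (ih u j ρ (name-elem σ₀∈ a) c) (q′ , g′ , k)) (N.≈-sym e)) d
          -- Two ways for `p` to rule equality out: an element of `u₀` that no element of the name
          -- can equal, or an element of the name that can equal no element of `u₀`. A condition
          -- without extensions of either kind is in `R` by `R-closed`, which gives the density of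
          -- `Dn`.
          Block₁ Block₂ : M.V → Set ℓ
          Block₁ p = ∃ λ u → u M.∈ u₀ × (∀ q ρ s → q ≤ p → M.⟨ ρ , s ⟩ M.∈ σ₀ → q ≤ s → ¬ (M.⟨ u , M.⟨ ρ , q ⟩ ⟩ M.∈ R))
          Block₂ p = ∃ λ ρ → ∃ λ s → M.⟨ ρ , s ⟩ M.∈ σ₀ × p ≤ s × (∀ q u → q ≤ p → u M.∈ u₀ → ¬ (M.⟨ u , M.⟨ ρ , q ⟩ ⟩ M.∈ R))
          dᶠ : Tm → Fm
          dᶠ p = ⟨ ! u₀ , ⟨ ! σ₀ , p ⟩ᶠ ⟩ᶠ ∈ᶠ ! R
            ∨ᶠ (∃ᶠ λ u → u ∈ᶠ ! u₀ ∧ᶠ (∀ᶠ λ q → ∀ᶠ λ ρ → ∀ᶠ λ s → q ≤ᶠ p ⇒ᶠ ⟨ ρ , s ⟩ᶠ ∈ᶠ ! σ₀ ⇒ᶠ q ≤ᶠ s ⇒ᶠ ¬ᶠ (⟨ u , ⟨ ρ , q ⟩ᶠ ⟩ᶠ ∈ᶠ ! R)))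
            ∨ᶠ (∃ᶠ λ ρ → ∃ᶠ λ s → ⟨ ρ , s ⟩ᶠ ∈ᶠ ! σ₀ ∧ᶠ p ≤ᶠ s ∧ᶠ (∀ᶠ λ q → ∀ᶠ λ u → q ≤ᶠ p ⇒ᶠ u ∈ᶠ ! u₀ ⇒ᶠ ¬ᶠ (⟨ u , ⟨ ρ , q ⟩ᶠ ⟩ᶠ ∈ᶠ ! R)))
          Dn : M.V → Set ℓ
          Dn p = M.⟨ u₀ , M.⟨ σ₀ , p ⟩ ⟩ M.∈ R ⊎ Block₁ p ⊎ Block₂ p
          dense : ∀ p → p M.∈ P → ∃ λ q → q ≤ p × Dn q
          dense p p∈ = go (em {∃ λ q → q ≤ p × Block₁ q}) (em {∃ λ q → q ≤ p × Block₂ q})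
            where
              go : Dec (∃ λ q → q ≤ p × Block₁ q) → Dec (∃ λ q → q ≤ p × Block₂ q) → ∃ λ q → q ≤ p × Dn q
              go (yes (q , l , b)) _ = q , l , inj₂ (inj₁ b)
              go (no _) (yes (q , l , b)) = q , l , inj₂ (inj₂ b)
              go (no n₁) (no n₂) = p , ≤-refl p∈ , inj₁ (R-closed u₀∈ σ₀∈ p∈
                ((λ u q i l → M.dne λ k → n₁ (q , l , u , i , λ q′ ρ s m j m′ r → k (q′ , m , ρ , s , j , m′ , r))) ,
                 λ ρ s q j l l′ → M.dne λ k → n₂ (q , l , ρ , s , j , l′ , λ q′ u m i r → k (q′ , m , u , i , r))))
          complete : v N.· ι σ₀ N.≈ ι u₀ → ∃ λ p → ⊩ p × M.⟨ u₀ , M.⟨ σ₀ , p ⟩ ⟩ M.∈ R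
          complete e = finish (dense-below dᶠ (proj₂ ⊩-ex) (λ q l → dense q (proj₁ (≤-dom l))))
            where
              finish : (∃ λ p → ⊩ p × Dn p) → ∃ λ p → ⊩ p × M.⟨ u₀ , M.⟨ σ₀ , p ⟩ ⟩ M.∈ R
              finish (p , g , inj₁ r) = p , g , r
              finish (p , g , inj₂ (inj₁ (u , i , n))) =
                let ρ , s , a , b , c , f = ι-v σ₀∈t (N.∈-congʳ (N.≈-sym e) (preserves _ _ i))
                    q , gq , r = to (ih u i ρ (name-elem σ₀∈ a) c) (N.≈-sym f)
                    q₁ , g₁ , l₁ , l₂ = ⊩-dir g gq
                    q₂ , g₂ , l₃ , l₄ = ⊩-dir g₁ b
                in ⊥-elim (n q₂ ρ s (≤-trans l₃ l₁) a l₄ (R-down r (≤-trans l₃ l₂)))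
              finish (p , g , inj₂ (inj₂ (ρ , s , a , l , n))) =
                let c , d = v-ι σ₀∈t a (⊩-up g l)
                    u , i , f = ∈ι (N.∈-congʳ e d)
                    q , gq , r = to (ih u i ρ (name-elem σ₀∈ a) c) f
                    q₁ , g₁ , l₁ , l₂ = ⊩-dir g gq
                in ⊥-elim (n q₁ u l₁ i (R-down r l₂))

        -- Induction on `u` for all names at once. It is carried out in the extension, where the
        -- evaluation and the filter live; `AgreeN` restates the claim for that purpose.
        truth : ∀ u → u M.∈ F₁ → ∀ σ → σ M.∈ F₂ → ι σ N.∈ t → Agree u σ
        truth u u∈ σ σ∈ h = from-N (N.∈-ind agreeᶠ (ι F₁) step (ι u) (preserves _ _ u∈)) u u∈ N.≈-refl σ σ∈ h
          where
            AgreeN : N.V → Set ℓ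
            AgreeN y = ∀ σ → σ N.∈ ι F₂ → σ N.∈ t → v N.· σ N.≈ y ⇔ (∃ λ p → p N.∈ G × N.⟨ y , N.⟨ σ , p ⟩ ⟩ N.∈ ι R)
            agreeᶠ : N.Tm → N.Fm
            agreeᶠ y = N.∀ᶠ λ σ → σ N.∈ᶠ N.! (ι F₂) N.⇒ᶠ σ N.∈ᶠ N.! t N.⇒ᶠ N.! v N.·ᶠ σ N.≈ᶠ y N.⇔ᶠ N.∃ᶠ λ p → p N.∈ᶠ N.! G N.∧ᶠ N.⟨ y , N.⟨ σ , p ⟩ᶠ ⟩ᶠ N.∈ᶠ N.! (ι R)
            conv : ∀ u σ → (∃ λ p → p N.∈ G × N.⟨ ι u , N.⟨ ι σ , p ⟩ ⟩ N.∈ ι R) ⇔ (∃ λ p → ⊩ p × M.⟨ u , M.⟨ σ , p ⟩ ⟩ M.∈ R)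
            conv u σ = mk⇔ (λ (p , g , r) → let p′ , _ , e = ∈ι (proj₁ filter g) in p′ , N.∈-congˡ e g ,
                              ι⟨⟩⁻ (N.∈-congˡ (N.⟨⟩-cong N.≈-refl (N.≈-trans (N.⟨⟩-cong N.≈-refl e) (N.≈-sym ι-⟨⟩))) r))
                           (λ (p , g , r) → ι p , g , N.∈-congˡ (N.⟨⟩-cong N.≈-refl ι-⟨⟩) (ι⟨⟩⁺ r))
            from-N : ∀ {y} → AgreeN y → ∀ u → u M.∈ F₁ → y N.≈ ι u → ∀ σ → σ M.∈ F₂ → ι σ N.∈ t → Agree u σ
            from-N a u u∈ e σ σ∈ h = ⇔-trans (mk⇔ (λ f → N.≈-trans f (N.≈-sym e)) (λ f → N.≈-trans f e))
              (⇔-trans (a (ι σ) (preserves _ _ σ∈) h) (⇔-trans (mk⇔ (λ (p , g , r) → p , g , N.∈-congˡ (N.⟨⟩-cong e N.≈-refl) r)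
                                                                    (λ (p , g , r) → p , g , N.∈-congˡ (N.⟨⟩-cong (N.≈-sym e) N.≈-refl) r)) (conv u σ)))
            step : ∀ y → y N.∈ ι F₁ → (∀ z → z N.∈ y → z N.∈ ι F₁ → AgreeN z) → AgreeN y
            step y y∈ ihN σ σ∈ σt =
              let u₀ , u₀∈ , e = ∈ι y∈
                  σ₀ , σ₀∈ , f = ∈ι σ∈
                  ih = λ u (i : u M.∈ u₀) → from-N (ihN (ι u) (N.∈-congʳ (N.≈-sym e) (preserves _ _ i)) (preserves _ _ (tr₁ u₀ u₀∈ u i))) u (tr₁ u₀ u₀∈ u i) N.≈-refl
                  open Case u₀ u₀∈ ih σ₀ σ₀∈ (N.∈-congˡ f σt)
              in ⇔-trans (mk⇔ (λ g → N.≈-trans (N.·-congʳ (N.≈-sym f)) (N.≈-trans g e)) (λ g → N.≈-trans (N.·-congʳ f) (N.≈-trans g (N.≈-sym e))))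
                   (⇔-trans (mk⇔ complete sound) (⇔-trans (⇔-sym (conv u₀ σ₀))
                     (mk⇔ (λ (p , g , r) → p , g , N.∈-congˡ (N.⟨⟩-cong (N.≈-sym e) (N.⟨⟩-cong (N.≈-sym f) N.≈-refl)) r)
                          (λ (p , g , r) → p , g , N.∈-congˡ (N.⟨⟩-cong e (N.⟨⟩-cong f N.≈-refl)) r))))

    -- `X` collects the pairs `⟨ t , p ⟩` such that `p` forces `t` to equal one of the elements that
    -- the given name puts in. Since `x` consists of ground-model sets, equality of such sets with
    -- names is the only atomic case of forcing involved.
    nice-name : ∀ T x → x N.⊑ ι T → ∃ λ X → X M.⊑ T M.⊗ P
      × (∀ t → t M.∈ T → ι t N.∈ x ⇔ (∃ λ p → ⊩ p × M.⟨ t , p ⟩ M.∈ X))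
      × (∀ t p q → M.⟨ t , p ⟩ M.∈ X → q ≤ p → M.⟨ t , q ⟩ M.∈ X)
    nice-name T x x⊑ = named (generated x) (M.transitive-closure T)
      where
        open M using (_∈ᶠ_; _∧ᶠ_; ∃ᶠ; !_; ⟨_,_⟩ᶠ; _≈ᶠ_; Tm; Fm; fstᶠ; sndᶠ)
        Goal : Set ℓ
        Goal = ∃ λ X → X M.⊑ T M.⊗ P
          × (∀ t → t M.∈ T → ι t N.∈ x ⇔ (∃ λ p → ⊩ p × M.⟨ t , p ⟩ M.∈ X))
          × (∀ t p q → M.⟨ t , p ⟩ M.∈ X → q ≤ p → M.⟨ t , q ⟩ M.∈ X)
        named : (∃ λ τ → N.IsValue G (ι τ) x) → (∃ λ F₁ → M.Trans F₁ × T M.∈ F₁) → Goal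
        named (τ , t , v , trt , τ∈t , (c , isF) , vs , vτ) (F₁ , tr₁ , T∈) = with-F₂ (M.transitive-closure τ)
          where
            v-spec : ∀ σ → σ N.∈ t → ∀ y → y N.∈ v N.· σ ⇔ (∃ λ ρ → ∃ λ p → N.⟨ ρ , p ⟩ N.∈ σ × p N.∈ G × ρ N.∈ t × y N.≈ v N.· ρ)
            v-spec σ h y = ⇔-trans (vs σ (v N.· σ) (N.fun-graph isF h) y) (mk⇔
              (λ (ρ , p , a , g , b) → ρ , p , to N.⟨⟩∈⇔ a , g , ρt a , N.≈-sym (N.fun-val isF b))
              (λ (ρ , p , a , g , b , e) → ρ , p , from N.⟨⟩∈⇔ a , g , from N.⟨⟩∈⇔ (N.∈-congˡ (N.⟨⟩-cong N.≈-refl (N.≈-sym e)) (to N.⟨⟩∈⇔ (N.fun-graph isF b)))))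
              where ρt : ∀ {ρ p} → N.⟨ ρ , p ⟩∈ σ → ρ N.∈ t
                    ρt a = let w , i , j = N.⋃⁻ N.∈⋃⟨⟩ˡ in trt _ (trt _ (trt _ h (to N.⟨⟩∈⇔ a)) i) j
            x≈ : v N.· ι τ N.≈ x
            x≈ = N.fun-val isF vτ
            with-F₂ : (∃ λ F₂ → M.Trans F₂ × τ M.∈ F₂) → Goal
            with-F₂ (F₂ , tr₂ , τ∈F₂) = X , (λ z → M.Sep⊑ {xᶠ}) , correct , down
              where
                open Forcing F₁ F₂ tr₁ tr₂
                open Truth t v (λ y p z q → trt y p q) v-spec
                In : M.V → M.V → Set ℓ
                In t p = ∃ λ ρ → ∃ λ s → M.⟨ ρ , s ⟩ M.∈ τ × p ≤ s × M.⟨ t , M.⟨ ρ , p ⟩ ⟩ M.∈ R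
                inᶠ : Tm → Tm → Fm
                inᶠ t p = ∃ᶠ λ ρ → ∃ᶠ λ s → ⟨ ρ , s ⟩ᶠ ∈ᶠ ! τ ∧ᶠ p ≤ᶠ s ∧ᶠ ⟨ t , ⟨ ρ , p ⟩ᶠ ⟩ᶠ ∈ᶠ ! R
                xᶠ : Tm → Fm
                xᶠ z = inᶠ (fstᶠ z) (sndᶠ z)
                X : M.V
                X = M.Sep xᶠ (T M.⊗ P)
                X⁺ : ∀ {t p} → t M.∈ T → In t p → M.⟨ t , p ⟩ M.∈ X
                X⁺ {t} {p} i h@(ρ , s , a , l , r) = M.∈Sep {xᶠ} (M.⊗⁺ i (proj₁ (≤-dom l)))
                  (ρ , s , a , ∈-congˡ (M.⟨⟩-cong (≈-sym M.snd-β) ≈-refl) l , ∈-congˡ (M.⟨⟩-cong (≈-sym M.fst-β) (M.⟨⟩-cong ≈-refl (≈-sym M.snd-β))) r)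
                X⁻ : ∀ {t p} → M.⟨ t , p ⟩ M.∈ X → t M.∈ T × In t p
                X⁻ h = let ρ , s , a , l , r = M.SepP {xᶠ} h in proj₁ (M.⊗⁻ (M.Sep⊑ {xᶠ} h)) ,
                  ρ , s , a , ∈-congˡ (M.⟨⟩-cong M.snd-β ≈-refl) l , ∈-congˡ (M.⟨⟩-cong M.fst-β (M.⟨⟩-cong ≈-refl M.snd-β)) r
                down : ∀ t p q → M.⟨ t , p ⟩ M.∈ X → q ≤ p → M.⟨ t , q ⟩ M.∈ X
                down t p q h l = let i , ρ , s , a , m , r = X⁻ h in X⁺ i (ρ , s , a , ≤-trans l m , R-down r l)
                correct : ∀ t → t M.∈ T → ι t N.∈ x ⇔ (∃ λ p → ⊩ p × M.⟨ t , p ⟩ M.∈ X)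
                correct u i = mk⇔
                  (λ h → let ρ , s , a , g , b , e = ι-v τ∈t (N.∈-congʳ (N.≈-sym x≈) h)
                             q , gq , r = to (truth u (tr₁ T T∈ u i) ρ (name-elem τ∈F₂ a) b) (N.≈-sym e)
                             q′ , g′ , l , l′ = ⊩-dir g gq
                         in q′ , g′ , X⁺ i (ρ , s , a , l , R-down r l′))
                  (λ (p , g , h) → let _ , ρ , s , a , l , r = X⁻ h
                                       b , c = v-ι τ∈t a (⊩-up g l)
                                   in N.∈-congʳ x≈ (N.∈-congˡ (from (truth u (tr₁ T T∈ u i) ρ (name-elem τ∈F₂ a) b) (p , g , r)) c))

    -- Directedness of the filter merges the conditions for the single elements. The induction on
    -- the finite set takes place in the extension, where `x` and the filter are available.
    forced-finite : ∀ {T x X} → (∀ t → t M.∈ T → ι t N.∈ x ⇔ (∃ λ p → ⊩ p × M.⟨ t , p ⟩ M.∈ X)) →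
      (∀ t p q → M.⟨ t , p ⟩ M.∈ X → q ≤ p → M.⟨ t , q ⟩ M.∈ X) →
      ∀ {s} → M.Finite s → s M.⊑ T → ι s N.⊑ x → ∃ λ p → ⊩ p × (∀ t → t M.∈ s → M.⟨ t , p ⟩ M.∈ X)
    forced-finite {T} {x} {X} X-spec X-down {s} (n , n∈ , l) s⊑T s⊑x =
        let p , g , h = N.fin-ind allᶠ base step (ι s) (ι n , N.∈-congʳ ι-ω (preserves _ _ n∈) , ι-≲ l) (ι-⊑ s⊑T) s⊑x
            p′ , _ , e = ∈ι (proj₁ filter g)
        in p′ , N.∈-congˡ e g , λ t m → ι⟨⟩⁻ (N.∈-congˡ (N.⟨⟩-cong N.≈-refl e) (h (ι t) (preserves _ _ m)))
      where
        All : N.V → Set ℓ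
        All s = s N.⊑ ι T → s N.⊑ x → ∃ λ p → p N.∈ G × (∀ t → t N.∈ s → N.⟨ t , p ⟩ N.∈ ι X)
        allᶠ : N.Tm → N.Fm
        allᶠ s = s N.⊑ᶠ N.! (ι T) N.⇒ᶠ s N.⊑ᶠ N.! x N.⇒ᶠ N.∃ᶠ λ p → p N.∈ᶠ N.! G N.∧ᶠ (N.∀ᶠ λ t → t N.∈ᶠ s N.⇒ᶠ N.⟨ t , p ⟩ᶠ N.∈ᶠ N.! (ι X))
        base : All N.∅
        base _ _ = let p , g = ⊩-ex in ι p , g , λ t m → ⊥-elim (N.∅⁻ m)
        step : ∀ y z → N.Finite y → All y → All (y N.∪ N.⟪ z ⟫)
        step y z _ ih y⊑T y⊑x =
          let p , g , h = ih (λ t m → y⊑T t (N.∪ˡ m)) (λ t m → y⊑x t (N.∪ˡ m))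
              p′ , _ , e = ∈ι (proj₁ filter g)
              z′ , z∈ , f = ∈ι (y⊑T z (N.∪ʳ (N.⟪⟫⁺ N.≈-refl)))
              q , k , i = to (X-spec z′ z∈) (N.∈-congˡ f (y⊑x z (N.∪ʳ (N.⟪⟫⁺ N.≈-refl))))
              r , gr , a , b = ⊩-dir (N.∈-congˡ e g) k
              down : ∀ {t u q} → t N.≈ ι u → M.⟨ u , q ⟩ M.∈ X → r ≤ q → N.⟨ t , ι r ⟩ N.∈ ι X
              down e i l = N.∈-congˡ (N.⟨⟩-cong (N.≈-sym e) N.≈-refl) (ι⟨⟩⁺ (X-down _ _ _ i l))
          in ι r , gr , λ t m →
            [ (λ m → let t′ , _ , e′ = ∈ι (y⊑T t (N.∪ˡ m)) in down e′ (ι⟨⟩⁻ (N.∈-congˡ (N.⟨⟩-cong e′ e) (h t m))) a) ,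
              (λ m → down (N.≈-trans (N.⟪⟫⁻ m) f) i b) ]′ (N.∪⁻ m)

    -- Preservation of ω₁ by c.c.c. posets

    module _ (ccc : M.CCC P L) where
      open M using (∈-congˡ; ≈-sym; _∈ᶠ_; _∧ᶠ_; ∃ᶠ; !_; ⟨_,_⟩ᶠ; _≈ᶠ_; ¬ᶠ; Tm; Fm)

      -- Labels of different indices are incompatible, so the chosen labels form an antichain and
      -- the choice is injective.
      ctb-labelled : ∀ (f : Tm → Tm → Fm) {I} → (∀ α → α M.∈ I → ∃ λ p → p M.∈ P × M.P₂ f α p) →
        (∀ α α′ p p′ r → α M.∈ I → α′ M.∈ I → M.P₂ f α p → M.P₂ f α′ p′ → r ≤ p → r ≤ p′ → α M.≈ α′) → M.Ctb I
      ctb-labelled f {I} h anti = chosen (M.uniformizeᶠ f I P h)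
        where
          chosen : (∃ λ c → ∀ α → α M.∈ I → c M.· α M.∈ P × M.P₂ f α (c M.· α)) → M.Ctb I
          chosen (c , hc) = M.≲-trans (M.≲-by cᶠ (λ α → M.∈Img {cᶠ})
              (λ α α′ i i′ e → anti α α′ _ _ _ i i′ (proj₂ (hc α i)) (proj₂ (hc α′ i′)) (≤-refl (proj₁ (hc α i)))
                 (∈-congˡ (M.⟨⟩-cong M.≈-refl e) (≤-refl (proj₁ (hc α i)))))) ctb-A
            where
              cᶠ : Tm → Tm
              cᶠ α = ! c M.·ᶠ α
              A : M.V
              A = M.Img cᶠ I
              A⊑P : A M.⊑ P
              A⊑P p m = let α , i , e = M.Img⁻ m in ∈-congˡ (≈-sym e) (proj₁ (hc α i))
              antichain : ∀ p q → p M.∈ A → q M.∈ A → ¬ (p M.≈ q) → ¬ M.Compatible L p q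
              antichain p q m n ne (r , l , l′) =
                let α , i , e = M.Img⁻ m; α′ , i′ , e′ = M.Img⁻ n
                    e″ = anti α α′ _ _ r i i′ (proj₂ (hc α i)) (proj₂ (hc α′ i′))
                           (∈-congˡ (M.⟨⟩-cong M.≈-refl e) (to M.⟨⟩∈⇔ l)) (∈-congˡ (M.⟨⟩-cong M.≈-refl e′) (to M.⟨⟩∈⇔ l′))
                in ne (M.≈-trans e (M.≈-trans (M.·-congʳ e″) (≈-sym e′)))
              ctb-A : M.Ctb A
              ctb-A = let o , io , l = ccc A (λ {x} → A⊑P x) antichain
                      in M.≲-cong M.≈-refl (M.IsOmega-unique io) (M.≲-by-≼ (λ _ x → x) l)

      -- Some `p₀` in the filter excludes that two arguments of the injection get the same value.
      -- Hence the elements of `w` that may be sent to a fixed `n` carry pairwise incompatible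
      -- conditions below `p₀`, so there are countably many of them, and ω many such sets would
      -- cover `w`.
      preserves-uncountable : ∀ {w} → ¬ M.Ctb w → ¬ N.Ctb (ι w)
      preserves-uncountable {w} unctb (g , gm , gi) = named (nice-name (w M.⊗ M.ω) x (λ _ → N.Sep⊑ {xᶠ}))
        where
          xᶠ : N.Tm → N.Fm
          xᶠ z = N.! g N.·ᶠ N.fstᶠ z N.≈ᶠ N.sndᶠ z
          x : N.V
          x = N.Sep xᶠ (ι (w M.⊗ M.ω))
          x⁺ : ∀ {α n} → α M.∈ w → n M.∈ M.ω → g N.· ι α N.≈ ι n → ι M.⟨ α , n ⟩ N.∈ x
          x⁺ a n e = N.∈Sep {xᶠ} (preserves _ _ (M.⊗⁺ a n))
            (N.≈-trans (N.·-congʳ (N.≈-trans (N.≈-cong N.fstᶠ ι-⟨⟩) N.fst-β)) (N.≈-trans e (N.≈-sym (N.≈-trans (N.≈-cong N.sndᶠ ι-⟨⟩) N.snd-β))))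
          x⁻ : ∀ {α n} → ι M.⟨ α , n ⟩ N.∈ x → g N.· ι α N.≈ ι n
          x⁻ m = N.≈-trans (N.·-congʳ (N.≈-sym (N.≈-trans (N.≈-cong N.fstᶠ ι-⟨⟩) N.fst-β)))
                   (N.≈-trans (N.SepP {xᶠ} m) (N.≈-trans (N.≈-cong N.sndᶠ ι-⟨⟩) N.snd-β))
          named : (∃ λ X → X M.⊑ (w M.⊗ M.ω) M.⊗ P
            × (∀ t → t M.∈ w M.⊗ M.ω → ι t N.∈ x ⇔ (∃ λ p → ⊩ p × M.⟨ t , p ⟩ M.∈ X))
            × (∀ t p q → M.⟨ t , p ⟩ M.∈ X → q ≤ p → M.⟨ t , q ⟩ M.∈ X)) → ⊥
          named (X , X⊑ , X-spec , X-down) = [ met , unmet ]′ (decide clashᶠ)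
            where
              Clash : M.V → Set ℓ
              Clash p = ∃ λ α → ∃ λ α′ → ∃ λ n → ¬ (α M.≈ α′) × M.⟨ M.⟨ α , n ⟩ , p ⟩ M.∈ X × M.⟨ M.⟨ α′ , n ⟩ , p ⟩ M.∈ X
              clashᶠ : Tm → Fm
              clashᶠ p = ∃ᶠ λ α → ∃ᶠ λ α′ → ∃ᶠ λ n → ¬ᶠ (α ≈ᶠ α′) ∧ᶠ ⟨ ⟨ α , n ⟩ᶠ , p ⟩ᶠ ∈ᶠ ! X ∧ᶠ ⟨ ⟨ α′ , n ⟩ᶠ , p ⟩ᶠ ∈ᶠ ! X
              member : ∀ {α n p} → M.⟨ M.⟨ α , n ⟩ , p ⟩ M.∈ X → α M.∈ w × n M.∈ M.ω
              member m = M.⊗⁻ (proj₁ (M.⊗⁻ (X⊑ _ m)))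
              met : (∃ λ p → ⊩ p × Clash p) → ⊥
              met (p , h , α , α′ , n , ne , m , m′) =
                let a , i = member m; a′ , _ = member m′
                    e = x⁻ (from (X-spec _ (M.⊗⁺ a i)) (p , h , m)); e′ = x⁻ (from (X-spec _ (M.⊗⁺ a′ i)) (p , h , m′))
                in ne (ι-inj (gi _ _ (preserves _ _ a) (preserves _ _ a′) (N.≈-trans e (N.≈-sym e′))))
              unmet : (∃ λ p → ⊩ p × ∀ q → q ≤ p → ¬ Clash q) → ⊥
              unmet (p₀ , h₀ , none) = unctb (M.ctb-⊑ all (M.ctb-⋃Img xsᶠ M.≲-refl (λ n _ → xs-ctb n)))
                where
                  Val : M.V → M.V → M.V → Set ℓ
                  Val n α p = p ≤ p₀ × M.⟨ M.⟨ α , n ⟩ , p ⟩ M.∈ X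
                  valᶠ : Tm → Tm → Tm → Fm
                  valᶠ n α p = p ≤ᶠ ! p₀ ∧ᶠ ⟨ ⟨ α , n ⟩ᶠ , p ⟩ᶠ ∈ᶠ ! X
                  xs : M.V → M.V
                  xs n = M.Sep (λ α → ∃ᶠ λ p → valᶠ (! n) α p) w
                  xs-spec : ∀ α n → α M.∈ xs n ⇔ (α M.∈ w × ∃ λ p → Val n α p)
                  xs-spec α n = M.Sep-spec (λ α → ∃ᶠ λ p → valᶠ (! n) α p)
                  abstract
                    xs-T : M.T 1 (λ ρ → xs (proj₁ ρ))
                    xs-T = M.T₁-by xs (λ α n → α ∈ᶠ ! w ∧ᶠ ∃ᶠ λ p → valᶠ n α p) xs-spec
                  xsᶠ : Tm → Tm
                  xsᶠ = M.fn₁ᶠ xs xs-T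
                  xs-ctb : ∀ n → M.Ctb (xs n)
                  xs-ctb n = ctb-labelled (λ α p → valᶠ (! n) α p)
                    (λ α m → let _ , p , v = to (xs-spec α n) m in p , proj₁ (≤-dom (proj₁ v)) , v)
                    (λ α α′ p p′ r _ _ (a , b) (a′ , b′) l l′ → M.dne λ ne → none r (≤-trans l a)
                      (α , α′ , n , ne , X-down _ _ _ b l , X-down _ _ _ b′ l′))
                  all : w M.⊑ M.⋃ (M.Img xsᶠ M.ω)
                  all α a =
                    let n , i , e = ∈ι (N.∈-congʳ (N.≈-sym ι-ω) (gm (ι α) (preserves _ _ a)))
                        p , h , m = to (X-spec _ (M.⊗⁺ a i)) (x⁺ a i e)
                        r , _ , l , l′ = ⊩-dir h h₀
                    in M.⋃⁺ (M.∈Img {xsᶠ} i) (from (xs-spec α n) (a , r , l′ , X-down _ _ _ m l))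

      preserves-ω₁ : ∀ {w} → M.Isω₁ w → N.Isω₁ (ι w)
      preserves-ω₁ h = ι-Isω₁ h (preserves-uncountable (M.Isω₁.unctb h))

  -- The extension by Q

  module RainbowExtension {ℓ} (em : ExcludedMiddle ℓ) (M : Model ℓ) (gch : Model.GCH M) (k : Model.Carrier M)
      (k∈ω : Model._∈_ M k (SetTheory.ω em M)) (k≉∅ : ¬ Model.Empty M k) where
    open Combinatorics em M
    open Colouring gch k k∈ω k≉∅ using (f; f-spec; isColouring; colour-singletons)
    open QGraph gch k k≉∅
    open Isω₁ ω₁-isω₁
    open Family gch k using (𝓕)

    module _ (Ext : GenericExtension M Cl Le) where
      open GenericNames em M Cl Le isPoset Ext using (module N; embed; G; ⊩; ⊩-dir; ⊩-ex; ⊩-P; dense-below; preserves; reflects; ∈ι; ι-inj; ι-cong; ι-⟨⟩; ⟨⟩∈ι; ι-ω; ι-pair; preserves-ω₁; filter)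
      private
        ι = embed

        Vertex : V → Set ℓ
        Vertex u = ∃ λ p → ⊩ p × u ∈ p

        vertex : ∀ {α} → α ∈ ω₁ → ∃ λ n → n ∈ ω × Vertex ⟨ α , n ⟩
        vertex {α} a = let p , h , n , i , m = dense-below dᶠ (proj₂ ⊩-ex) (λ q l → dns q (proj₁ (Le⁻ l))) in n , i , p , h , m
          where
            Dn : V → Set ℓ
            Dn p = ∃ λ n → n ∈ ω × ⟨ α , n ⟩ ∈ p
            dᶠ : Tm → Fm
            dᶠ p = ∃ᶠ λ n → n ∈ᶠ ! ω ∧ᶠ ⟨ ! α , n ⟩ᶠ ∈ᶠ p
            dns : ∀ q → q ∈ Cl → ∃ λ q′ → ⟨ q′ , q ⟩ ∈ Le × Dn q′
            dns q q∈ = go (em {Dn q})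
              where
                go : Dec (Dn q) → ∃ λ q′ → ⟨ q′ , q ⟩ ∈ Le × Dn q′
                go (yes d) = q , Le⁺ q∈ q∈ (λ _ p → p) , d
                go (no none) = add (fin-bounded (Img-fin sndᶠ (Cl-fin q∈)) snd∈)
                  where
                    form : ∀ {u} → u ∈ q → ∃ λ x → ∃ λ m → x ∈ ω₁ × m ∈ ω × u ≈ ⟨ x , m ⟩
                    form m = ⊗⁻′ (Cl-⊑U q∈ _ m)
                    snd∈ : Img sndᶠ q ⊑ ω
                    snd∈ y m = let u , i , e = Img⁻ m; x , n , _ , n∈ , g = form i in
                      ∈-congˡ (≈-sym (≈-trans e (≈-trans (≈-cong sndᶠ g) snd-β))) n∈
                    add : (∃ λ n → n ∈ ω × Img sndᶠ q ⊑ n) → ∃ λ q′ → ⟨ q′ , q ⟩ ∈ Le × Dn q′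
                    -- Row `n` is beyond all rows that `q` uses, so the new vertex meets no
                    -- constraint from `𝓕`.
                    add (n , n∈ , below) = q ∪ ⟪ w ⟫ , Le⁺ new q∈ (λ x → ∪ˡ) , n , n∈ , ∪ʳ (⟪⟫⁺ ≈-refl)
                      where
                        w = ⟨ α , n ⟩
                        w∈ : w ∈ UQ
                        w∈ = ⊗⁺ a n∈
                        ⟪w⟫∈ : ⟪ w ⟫ ∈ Cl
                        ⟪w⟫∈ = Cl⁺ (λ x m → ∈-congˡ (≈-sym (⟪⟫⁻ m)) w∈) fin-⟪⟫ (λ u v m m′ → inj₁ (≈-trans (⟪⟫⁻ m) (≈-sym (⟪⟫⁻ m′))))
                        edge : ∀ u → u ∈ q → Edge u w
                        edge u m = (λ e → let x , l , _ , l∈ , g = form m in none (l , l∈ ,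
                                      ∈-congˡ (≈-trans g (⟨⟩-cong (≈-trans (≈-sym (≈-trans (≈-cong fstᶠ g) fst-β)) (≈-trans e fst-β)) ≈-refl)) m)) ,
                                   λ e → ⊥-elim (∈-irrefl′ (≈-trans e snd-β) (below _ (∈Img {sndᶠ} m)))
                        new : q ∪ ⟪ w ⟫ ∈ Cl
                        new = ∪-Cl ΓQ-sym q∈ ⟪w⟫∈ λ u v m m′ → inj₂ (ΓQ⁺ (Cl-⊑U q∈ u m) (∈-congˡ (≈-sym (⟪⟫⁻ m′)) w∈) (Edge-resp ≈-refl (≈-sym (⟪⟫⁻ m′)) (edge u m)))

        linked : ∀ {α b n} → α ∈ b → Vertex ⟨ α , n ⟩ → Vertex ⟨ b , n ⟩ → ⟪ α ⟫ ∈ 𝓕 · b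
        linked {α} {b} {n} a (p , h , m) (q , h′ , m′) =
          let r , hr , l , l′ = ⊩-dir h h′ in
          [ (λ e → ⊥-elim (∈-irrefl′ (⟨⟩-fst e) a)) ,
            (λ g → let _ , _ , _ , c = ΓQ⁻ g in
               ∈-congˡ (≈-cong ⟪_⟫ᶠ fst-β) (∈-congʳ (·-congʳ fst-β) (proj₁ (c (≈-trans snd-β (≈-sym snd-β))) (∈-congˡ (≈-sym fst-β) (∈-congʳ (≈-sym fst-β) a))))) ]′
            (Cl-clique (⊩-P hr) _ _ (proj₂ (proj₂ (Le⁻ l)) _ m) (proj₂ (proj₂ (Le⁻ l′)) _ m′))

        rowᶠ : N.Tm → N.Tm → N.Fm
        rowᶠ n α = N.∃ᶠ λ p → p N.∈ᶠ N.! G N.∧ᶠ N.⟨ α , n ⟩ᶠ N.∈ᶠ p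
        Row : N.V → N.V
        Row n = N.Sep (λ α → rowᶠ (N.! n) α) (ι ω₁)
        Row-spec : ∀ α n → α N.∈ Row n ⇔ (α N.∈ ι ω₁ × ∃ λ p → p N.∈ G × N.⟨ α , n ⟩ N.∈ p)
        Row-spec α n = N.Sep-spec (λ α → rowᶠ (N.! n) α)
        abstract
          Row-T : N.T 1 (λ ρ → Row (proj₁ ρ))
          Row-T = N.T₁-by Row (λ α n → α N.∈ᶠ N.! (ι ω₁) N.∧ᶠ rowᶠ n α) Row-spec
        Rowᶠ : N.Tm → N.Tm
        Rowᶠ = N.fn₁ᶠ Row Row-T

        Row⁻ : ∀ {x n} → n N.∈ N.ω → x N.∈ Row n → ∃ λ α → α ∈ ω₁ × x N.≈ ι α × ∃ λ m → n N.≈ ι m × Vertex ⟨ α , m ⟩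
        Row⁻ {x} {n} n∈ h =
          let x∈ , p , g , m = to (Row-spec _ _) h
              α , a , e = ∈ι x∈
              n′ , _ , e′ = ∈ι (N.∈-congʳ (N.≈-sym ι-ω) n∈)
              p′ , _ , e″ = ∈ι (proj₁ filter g)
          in α , a , e , n′ , e′ , p′ , N.∈-congˡ e″ g ,
             reflects _ _ (N.∈-congʳ e″ (N.∈-congˡ (N.≈-trans (N.⟨⟩-cong e e′) (N.≈-sym ι-⟨⟩)) m))

        Row-pair : ∀ {z n} → n N.∈ N.ω → N.[ Row n ]² z → ∃ λ α → ∃ λ b → α ∈ b × b ∈ ω₁ × ⟪ α ⟫ ∈ 𝓕 · b × z N.≈ ι (pair α b)
        Row-pair {z} {n} n∈ (x , y , hx , hy , ne , e) =
          let α , a , g , m , i , v = Row⁻ n∈ hx; b , b∈ , g′ , m′ , i′ , v′ = Row⁻ n∈ hy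
              e″ = ι-inj (N.≈-trans (N.≈-sym i′) i)
              p , h , w = v′
              z≈ = N.≈-trans (to N.isPair⇔ e) (N.≈-trans (N.pair-cong g g′) (N.≈-sym ι-pair))
          in order α b m a b∈ (λ f → ne (N.≈-trans g (N.≈-trans (ι-cong f) (N.≈-sym g′)))) v (p , h , ∈-congˡ (⟨⟩-cong ≈-refl e″) w) z≈
          where
            order : ∀ α b m → α ∈ ω₁ → b ∈ ω₁ → ¬ (α ≈ b) → Vertex ⟨ α , m ⟩ → Vertex ⟨ b , m ⟩ → z N.≈ ι (pair α b) →
                    ∃ λ α → ∃ λ b → α ∈ b × b ∈ ω₁ × ⟪ α ⟫ ∈ 𝓕 · b × z N.≈ ι (pair α b)
            order α b m a b∈ ne v v′ e = [ (λ l → α , b , l , b∈ , linked l v v′ , e) , [ (λ g → ⊥-elim (ne g)) ,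
              (λ l → b , α , l , a , linked l v′ v , N.≈-trans e (ι-cong pair-comm)) ]′ ]′ (Ord-cmp (⊑-ord a) (⊑-ord b∈))

        rainbow : ∀ {n} → n N.∈ N.ω → N.Rainbow (ι f) (ι ω₁) (Row n)
        rainbow n∈ = (λ h → proj₁ (to (Row-spec _ _) h)) , λ z z′ ξ h h′ c c′ →
          let α , b , a , b∈ , s , e = Row-pair n∈ h; α′ , b′ , a′ , b∈′ , s′ , e′ = Row-pair n∈ h′
              z₁ , ξ₁ , c₁ , g , i = ⟨⟩∈ι (to N.⟨⟩∈⇔ c); z₂ , ξ₂ , c₂ , g′ , i′ = ⟨⟩∈ι (to N.⟨⟩∈⇔ c′)
              u , v = colour-singletons a b∈ a′ b∈′ s s′ (∈-congˡ (⟨⟩-cong (ι-inj (N.≈-trans (N.≈-sym g) e)) ≈-refl) c₁)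
                        (∈-congˡ (⟨⟩-cong (ι-inj (N.≈-trans (N.≈-sym g′) e′)) (ι-inj (N.≈-trans (N.≈-sym i′) i))) c₂)
          in N.≈-trans e (N.≈-trans (ι-cong (pair-cong u v)) (N.≈-sym e′))

        Rows : N.V
        Rows = N.Img Rowᶠ N.ω
        Rows-countable : N.Countable Rows
        Rows-countable = N.ω , N.ω-isOmega , N.≼-by {Rows} {N.ω} (λ _ → ⇔-refl) (λ _ p → p) (N.ctb-Img Rowᶠ N.≲-refl)
        Rainbow-resp : ∀ {R S} → R N.≈ S → N.Rainbow (ι f) (ι ω₁) S → N.Rainbow (ι f) (ι ω₁) R
        Rainbow-resp {R} {S} e (s , i) = (λ h → s (to (e _) h)) , λ z z′ ξ h h′ → i z z′ ξ (move h) (move h′)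
          where
            move : ∀ {z} → N.[ R ]² z → N.[ S ]² z
            move (α , β , a , b , ne , p) = α , β , to (e _) a , to (e _) b , ne , p
        Rows-rainbow : ∀ R → R N.∈ Rows → N.Rainbow (ι f) (ι ω₁) R
        Rows-rainbow R m = let n , n∈ , e = N.Img⁻ m in Rainbow-resp e (rainbow n∈)
        covered : ∀ x → x N.∈ ι ω₁ → ∃ λ R → R N.∈ Rows × x N.∈ R
        covered x m = let α , a , e = ∈ι m; n , n∈ , p , h , v = vertex a in
          Row (ι n) , N.∈Img {Rowᶠ} (N.∈-congʳ ι-ω (preserves _ _ n∈)) , from (Row-spec _ _) (m , ι p , h ,
            N.∈-congˡ (N.≈-trans ι-⟨⟩ (N.⟨⟩-cong (N.≈-sym e) N.≈-refl)) (preserves _ _ v))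
        Rows-union : N.IsUnion (ι ω₁) Rows
        Rows-union x = mk⇔ (covered x) (λ (R , m , h) → proj₁ (Rows-rainbow R m) h)

      countable-union : N.Omega₁IsCountableUnionOfRainbowSets (ι f)
      countable-union = ι ω₁ , N.isOmega₁ (preserves-ω₁ (SC⇒CCC sc) ω₁-isω₁) , Rows , Rows-countable , Rows-rainbow , Rows-union

  -- Extensions by P followed by a c.c.c. poset

  module Indestructibility {ℓ} (em : ExcludedMiddle ℓ) (M : Model ℓ) (gch : Model.GCH M) (k : Model.Carrier M)
      (k∈ω : Model._∈_ M k (SetTheory.ω em M)) where
    open Combinatorics em M
    open GenericRow gch k
    open Isω₁ ω₁-isω₁

    module TwoSteps (Ext₁ : GenericExtension M Cl Le) (R LR : Model.Carrier (GenericExtension.extension Ext₁))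
        (ccc : Model.IsCCCPoset (GenericExtension.extension Ext₁) R LR) (Ext₂ : GenericExtension (GenericExtension.extension Ext₁) R LR) where
      N₁ N₂ : Model ℓ
      N₁ = GenericExtension.extension Ext₁
      N₂ = GenericExtension.extension Ext₂
      module F₁ = GenericNames em M Cl Le isPoset Ext₁ using (module N; G; dense-below; filter; nice-name; preserves; preserves-ω₁; reflects; ι-cong; ι-·; ι-ω; ι-≲; ι-⊑; ι-⟨⟩; ι⟨⟩⁻; ∈ι; _≤_; ≤-refl; ⊩; ⊩-P; ⊩-dir; ⊩-ex)
      module F₂ = GenericNames em N₁ R LR (proj₁ ccc) Ext₂ using (module N; ctb-labelled; decide; forced-finite; nice-name; preserves; preserves-ω₁; reflects; ι-cong; ι-≲; ∈ι; _≤_; ≤-dom; ≤-trans; _≤ᶠ_; ⊩; ⊩-dir)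
      open F₁ using () renaming (module N to W₁)
      open F₂ using () renaming (module N to W₂)
      ι₁ : V → W₁.V
      ι₁ = GenericExtension.embed Ext₁
      ι₂ : W₁.V → W₂.V
      ι₂ = GenericExtension.embed Ext₂
      ι : V → W₂.V
      ι x = ι₂ (ι₁ x)

      ω₁-isω₁¹ : W₁.Isω₁ (ι₁ ω₁)
      ω₁-isω₁¹ = F₁.preserves-ω₁ (SC⇒CCC sc) ω₁-isω₁
      ω₁-isω₁² : W₂.Isω₁ (ι ω₁)
      ω₁-isω₁² = F₂.preserves-ω₁ (proj₂ ccc) ω₁-isω₁¹

      preserves₁₂ : ∀ x y → x ∈ y → ι x W₂.∈ ι y
      preserves₁₂ x y p = F₂.preserves _ _ (F₁.preserves _ _ p)
      reflects₁₂ : ∀ x y → ι x W₂.∈ ι y → x ∈ y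
      reflects₁₂ x y p = F₁.reflects _ _ (F₂.reflects _ _ p)
      transitive₁₂ : ∀ x y → y W₂.∈ ι x → ∃ λ x′ → y W₂.≈ ι x′
      transitive₁₂ x y p = let x₁ , m , e = F₂.∈ι p; x′ , _ , e′ = F₁.∈ι m in x′ , W₂.≈-trans e (F₂.ι-cong e′)
      open Embedding em M N₂ ι preserves₁₂ reflects₁₂ transitive₁₂ using (∈ι; ι⟨⟩⁺; ι-pair; ι-IsColouring; ι-Bounded; module SpreadSubsets)
      open SpreadSubsets using (spread-subset)

      module Catching (𝔸 𝔹 : W₂.V) (A⊑ : 𝔸 W₂.⊑ ι ω₁) (B⊑ : 𝔹 W₂.⊑ ι ω₁)
          (A-unb : ∀ δ → δ ∈ ω₁ → ∃ λ a → a ∈ ω₁ × δ ∈ a × ι a W₂.∈ 𝔸)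
          (B-unb : ∀ δ → δ ∈ ω₁ → ∃ λ b → b ∈ ω₁ × δ ∈ b × ι b W₂.∈ 𝔹) where

        Caught : Set ℓ
        Caught = ∃ λ b → ∃ λ s → b ∈ ω₁ × s ∈ 𝓕 · b × ι₁ k W₁.≲ ι₁ s × ι s W₂.⊑ 𝔸 × ι b W₂.∈ 𝔹

        module Named (XA XB : W₁.V)
            (XA-spec : ∀ t → t W₁.∈ ι₁ ω₁ → ι₂ t W₂.∈ 𝔸 ⇔ (∃ λ r → F₂.⊩ r × W₁.⟨ t , r ⟩ W₁.∈ XA))
            (XA-down : ∀ t p q → W₁.⟨ t , p ⟩ W₁.∈ XA → q F₂.≤ p → W₁.⟨ t , q ⟩ W₁.∈ XA)
            (XB-spec : ∀ t → t W₁.∈ ι₁ ω₁ → ι₂ t W₂.∈ 𝔹 ⇔ (∃ λ r → F₂.⊩ r × W₁.⟨ t , r ⟩ W₁.∈ XB))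
            (XB-down : ∀ t p q → W₁.⟨ t , p ⟩ W₁.∈ XB → q F₂.≤ p → W₁.⟨ t , q ⟩ W₁.∈ XB) where

          -- r forces a member of some 𝓕 · b with at least k elements into A, and b into B.
          Catches : W₁.V → Set ℓ
          Catches r = ∃ λ b → ∃ λ s → b W₁.∈ ι₁ ω₁ × s W₁.∈ ι₁ 𝓕 W₁.· b × ι₁ k W₁.≲ s × (∀ x → x W₁.∈ s → W₁.⟨ x , r ⟩ W₁.∈ XA) × W₁.⟨ b , r ⟩ W₁.∈ XB
          catchesᶠ : W₁.Tm → W₁.Fm
          catchesᶠ r = W₁.∃ᶠ λ b → W₁.∃ᶠ λ s → b W₁.∈ᶠ W₁.! (ι₁ ω₁) W₁.∧ᶠ s W₁.∈ᶠ W₁.! (ι₁ 𝓕) W₁.·ᶠ b W₁.∧ᶠ W₁.! (ι₁ k) W₁.≲ᶠ s W₁.∧ᶠ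
            (W₁.∀ᶠ λ x → x W₁.∈ᶠ s W₁.⇒ᶠ W₁.⟨ x , r ⟩ᶠ W₁.∈ᶠ W₁.! XA) W₁.∧ᶠ W₁.⟨ b , r ⟩ᶠ W₁.∈ᶠ W₁.! XB

          met : (∃ λ r → F₂.⊩ r × Catches r) → Caught
          met (r , g , b , s , b∈ , s∈ , l , a , h) =
            let b′ , b∈′ , e = F₁.∈ι b∈
                s′ , s∈′ , e′ = F₁.∈ι (W₁.∈-congʳ (W₁.≈-trans (W₁.·-congʳ e) (W₁.≈-sym F₁.ι-·)) s∈)
                s⊑ω₁ = λ x (m : x ∈ s′) → proj₁ ord b′ b∈′ x (𝓕-⊑ b∈′ s∈′ x m)
            in b′ , s′ , b∈′ , s∈′ , W₁.≲-cong W₁.≈-refl e′ l ,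
               (λ z m → let x , i , f = ∈ι m in W₂.∈-congˡ (W₂.≈-sym f)
                  (from (XA-spec (ι₁ x) (F₁.preserves _ _ (s⊑ω₁ x i))) (r , g , a (ι₁ x) (W₁.∈-congʳ (W₁.≈-sym e′) (F₁.preserves _ _ i))))) ,
               from (XB-spec (ι₁ b′) (F₁.preserves _ _ b∈′)) (r , g , W₁.∈-congˡ (W₁.⟨⟩-cong e W₁.≈-refl) h)

          module Unmet (r₀ : W₁.V) (g₀ : F₂.⊩ r₀) (none : ∀ r → r F₂.≤ r₀ → ¬ Catches r) where
            abstract
              -- `pts` and `B` as functions inside the ground model: `ι-·` carries their values
              -- over, so that `Force` can be formulated in the intermediate model.
              Pt Bt : V
              Pt = lam Data ptsᶠ
              Bt = lam Data Bᶠ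
              Pt-β : ∀ {d} → d ∈ Data → Pt · d ≈ pts d
              Pt-β = lam-β ptsᶠ
              Bt-β : ∀ {d} → d ∈ Data → Bt · d ≈ B d
              Bt-β = lam-β Bᶠ
            Pt-ι : ∀ {d} → d ∈ Data → ι₁ Pt W₁.· ι₁ d W₁.≈ ι₁ (pts d)
            Pt-ι i = W₁.≈-trans (W₁.≈-sym F₁.ι-·) (F₁.ι-cong (Pt-β i))
            Bt-ι : ∀ {d} → d ∈ Data → ι₁ Bt W₁.· ι₁ d W₁.≈ ι₁ (B d)
            Bt-ι i = W₁.≈-trans (W₁.≈-sym F₁.ι-·) (F₁.ι-cong (Bt-β i))
            Force : W₁.V → W₁.V → Set ℓ
            Force d r = r F₂.≤ r₀ × (∀ x → x W₁.∈ ι₁ Pt W₁.· d → W₁.⟨ x , r ⟩ W₁.∈ XA) × W₁.⟨ ι₁ Bt W₁.· d , r ⟩ W₁.∈ XB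
            forceᶠ : W₁.Tm → W₁.Tm → W₁.Fm
            forceᶠ d r = r F₂.≤ᶠ W₁.! r₀ W₁.∧ᶠ (W₁.∀ᶠ λ x → x W₁.∈ᶠ W₁.! (ι₁ Pt) W₁.·ᶠ d W₁.⇒ᶠ W₁.⟨ x , r ⟩ᶠ W₁.∈ᶠ W₁.! XA) W₁.∧ᶠ W₁.⟨ W₁.! (ι₁ Bt) W₁.·ᶠ d , r ⟩ᶠ W₁.∈ᶠ W₁.! XB
            Forced : V → W₁.V → Set ℓ
            Forced d r = (∀ x → x ∈ pts d → W₁.⟨ ι₁ x , r ⟩ W₁.∈ XA) × W₁.⟨ ι₁ (B d) , r ⟩ W₁.∈ XB
            force⁺ : ∀ {d r} → d ∈ Data → r F₂.≤ r₀ → Forced d r → Force (ι₁ d) r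
            force⁺ i l (a , b) = l , (λ x m → let x′ , j , e = F₁.∈ι (W₁.∈-congʳ (Pt-ι i) m) in W₁.∈-congˡ (W₁.⟨⟩-cong (W₁.≈-sym e) W₁.≈-refl) (a x′ j)) ,
              W₁.∈-congˡ (W₁.⟨⟩-cong (W₁.≈-sym (Bt-ι i)) W₁.≈-refl) b
            force⁻ : ∀ {d e r} → d ∈ Data → e W₁.≈ ι₁ d → Force e r → Forced d r
            force⁻ i e (_ , a , b) = (λ x m → a (ι₁ x) (W₁.∈-congʳ (W₁.≈-sym (W₁.≈-trans (W₁.·-congʳ e) (Pt-ι i))) (F₁.preserves _ _ m))) ,
              W₁.∈-congˡ (W₁.⟨⟩-cong (W₁.≈-trans (W₁.·-congʳ e) (Bt-ι i)) W₁.≈-refl) b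
            𝒲 : W₁.V
            𝒲 = W₁.Sep (λ d → W₁.∃ᶠ λ r → forceᶠ d r) (ι₁ Data)
            𝒲-spec : ∀ d → d W₁.∈ 𝒲 ⇔ (d W₁.∈ ι₁ Data × ∃ λ r → Force d r)
            𝒲-spec d = W₁.Sep-spec (λ d → W₁.∃ᶠ λ r → forceᶠ d r)

            -- Both halves are taken from `𝔸`, the second above some `c` in `C` that lies above all
            -- of the first, so `c` separates them. `spread-subset` finds them as sets of the ground
            -- model, and a condition below `r₀` in the filter of `R` forces the resulting triple.
            rich : ∀ C → Unbounded C → ∀ γ → γ ∈ ω₁ → ∃ λ d → d ∈ Data × ι₁ d W₁.∈ 𝒲 × High γ d × Spread C d
            rich C (C⊑ , C-unb) γ γ∈ = first (spread-subset C C⊑ C-unb 𝔸 A-unb k∈ω γ∈)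
              where
                Goal : Set ℓ
                Goal = ∃ λ d → d ∈ Data × ι₁ d W₁.∈ 𝒲 × High γ d × Spread C d
                Part : V → V → Set ℓ
                Part δ s = s ∈ 𝔽 ω₁ × (s ≲ k × k ≲ s × (∀ x y → x ∈ s → y ∈ s → x ∈ y → ∃ λ c → c ∈ C × x ∈ c × ¬ (y ∈ c)) × Disjoint s δ) × ι s W₂.⊑ 𝔸
                first : (∃ λ s → Part γ s) → Goal
                first (s₁ , s₁∈ , (a₁ , b₁ , spr₁ , dis₁) , s₁A) =
                  let ζ , ζ∈ , below = bounded (proj₁ (𝔽⁻ s₁∈)) (fin⇒ctb (proj₂ (𝔽⁻ s₁∈)))
                      c , c∈ , ζ∈c = C-unb ζ ζ∈
                      δ , δ∈ , γδ , cδ = max-mem γ∈ (C⊑ c c∈)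
                      b , b∈ , γb , bB = B-unb γ γ∈
                  in second c c∈ (λ x m → proj₁ (⊑-ord (C⊑ c c∈)) ζ ζ∈c x (below x m)) δ δ∈ γδ cδ b b∈ γb bB (spread-subset C C⊑ C-unb 𝔸 A-unb k∈ω δ∈)
                  where
                    second : ∀ c → c ∈ C → s₁ ⊑ c → ∀ δ → δ ∈ ω₁ → γ ∈ δ → c ∈ δ → ∀ b → b ∈ ω₁ → γ ∈ b → ι b W₂.∈ 𝔹 → (∃ λ s → Part δ s) → Goal
                    second c c∈ s₁⊑c δ δ∈ γδ cδ b b∈ γb bB (s₂ , s₂∈ , (a₂ , b₂ , spr₂ , dis₂) , s₂A) =
                        d , d∈ , from (𝒲-spec _) (F₁.preserves _ _ d∈ , forced) ,
                        ((λ x m i → [ (λ m → dis₁ x m i) , (λ m → dis₂ x m (δ-tr γ γδ x i)) ]′ (∪⁻ (to (pts≈ x) m))) , (λ i → ∈-asym γb (∈-congˡ snd-β i))) ,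
                        spread
                      where
                        d = ⟨ ⟨ s₁ , s₂ ⟩ , b ⟩
                        δ-tr : Trans δ
                        δ-tr = proj₁ (⊑-ord δ∈)
                        above : ∀ y → y ∈ s₂ → ¬ (y ∈ c)
                        above y m i = dis₂ y m (δ-tr c cδ y i)
                        d∈ : d ∈ Data
                        d∈ = Data⁺ s₁∈ s₂∈ b∈ (λ x m m′ → above x m′ (s₁⊑c x m)) (a₁ , b₁) (a₂ , b₂)
                        pts≈ : pts d ≈ s₁ ∪ s₂
                        pts≈ = ∪-cong (≈-trans (≈-cong fstᶠ fst-β) fst-β) (≈-trans (≈-cong sndᶠ fst-β) snd-β)
                        spread : Spread C d
                        spread x y m n i = [ (λ m → [ (λ n → spr₁ x y m n i) , (λ n → c , c∈ , s₁⊑c x m , above y n) ]′ (∪⁻ (to (pts≈ y) n))) ,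
                                             (λ m → [ (λ n → ⊥-elim (above x m (proj₁ (⊑-ord (C⊑ c c∈)) y (s₁⊑c y n) x i))) , (λ n → spr₂ x y m n i) ]′ (∪⁻ (to (pts≈ y) n))) ]′ (∪⁻ (to (pts≈ x) m))
                        s : V
                        s = s₁ ∪ s₂
                        s⊑ : s ⊑ ω₁
                        s⊑ x m = [ proj₁ (𝔽⁻ s₁∈) x , proj₁ (𝔽⁻ s₂∈) x ]′ (∪⁻ m)
                        s-fin : W₁.Finite (ι₁ s)
                        s-fin = let n , n∈ , l = fin-∪ (proj₂ (𝔽⁻ s₁∈)) (proj₂ (𝔽⁻ s₂∈)) in ι₁ n , W₁.∈-congʳ F₁.ι-ω (F₁.preserves _ _ n∈) , F₁.ι-≲ l
                        sA : ι s W₂.⊑ 𝔸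
                        sA z m = let x , i , e = ∈ι m in W₂.∈-congˡ (W₂.≈-sym e) ([ (λ i → s₁A _ (preserves₁₂ _ _ i)) , (λ i → s₂A _ (preserves₁₂ _ _ i)) ]′ (∪⁻ i))
                        forced : ∃ λ r → Force (ι₁ d) r
                        forced = by (F₂.forced-finite XA-spec XA-down s-fin (F₁.ι-⊑ s⊑) sA) (to (XB-spec (ι₁ b) (F₁.preserves _ _ b∈)) bB)
                          where
                            by : (∃ λ r → F₂.⊩ r × (∀ t → t W₁.∈ ι₁ s → W₁.⟨ t , r ⟩ W₁.∈ XA)) → (∃ λ r → F₂.⊩ r × W₁.⟨ ι₁ b , r ⟩ W₁.∈ XB) → ∃ λ r → Force (ι₁ d) r
                            by (r₁ , g₁ , h₁) (r₂ , g₂ , h₂) =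
                              let r₃ , g₃ , l₁ , l₂ = F₂.⊩-dir g₁ g₂; r , _ , l₃ , l₀ = F₂.⊩-dir g₃ g₀ in
                              r , force⁺ d∈ l₀ ((λ x m → XA-down _ _ _ (h₁ (ι₁ x) (F₁.preserves _ _ (to (pts≈ x) m))) (F₂.≤-trans l₃ l₁)) ,
                                W₁.∈-congˡ (W₁.⟨⟩-cong (F₁.ι-cong (≈-sym snd-β)) W₁.≈-refl) (XB-down _ _ _ h₂ (F₂.≤-trans l₃ l₂)))

            -- Such an `r` would force a member of a family at an ordinal of `𝔹`, with at least `k`
            -- elements, into `𝔸`; this is what `none` excludes below `r₀`.
            clash : ∀ u v r → u ∈ UP → v ∈ UP → r F₂.≤ r₀ → Forced (datum u) r → Forced (datum v) r → ¬ Catch u v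
            clash u v r u∈ v∈ l (a , _) (_ , b) (s , half , s∈) = none r l
                (ι₁ (B (datum v)) , ι₁ s , F₁.preserves _ _ (B∈ (UP-data v∈)) , W₁.∈-congʳ F₁.ι-· (F₁.preserves _ _ s∈) , F₁.ι-≲ size ,
                 (λ x m → let x′ , i , e = F₁.∈ι m in W₁.∈-congˡ (W₁.⟨⟩-cong (W₁.≈-sym e) W₁.≈-refl) (a x′ (sub x′ i))) , b)
              where
                size : k ≲ s
                size = [ (λ e → ≲-cong ≈-refl (≈-sym e) (proj₂ (S₁-size (UP-data u∈)))) , (λ e → ≲-cong ≈-refl (≈-sym e) (proj₂ (S₂-size (UP-data u∈)))) ]′ half
                sub : s ⊑ pts (datum u)
                sub x m = [ (λ e → ∪ˡ (∈-congʳ e m)) , (λ e → ∪ʳ (∈-congʳ e m)) ]′ half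

            module Rowed (Y : V) (Y⊑ : Y ⊑ Data ⊗ Cl)
                (Y-spec : ∀ d → d ∈ Data → ι₁ d W₁.∈ 𝒲 ⇔ (∃ λ p → F₁.⊩ p × ⟨ d , p ⟩ ∈ Y))
                (Y-down : ∀ d p q → ⟨ d , p ⟩ ∈ Y → ⟨ q , p ⟩ ∈ Le → ⟨ d , q ⟩ ∈ Y) where
              -- Each triple found by `rich` is put into `𝒲` by some member of the filter, which has
              -- a common extension with `p`.
              wide : ∀ {p} → F₁.⊩ p → Wide Y p
              wide g C un γ γ∈ =
                let d , d∈ , w , h , s = rich C un γ γ∈
                    p₁ , g₁ , y = to (Y-spec d d∈) w
                    q , _ , l , l′ = F₁.⊩-dir g₁ g
                in d , d∈ , (q , l′ , Y-down _ _ _ y l) , h , s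
              -- By `wide⇒hit`, the conditions that hit or fail to be wide are dense, and the
              -- members of the filter are wide.
              hit : ∃ λ p → F₁.⊩ p × Hit Y p
              hit = let p , g , h = F₁.dense-below (λ p → Hitᶠ! p ∨ᶠ ¬ᶠ (Wideᶠ! p)) (proj₂ F₁.⊩-ex) (λ q l → dns q (proj₁ (Le⁻ l)))
                    in p , g , [ (λ x → x) , (λ n → ⊥-elim (n (wide g))) ]′ h
                where
                  Hitᶠ! Wideᶠ! : Tm → Fm
                  Hitᶠ! = rel₁ᶠ (Hit Y) (D₁ (λ q → ∃ᶠ λ ξ → ξ ∈ᶠ ! ω₂ ∧ᶠ Hitsᶠ Y ξ q))
                  Wideᶠ! = rel₁ᶠ (Wide Y) (D₁ (Wideᶠ Y))
                  dns : ∀ q → q ∈ Cl → ∃ λ q′ → ⟨ q′ , q ⟩ ∈ Le × (Hit Y q′ ⊎ ¬ Wide Y q′)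
                  dns q q∈ = go (em {Wide Y q})
                    where
                      go : Dec (Wide Y q) → ∃ λ q′ → ⟨ q′ , q ⟩ ∈ Le × (Hit Y q′ ⊎ ¬ Wide Y q′)
                      go (yes w) = let q′ , l , h = wide⇒hit Y Y-down q∈ w in q′ , l , inj₁ h
                      go (no n) = q , F₁.≤-refl q∈ , inj₂ n

              module Row (q ξ : V) (gq : F₁.⊩ q) (hits : Hits Y ξ q) where
                In : W₁.V → Set ℓ
                In γ = (∃ λ p → p W₁.∈ F₁.G × W₁.⟨ ι₁ ξ , γ ⟩ W₁.∈ p) × ι₁ X W₁.· ι₁ ξ W₁.· γ W₁.∈ 𝒲
                inᶠ : W₁.Tm → W₁.Fm
                inᶠ γ = (W₁.∃ᶠ λ p → p W₁.∈ᶠ W₁.! F₁.G W₁.∧ᶠ W₁.⟨ W₁.! (ι₁ ξ) , γ ⟩ᶠ W₁.∈ᶠ p) W₁.∧ᶠ W₁.! (ι₁ X) W₁.·ᶠ W₁.! (ι₁ ξ) W₁.·ᶠ γ W₁.∈ᶠ W₁.! 𝒲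
                I : W₁.V
                I = W₁.Sep inᶠ (ι₁ ω₁)
                row≈ : ∀ {γ} → ι₁ X W₁.· ι₁ ξ W₁.· ι₁ γ W₁.≈ ι₁ (X · ξ · γ)
                row≈ = W₁.≈-trans (W₁.·-cong (W₁.≈-sym F₁.ι-·) W₁.≈-refl) (W₁.≈-sym F₁.ι-·)
                unbounded-I : ∀ ζ → ζ W₁.∈ ι₁ ω₁ → ∃ λ γ → γ W₁.∈ I × ζ W₁.∈ γ
                unbounded-I ζ z = let ζ′ , z′ , e = F₁.∈ι z in found e
                    (F₁.dense-below (λ q″ → ∃ᶠ λ γ → γ ∈ᶠ ! ω₁ ∧ᶠ ! ζ′ ∈ᶠ γ ∧ᶠ ⟨ ! ξ , γ ⟩ᶠ ∈ᶠ q″ ∧ᶠ ⟨ ! X ·ᶠ ! ξ ·ᶠ γ , q″ ⟩ᶠ ∈ᶠ ! Y) gq (hits ζ′ z′))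
                  where
                    found : ∀ {ζ′} → ζ W₁.≈ ι₁ ζ′ → (∃ λ p → F₁.⊩ p × ∃ λ γ → γ ∈ ω₁ × ζ′ ∈ γ × ⟨ ξ , γ ⟩ ∈ p × ⟨ X · ξ · γ , p ⟩ ∈ Y) →
                            ∃ λ γ → γ W₁.∈ I × ζ W₁.∈ γ
                    found e (p , g , γ , γ∈ , j , m , y) = ι₁ γ , W₁.∈Sep {inᶠ} (F₁.preserves _ _ γ∈)
                        ((ι₁ p , g , W₁.∈-congˡ F₁.ι-⟨⟩ (F₁.preserves _ _ m)) ,
                         W₁.∈-congˡ (W₁.≈-sym row≈) (from (Y-spec _ (proj₁ (⊗⁻ (Y⊑ _ y)))) (p , g , y))) ,
                      W₁.∈-congˡ (W₁.≈-sym e) (F₁.preserves _ _ j)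

                Vertex : W₁.V → W₁.V → Set ℓ
                Vertex γ r = ∃ λ γ′ → γ W₁.≈ ι₁ γ′ × (∃ λ p → F₁.⊩ p × ⟨ ξ , γ′ ⟩ ∈ p) × r F₂.≤ r₀ × Forced (datum ⟨ ξ , γ′ ⟩) r
                vertex : ∀ γ r → γ W₁.∈ I → Force (ι₁ X W₁.· ι₁ ξ W₁.· γ) r → Vertex γ r
                vertex γ r m h = from-name (F₁.∈ι (W₁.Sep⊑ {inᶠ} m)) (proj₁ (W₁.SepP {inᶠ} m))
                  where
                    from-name : (∃ λ γ′ → γ′ ∈ ω₁ × γ W₁.≈ ι₁ γ′) → (∃ λ p → p W₁.∈ F₁.G × W₁.⟨ ι₁ ξ , γ ⟩ W₁.∈ p) → Vertex γ r
                    from-name (γ′ , γ∈ , e) (p , g , n) =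
                        γ′ , e , (p′ , W₁.∈-congˡ e′ g , v) , proj₁ h ,
                        force⁻ (UP-data (Cl-⊑U (F₁.⊩-P (W₁.∈-congˡ e′ g)) _ v))
                          (W₁.≈-trans (W₁.·-congʳ e) (W₁.≈-trans row≈ (F₁.ι-cong (·-cong (·-congʳ (≈-sym fst-β)) (≈-sym snd-β))))) h
                      where
                        p∃ = F₁.∈ι (proj₁ F₁.filter g)
                        p′ = proj₁ p∃
                        e′ = proj₂ (proj₂ p∃)
                        v : ⟨ ξ , γ′ ⟩ ∈ p′
                        v = F₁.ι⟨⟩⁻ (W₁.∈-congˡ (W₁.⟨⟩-cong W₁.≈-refl e) (W₁.∈-congʳ e′ n))
                forced-down : ∀ {d r t} → t F₂.≤ r → Forced d r → Forced d t
                forced-down l (a , b) = (λ x m → XA-down _ _ _ (a x m) l) , XB-down _ _ _ b l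
                -- Different vertices of one row of the generic clique are joined, so one of them
                -- catches the other; a common extension `t` of their labels would contradict
                -- `clash`.
                same : ∀ γ γ′ r r′ t → Vertex γ r → Vertex γ′ r′ → t F₂.≤ r → t F₂.≤ r′ → γ W₁.≈ γ′
                same γ γ′ r r′ t (δ , e , (p , g , m) , l , h) (δ′ , e′ , (p′ , g′ , m′) , l′ , h′) a a′ =
                  let q , gq , b , b′ = F₁.⊩-dir g g′
                      q∈ = F₁.⊩-P gq
                      m₁ = proj₂ (proj₂ (Le⁻ b)) _ m
                      m₂ = proj₂ (proj₂ (Le⁻ b′)) _ m′
                  in [ (λ f → W₁.≈-trans e (W₁.≈-trans (F₁.ι-cong (⟨⟩-snd f)) (W₁.≈-sym e′))) ,
                       (λ edge → let u∈ , v∈ , c = ΓP⁻ edge; t≤ = F₂.≤-trans a l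
                                     hu = forced-down {datum ⟨ ξ , δ ⟩} a h; hv = forced-down {datum ⟨ ξ , δ′ ⟩} a′ h′ in
                          ⊥-elim ([ clash _ _ t u∈ v∈ t≤ hu hv , clash _ _ t v∈ u∈ t≤ hv hu ]′ (c (≈-trans fst-β (≈-sym fst-β))))) ]′
                     (Cl-clique q∈ _ _ m₁ m₂)
                ctb-I : W₁.Ctb I
                ctb-I = F₂.ctb-labelled (proj₂ ccc) (λ γ r → forceᶠ (W₁.! (ι₁ X) W₁.·ᶠ W₁.! (ι₁ ξ) W₁.·ᶠ γ) r)
                  (λ γ m → let _ , r , h = to (𝒲-spec _) (proj₂ (W₁.SepP {inᶠ} m)) in r , proj₁ (F₂.≤-dom (proj₁ h)) , h)
                  (λ γ γ′ r r′ t m m′ h h′ → same γ γ′ r r′ t (vertex γ r m h) (vertex γ′ r′ m′ h′))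
                contradiction : ⊥
                contradiction = W₁.Isω₁.unbounded ω₁-isω₁¹ (λ x → W₁.Sep⊑ {inᶠ}) unbounded-I ctb-I

            impossible : ⊥
            impossible = named (F₁.nice-name Data 𝒲 (λ d m → proj₁ (to (𝒲-spec d) m)))
              where
                named : (∃ λ Y → Y ⊑ Data ⊗ Cl
                  × (∀ d → d ∈ Data → ι₁ d W₁.∈ 𝒲 ⇔ (∃ λ p → F₁.⊩ p × ⟨ d , p ⟩ ∈ Y))
                  × (∀ d p q → ⟨ d , p ⟩ ∈ Y → q F₁.≤ p → ⟨ d , q ⟩ ∈ Y)) → ⊥
                named (Y , Y⊑ , Y-spec , Y-down) = with-row hit
                  where
                    open Rowed Y Y⊑ Y-spec Y-down
                    with-row : (∃ λ q → F₁.⊩ q × Hit Y q) → ⊥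
                    with-row (q , g , ξ , _ , h) = Row.contradiction q ξ g h

          caught-named : Caught
          caught-named = [ met , (λ (r₀ , g₀ , none) → ⊥-elim (Unmet.impossible r₀ g₀ none)) ]′ (F₂.decide catchesᶠ)

        caught : Caught
        caught = with-A (F₂.nice-name (ι₁ ω₁) 𝔸 A⊑)
          where
            Name : W₂.V → W₁.V → Set ℓ
            Name x X = (∀ t → t W₁.∈ ι₁ ω₁ → ι₂ t W₂.∈ x ⇔ (∃ λ r → F₂.⊩ r × W₁.⟨ t , r ⟩ W₁.∈ X))
                     × (∀ t p q → W₁.⟨ t , p ⟩ W₁.∈ X → q F₂.≤ p → W₁.⟨ t , q ⟩ W₁.∈ X)
            with-A : (∃ λ X → X W₁.⊑ ι₁ ω₁ W₁.⊗ R × Name 𝔸 X) → Caught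
            with-A (XA , _ , XA-spec , XA-down) = with-B (F₂.nice-name (ι₁ ω₁) 𝔹 B⊑)
              where
                with-B : (∃ λ X → X W₁.⊑ ι₁ ω₁ W₁.⊗ R × Name 𝔹 X) → Caught
                with-B (XB , _ , XB-spec , XB-down) = Named.caught-named XA XB XA-spec XA-down XB-spec XB-down

      module _ (k≉∅ : ¬ Empty k) where
        open Colouring gch k k∈ω k≉∅ using (f; isColouring; bounded-f; colour-constant; hue)

        uncountable : ∀ {A} → W₂.HasOrderType A (ι ω₁) → ¬ W₂.Ctb A
        uncountable (h , F , i , _) c = W₂.Isω₁.unctb ω₁-isω₁² (W₂.≲-trans (W₂.≲-by-≼ (λ _ x → x) (h , F , i)) c)

        cofinal₂ : ∀ {A} → A W₂.⊑ ι ω₁ → ¬ W₂.Ctb A → ∀ δ → δ ∈ ω₁ → ∃ λ a → a ∈ ω₁ × δ ∈ a × ι a W₂.∈ A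
        cofinal₂ {A} s n δ δ∈ = let a , m , l = W₂.Isω₁.cofinal ω₁-isω₁² s n (ι δ) (preserves₁₂ _ _ δ∈); a′ , a∈ , e = ∈ι (s a m) in
          a′ , a∈ , reflects₁₂ _ _ (W₂.∈-congʳ e l) , W₂.∈-congˡ e m

        Repeated : W₂.V → W₂.V → Set ℓ
        Repeated A B = ∃ λ ξ → (∃ λ z → W₂.⟨ z , ξ ⟩∈ ι f) × W₂.⌊ ι k ⌋ W₂.≼ (λ z → W₂.[ A ⨾ B ] z × W₂.fiber (ι f) ξ z)

        -- By `colour-constant` the pairs of `b` with the points of `s` all have the same colour,
        -- and `s` lies in `A` and below `b`.
        repeated : ∀ {A B b s} → b ∈ ω₁ → s ∈ 𝓕 · b → ι k W₂.≲ ι s → ι s W₂.⊑ A → ι b W₂.∈ B → Repeated A B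
        repeated {A} {B} {b} {s} b∈ s∈ l sA bB = ξ , (let z , i = nonempty′ in let x , m = sized z i in ι (pair x b) , coloured x m) ,
            W₂.≼-by {ι k} {S} (λ _ → ⇔-refl) (λ z m → member z m) size
          where
            pᶠ : W₂.Tm → W₂.Tm
            pᶠ x = W₂.pairᶠ x (W₂.! (ι b))
            S : W₂.V
            S = W₂.Img pᶠ (ι s)
            ξ : W₂.V
            ξ = ι (hue · (s ∪ ⟪ b ⟫))
            coloured : ∀ x → x ∈ s → W₂.⟨ ι (pair x b) , ξ ⟩∈ ι f
            coloured x m = from W₂.⟨⟩∈⇔ (ι⟨⟩⁺ (colour-constant b∈ s∈ m))
            nonempty′ : ∃ λ z → z ∈ k
            nonempty′ = dne (λ n → k≉∅ λ z p → n (z , p))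
            sized : ∀ z → z ∈ k → ∃ λ x → x ∈ s
            sized z i = let x , m , _ = ∈ι (proj₁ (proj₂ l) (ι z) (preserves₁₂ _ _ i)) in x , m
            below : ∀ {z} → z W₂.∈ ι s → z W₂.∈ ι b
            below m = let x , i , e = ∈ι m in W₂.∈-congˡ (W₂.≈-sym e) (preserves₁₂ _ _ (𝓕-⊑ b∈ s∈ x i))
            size : ι k W₂.≲ S
            size = W₂.≲-trans l (W₂.≲-by pᶠ (λ x m → W₂.∈Img {pᶠ} m) (λ x y m n e → proj₁ (W₂.pair-ordered (below m) (below n) e)))
            member : ∀ z → z W₂.∈ S → W₂.[ A ⨾ B ] z × W₂.fiber (ι f) ξ z
            member z m =
              let x , i , e = W₂.Img⁻ m; x′ , i′ , e′ = ∈ι i in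
              (x , ι b , sA x i , bB , below i , from W₂.isPair⇔ e) ,
              from W₂.⟨⟩∈⇔ (W₂.∈-congˡ (W₂.⟨⟩-cong (W₂.≈-sym (W₂.≈-trans e (W₂.≈-trans (W₂.pair-cong e′ W₂.≈-refl) (W₂.≈-sym ι-pair)))) W₂.≈-refl)
                (to W₂.⟨⟩∈⇔ (coloured x′ i′)))

        establishes : W₂.Establishes (ι k) (ι f)
        establishes = ι ω₁ , W₂.isOmega₁ ω₁-isω₁² , (ι ω₁ , ι-IsColouring isColouring) , ι-Bounded bounded-f , all
          where
            all : ∀ A B → W₂.⌊ A ⌋ ⊆ W₂.⌊ ι ω₁ ⌋ → W₂.⌊ B ⌋ ⊆ W₂.⌊ ι ω₁ ⌋ → W₂.HasOrderType A (ι ω₁) → W₂.HasOrderType B (ι ω₁) → Repeated A B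
            all A B A⊑ B⊑ oA oB =
              let b , s , b∈ , s∈ , l , sA , bB = Catching.caught A B (λ x m → A⊑ m) (λ x m → B⊑ m)
                    (cofinal₂ (λ x m → A⊑ m) (uncountable oA)) (cofinal₂ (λ x m → B⊑ m) (uncountable oB))
              in repeated b∈ s∈ (F₂.ι-≲ l) sA bB

theorem1p1 : ∀ {ℓ} → ExcludedMiddle ℓ → (V : Model ℓ) → let open Model V in
    GCH →
    ∀ k → IsInteger k → ¬ Empty k →
    ∃[ w ] ∃[ f ] IsOmega₁ w × IsColouring f w w × Bounded k f ×
    (∃[ P ] ∃[ ≤P ] ∃[ Q ] ∃[ ≤Q ] IsCCCPoset P ≤P × IsCCCPoset Q ≤Q
    × Forces V P ≤P (λ N ι → CCCIndestructiblyEstablishes N (ι k) (ι f))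
    × Forces V Q ≤Q (λ N ι → Model.Omega₁IsCountableUnionOfRainbowSets N (ι f)))
theorem1p1 em V gch k (o , isω , k∈o) k≉∅ =
    ω₁ , C.f , isOmega₁ ω₁-isω₁ , C.isColouring , C.bounded-f ,
    P.Cl , P.Le , Q.Cl , Q.Le , P.isCCCPoset P.sc , Q.isCCCPoset Q.sc ,
    (λ Ext₁ R LR ccc Ext₂ → Indestructibility.TwoSteps.establishes em V gch k k∈ω Ext₁ R LR ccc Ext₂ k≉∅) ,
    (λ Ext → RainbowExtension.countable-union em V gch k k∈ω k≉∅ Ext)
  where
    open Combinatorics em V using (_∈_; ω; ω₁; ω₁-isω₁; isOmega₁; IsOmega-unique; module Colouring; module PPoset; module QGraph)
    k∈ω : k ∈ ω
    k∈ω = to (IsOmega-unique isω k) k∈o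
    module C = Colouring gch k k∈ω k≉∅
    module P = PPoset gch k
    module Q = QGraph gch k k≉∅
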